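{- Let $p,q\ge 2$ be integers. There is a tight chiral polyhedron of type $\{p, q\}$ if and only if one of the following is true: (1) $q$ is odd, $p$ is an even divisor of $2q$, and there is an odd prime $m$ such that $m$ divides $p$ and $m^2$ divides $q$; (2) $p$ is odd, $q$ is an even divisor of $2p$, and there is an odd prime $m$ such that $m$ divides $q$ and $m^2$ divides $p$; (3) $p$ and $q$ are both even, and there is an odd prime $m$ such that $m$ divides $p$ and $m^2$ divides $q$; (4) $p$ and $q$ are both even, and there is an odd prime $m$ such that $m$ divides $q$ and $m^2$ divides $p$; (5) $p$ is divisible by $8$ and $q$ is divisible by $32$; (6) $q$ is divisible by $8$ and $p$ is divisible by $32$.
   Context: An (abstract) polyhedron is a partially ordered set whose elements have rank $0$ (vertices), $1$ (edges) or $2$ (faces), where two elements are incident if they are comparable, such that: every edge is incident to exactly two vertices and two faces; whenever a vertex is incident to a face there are exactly two edges incident to both; the graph of the incidence relation is connected; and for every vertex or face $F$, the subgraph of the incidence graph induced on the neighbours of $F$ is connected. A flag is a mutually incident triple (vertex, edge, face); for a flag $\Phi$ and $i\in\{0,1,2\}$, $\Phi^i$ denotes the unique flag differing from $\Phi$ exactly in its rank-$i$ element. The polyhedron has type (Schläfli symbol) $\{p,q\}$ if every face is incident to exactly $p$ edges and every vertex to exactly $q$ edges. An automorphism is an incidence-preserving bijection. The polyhedron is chiral if its flags can be split into two classes such that flags $\Phi$ and $\Phi^i$ always lie in different classes and the automorphism group acts transitively on each class but not on all flags. A polyhedron of type $\{p,q\}$ has at least $2pq$ flags; it is called tight if it has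 exactly $2pq$ flags. -}

module Defs where

open import Data.Nat using (ℕ; zero; suc; _+_; _*_)
open import Data.Nat.Divisibility using (_∣_)
open import Data.Nat.Primality using (Prime)
open import Data.Bool using (Bool; true; false; T; _∧_; if_then_else_)
open import Data.Fin using (Fin) renaming (zero to fz; suc to fs)
open import Data.Product using (Σ; ∃; ∃-syntax; _×_; _,_; proj₁; proj₂)
open import Data.Sum using (_⊎_)
open import Data.Empty using (⊥)
open import Relation.Nullary using (¬_)
open import Relation.Binary.PropositionalEquality using (_≡_; _≢_)
open import Relation.Binary.Construct.Closure.ReflexiveTransitive using (Star)
open import Function.Bundles using (_↔_; Inverse)

count : (n : ℕ) → (Fin n → Bool) → ℕ
count zero    b = 0
count (suc n) b = (if b fz then 1 else 0) + count n (λ i → b (fs i))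

sumFin : (n : ℕ) → (Fin n → ℕ) → ℕ
sumFin zero    g = 0
sumFin (suc n) g = g fz + sumFin n (λ i → g (fs i))

-- A finite ranked poset of rank ≤ 2 (vertices, edges, faces).
-- Elements of rank 0,1,2 are Fin nv, Fin ne, Fin nf; the order relation
-- between elements of different ranks is given by the Boolean relations
-- I01 (vertex < edge), I12 (edge < face), I02 (vertex < face).
-- Elements of equal rank are incomparable; transitivity is the field
-- 'trans012'.  Two elements are incident iff comparable.

record RankedPoset : Set where
  field
    nv ne nf : ℕ
    I01 : Fin nv → Fin ne → Bool
    I12 : Fin ne → Fin nf → Bool
    I02 : Fin nv → Fin nf → Bool
    trans012 : ∀ v e f → T (I01 v e) → T (I12 e f) → T (I02 v f)

  data Elem : Set where
    vtx : Fin nv → Elem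
    edg : Fin ne → Elem
    fac : Fin nf → Elem

  Inc : Elem → Elem → Set
  Inc (vtx v) (edg e) = T (I01 v e)
  Inc (edg e) (vtx v) = T (I01 v e)
  Inc (edg e) (fac f) = T (I12 e f)
  Inc (fac f) (edg e) = T (I12 e f)
  Inc (vtx v) (fac f) = T (I02 v f)
  Inc (fac f) (vtx v) = T (I02 v f)
  Inc _ _ = ⊥

  Nbr : Elem → Set
  Nbr x = Σ Elem (Inc x)

  NbrAdj : (x : Elem) → Nbr x → Nbr x → Set
  NbrAdj x a b = Inc (proj₁ a) (proj₁ b)

  Flag : Set
  Flag = Σ (Fin nv) λ v → Σ (Fin ne) λ e → Σ (Fin nf) λ f →
           T (I01 v e) × T (I12 e f) × T (I02 v f)

  fv : Flag → Fin nv
  fv (v , _) = v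
  fe : Flag → Fin ne
  fe (_ , e , _) = e
  ff : Flag → Fin nf
  ff (_ , _ , f , _) = f

  Adjacent : Fin 3 → Flag → Flag → Set
  Adjacent fz Φ Ψ =
    fv Φ ≢ fv Ψ × fe Φ ≡ fe Ψ × ff Φ ≡ ff Ψ
  Adjacent (fs fz) Φ Ψ =
    fv Φ ≡ fv Ψ × fe Φ ≢ fe Ψ × ff Φ ≡ ff Ψ
  Adjacent (fs (fs fz)) Φ Ψ =
    fv Φ ≡ fv Ψ × fe Φ ≡ fe Ψ × ff Φ ≢ ff Ψ

  numFlags : ℕ
  numFlags = sumFin nv λ v → sumFin ne λ e →
               count nf λ f → I01 v e ∧ I12 e f ∧ I02 v f

  -- automorphisms: incidence-preserving bijections (rank-preserving,
  -- as every order automorphism of such a poset is)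
  record Automorphism : Set where
    field
      σ0 : Fin nv ↔ Fin nv
      σ1 : Fin ne ↔ Fin ne
      σ2 : Fin nf ↔ Fin nf
    a0 = Inverse.to σ0
    a1 = Inverse.to σ1
    a2 = Inverse.to σ2
    field
      pres01 : ∀ v e → I01 (a0 v) (a1 e) ≡ I01 v e
      pres12 : ∀ e f → I12 (a1 e) (a2 f) ≡ I12 e f
      pres02 : ∀ v f → I02 (a0 v) (a2 f) ≡ I02 v f

  Maps : Automorphism → Flag → Flag → Set
  Maps α Φ Ψ = Automorphism.a0 α (fv Φ) ≡ fv Ψ
             × Automorphism.a1 α (fe Φ) ≡ fe Ψ
             × Automorphism.a2 α (ff Φ) ≡ ff Ψ



record IsPolyhedron (P : RankedPoset) : Set where
  open RankedPoset P
  field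
    edge-vertices : ∀ e → count nv (λ v → I01 v e) ≡ 2
    edge-faces    : ∀ e → count nf (λ f → I12 e f) ≡ 2
    diamond : ∀ v f → T (I02 v f) →
              count ne (λ e → I01 v e ∧ I12 e f) ≡ 2
    connected : ∀ x y → Star Inc x y
    vertex-conn : ∀ v (a b : Nbr (vtx v)) → Star (NbrAdj (vtx v)) a b
    face-conn   : ∀ f (a b : Nbr (fac f)) → Star (NbrAdj (fac f)) a b

HasType : RankedPoset → ℕ → ℕ → Set
HasType P p q =
  (∀ f → count ne (λ e → I12 e f) ≡ p) ×
  (∀ v → count ne (λ e → I01 v e) ≡ q)
  where open RankedPoset P

Tight : RankedPoset → ℕ → ℕ → Set
Tight P p q = RankedPoset.numFlags P ≡ 2 * p * q

Chiral : RankedPoset → Set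
Chiral P =
  Σ (Flag → Bool) λ cls →
    (∀ i Φ Ψ → Adjacent i Φ Ψ → cls Φ ≢ cls Ψ) ×
    (∀ Φ Ψ → cls Φ ≡ cls Ψ → Σ Automorphism λ α → Maps α Φ Ψ) ×
    (Σ Flag λ Φ → Σ Flag λ Ψ → ¬ (Σ Automorphism λ α → Maps α Φ Ψ))
  where open RankedPoset P

TightChiralPolyhedronOfType : ℕ → ℕ → Set
TightChiralPolyhedronOfType p q =
  Σ RankedPoset λ P → IsPolyhedron P × HasType P p q × Tight P p q × Chiral P

Odd : ℕ → Set
Odd n = ¬ (2 ∣ n)

Even : ℕ → Set
Even n = 2 ∣ n

OddPrime : ℕ → Set
OddPrime m = Prime m × Odd m

Conditions : ℕ → ℕ → Set
Conditions p q =
    (Odd q × Even p × p ∣ 2 * q × ∃[ m ] (OddPrime m × m ∣ p × m * m ∣ q))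
  ⊎ (Odd p × Even q × q ∣ 2 * p × ∃[ m ] (OddPrime m × m ∣ q × m * m ∣ p))
  ⊎ (Even p × Even q × ∃[ m ] (OddPrime m × m ∣ p × m * m ∣ q))
  ⊎ (Even p × Even q × ∃[ m ] (OddPrime m × m ∣ q × m * m ∣ p))
  ⊎ (8 ∣ p × 32 ∣ q)
  ⊎ (8 ∣ q × 32 ∣ p)

{-# OPTIONS --safe #-}
module Submission where

-- A tight chiral polyhedron of type {p,q} amounts to a group G = ⟨a⟩⟨b⟩ of order pq with a of
-- order p, b of order q and (ab)² = 1 that has no automorphism inverting both a and b: G is the
-- rotation group acting on one class of flags, and conversely vertices, edges and faces are the
-- cosets of ⟨b⟩, ⟨ab⟩ and ⟨a⟩.
--
-- Necessity.  By Itô's theorem the commutator subgroup M of G = ⟨a⟩⟨b⟩ is abelian, so G acts on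
-- it by a commutative ring, and the involution ab inverts M.  The quotient M/(M ∩ ⟨a⟩) is then
-- itself a commutative ring, transitively permuted by an affine map s ↦ 1 + y s; this forces the
-- ring to be ℤ/N, with a acting as multiplication by some r.  The reflection exists as soon as
-- r² ≡ 1 mod N, and a prime power dividing N but not r² - 1 gives the divisibility conditions.
--
-- Sufficiency.  The groups are realised as permutation groups acting affinely on ℤ/N through
-- the multipliers ±1 ± u with u² ≡ 0, where 2u ≢ 0 (8u ≢ 0 in the odd case) prevents a reflection.

-- That `s ↦ 1 + y s` permutes a finite commutative ring in a single cycle does not make the ring
-- `ℤ/N`: over `𝔽₂[ε]/(ε²)` with `y = 1 + ε` the cycle is `0, 1, ε, 1 + ε`. The missing ingredient
-- is that `y` is a square, and the argument at the prime 2 turns on it. For even `q` one has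
-- `y = x²` with `x` the action of `a`. For odd `q` the element `b` itself lies in `M⟨a⟩`, its
-- action takes the place of `y`, and the odd period provides the square root.
--
-- For even `p` and `q`, `r² = 1` only says that `a²` centralises `M` modulo `⟨a⟩`. The dual group
-- gives the same modulo `⟨b⟩`, and `⟨a⟩ ∩ ⟨b⟩ = 1` removes both errors. A chiral group therefore
-- has an obstruction on one of the two sides, whence the pairing of the conditions.
--
-- At the prime 2 the numbers 8 and 32 arise because `r` is odd, so that 8 divides `r² - 1`: an
-- excess of 2 in `q / 2` over `r² - 1` makes `q / 2` divisible by 16.

open import Defs
open import Data.Nat using (ℕ; _≤_)
open import Function.Bundles using (_⇔_)

-- Commutative rings permuted in one cycle by an affine map.

module GeometricSums where
  open import Algebra.Bundles using (CommutativeRing)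
  open import Level using (0ℓ)
  open import Data.Nat.Base as ℕ using (ℕ; zero; suc; NonZero)
  import Data.Nat.Properties as ℕₚ
  open import Data.Nat.DivMod using (_%_; _/_; m≡m%n+[m/n]*n; m%n<n)
  open import Data.Nat.Divisibility using (_∣_; _∣?_; ∣⇒≤; m%n≡0⇒n∣m; ∣m+n∣m⇒∣n; ∣m⇒∣m*n; ∣1⇒≡1; ∣-trans; n∣m*n)
  open import Data.Nat.Primality using (Prime; prime⇒irreducible; ¬prime[1])
  open import Data.Nat.GCD using (module Bézout)
  open import Data.Nat.Coprimality as Coprime using (Coprime; coprime-Bézout)
  open import Data.Fin.Base using (Fin; toℕ; fromℕ<)
  open import Data.Fin.Properties using (pigeonhole; fromℕ<-injective; injective⇒≤; toℕ-injective; toℕ<n)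
  open import Data.Product using (∃; _,_; proj₁; proj₂; _×_)
  open import Data.Sum using (_⊎_; inj₁; inj₂)
  open import Data.Empty using (⊥; ⊥-elim)
  open import Relation.Nullary using (¬_; yes; no)
  open import Relation.Binary.PropositionalEquality as ≡ using (_≡_)

  parity : ∀ n → ∃ λ k → n ≡ 2 ℕ.* k ⊎ n ≡ suc (2 ℕ.* k)
  parity zero = 0 , inj₁ ≡.refl
  parity (suc n) with parity n
  ... | k , inj₁ e = k , inj₂ (≡.cong suc e)
  ... | k , inj₂ e = suc k , inj₁ (≡.trans (≡.cong suc e) (≡.sym (ℕₚ.*-distribˡ-+ 2 1 k)))

  module Sums (R : CommutativeRing 0ℓ 0ℓ) where
    open CommutativeRing R
    open import Algebra.Properties.Semiring.Mult semiring public using (×-homo-+; ×1-homo-*; ×-congʳ) renaming (_×_ to _×ᵣ_)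
    open import Algebra.Properties.Semiring.Exp semiring public using (_^_; ^-homo-*; ^-assocʳ; ^-congˡ)
    open import Algebra.Solver.Ring.NaturalCoefficients.Default commutativeSemiring
    open import Relation.Binary.Reasoning.Setoid setoid

    nat : ℕ → Carrier
    nat n = n ×ᵣ 1#

    geo : Carrier → ℕ → Carrier
    geo y zero    = 0#
    geo y (suc j) = 1# + y * geo y j

    geo-cong : ∀ {y z} → y ≈ z → ∀ j → geo y j ≈ geo z j
    geo-cong e zero    = refl
    geo-cong e (suc j) = +-congˡ (*-cong e (geo-cong e j))

    geo-+ : ∀ y i j → geo y (i ℕ.+ j) ≈ geo y i + y ^ i * geo y j
    geo-+ y zero    j = sym (trans (+-identityˡ _) (*-identityˡ _))
    geo-+ y (suc i) j = begin
      1# + y * geo y (i ℕ.+ j)                ≈⟨ +-congˡ (*-congˡ (geo-+ y i j)) ⟩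
      1# + y * (geo y i + y ^ i * geo y j)    ≈⟨ solve 4 (λ y g p h → con 1 :+ y :* (g :+ p :* h) := (con 1 :+ y :* g) :+ (y :* p) :* h) refl y (geo y i) (y ^ i) (geo y j) ⟩
      (1# + y * geo y i) + y * y ^ i * geo y j ∎

    -- The binomial coefficient `j (j - 1) / 2`, by a recursion that avoids division.
    triangle : ℕ → ℕ
    triangle zero    = 0
    triangle (suc j) = triangle j ℕ.+ j

    module _ (y Y : Carrier) (y≈1+Y : y ≈ 1# + Y) where

      power-geo : ∀ j → y ^ j ≈ 1# + Y * geo y j
      power-geo zero    = sym (trans (+-congˡ (zeroʳ Y)) (+-identityʳ 1#))
      power-geo (suc j) = begin
        y * y ^ j                   ≈⟨ *-congˡ (power-geo j) ⟩
        y * (1# + Y * geo y j)      ≈⟨ solve 3 (λ y Y g → y :* (con 1 :+ Y :* g) := y :+ Y :* (y :* g)) refl y Y (geo y j) ⟩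
        y + Y * (y * geo y j)       ≈⟨ +-congʳ y≈1+Y ⟩
        1# + Y + Y * (y * geo y j)  ≈⟨ solve 3 (λ y Y g → con 1 :+ Y :+ Y :* (y :* g) := con 1 :+ Y :* (con 1 :+ y :* g)) refl y Y (geo y j) ⟩
        1# + Y * (1# + y * geo y j) ∎

      abstract
        -- This is the expansion of `((1 + Y)^j - 1) / Y` to second order. Whether `j` divides the
        -- coefficient of `Y` depends on the parity of `j`, which is the source of all trouble at
        -- the prime 2.
        geo-order2 : ∀ j → ∃ λ w → geo y j ≈ nat j + nat (triangle j) * Y + Y * Y * w
        geo-order2 zero    = 0# , solve 1 (λ Y → con 0 := con 0 :+ con 0 :* Y :+ Y :* Y :* con 0) refl Y
        geo-order2 (suc j) with geo-order2 j
        ... | w , e = nat (triangle j) + w + Y * w , (begin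
          1# + y * geo y j ≈⟨ +-congˡ (*-cong y≈1+Y e) ⟩
          1# + (1# + Y) * (nat j + nat (triangle j) * Y + Y * Y * w)
            ≈⟨ solve 4 (λ Y j t w → con 1 :+ (con 1 :+ Y) :* (j :+ t :* Y :+ Y :* Y :* w)
                  := (con 1 :+ j) :+ (t :+ j) :* Y :+ Y :* Y :* (t :+ w :+ Y :* w)) refl Y (nat j) (nat (triangle j)) w ⟩
          (1# + nat j) + (nat (triangle j) + nat j) * Y + Y * Y * (nat (triangle j) + w + Y * w)
            ≈⟨ +-congʳ (+-congˡ (*-congʳ (×-homo-+ 1# (triangle j) j))) ⟨
          nat (suc j) + nat (triangle (suc j)) * Y + Y * Y * (nat (triangle j) + w + Y * w) ∎)

        geo-order1 : ∀ j → ∃ λ w → geo y j ≈ nat j + Y * w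
        geo-order1 j with geo-order2 j
        ... | w , e = nat (triangle j) + Y * w , trans e (solve 4 (λ Y j t w → j :+ t :* Y :+ Y :* Y :* w := j :+ Y :* (t :+ Y :* w)) refl Y (nat j) (nat (triangle j)) w)

    2*triangle : ∀ j → 2 ℕ.* triangle (suc j) ≡ suc j ℕ.* j
    2*triangle zero    = ≡.refl
    2*triangle (suc j) = ≡.trans (ℕₚ.*-distribˡ-+ 2 (triangle (suc j)) (suc j))
      (≡.trans (≡.cong (ℕ._+ 2 ℕ.* suc j) (2*triangle j)) (NS.solve 1 (λ j → (con′ 1 ⊕ j) ⊗ j ⊕ con′ 2 ⊗ (con′ 1 ⊕ j) NS.:= (con′ 2 ⊕ j) ⊗ (con′ 1 ⊕ j)) ≡.refl j))
      where
      import Data.Nat.Solver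
      module NS = Data.Nat.Solver.+-*-Solver
      open NS using () renaming (con to con′; _:+_ to _⊕_; _:*_ to _⊗_)

    triangle-odd : ∀ k → triangle (suc (2 ℕ.* k)) ≡ suc (2 ℕ.* k) ℕ.* k
    triangle-odd k = ℕₚ.*-cancelˡ-≡ _ _ 2 (≡.trans (2*triangle (2 ℕ.* k))
      (≡.trans (≡.sym (ℕₚ.*-assoc (suc (2 ℕ.* k)) 2 k)) (≡.trans (≡.cong (ℕ._* k) (ℕₚ.*-comm (suc (2 ℕ.* k)) 2)) (ℕₚ.*-assoc 2 (suc (2 ℕ.* k)) k))))

    -- For even `j = 2k` the binomial coefficient misses a multiple of `j` by exactly `k`. The
    -- square root `x` will have to absorb this defect.
    triangle-even : ∀ k → triangle (2 ℕ.* k) ℕ.+ k ≡ 2 ℕ.* k ℕ.* k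
    triangle-even zero    = ≡.refl
    triangle-even (suc k) = ℕₚ.*-cancelˡ-≡ _ _ 2 (≡.trans (ℕₚ.*-distribˡ-+ 2 (triangle (2 ℕ.* suc k)) (suc k))
      (≡.trans (≡.cong (ℕ._+ 2 ℕ.* suc k) (2*triangle (k ℕ.+ suc (k ℕ.+ 0))))
        (NS.solve 1 (λ k → (con′ 1 ⊕ (k ⊕ (con′ 1 ⊕ (k ⊕ con′ 0)))) ⊗ (k ⊕ (con′ 1 ⊕ (k ⊕ con′ 0))) ⊕ con′ 2 ⊗ (con′ 1 ⊕ k)
           NS.:= con′ 2 ⊗ (con′ 2 ⊗ (con′ 1 ⊕ k) ⊗ (con′ 1 ⊕ k))) ≡.refl k)))
      where
      import Data.Nat.Solver
      module NS = Data.Nat.Solver.+-*-Solver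
      open NS using () renaming (con to con′; _:+_ to _⊕_; _:*_ to _⊗_)

    add-odd-form : ∀ K Y v s z → (1# + 1#) * K + Y * v + (1# + (1# + 1#) * s + Y * (1# + z)) ≈ 1# + (1# + 1#) * (K + s) + Y * (v + 1# + z)
    add-odd-form = solve 5 (λ K Y v s z → con 2 :* K :+ Y :* v :+ (con 1 :+ con 2 :* s :+ Y :* (con 1 :+ z)) := con 1 :+ con 2 :* (K :+ s) :+ Y :* (v :+ con 1 :+ z)) refl

    square-even-form : ∀ K Y v → ((1# + 1#) * K + Y * v) * ((1# + 1#) * K + Y * v) ≈ (1# + 1#) * ((1# + 1#) * K * K) + Y * ((1# + 1#) * (1# + 1#) * K * v + Y * v * v)
    square-even-form = solve 3 (λ K Y v → (con 2 :* K :+ Y :* v) :* (con 2 :* K :+ Y :* v) := con 2 :* (con 2 :* K :* K) :+ Y :* (con 2 :* con 2 :* K :* v :+ Y :* v :* v)) refl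

    split-odd-form : ∀ s Y z → 1# + (1# + 1#) * s + Y * (1# + z) ≈ (1# + Y) + ((1# + 1#) * s + Y * z)
    split-odd-form = solve 3 (λ s Y z → con 1 :+ con 2 :* s :+ Y :* (con 1 :+ z) := (con 1 :+ Y) :+ (con 2 :* s :+ Y :* z)) refl

    add-even-form : ∀ s s′ Y z z′ → ((1# + 1#) * s + Y * z) + ((1# + 1#) * s′ + Y * z′) ≈ (1# + 1#) * (s + s′) + Y * (z + z′)
    add-even-form = solve 5 (λ s s′ Y z z′ → (con 2 :* s :+ Y :* z) :+ (con 2 :* s′ :+ Y :* z′) := con 2 :* (s :+ s′) :+ Y :* (z :+ z′)) refl

    factor-Y : ∀ Y z → Y + Y * z ≈ Y * (1# + z)
    factor-Y = solve 2 (λ Y z → Y :+ Y :* z := Y :* (con 1 :+ z)) refl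

    expand-mod-Y : ∀ J t Y w → J + t * Y + Y * Y * w ≈ J + Y * (t + Y * w)
    expand-mod-Y = solve 4 (λ J t Y w → J :+ t :* Y :+ Y :* Y :* w := J :+ Y :* (t :+ Y :* w)) refl

    factor-J : ∀ J k Y w → J + J * k * Y + Y * Y * w ≈ J * (1# + k * Y) + Y * Y * w
    factor-J = solve 4 (λ J k Y w → J :+ J :* k :* Y :+ Y :* Y :* w := J :* (con 1 :+ k :* Y) :+ Y :* Y :* w) refl

    add-mod-Y² : ∀ J s Y w e₁ e₂ → (J * s + Y * Y * w) + (J * e₁ + Y * Y * e₂) ≈ J * (s + e₁) + Y * Y * (w + e₂)
    add-mod-Y² = solve 6 (λ J s Y w e₁ e₂ → (J :* s :+ Y :* Y :* w) :+ (J :* e₁ :+ Y :* Y :* e₂) := J :* (s :+ e₁) :+ Y :* Y :* (w :+ e₂)) refl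

    square-odd-form : ∀ h Y v → (1# + (1# + 1#) * h + Y * v) * (1# + (1# + 1#) * h + Y * v) ≈ 1# + ((1# + 1#) * (1# + 1#) * h * (1# + h) + (1# + 1#) * (1# + (1# + 1#) * h) * v * Y + Y * Y * v * v)
    square-odd-form = solve 3 (λ h Y v → (con 1 :+ con 2 :* h :+ Y :* v) :* (con 1 :+ con 2 :* h :+ Y :* v) := con 1 :+ (con 2 :* con 2 :* h :* (con 1 :+ h) :+ con 2 :* (con 1 :+ con 2 :* h) :* v :* Y :+ Y :* Y :* v :* v)) refl

    scaled-square-excess : ∀ k h Y v → k * ((1# + 1#) * (1# + 1#) * h * (1# + h) + (1# + 1#) * (1# + (1# + 1#) * h) * v * Y + Y * Y * v * v) ≈ (1# + 1#) * k * ((1# + 1#) * h * (1# + h) + (1# + (1# + 1#) * h) * v * Y) + Y * Y * (k * v * v)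
    scaled-square-excess = solve 4 (λ k h Y v → k :* (con 2 :* con 2 :* h :* (con 1 :+ h) :+ con 2 :* (con 1 :+ con 2 :* h) :* v :* Y :+ Y :* Y :* v :* v) := con 2 :* k :* (con 2 :* h :* (con 1 :+ h) :+ (con 1 :+ con 2 :* h) :* v :* Y) :+ Y :* Y :* (k :* v :* v)) refl

    collect-Y : ∀ J t k Y w → (J + t * Y + Y * Y * w) + k * Y ≈ J + (t + k) * Y + Y * Y * w
    collect-Y = solve 5 (λ J t k Y w → (J :+ t :* Y :+ Y :* Y :* w) :+ k :* Y := J :+ (t :+ k) :* Y :+ Y :* Y :* w) refl

    absorb-unit-Y : ∀ Y z u → Y * ((1# + Y * z) * u) ≈ (Y + Y * Y * z) * u
    absorb-unit-Y = solve 3 (λ Y z u → Y :* ((con 1 :+ Y :* z) :* u) := (Y :+ Y :* Y :* z) :* u) refl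

    collect-Y² : ∀ J s Y z z′ → J * s + Y * Y * z + Y * Y * z′ ≈ J * s + Y * Y * (z + z′)
    collect-Y² = solve 5 (λ J s Y z z′ → J :* s :+ Y :* Y :* z :+ Y :* Y :* z′ := J :* s :+ Y :* Y :* (z :+ z′)) refl

    substitute-step : ∀ i Jk i′ J s v → i + Jk * (i′ + J * s * v) ≈ (i + Jk * i′) + J * Jk * (s * v)
    substitute-step = solve 6 (λ i Jk i′ J s v → i :+ Jk :* (i′ :+ J :* s :* v) := (i :+ Jk :* i′) :+ J :* Jk :* (s :* v)) refl

    absorb-unit : ∀ P Y z u → P * ((1# + Y * z) * u) ≈ (P + P * (Y * z)) * u
    absorb-unit = solve 4 (λ P Y z u → P :* ((con 1 :+ Y :* z) :* u) := (P :+ P :* (Y :* z)) :* u) refl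

    collect-PY : ∀ P Y z z′ → P * (Y * z) + P * (Y * z′) ≈ P * Y * (z + z′)
    collect-PY = solve 4 (λ P Y z z′ → P :* (Y :* z) :+ P :* (Y :* z′) := P :* Y :* (z :+ z′)) refl

    swap-factors : ∀ p u f → p * u * f ≈ u * (p * f)
    swap-factors = solve 3 (λ p u f → p :* u :* f := u :* (p :* f)) refl

    collect-2+Y : ∀ Y f → (1# + 1#) * f + Y * f ≈ (1# + (1# + Y)) * f
    collect-2+Y = solve 2 (λ Y f → con 2 :* f :+ Y :* f := (con 1 :+ (con 1 :+ Y)) :* f) refl

    double-sum-factor : ∀ g h Y u → g * (((1# + 1#) * h + Y * (g * h)) * u) ≈ (g + (1# + Y * g) * g) * (h * u)
    double-sum-factor = solve 4 (λ g h Y u → g :* ((con 2 :* h :+ Y :* (g :* h)) :* u) := (g :+ (con 1 :+ Y :* g) :* g) :* (h :* u)) refl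

    move : ∀ {p q r} → p + q ≈ r → p ≈ r + - q
    move {p} {q} {r} e = begin
      p              ≈⟨ +-identityʳ p ⟨
      p + 0#         ≈⟨ +-congˡ (-‿inverseʳ q) ⟨
      p + (q + - q)  ≈⟨ +-assoc p q (- q) ⟨
      (p + q) + - q  ≈⟨ +-congʳ e ⟩
      r + - q        ∎

    -- Every element is a partial geometric sum 1 + y + ⋯ + y^(j-1), i.e. the affine map
    -- s ↦ 1 + y s acts transitively on the ring.
    module Spanned (N : ℕ) {{N≢0 : NonZero N}} (y : Carrier)
      (span : ∀ f → ∃ λ j → f ≈ geo y j)
      (period : geo y N ≈ 0#) where

      Y : Carrier
      Y = y + - 1#

      y≈1+Y : y ≈ 1# + Y
      y≈1+Y = sym (trans (+-comm 1# _) (trans (+-assoc y _ _) (trans (+-congˡ (-‿inverseˡ 1#)) (+-identityʳ y))))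

      y^N≈1 : y ^ N ≈ 1#
      y^N≈1 = trans (power-geo y Y y≈1+Y N) (trans (+-congˡ (trans (*-congˡ period) (zeroʳ Y))) (+-identityʳ 1#))

      1^≈1 : ∀ k → 1# ^ k ≈ 1#
      1^≈1 zero = refl
      1^≈1 (suc k) = trans (*-identityˡ _) (1^≈1 k)

      abstract
        -- 1 + Y t is always a power of y.
        unit : ∀ t → ∃ λ u → (1# + Y * t) * u ≈ 1#
        unit t with span t
        ... | i , e = y ^ (ℕ.pred N ℕ.* i) , (begin
          (1# + Y * t) * y ^ (ℕ.pred N ℕ.* i)        ≈⟨ *-congʳ (+-congˡ (*-congˡ e)) ⟩
          (1# + Y * geo y i) * y ^ (ℕ.pred N ℕ.* i)  ≈⟨ *-congʳ (power-geo y Y y≈1+Y i) ⟨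
          y ^ i * y ^ (ℕ.pred N ℕ.* i)               ≈⟨ ^-homo-* y i (ℕ.pred N ℕ.* i) ⟨
          y ^ (suc (ℕ.pred N) ℕ.* i)                 ≡⟨ ≡.cong (λ n → y ^ (n ℕ.* i)) (ℕₚ.suc-pred N) ⟩
          y ^ (N ℕ.* i)                              ≈⟨ ^-assocʳ y N i ⟨
          (y ^ N) ^ i                                ≈⟨ ^-congˡ i y^N≈1 ⟩
          1# ^ i                                     ≈⟨ 1^≈1 i ⟩
          1# ∎)

      -- Since `1 + y = 2 + Y`, the hypothesis reads `2 f = 1 - Y f`, and the right-hand side is a
      -- unit.
      2-unit : ∀ f → (1# + y) * f ≈ 1# → ∃ λ h → (1# + 1#) * h ≈ 1#
      2-unit f e with unit (- f)
      ... | u , inverse = f * u , (begin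
        (1# + 1#) * (f * u)     ≈⟨ *-assoc _ f u ⟨
        (1# + 1#) * f * u       ≈⟨ *-congʳ (move shifted) ⟩
        (1# + - (Y * f)) * u    ≈⟨ *-congʳ (+-congˡ (-‿distribʳ-* Y f)) ⟩
        (1# + Y * - f) * u      ≈⟨ inverse ⟩
        1#                      ∎)
        where
        open import Algebra.Properties.Ring ring using (-‿distribʳ-*)
        shifted : (1# + 1#) * f + Y * f ≈ 1#
        shifted = begin
          (1# + 1#) * f + Y * f   ≈⟨ collect-2+Y Y f ⟩
          (1# + (1# + Y)) * f     ≈⟨ *-congʳ (+-congˡ y≈1+Y) ⟨
          (1# + y) * f            ≈⟨ e ⟩
          1#                      ∎

      -- If 2 is a unit then so is 1 + y^k = 2 + Y [k], and the period is odd.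
      halve : ∀ h → (1# + 1#) * h ≈ 1# → ∀ k → geo y (k ℕ.+ k) ≈ 0# → geo y k ≈ 0#
      halve h 2h≈1 k e with unit (g * h)
        where
        g : Carrier
        g = geo y k
      ... | u , inverse = begin
        g                                 ≈⟨ *-identityʳ g ⟨
        g * 1#                            ≈⟨ *-congˡ inverse ⟨
        g * ((1# + Y * (g * h)) * u)      ≈⟨ *-congˡ (*-congʳ (+-congʳ 2h≈1)) ⟨
        g * (((1# + 1#) * h + Y * (g * h)) * u) ≈⟨ double-sum-factor g h Y u ⟩
        (g + (1# + Y * g) * g) * (h * u)  ≈⟨ *-congʳ (+-congˡ (*-congʳ (power-geo y Y y≈1+Y k))) ⟨
        (g + y ^ k * g) * (h * u)         ≈⟨ *-congʳ (geo-+ y k k) ⟨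
        geo y (k ℕ.+ k) * (h * u)         ≈⟨ *-congʳ e ⟩
        0# * (h * u)                      ≈⟨ zeroˡ _ ⟩
        0#                                ∎
        where
        g : Carrier
        g = geo y k

    -- Strategy: `Y = geo y j` for some `j`, and `Y` generates the same ideal as the integer
    -- `J = nat j`. Every geometric sum is an integer modulo `Y`, so every element is an integer
    -- modulo each power of `J`, and `J` is nilpotent.
    module Transitive (N : ℕ) {{N≢0 : NonZero N}} (x : Carrier)
      (span : ∀ f → ∃ λ j → f ≈ geo (x * x) j)
      (period : geo (x * x) N ≈ 0#)
      (faithful : ∀ j → geo (x * x) j ≈ 0# → N ∣ j) where

      open Spanned N (x * x) span period

      private
        y : Carrier
        y = x * x

      nat-2* : ∀ k → nat (2 ℕ.* k) ≈ (1# + 1#) * nat k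
      nat-2* k = trans (×1-homo-* 2 k) (*-congʳ (+-congˡ (+-identityʳ 1#)))

      -- If `x` is even modulo `Y`, so is `x * x = 1 + Y`; hence zero has an expression
      -- `1 + 2 (…) + Y (…)`, and adding it turns the even form of `x` into an odd one.
      odd-part-even : ∀ K v → x ≈ (1# + 1#) * K + Y * v → ∃ λ h → ∃ λ v → x ≈ 1# + (1# + 1#) * h + Y * v
      odd-part-even K v x≈ = K + - sq , v + 1# + - z , (begin
        x ≈⟨ x≈ ⟩
        (1# + 1#) * K + Y * v ≈⟨ +-identityʳ _ ⟨
        (1# + 1#) * K + Y * v + 0# ≈⟨ +-congˡ zero-form ⟨
        (1# + 1#) * K + Y * v + (1# + (1# + 1#) * - sq + Y * (1# + - z)) ≈⟨ add-odd-form K Y v (- sq) (- z) ⟩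
        1# + (1# + 1#) * (K + - sq) + Y * (v + 1# + - z) ∎)
        where
        sq z : Carrier
        sq = (1# + 1#) * K * K
        z = (1# + 1#) * (1# + 1#) * K * v + Y * v * v
        square : 1# + Y ≈ (1# + 1#) * sq + Y * z
        square = begin
          1# + Y ≈⟨ y≈1+Y ⟨
          x * x ≈⟨ *-cong x≈ x≈ ⟩
          ((1# + 1#) * K + Y * v) * ((1# + 1#) * K + Y * v) ≈⟨ square-even-form K Y v ⟩
          (1# + 1#) * sq + Y * z ∎
        zero-form : 1# + (1# + 1#) * - sq + Y * (1# + - z) ≈ 0#
        zero-form = begin
          1# + (1# + 1#) * - sq + Y * (1# + - z) ≈⟨ split-odd-form (- sq) Y (- z) ⟩
          (1# + Y) + ((1# + 1#) * - sq + Y * - z) ≈⟨ +-congʳ square ⟩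
          ((1# + 1#) * sq + Y * z) + ((1# + 1#) * - sq + Y * - z) ≈⟨ add-even-form sq (- sq) Y z (- z) ⟩
          (1# + 1#) * (sq + - sq) + Y * (z + - z) ≈⟨ +-cong (*-congˡ (-‿inverseʳ sq)) (*-congˡ (-‿inverseʳ z)) ⟩
          (1# + 1#) * 0# + Y * 0# ≈⟨ +-cong (zeroʳ _) (zeroʳ _) ⟩
          0# + 0# ≈⟨ +-identityʳ 0# ⟩
          0# ∎

      odd-part : ∃ λ h → ∃ λ v → x ≈ 1# + (1# + 1#) * h + Y * v
      odd-part = cases (proj₁ (span x)) (parity _) (trans (proj₂ (span x)) (proj₂ (geo-order1 y Y y≈1+Y (proj₁ (span x)))))
        where
        cases : ∀ i → (∃ λ k → i ≡ 2 ℕ.* k ⊎ i ≡ suc (2 ℕ.* k)) → ∀ {v} → x ≈ nat i + Y * v → ∃ λ h → ∃ λ v → x ≈ 1# + (1# + 1#) * h + Y * v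
        cases _ (k , inj₂ ≡.refl) {v} e = nat k , v , trans e (+-congʳ (+-congˡ (nat-2* k)))
        cases _ (k , inj₁ ≡.refl) {v} e = odd-part-even (nat k) v (trans e (+-congʳ (nat-2* k)))

      private
        j : ℕ
        j = proj₁ (span Y)
        J w : Carrier
        J = nat j
        w = proj₁ (geo-order2 y Y y≈1+Y j)

      Y-expansion : Y ≈ J + nat (triangle j) * Y + Y * Y * w
      Y-expansion = trans (proj₂ (span Y)) (proj₂ (geo-order2 y Y y≈1+Y j))

      J∈Y : ∃ λ v → J ≈ Y * v
      J∈Y = 1# + - z , (begin
        J ≈⟨ move e ⟩
        Y + - (Y * z) ≈⟨ +-congˡ (-‿distribʳ-* Y z) ⟩
        Y + Y * - z ≈⟨ factor-Y Y (- z) ⟩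
        Y * (1# + - z) ∎)
        where
        open import Algebra.Properties.Ring ring using (-‿distribʳ-*)
        z = nat (triangle j) + Y * w
        e : J + Y * z ≈ Y
        e = sym (trans Y-expansion (expand-mod-Y J (nat (triangle j)) Y w))

      -- Modulo `Y * Y` one has `Y = J + triangle j * Y`. For odd `j` the coefficient is a multiple
      -- of `j`. For `j = 2k` the defect `k * Y` remains; squaring `x = 1 + 2h + Y v` shows that `Y`
      -- is a multiple of 2 modulo `Y * Y`, so `k * Y` is a multiple of `2k = j`.
      Y-mod-square : ∃ λ s → ∃ λ z → Y ≈ J * s + Y * Y * z
      Y-mod-square with parity j
      ... | k , inj₂ e = 1# + nat k * Y , w , (begin
        Y ≈⟨ Y-expansion ⟩
        J + nat (triangle j) * Y + Y * Y * w ≈⟨ +-congʳ (+-congˡ (*-congʳ tri)) ⟩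
        J + J * nat k * Y + Y * Y * w ≈⟨ factor-J J (nat k) Y w ⟩
        J * (1# + nat k * Y) + Y * Y * w ∎)
        where
        tri : nat (triangle j) ≈ J * nat k
        tri = trans (reflexive (≡.cong nat (≡.trans (≡.cong triangle e) (≡.trans (triangle-odd k) (≡.cong (ℕ._* k) (≡.sym e)))))) (×1-homo-* j k)
      ... | k , inj₁ e = (1# + nat k * Y) + - e₁ , w + - e₂ , (begin
        Y ≈⟨ move shifted ⟩
        (J * (1# + nat k * Y) + Y * Y * w) + - (J * e₁ + Y * Y * e₂)
          ≈⟨ +-congˡ (-‿+-comm (J * e₁) (Y * Y * e₂)) ⟨
        (J * (1# + nat k * Y) + Y * Y * w) + (- (J * e₁) + - (Y * Y * e₂))
          ≈⟨ +-congˡ (+-cong (-‿distribʳ-* J e₁) (-‿distribʳ-* (Y * Y) e₂)) ⟩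
        (J * (1# + nat k * Y) + Y * Y * w) + (J * - e₁ + Y * Y * - e₂)
          ≈⟨ add-mod-Y² J (1# + nat k * Y) Y w (- e₁) (- e₂) ⟩
        J * ((1# + nat k * Y) + - e₁) + Y * Y * (w + - e₂) ∎)
        where
        open import Algebra.Properties.Ring ring using (-‿distribʳ-*)
        open import Algebra.Properties.AbelianGroup +-abelianGroup using () renaming (⁻¹-∙-comm to -‿+-comm)
        h = proj₁ odd-part
        v = proj₁ (proj₂ odd-part)
        e₁ = (1# + 1#) * h * (1# + h) + (1# + (1# + 1#) * h) * v * Y
        e₂ = nat k * v * v
        J≈2k : J ≈ (1# + 1#) * nat k
        J≈2k = trans (reflexive (≡.cong nat e)) (trans (×1-homo-* 2 k) (*-congʳ (+-congˡ (+-identityʳ 1#))))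
        tri : nat (triangle j) + nat k ≈ J * nat k
        tri = begin
          nat (triangle j) + nat k ≈⟨ ×-homo-+ 1# (triangle j) k ⟨
          nat (triangle j ℕ.+ k) ≡⟨ ≡.cong nat (≡.trans (≡.cong (λ i → triangle i ℕ.+ k) e) (≡.trans (triangle-even k) (≡.cong (ℕ._* k) (≡.sym e)))) ⟩
          nat (j ℕ.* k) ≈⟨ ×1-homo-* j k ⟩
          J * nat k ∎
        X-square : 1# + Y ≈ 1# + ((1# + 1#) * (1# + 1#) * h * (1# + h) + (1# + 1#) * (1# + (1# + 1#) * h) * v * Y + Y * Y * v * v)
        X-square = begin
          1# + Y ≈⟨ y≈1+Y ⟨
          x * x ≈⟨ *-cong (proj₂ (proj₂ odd-part)) (proj₂ (proj₂ odd-part)) ⟩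
          (1# + (1# + 1#) * h + Y * v) * (1# + (1# + 1#) * h + Y * v)
            ≈⟨ square-odd-form h Y v ⟩
          _ ∎
        Y≈ : Y ≈ (1# + 1#) * (1# + 1#) * h * (1# + h) + (1# + 1#) * (1# + (1# + 1#) * h) * v * Y + Y * Y * v * v
        Y≈ = +-cancelˡ 1# _ _ X-square
          where open import Algebra.Properties.AbelianGroup +-abelianGroup using () renaming (∙-cancelˡ to +-cancelˡ)
        kY : nat k * Y ≈ J * e₁ + Y * Y * e₂
        kY = begin
          nat k * Y ≈⟨ *-congˡ Y≈ ⟩
          nat k * ((1# + 1#) * (1# + 1#) * h * (1# + h) + (1# + 1#) * (1# + (1# + 1#) * h) * v * Y + Y * Y * v * v)
            ≈⟨ scaled-square-excess (nat k) h Y v ⟩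
          (1# + 1#) * nat k * e₁ + Y * Y * e₂ ≈⟨ +-congʳ (*-congʳ J≈2k) ⟨
          J * e₁ + Y * Y * e₂ ∎
        shifted : Y + (J * e₁ + Y * Y * e₂) ≈ J * (1# + nat k * Y) + Y * Y * w
        shifted = begin
          Y + (J * e₁ + Y * Y * e₂) ≈⟨ +-cong Y-expansion (sym kY) ⟩
          (J + nat (triangle j) * Y + Y * Y * w) + nat k * Y
            ≈⟨ collect-Y J (nat (triangle j)) (nat k) Y w ⟩
          J + (nat (triangle j) + nat k) * Y + Y * Y * w ≈⟨ +-congʳ (+-congˡ (*-congʳ tri)) ⟩
          J + J * nat k * Y + Y * Y * w ≈⟨ factor-J J (nat k) Y w ⟩
          J * (1# + nat k * Y) + Y * Y * w ∎

      -- Nakayama's argument: `Y (1 - Y z) = J s`, and `1 - Y z` is a unit.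
      Y∈J : ∃ λ s → Y ≈ J * s
      Y∈J with Y-mod-square
      ... | s , z , e with unit (- z)
      ... | u , inverse = s * u , (begin
        Y ≈⟨ *-identityʳ Y ⟨
        Y * 1# ≈⟨ *-congˡ inverse ⟨
        Y * ((1# + Y * - z) * u) ≈⟨ absorb-unit-Y Y (- z) u ⟩
        (Y + Y * Y * - z) * u ≈⟨ *-congʳ (+-congʳ e) ⟩
        (J * s + Y * Y * z + Y * Y * - z) * u ≈⟨ *-congʳ (collect-Y² J s Y z (- z)) ⟩
        (J * s + Y * Y * (z + - z)) * u ≈⟨ *-congʳ (+-congˡ (trans (*-congˡ (-‿inverseʳ z)) (zeroʳ _))) ⟩
        (J * s + 0#) * u ≈⟨ *-congʳ (+-identityʳ _) ⟩
        J * s * u ≈⟨ *-assoc J s u ⟩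
        J * (s * u) ∎)

      -- Successive approximation: the error `s` is again a geometric sum, hence an integer up to a
      -- multiple of `Y`, that is, of `J`.
      nat+J : ∀ k f → ∃ λ i → ∃ λ s → f ≈ nat i + J ^ k * s
      nat+J zero f = 0 , f , sym (trans (+-identityˡ _) (*-identityˡ f))
      nat+J (suc k) f with nat+J k f
      ... | i , s , e with span s
      ... | i′ , e′ with geo-order1 y Y y≈1+Y i′
      ... | v , e″ = i ℕ.+ j ℕ.^ k ℕ.* i′ , proj₁ Y∈J * v , (begin
        f ≈⟨ e ⟩
        nat i + J ^ k * s ≈⟨ +-congˡ (*-congˡ (trans e′ (trans e″ (+-congˡ (*-congʳ (proj₂ Y∈J)))))) ⟩
        nat i + J ^ k * (nat i′ + J * proj₁ Y∈J * v)
          ≈⟨ substitute-step (nat i) (J ^ k) (nat i′) J (proj₁ Y∈J) v ⟩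
        (nat i + J ^ k * nat i′) + J * J ^ k * (proj₁ Y∈J * v) ≈⟨ +-congʳ (+-congˡ (*-congʳ (nat-^ k))) ⟨
        (nat i + nat (j ℕ.^ k) * nat i′) + J * J ^ k * (proj₁ Y∈J * v) ≈⟨ +-congʳ (+-congˡ (×1-homo-* (j ℕ.^ k) i′)) ⟨
        (nat i + nat (j ℕ.^ k ℕ.* i′)) + J * J ^ k * (proj₁ Y∈J * v) ≈⟨ +-congʳ (×-homo-+ 1# i (j ℕ.^ k ℕ.* i′)) ⟨
        nat (i ℕ.+ j ℕ.^ k ℕ.* i′) + J ^ suc k * (proj₁ Y∈J * v) ∎)
        where
        nat-^ : ∀ k → nat (j ℕ.^ k) ≈ J ^ k
        nat-^ zero    = +-identityʳ 1#
        nat-^ (suc k) = trans (×1-homo-* j (j ℕ.^ k)) (*-congˡ (nat-^ k))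

      geo-mod : ∀ i → geo y i ≈ geo y (i % N)
      geo-mod i = begin
        geo y i ≡⟨ ≡.cong (geo y) (≡.trans (m≡m%n+[m/n]*n i N) (ℕₚ.+-comm (i % N) _)) ⟩
        geo y (i / N ℕ.* N ℕ.+ i % N) ≈⟨ geo-multiple (i / N) (i % N) ⟩
        geo y (i % N) ∎
        where
        geo-multiple : ∀ k r → geo y (k ℕ.* N ℕ.+ r) ≈ geo y r
        geo-multiple zero    r = refl
        geo-multiple (suc k) r = begin
          geo y (N ℕ.+ k ℕ.* N ℕ.+ r) ≡⟨ ≡.cong (geo y) (ℕₚ.+-assoc N _ r) ⟩
          geo y (N ℕ.+ (k ℕ.* N ℕ.+ r)) ≈⟨ geo-+ y N _ ⟩
          geo y N + y ^ N * geo y (k ℕ.* N ℕ.+ r) ≈⟨ +-cong period (*-congʳ y^N≈1) ⟩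
          0# + 1# * geo y (k ℕ.* N ℕ.+ r) ≈⟨ trans (+-identityˡ _) (*-identityˡ _) ⟩
          geo y (k ℕ.* N ℕ.+ r) ≈⟨ geo-multiple k r ⟩
          geo y r ∎

      index : Carrier → Fin N
      index f = fromℕ< (m%n<n (proj₁ (span f)) N)

      index-injective : ∀ f g → index f ≡ index g → f ≈ g
      index-injective f g e = begin
        f ≈⟨ trans (proj₂ (span f)) (geo-mod _) ⟩
        geo y (proj₁ (span f) % N) ≡⟨ ≡.cong (geo y) (fromℕ<-injective _ _ _ _ e) ⟩
        geo y (proj₁ (span g) % N) ≈⟨ trans (proj₂ (span g)) (geo-mod _) ⟨
        g ∎

      -- The ring is finite, so two powers of `J` coincide. This gives `J^i = J^i * (Y z)`, and
      -- `1 - Y z` is a unit.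
      J-nilpotent : ∃ λ k → J ^ k ≈ 0#
      J-nilpotent with pigeonhole (ℕₚ.n<1+n N) (λ (i : Fin (suc N)) → index (J ^ toℕ i))
      ... | i , i′ , i<i′ , e with ℕₚ.m≤n⇒∃[o]m+o≡n i<i′
      ... | d , eq with unit (- (proj₁ J∈Y * J ^ d))
      ... | u , inverse = toℕ i , (begin
        J ^ toℕ i ≈⟨ *-identityʳ _ ⟨
        J ^ toℕ i * 1# ≈⟨ *-congˡ inverse ⟨
        J ^ toℕ i * ((1# + Y * - z) * u) ≈⟨ absorb-unit (J ^ toℕ i) Y (- z) u ⟩
        (J ^ toℕ i + J ^ toℕ i * (Y * - z)) * u ≈⟨ *-congʳ (+-congʳ step) ⟩
        (J ^ toℕ i * (Y * z) + J ^ toℕ i * (Y * - z)) * u ≈⟨ *-congʳ (collect-PY (J ^ toℕ i) Y z (- z)) ⟩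
        J ^ toℕ i * Y * (z + - z) * u ≈⟨ *-congʳ (trans (*-congˡ (-‿inverseʳ z)) (zeroʳ _)) ⟩
        0# * u ≈⟨ zeroˡ u ⟩
        0# ∎)
        where
        z = proj₁ J∈Y * J ^ d
        step : J ^ toℕ i ≈ J ^ toℕ i * (Y * z)
        step = begin
          J ^ toℕ i ≈⟨ index-injective _ _ e ⟩
          J ^ toℕ i′ ≡⟨ ≡.cong (J ^_) (≡.trans (ℕₚ.+-suc (toℕ i) d) eq) ⟨
          J ^ (toℕ i ℕ.+ suc d) ≈⟨ ^-homo-* J (toℕ i) (suc d) ⟩
          J ^ toℕ i * (J * J ^ d) ≈⟨ *-congˡ (*-congʳ (proj₂ J∈Y)) ⟩
          J ^ toℕ i * (Y * proj₁ J∈Y * J ^ d) ≈⟨ *-congˡ (*-assoc _ _ _) ⟩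
          J ^ toℕ i * (Y * z) ∎

      abstract
        natural : ∀ f → ∃ λ k → f ≈ nat k
        natural f with nat+J (proj₁ J-nilpotent) f
        ... | k , s , e = k , trans e (trans (+-congˡ (trans (*-congʳ (proj₂ J-nilpotent)) (zeroˡ s))) (+-identityʳ _))

      nat-mod : ∀ e {{_ : NonZero e}} → nat e ≈ 0# → ∀ k → nat k ≈ nat (k % e)
      nat-mod e e≈0 k = begin
        nat k ≡⟨ ≡.cong nat (m≡m%n+[m/n]*n k e) ⟩
        nat (k % e ℕ.+ k / e ℕ.* e) ≈⟨ ×-homo-+ 1# (k % e) _ ⟩
        nat (k % e) + nat (k / e ℕ.* e) ≈⟨ +-congˡ (trans (×1-homo-* (k / e) e) (trans (*-congˡ e≈0) (zeroʳ _))) ⟩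
        nat (k % e) + 0# ≈⟨ +-identityʳ _ ⟩
        nat (k % e) ∎

      move0 : ∀ {p q} → p ≈ p + q → q ≈ 0#
      move0 {p} {q} e = ∙-cancelˡ p q 0# (trans (sym e) (sym (+-identityʳ p)))
        where open import Algebra.Properties.AbelianGroup +-abelianGroup

      y^-cancel : ∀ i f → y ^ i * f ≈ 0# → f ≈ 0#
      y^-cancel i f e with unit (geo y i)
      ... | u , inverse = begin
        f ≈⟨ *-identityˡ f ⟨
        1# * f ≈⟨ *-congʳ inverse ⟨
        (1# + Y * geo y i) * u * f ≈⟨ *-congʳ (*-congʳ (power-geo y Y y≈1+Y i)) ⟨
        y ^ i * u * f ≈⟨ swap-factors (y ^ i) u f ⟩
        u * (y ^ i * f) ≈⟨ *-congˡ e ⟩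
        u * 0# ≈⟨ zeroʳ u ⟩
        0# ∎

      geo-injective-≤ : ∀ i k → i ℕ.≤ k → k ℕ.< N → geo y i ≈ geo y k → i ≡ k
      geo-injective-≤ i k i≤k k<N e with ℕₚ.m≤n⇒∃[o]m+o≡n i≤k
      ... | zero  , eq = ≡.trans (≡.sym (ℕₚ.+-identityʳ i)) eq
      ... | suc o , ≡.refl = ⊥-elim (ℕₚ.<⇒≱ (ℕₚ.≤-<-trans (ℕₚ.m≤n+m (suc o) i) k<N)
             (∣⇒≤ (faithful (suc o) (y^-cancel i _ (move0 (trans e (geo-+ y i (suc o))))))))

      geo-injective : ∀ i k → i ℕ.< N → k ℕ.< N → geo y i ≈ geo y k → i ≡ k
      geo-injective i k i<N k<N e with ℕₚ.≤-total i k
      ... | inj₁ i≤k = geo-injective-≤ i k i≤k k<N e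
      ... | inj₂ k≤i = ≡.sym (geo-injective-≤ k i k≤i i<N (sym e))

      -- The `N` distinct geometric sums are all integers, and integers take at most `suc e` values
      -- once `suc e` vanishes.
      N≤char : ∀ e → nat (suc e) ≈ 0# → N ℕ.≤ suc e
      N≤char e e≈0 = injective⇒≤ {f = f} λ {i} {k} eq → toℕ-injective
        (geo-injective _ _ (toℕ<n i) (toℕ<n k) (trans (reduce i) (trans (reflexive (≡.cong nat (fromℕ<-injective _ _ _ _ eq))) (sym (reduce k)))))
        where
        ρ : Fin N → ℕ
        ρ i = proj₁ (natural (geo y (toℕ i)))
        f : Fin N → Fin (suc e)
        f i = fromℕ< (m%n<n (ρ i) (suc e))
        reduce : ∀ i → geo y (toℕ i) ≈ nat (ρ i % suc e)
        reduce i = trans (proj₂ (natural (geo y (toℕ i)))) (nat-mod (suc e) e≈0 (ρ i))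

      char-multiple : ∀ k → nat k ≈ 0# → N ∣ k
      nat-N≈0 : nat N ≈ 0#

      nat-N≈0 with pigeonhole (ℕₚ.n<1+n N) (λ (i : Fin (suc N)) → index (nat (toℕ i)))
      ... | i , k , i<k , e with ℕₚ.m≤n⇒∃[o]m+o≡n i<k
      ... | o , eq = trans (reflexive (≡.cong nat (ℕₚ.≤-antisym (N≤char o o≈0) o≤N))) o≈0
        where
        k≡ : toℕ i ℕ.+ suc o ≡ toℕ k
        k≡ = ≡.trans (ℕₚ.+-suc (toℕ i) o) eq
        o≈0 : nat (suc o) ≈ 0#
        o≈0 = move0 (trans (index-injective _ _ e) (trans (reflexive (≡.cong nat (≡.sym k≡))) (×-homo-+ 1# (toℕ i) (suc o))))
        o≤N : suc o ℕ.≤ N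
        o≤N = ℕₚ.≤-trans (ℕₚ.m≤n+m (suc o) (toℕ i)) (ℕₚ.≤-trans (ℕₚ.≤-reflexive k≡) (ℕₚ.≤-pred (toℕ<n k)))

      char-multiple k k≈0 = m%n≡0⇒n∣m k N (remainder (k % N) ≡.refl)
        where
        remainder : ∀ r → k % N ≡ r → k % N ≡ 0
        remainder zero    e = e
        remainder (suc r) e = ⊥-elim (ℕₚ.<⇒≱ (≡.subst (ℕ._< N) e (m%n<n k N))
          (N≤char r (trans (reflexive (≡.cong nat (≡.sym e))) (trans (sym (nat-mod N nat-N≈0 k)) k≈0))))

      unit-natural : ∀ k f → nat k * f ≈ 1# → ∀ {l} → Prime l → l ∣ N → l ∣ k → ⊥
      unit-natural k f e {l} l-prime l∣N l∣k with natural f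
      ... | i , f≈ = contra (k ℕ.* i) (∣m⇒∣m*n i l∣k) (trans (×1-homo-* k i) (trans (*-congˡ (sym f≈)) e))
        where
        l∤1 : ¬ (l ∣ 1)
        l∤1 l∣1 = ¬prime[1] (≡.subst Prime (∣1⇒≡1 l∣1) l-prime)
        contra : ∀ m → l ∣ m → nat m ≈ 1# → ⊥
        contra zero    _    0≈1 = l∤1 (∣-trans l∣N (char-multiple 1 (trans (+-identityʳ 1#) (sym 0≈1))))
        contra (suc m) l∣m′ e′  = l∤1 (∣m+n∣m⇒∣n (≡.subst (l ∣_) (ℕₚ.+-comm 1 m) l∣m′)
          (∣-trans l∣N (char-multiple m (move0 (sym e′)))))

      -- `Y = nat D` lies in the Jacobson radical, because `1 + Y t` is always a unit. If `l` did
      -- not divide `D`, a Bézout identity would make such a unit, up to sign, an integer multiple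
      -- of `l`; this cannot be invertible when `l` divides the characteristic.
      prime-divides : ∀ r D → x ≈ nat r → r ℕ.* r ≡ suc D → ∀ {l} → Prime l → l ∣ N → l ∣ D
      prime-divides r D x≈r rr≡ {l} l-prime l∣N with l ∣? D
      ... | yes l∣D = l∣D
      ... | no  l∤D = ⊥-elim (impossible (coprime-Bézout coprime))
        where
        coprime : Coprime l D
        coprime {d} (d∣l , d∣D) with prime⇒irreducible l-prime d∣l
        ... | inj₁ d≡1 = d≡1
        ... | inj₂ ≡.refl = ⊥-elim (l∤D d∣D)
        Y≈D : Y ≈ nat D
        Y≈D = ∙-cancelˡ 1# _ _ (trans (sym y≈1+Y) (trans (*-cong x≈r x≈r) (trans (sym (×1-homo-* r r)) (reflexive (≡.cong nat rr≡)))))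
          where open import Algebra.Properties.AbelianGroup +-abelianGroup
        YD : ∀ t → nat (t ℕ.* D) ≈ Y * nat t
        YD t = trans (×1-homo-* t D) (trans (*-congˡ (sym Y≈D)) (*-comm _ _))
        impossible : Bézout.Identity 1 l D → ⊥
        impossible (Bézout.+- s t eq) with unit (nat t)
        ... | u , inverse = unit-natural (s ℕ.* l) u (trans (*-congʳ sl) inverse) l-prime l∣N (n∣m*n s)
          where
          sl : nat (s ℕ.* l) ≈ 1# + Y * nat t
          sl = trans (reflexive (≡.cong nat (≡.sym eq))) (+-congˡ (YD t))
        impossible (Bézout.-+ s t eq) with unit (- nat t)
        ... | u , inverse = unit-natural (s ℕ.* l) (- u) (begin
          nat (s ℕ.* l) * - u ≈⟨ -‿distribʳ-* _ u ⟨
          - (nat (s ℕ.* l) * u) ≈⟨ -‿distribˡ-* _ u ⟩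
          - nat (s ℕ.* l) * u ≈⟨ *-congʳ sl ⟨
          (1# + Y * - nat t) * u ≈⟨ inverse ⟩
          1# ∎) l-prime l∣N (n∣m*n s)
          where
          open import Algebra.Properties.Ring ring using (-‿distribʳ-*; -‿distribˡ-*)
          eq′ : 1# + nat (s ℕ.* l) ≈ Y * nat t
          eq′ = trans (reflexive (≡.cong nat eq)) (YD t)
          sl : 1# + Y * - nat t ≈ - nat (s ℕ.* l)
          sl = begin
            1# + Y * - nat t ≈⟨ +-congˡ (-‿distribʳ-* Y (nat t)) ⟨
            1# + - (Y * nat t) ≈⟨ +-congʳ (move eq′) ⟩
            Y * nat t + - nat (s ℕ.* l) + - (Y * nat t) ≈⟨ +-congʳ (+-comm _ _) ⟩
            - nat (s ℕ.* l) + Y * nat t + - (Y * nat t) ≈⟨ +-assoc _ _ _ ⟩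
            - nat (s ℕ.* l) + (Y * nat t + - (Y * nat t)) ≈⟨ +-congˡ (-‿inverseʳ _) ⟩
            - nat (s ℕ.* l) + 0# ≈⟨ +-identityʳ _ ⟩
            - nat (s ℕ.* l) ∎

-- The ring generated by one endomorphism of an abelian group.

module PolynomialAction where
  open import Algebra.Bundles using (CommutativeRing; AbelianGroup)
  open import Level using (0ℓ)
  open import Data.Product using (_,_)

  -- The cyclic module generated by n over ℤ[X], as a ring: f and g are equal when f·n ≈ g·n.
  module CyclicModule (𝓜 : AbelianGroup 0ℓ 0ℓ)
    (X : AbelianGroup.Carrier 𝓜 → AbelianGroup.Carrier 𝓜)
    (X-cong : ∀ {x y} → AbelianGroup._≈_ 𝓜 x y → AbelianGroup._≈_ 𝓜 (X x) (X y))
    (X-homo : ∀ x y → AbelianGroup._≈_ 𝓜 (X (AbelianGroup._∙_ 𝓜 x y)) (AbelianGroup._∙_ 𝓜 (X x) (X y)))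
    (n : AbelianGroup.Carrier 𝓜) where

    open AbelianGroup 𝓜
    open import Algebra.Properties.AbelianGroup 𝓜
    open import Algebra.Properties.CommutativeSemigroup commutativeSemigroup using (interchange)
    open import Relation.Binary.Reasoning.Setoid setoid

    -- Formal expressions stand for polynomials, since only their action on `n` is ever compared;
    -- the resulting ring is `ℤ[X]` modulo the annihilator of `n`.
    data Poly : Set where
      𝟘 𝟙 𝕏   : Poly
      _⊕_ _⊛_ : Poly → Poly → Poly
      ⊝_      : Poly → Poly

    infixl 6 _⊕_
    infixl 7 _⊛_

    ⟦_⟧ : Poly → Carrier → Carrier
    ⟦ 𝟘 ⟧     m = ε
    ⟦ 𝟙 ⟧     m = m
    ⟦ 𝕏 ⟧     m = X m
    ⟦ f ⊕ g ⟧ m = ⟦ f ⟧ m ∙ ⟦ g ⟧ m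
    ⟦ f ⊛ g ⟧ m = ⟦ f ⟧ (⟦ g ⟧ m)
    ⟦ ⊝ f ⟧   m = ⟦ f ⟧ m ⁻¹

    ⟦⟧-cong : ∀ f {x y} → x ≈ y → ⟦ f ⟧ x ≈ ⟦ f ⟧ y
    ⟦⟧-cong 𝟘       e = refl
    ⟦⟧-cong 𝟙       e = e
    ⟦⟧-cong 𝕏       e = X-cong e
    ⟦⟧-cong (f ⊕ g) e = ∙-cong (⟦⟧-cong f e) (⟦⟧-cong g e)
    ⟦⟧-cong (f ⊛ g) e = ⟦⟧-cong f (⟦⟧-cong g e)
    ⟦⟧-cong (⊝ f)   e = ⁻¹-cong (⟦⟧-cong f e)

    ⟦⟧-homo : ∀ f x y → ⟦ f ⟧ (x ∙ y) ≈ ⟦ f ⟧ x ∙ ⟦ f ⟧ y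
    ⟦⟧-homo 𝟘       x y = sym (identityˡ ε)
    ⟦⟧-homo 𝟙       x y = refl
    ⟦⟧-homo 𝕏       x y = X-homo x y
    ⟦⟧-homo (f ⊕ g) x y = trans (∙-cong (⟦⟧-homo f x y) (⟦⟧-homo g x y)) (interchange _ _ _ _)
    ⟦⟧-homo (f ⊛ g) x y = trans (⟦⟧-cong f (⟦⟧-homo g x y)) (⟦⟧-homo f _ _)
    ⟦⟧-homo (⊝ f)   x y = trans (⁻¹-cong (⟦⟧-homo f x y)) (sym (⁻¹-∙-comm _ _))

    ⟦⟧-ε : ∀ f → ⟦ f ⟧ ε ≈ ε
    ⟦⟧-ε f = ∙-cancelˡ (⟦ f ⟧ ε) _ _ (trans (sym (⟦⟧-homo f ε ε)) (trans (⟦⟧-cong f (identityˡ ε)) (sym (identityʳ _))))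

    ⟦⟧-⁻¹ : ∀ f x → ⟦ f ⟧ (x ⁻¹) ≈ ⟦ f ⟧ x ⁻¹
    ⟦⟧-⁻¹ f x = inverseˡ-unique _ _ (trans (sym (⟦⟧-homo f (x ⁻¹) x)) (trans (⟦⟧-cong f (inverseˡ x)) (⟦⟧-ε f)))

    ⟦⟧-comm-X : ∀ f m → ⟦ f ⟧ (X m) ≈ X (⟦ f ⟧ m)
    ⟦⟧-comm-X 𝟘       m = sym (⟦⟧-ε 𝕏)
    ⟦⟧-comm-X 𝟙       m = refl
    ⟦⟧-comm-X 𝕏       m = refl
    ⟦⟧-comm-X (f ⊕ g) m = trans (∙-cong (⟦⟧-comm-X f m) (⟦⟧-comm-X g m)) (sym (X-homo _ _))
    ⟦⟧-comm-X (f ⊛ g) m = trans (⟦⟧-cong f (⟦⟧-comm-X g m)) (⟦⟧-comm-X f _)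
    ⟦⟧-comm-X (⊝ f)   m = trans (⁻¹-cong (⟦⟧-comm-X f m)) (sym (⟦⟧-⁻¹ 𝕏 _))

    -- This makes the product of the ring well defined: equal elements agree only at `n`, so a
    -- second factor has to be moved past them before the equality can be applied.
    ⟦⟧-comm : ∀ f g m → ⟦ f ⟧ (⟦ g ⟧ m) ≈ ⟦ g ⟧ (⟦ f ⟧ m)
    ⟦⟧-comm f 𝟘       m = ⟦⟧-ε f
    ⟦⟧-comm f 𝟙       m = refl
    ⟦⟧-comm f 𝕏       m = ⟦⟧-comm-X f m
    ⟦⟧-comm f (g ⊕ h) m = trans (⟦⟧-homo f _ _) (∙-cong (⟦⟧-comm f g m) (⟦⟧-comm f h m))
    ⟦⟧-comm f (g ⊛ h) m = trans (⟦⟧-comm f g _) (⟦⟧-cong g (⟦⟧-comm f h m))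
    ⟦⟧-comm f (⊝ g)   m = trans (⟦⟧-⁻¹ f _) (⁻¹-cong (⟦⟧-comm f g m))

    ring : CommutativeRing 0ℓ 0ℓ
    ring = record
      { Carrier = Poly
      ; _≈_ = λ f g → ⟦ f ⟧ n ≈ ⟦ g ⟧ n
      ; _+_ = _⊕_ ; _*_ = _⊛_ ; -_ = ⊝_ ; 0# = 𝟘 ; 1# = 𝟙
      ; isCommutativeRing = record
        { isRing = record
          { +-isAbelianGroup = record
            { isGroup = record
              { isMonoid = record
                { isSemigroup = record
                  { isMagma = record
                    { isEquivalence = record { refl = refl ; sym = sym ; trans = trans }
                    ; ∙-cong = ∙-cong }
                  ; assoc = λ f g h → assoc _ _ _ }
                ; identity = (λ f → identityˡ _) , (λ f → identityʳ _) }
              ; inverse = (λ f → inverseˡ _) , (λ f → inverseʳ _)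
              ; ⁻¹-cong = ⁻¹-cong }
            ; comm = λ f g → comm _ _ }
          ; *-cong = λ {f} {f′} {g} {g′} e e′ → begin
              ⟦ f ⟧ (⟦ g ⟧ n)   ≈⟨ ⟦⟧-cong f e′ ⟩
              ⟦ f ⟧ (⟦ g′ ⟧ n)  ≈⟨ ⟦⟧-comm f g′ n ⟩
              ⟦ g′ ⟧ (⟦ f ⟧ n)  ≈⟨ ⟦⟧-cong g′ e ⟩
              ⟦ g′ ⟧ (⟦ f′ ⟧ n) ≈⟨ ⟦⟧-comm g′ f′ n ⟩
              ⟦ f′ ⟧ (⟦ g′ ⟧ n) ∎
          ; *-assoc = λ f g h → refl
          ; *-identity = (λ f → refl) , (λ f → refl)
          ; distrib = (λ f g h → ⟦⟧-homo f _ _) , (λ f g h → refl)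
          }
        ; *-comm = λ f g → ⟦⟧-comm f g n
        }
      }

-- Reduced words in the free product of a free group and a group of order two.

module GroupWords where
  open import Algebra.Bundles using (Group)
  open import Level using (0ℓ)
  open import Data.Nat.Base as ℕ using (ℕ; zero; suc)
  open import Data.Fin.Base using (Fin; zero; suc)
  open import Data.Fin.Properties using (_≟_)
  open import Data.Vec.Base using (Vec; lookup)
  open import Data.List.Base using (List; []; _∷_)
  open import Relation.Nullary using (yes; no)
  open import Relation.Binary.PropositionalEquality as ≡ using (_≡_)

  -- A decision procedure for word equations in a group with a distinguished involution t.
  module Words (G : Group 0ℓ 0ℓ) (t : Group.Carrier G)
    (tt≈ε : Group._≈_ G (Group._∙_ G t t) (Group.ε G)) where

    open Group G
    open import Algebra.Properties.Group G
    open import Relation.Binary.Reasoning.Setoid setoid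

    data Expr (n : ℕ) : Set where
      var : Fin n → Expr n
      τ 𝕖 : Expr n
      _⊙_ : Expr n → Expr n → Expr n
      _⁻  : Expr n → Expr n

    infixl 7 _⊙_
    infix 8 _⁻

    data Letter (n : ℕ) : Set where
      inv     : Letter n
      pos neg : Fin n → Letter n

    flip : ∀ {n} → Letter n → Letter n
    flip inv     = inv
    flip (pos i) = neg i
    flip (neg i) = pos i

    push : ∀ {n} → Letter n → List (Letter n) → List (Letter n)
    push l       []            = l ∷ []
    push inv     (inv ∷ w)     = w
    push inv     (pos k ∷ w)   = inv ∷ pos k ∷ w
    push inv     (neg k ∷ w)   = inv ∷ neg k ∷ w
    push (pos i) (inv ∷ w)     = pos i ∷ inv ∷ w
    push (pos i) (pos k ∷ w)   = pos i ∷ pos k ∷ w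
    push (pos i) (neg k ∷ w) with i ≟ k
    ... | yes _ = w
    ... | no  _ = pos i ∷ neg k ∷ w
    push (neg i) (inv ∷ w)     = neg i ∷ inv ∷ w
    push (neg i) (neg k ∷ w)   = neg i ∷ neg k ∷ w
    push (neg i) (pos k ∷ w) with i ≟ k
    ... | yes _ = w
    ... | no  _ = neg i ∷ pos k ∷ w

    append : ∀ {n} → List (Letter n) → List (Letter n) → List (Letter n)
    append []      v = v
    append (l ∷ w) v = push l (append w v)

    invert : ∀ {n} → List (Letter n) → List (Letter n)
    invert []      = []
    invert (l ∷ w) = append (invert w) (flip l ∷ [])

    normalise : ∀ {n} → Expr n → List (Letter n)
    normalise (var i) = pos i ∷ []
    normalise τ       = inv ∷ []
    normalise 𝕖       = []
    normalise (x ⊙ y) = append (normalise x) (normalise y)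
    normalise (x ⁻)   = invert (normalise x)

    module _ {n} (ρ : Vec Carrier n) where

      ⟦_⟧ₑ : Expr n → Carrier
      ⟦ var i ⟧ₑ = lookup ρ i
      ⟦ τ ⟧ₑ     = t
      ⟦ 𝕖 ⟧ₑ     = ε
      ⟦ x ⊙ y ⟧ₑ = ⟦ x ⟧ₑ ∙ ⟦ y ⟧ₑ
      ⟦ x ⁻ ⟧ₑ   = ⟦ x ⟧ₑ ⁻¹

      letter : Letter n → Carrier
      letter inv     = t
      letter (pos i) = lookup ρ i
      letter (neg i) = lookup ρ i ⁻¹

      word : List (Letter n) → Carrier
      word []      = ε
      word (l ∷ w) = letter l ∙ word w

      cancel : ∀ x y w → x ∙ y ≈ ε → w ≈ x ∙ (y ∙ w)
      cancel x y w xy≈ε = sym (trans (sym (assoc x y w)) (trans (∙-congʳ xy≈ε) (identityˡ w)))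

      push-sound : ∀ l w → word (push l w) ≈ letter l ∙ word w
      push-sound l       []          = refl
      push-sound inv     (inv ∷ w)   = cancel t t (word w) tt≈ε
      push-sound inv     (pos k ∷ w) = refl
      push-sound inv     (neg k ∷ w) = refl
      push-sound (pos i) (inv ∷ w)   = refl
      push-sound (pos i) (pos k ∷ w) = refl
      push-sound (pos i) (neg k ∷ w) with i ≟ k
      ... | yes ≡.refl = cancel _ _ (word w) (inverseʳ _)
      ... | no  _      = refl
      push-sound (neg i) (inv ∷ w)   = refl
      push-sound (neg i) (neg k ∷ w) = refl
      push-sound (neg i) (pos k ∷ w) with i ≟ k
      ... | yes ≡.refl = cancel _ _ (word w) (inverseˡ _)
      ... | no  _      = refl

      append-sound : ∀ w v → word (append w v) ≈ word w ∙ word v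
      append-sound []      v = sym (identityˡ _)
      append-sound (l ∷ w) v = trans (push-sound l (append w v)) (trans (∙-congˡ (append-sound w v)) (sym (assoc _ _ _)))

      flip-sound : ∀ l → letter (flip l) ≈ letter l ⁻¹
      flip-sound inv     = inverseˡ-unique t t tt≈ε
      flip-sound (pos i) = refl
      flip-sound (neg i) = sym (⁻¹-involutive _)

      invert-sound : ∀ w → word (invert w) ≈ word w ⁻¹
      invert-sound []      = sym ε⁻¹≈ε
      invert-sound (l ∷ w) = begin
        word (append (invert w) (flip l ∷ []))   ≈⟨ append-sound (invert w) (flip l ∷ []) ⟩
        word (invert w) ∙ (letter (flip l) ∙ ε)  ≈⟨ ∙-cong (invert-sound w) (trans (identityʳ _) (flip-sound l)) ⟩
        word w ⁻¹ ∙ letter l ⁻¹                  ≈⟨ ⁻¹-anti-homo-∙ _ _ ⟨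
        (letter l ∙ word w) ⁻¹                   ∎

      normalise-sound : ∀ x → word (normalise x) ≈ ⟦ x ⟧ₑ
      normalise-sound (var i) = identityʳ _
      normalise-sound τ       = identityʳ t
      normalise-sound 𝕖       = refl
      normalise-sound (x ⊙ y) = trans (append-sound (normalise x) (normalise y)) (∙-cong (normalise-sound x) (normalise-sound y))
      normalise-sound (x ⁻)   = trans (invert-sound (normalise x)) (⁻¹-cong (normalise-sound x))

      solve : ∀ x y → normalise x ≡ normalise y → ⟦ x ⟧ₑ ≈ ⟦ y ⟧ₑ
      solve x y eq = trans (sym (normalise-sound x)) (trans (reflexive (≡.cong word eq)) (normalise-sound y))

-- Groups `⟨a⟩⟨b⟩` with an involution `ab`, and their reflections.

module TightGroups where
  open import Algebra.Bundles using (Group)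
  open import Level using (0ℓ)
  open import Data.Nat.Base as ℕ using (ℕ; zero; suc; NonZero)
  import Data.Nat.Properties as ℕₚ
  open import Data.Nat.Divisibility using (_∣_; divides)
  open import Data.Product using (Σ; ∃; _×_; _,_; proj₁; proj₂)
  open import Relation.Binary.PropositionalEquality as ≡ using (_≡_)

  module Powers (G : Group 0ℓ 0ℓ) where
    open Group G
    open import Algebra.Properties.Group G
    open import Algebra.Properties.Monoid.Mult monoid using () renaming (_×_ to _×ᵍ_; ×-homo-+ to homo-+; ×-assocˡ to assoc-*; ×-congʳ to cong-pow)
    open import Relation.Binary.Reasoning.Setoid setoid

    infixr 9 _^_
    _^_ : Carrier → ℕ → Carrier
    g ^ n = n ×ᵍ g

    ^-+ : ∀ g m n → g ^ (m ℕ.+ n) ≈ g ^ m ∙ g ^ n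
    ^-+ = homo-+

    ^-* : ∀ g m n → (g ^ n) ^ m ≈ g ^ (m ℕ.* n)
    ^-* = assoc-*

    ^-cong : ∀ n {g h} → g ≈ h → g ^ n ≈ h ^ n
    ^-cong = cong-pow

    ε^ : ∀ n → ε ^ n ≈ ε
    ε^ zero    = refl
    ε^ (suc n) = trans (identityˡ _) (ε^ n)

    ^-≡ : ∀ g {m n} → m ≡ n → g ^ m ≈ g ^ n
    ^-≡ g ≡.refl = refl

    ^-1 : ∀ g → g ^ 1 ≈ g
    ^-1 = identityʳ

    ^-suc′ : ∀ g n → g ^ suc n ≈ g ^ n ∙ g
    ^-suc′ g n = trans (^-≡ g (ℕₚ.+-comm 1 n)) (trans (^-+ g n 1) (∙-congˡ (^-1 g)))

    ^-comm : ∀ g m n → g ^ m ∙ g ^ n ≈ g ^ n ∙ g ^ m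
    ^-comm g m n = trans (sym (^-+ g m n)) (trans (^-≡ g (ℕₚ.+-comm m n)) (^-+ g n m))

    ^-⁻¹ : ∀ g n → (g ⁻¹) ^ n ≈ (g ^ n) ⁻¹
    ^-⁻¹ g zero    = sym ε⁻¹≈ε
    ^-⁻¹ g (suc n) = trans (∙-congˡ (^-⁻¹ g n)) (trans (sym (⁻¹-anti-homo-∙ _ _)) (⁻¹-cong (sym (^-suc′ g n))))

    ^-multiple : ∀ g {m n} → g ^ m ≈ ε → m ∣ n → g ^ n ≈ ε
    ^-multiple g {m} e (divides k ≡.refl) = trans (sym (^-* g k m)) (trans (^-cong k e) (ε^ k))

    ^-inverse : ∀ g m .{{_ : NonZero m}} → g ^ m ≈ ε → ∀ i → (g ^ i) ⁻¹ ≈ g ^ (ℕ.pred m ℕ.* i)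
    ^-inverse g m e i = sym (inverseʳ-unique _ _ (begin
      g ^ i ∙ g ^ (ℕ.pred m ℕ.* i)   ≈⟨ ^-+ g i _ ⟨
      g ^ (suc (ℕ.pred m) ℕ.* i)     ≈⟨ ^-≡ g (≡.trans (≡.cong (ℕ._* i) (ℕₚ.suc-pred m)) (ℕₚ.*-comm m i)) ⟩
      g ^ (i ℕ.* m)                  ≈⟨ ^-multiple g e (divides i ≡.refl) ⟩
      ε                              ∎))

  record TightGroup (p q : ℕ) : Set₁ where
    field
      group : Group 0ℓ 0ℓ
    open Group group public
    open Powers group public
    field
      a b        : Carrier
      a^p≈ε      : a ^ p ≈ ε
      b^q≈ε      : b ^ q ≈ ε
      a-order    : ∀ i → a ^ i ≈ ε → p ∣ i
      b-order    : ∀ j → b ^ j ≈ ε → q ∣ j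
      A∩B        : ∀ i j → a ^ i ≈ b ^ j → a ^ i ≈ ε
      factor     : ∀ g → ∃ λ i → ∃ λ j → g ≈ a ^ i ∙ b ^ j
      involution : (a ∙ b) ∙ (a ∙ b) ≈ ε

  -- Equivariance under right multiplication by the two generators is what the geometry and the
  -- explicit mirror relations supply directly. As `G = ⟨a⟩⟨b⟩`, it forces `θ` to be a homomorphism
  -- and an involution.
  Reflexible : ∀ {p q} → TightGroup p q → Set
  Reflexible T = Σ (Carrier → Carrier) λ θ →
      (∀ {g h} → g ≈ h → θ g ≈ θ h) × θ ε ≈ ε
    × (∀ g → θ (g ∙ a) ≈ θ g ∙ a ⁻¹) × (∀ g → θ (g ∙ b) ≈ θ g ∙ b ⁻¹)
    where open TightGroup T

  module _ {p q} .{{_ : NonZero p}} .{{_ : NonZero q}} (T : TightGroup p q) where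
    open TightGroup T
    open import Algebra.Properties.Group group
    open import Relation.Binary.Reasoning.Setoid setoid

    -- Corresponds to exchanging vertices and faces. With the generators inverted as well as
    -- exchanged, their product is `(ab)⁻¹`, again an involution.
    dual : TightGroup q p
    dual = record
      { group = group
      ; a = b ⁻¹
      ; b = a ⁻¹
      ; a^p≈ε = trans (^-⁻¹ b q) (trans (⁻¹-cong b^q≈ε) ε⁻¹≈ε)
      ; b^q≈ε = trans (^-⁻¹ a p) (trans (⁻¹-cong a^p≈ε) ε⁻¹≈ε)
      ; a-order = λ i e → b-order i (⁻¹-injective (trans (sym (^-⁻¹ b i)) (trans e (sym ε⁻¹≈ε))))
      ; b-order = λ i e → a-order i (⁻¹-injective (trans (sym (^-⁻¹ a i)) (trans e (sym ε⁻¹≈ε))))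
      ; A∩B = λ i j e → let b≈a = ⁻¹-injective (trans (sym (^-⁻¹ b i)) (trans e (^-⁻¹ a j))) in
          trans (^-⁻¹ b i) (trans (⁻¹-cong (trans b≈a (A∩B j i (sym b≈a)))) ε⁻¹≈ε)
      ; factor = λ g → let i , j , e = factor (g ⁻¹) in j , i , (begin
          g                             ≈⟨ ⁻¹-involutive g ⟨
          (g ⁻¹) ⁻¹                     ≈⟨ ⁻¹-cong e ⟩
          (a ^ i ∙ b ^ j) ⁻¹            ≈⟨ ⁻¹-anti-homo-∙ _ _ ⟩
          (b ^ j) ⁻¹ ∙ (a ^ i) ⁻¹       ≈⟨ ∙-cong (^-⁻¹ b j) (^-⁻¹ a i) ⟨
          (b ⁻¹) ^ j ∙ (a ⁻¹) ^ i       ∎)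
      ; involution = begin
          (b ⁻¹ ∙ a ⁻¹) ∙ (b ⁻¹ ∙ a ⁻¹)  ≈⟨ ∙-cong (⁻¹-anti-homo-∙ a b) (⁻¹-anti-homo-∙ a b) ⟨
          (a ∙ b) ⁻¹ ∙ (a ∙ b) ⁻¹        ≈⟨ ⁻¹-anti-homo-∙ _ _ ⟨
          ((a ∙ b) ∙ (a ∙ b)) ⁻¹         ≈⟨ ⁻¹-cong involution ⟩
          ε ⁻¹                           ≈⟨ ε⁻¹≈ε ⟩
          ε                              ∎
      }

    -- A relation between words in (a, b) and their mirror images in (a⁻¹, b⁻¹)
    -- that is functional yields the reflection.
    module Mirror (_↦_ : Carrier → Carrier → Set)
      (start : ε ↦ ε)
      (step-a : ∀ {g h} → g ↦ h → (g ∙ a) ↦ (h ∙ a ⁻¹))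
      (step-b : ∀ {g h} → g ↦ h → (g ∙ b) ↦ (h ∙ b ⁻¹))
      (functional : ∀ {g g′ h h′} → g ↦ h → g′ ↦ h′ → g ≈ g′ → h ≈ h′) where

      -- Following a word `a ^ i ∙ b ^ j` letter by letter shows that the relation is total, so it
      -- is the graph of a map.
      respects : (∀ {g g′ h h′} → g ↦ h → g ≈ g′ → h ≈ h′ → g′ ↦ h′) → Reflexible T
      respects resp = θ , θ-cong , θ-ε , θ-a , θ-b
        where
        steps-a : ∀ i {g h} → g ↦ h → (g ∙ a ^ i) ↦ (h ∙ (a ⁻¹) ^ i)
        steps-a zero    r = resp r (sym (identityʳ _)) (sym (identityʳ _))
        steps-a (suc i) r = resp (steps-a i (step-a r)) (assoc _ _ _) (assoc _ _ _)
        steps-b : ∀ i {g h} → g ↦ h → (g ∙ b ^ i) ↦ (h ∙ (b ⁻¹) ^ i)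
        steps-b zero    r = resp r (sym (identityʳ _)) (sym (identityʳ _))
        steps-b (suc i) r = resp (steps-b i (step-b r)) (assoc _ _ _) (assoc _ _ _)
        θ : Carrier → Carrier
        θ g = (a ⁻¹) ^ proj₁ (factor g) ∙ (b ⁻¹) ^ proj₁ (proj₂ (factor g))
        θ-graph : ∀ g → g ↦ θ g
        θ-graph g = resp (steps-b (proj₁ (proj₂ (factor g))) (steps-a (proj₁ (factor g)) start))
          (trans (∙-congʳ (identityˡ _)) (sym (proj₂ (proj₂ (factor g))))) (∙-congʳ (identityˡ _))
        θ-cong : ∀ {g h} → g ≈ h → θ g ≈ θ h
        θ-cong e = functional (θ-graph _) (θ-graph _) e
        θ-ε : θ ε ≈ ε
        θ-ε = functional (θ-graph ε) start refl
        θ-a : ∀ g → θ (g ∙ a) ≈ θ g ∙ a ⁻¹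
        θ-a g = functional (θ-graph _) (step-a (θ-graph g)) refl
        θ-b : ∀ g → θ (g ∙ b) ≈ θ g ∙ b ⁻¹
        θ-b g = functional (θ-graph _) (step-b (θ-graph g)) refl

    module Reflection (ρ : Reflexible T) where
      θ : Carrier → Carrier
      θ = proj₁ ρ
      θ-cong : ∀ {g h} → g ≈ h → θ g ≈ θ h
      θ-cong = proj₁ (proj₂ ρ)
      θ-ε : θ ε ≈ ε
      θ-ε = proj₁ (proj₂ (proj₂ ρ))

      private
        θ-∙a : ∀ g → θ (g ∙ a) ≈ θ g ∙ a ⁻¹
        θ-∙a = proj₁ (proj₂ (proj₂ (proj₂ ρ)))
        θ-∙b : ∀ g → θ (g ∙ b) ≈ θ g ∙ b ⁻¹
        θ-∙b = proj₂ (proj₂ (proj₂ (proj₂ ρ)))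

        powers : ∀ x → (∀ g → θ (g ∙ x) ≈ θ g ∙ x ⁻¹) → ∀ i g → θ (g ∙ x ^ i) ≈ θ g ∙ (x ⁻¹) ^ i
        powers x h zero    g = trans (θ-cong (identityʳ g)) (sym (identityʳ _))
        powers x h (suc i) g = begin
          θ (g ∙ (x ∙ x ^ i))              ≈⟨ θ-cong (assoc g x (x ^ i)) ⟨
          θ (g ∙ x ∙ x ^ i)                ≈⟨ powers x h i (g ∙ x) ⟩
          θ (g ∙ x) ∙ (x ⁻¹) ^ i           ≈⟨ ∙-congʳ (h g) ⟩
          θ g ∙ x ⁻¹ ∙ (x ⁻¹) ^ i          ≈⟨ assoc _ _ _ ⟩
          θ g ∙ (x ⁻¹ ∙ (x ⁻¹) ^ i)        ∎

        θ-factored : ∀ g i j → θ (g ∙ (a ^ i ∙ b ^ j)) ≈ θ g ∙ ((a ⁻¹) ^ i ∙ (b ⁻¹) ^ j)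
        θ-factored g i j = begin
          θ (g ∙ (a ^ i ∙ b ^ j))                    ≈⟨ θ-cong (assoc g _ _) ⟨
          θ (g ∙ a ^ i ∙ b ^ j)                      ≈⟨ powers b θ-∙b j (g ∙ a ^ i) ⟩
          θ (g ∙ a ^ i) ∙ (b ⁻¹) ^ j                 ≈⟨ ∙-congʳ (powers a θ-∙a i g) ⟩
          θ g ∙ (a ⁻¹) ^ i ∙ (b ⁻¹) ^ j              ≈⟨ assoc _ _ _ ⟩
          θ g ∙ ((a ⁻¹) ^ i ∙ (b ⁻¹) ^ j)            ∎

      θ-homo : ∀ g h → θ (g ∙ h) ≈ θ g ∙ θ h
      θ-homo g h = let i , j , h≈ = factor h in begin
        θ (g ∙ h)                                  ≈⟨ θ-cong (∙-congˡ h≈) ⟩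
        θ (g ∙ (a ^ i ∙ b ^ j))                    ≈⟨ θ-factored g i j ⟩
        θ g ∙ ((a ⁻¹) ^ i ∙ (b ⁻¹) ^ j)            ≈⟨ ∙-congˡ (trans (θ-factored ε i j) (trans (∙-congʳ θ-ε) (identityˡ _))) ⟨
        θ g ∙ θ (ε ∙ (a ^ i ∙ b ^ j))              ≈⟨ ∙-congˡ (θ-cong (trans (identityˡ _) (sym h≈))) ⟩
        θ g ∙ θ h                                  ∎

      θ-a : θ a ≈ a ⁻¹
      θ-a = trans (θ-cong (sym (identityˡ a))) (trans (θ-∙a ε) (trans (∙-congʳ θ-ε) (identityˡ _)))

      θ-b : θ b ≈ b ⁻¹
      θ-b = trans (θ-cong (sym (identityˡ b))) (trans (θ-∙b ε) (trans (∙-congʳ θ-ε) (identityˡ _)))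

      θ-⁻¹ : ∀ g → θ (g ⁻¹) ≈ θ g ⁻¹
      θ-⁻¹ g = inverseˡ-unique _ _ (trans (sym (θ-homo (g ⁻¹) g)) (trans (θ-cong (inverseˡ g)) θ-ε))

      θ-involutive : ∀ g → θ (θ g) ≈ g
      θ-involutive g = let i , j , g≈ = factor g in begin
        θ (θ g)                           ≈⟨ θ-cong (θ-cong g≈) ⟩
        θ (θ (a ^ i ∙ b ^ j))             ≈⟨ trans (θ-cong (θ-homo _ _)) (θ-homo _ _) ⟩
        θ (θ (a ^ i)) ∙ θ (θ (b ^ j))     ≈⟨ ∙-cong (twice a θ-a i) (twice b θ-b j) ⟩
        a ^ i ∙ b ^ j                     ≈⟨ g≈ ⟨
        g                                 ∎
        where
        twice : ∀ x → θ x ≈ x ⁻¹ → ∀ i → θ (θ (x ^ i)) ≈ x ^ i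
        twice x h zero    = trans (θ-cong θ-ε) θ-ε
        twice x h (suc i) = begin
          θ (θ (x ∙ x ^ i))            ≈⟨ trans (θ-cong (θ-homo x (x ^ i))) (θ-homo _ _) ⟩
          θ (θ x) ∙ θ (θ (x ^ i))      ≈⟨ ∙-cong (trans (θ-cong h) (trans (θ-⁻¹ x) (trans (⁻¹-cong h) (⁻¹-involutive x)))) (twice x h i) ⟩
          x ∙ x ^ i                    ∎

-- Itô's theorem and the abelian normal subgroup `M`.

module CommutatorSubgroup where
  open import Algebra.Bundles using (Group; AbelianGroup)
  open import Level using (0ℓ)
  open import Data.Nat.Base as ℕ using (ℕ; zero; suc; NonZero)
  open import Data.Fin.Patterns
  open import Data.Vec.Base using ([]; _∷_)
  open import Data.Product using (Σ; ∃; _×_; _,_)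
  open import Relation.Binary.PropositionalEquality as ≡ using (_≡_)
  open GroupWords
  open TightGroups
  open PolynomialAction

  module Commutators {p q} {{p≢0 : NonZero p}} {{q≢0 : NonZero q}} (T : TightGroup p q) where
    open TightGroup T public
    open import Algebra.Properties.Group group public
    open import Relation.Binary.Reasoning.Setoid setoid

    t : Carrier
    t = a ∙ b

    open Words group t involution public using (solve; var; τ; 𝕖; _⊙_; _⁻)

    private
      pattern v0 = var 0F
      pattern v1 = var 1F
      pattern v2 = var 2F
      pattern v3 = var 3F

    conj : Carrier → Carrier → Carrier
    conj g h = h ⁻¹ ∙ g ∙ h

    [_,_] : Carrier → Carrier → Carrier
    [ x , y ] = x ⁻¹ ∙ y ⁻¹ ∙ x ∙ y

    conj-cong : ∀ {g g′ h h′} → g ≈ g′ → h ≈ h′ → conj g h ≈ conj g′ h′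
    conj-cong e e′ = ∙-cong (∙-cong (⁻¹-cong e′) e) e′

    [,]-cong : ∀ {g g′ h h′} → g ≈ g′ → h ≈ h′ → [ g , h ] ≈ [ g′ , h′ ]
    [,]-cong e e′ = ∙-cong (∙-cong (∙-cong (⁻¹-cong e) (⁻¹-cong e′)) e) e′

    conj-∙ : ∀ g h k → conj (g ∙ h) k ≈ conj g k ∙ conj h k
    conj-∙ g h k = solve (g ∷ h ∷ k ∷ []) (v2 ⁻ ⊙ (v0 ⊙ v1) ⊙ v2) ((v2 ⁻ ⊙ v0 ⊙ v2) ⊙ (v2 ⁻ ⊙ v1 ⊙ v2)) ≡.refl

    conj-conj : ∀ g h k → conj (conj g h) k ≈ conj g (h ∙ k)
    conj-conj g h k = solve (g ∷ h ∷ k ∷ []) (v2 ⁻ ⊙ (v1 ⁻ ⊙ v0 ⊙ v1) ⊙ v2) ((v1 ⊙ v2) ⁻ ⊙ v0 ⊙ (v1 ⊙ v2)) ≡.refl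

    conj-⁻¹ : ∀ g k → conj (g ⁻¹) k ≈ conj g k ⁻¹
    conj-⁻¹ g k = solve (g ∷ k ∷ []) (v1 ⁻ ⊙ v0 ⁻ ⊙ v1) ((v1 ⁻ ⊙ v0 ⊙ v1) ⁻) ≡.refl

    conj-ε : ∀ k → conj ε k ≈ ε
    conj-ε k = solve (k ∷ []) (v0 ⁻ ⊙ 𝕖 ⊙ v0) 𝕖 ≡.refl

    commute⇒conj : ∀ {g h} → g ∙ h ≈ h ∙ g → conj g h ≈ g
    commute⇒conj {g} {h} gh≈hg = begin
      h ⁻¹ ∙ g ∙ h    ≈⟨ assoc _ _ _ ⟩
      h ⁻¹ ∙ (g ∙ h)  ≈⟨ ∙-congˡ gh≈hg ⟩
      h ⁻¹ ∙ (h ∙ g)  ≈⟨ solve (g ∷ h ∷ []) (v1 ⁻ ⊙ (v1 ⊙ v0)) v0 ≡.refl ⟩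
      g               ∎

    InA InB : Carrier → Set
    InA g = ∃ λ i → g ≈ a ^ i
    InB g = ∃ λ i → g ≈ b ^ i

    A-inv : ∀ {g} → InA g → InA (g ⁻¹)
    A-inv (i , g≈) = ℕ.pred p ℕ.* i , trans (⁻¹-cong g≈) (^-inverse a p a^p≈ε i)

    B-inv : ∀ {g} → InB g → InB (g ⁻¹)
    B-inv (i , g≈) = ℕ.pred q ℕ.* i , trans (⁻¹-cong g≈) (^-inverse b q b^q≈ε i)

    A-mul : ∀ {g h} → InA g → InA h → InA (g ∙ h)
    A-mul (i , e) (j , e′) = i ℕ.+ j , trans (∙-cong e e′) (sym (^-+ a i j))

    A-comm : ∀ {g h} → InA g → InA h → g ∙ h ≈ h ∙ g
    A-comm (i , e) (j , e′) = trans (∙-cong e e′) (trans (^-comm a i j) (∙-cong (sym e′) (sym e)))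

    B-comm : ∀ {g h} → InB g → InB h → g ∙ h ≈ h ∙ g
    B-comm (i , e) (j , e′) = trans (∙-cong e e′) (trans (^-comm b i j) (∙-cong (sym e′) (sym e)))

    a∈A : InA a
    a∈A = 1 , sym (^-1 a)
    b∈B : InB b
    b∈B = 1 , sym (^-1 b)

    factor-AB : ∀ g → ∃ λ α → ∃ λ β → InA α × InB β × g ≈ α ∙ β
    factor-AB g = let i , j , e = factor g in a ^ i , b ^ j , (i , refl) , (j , refl) , e

    factor-BA : ∀ g → ∃ λ β → ∃ λ α → InB β × InA α × g ≈ β ∙ α
    factor-BA g = let α , β , α∈ , β∈ , e = factor-AB (g ⁻¹) in
      β ⁻¹ , α ⁻¹ , B-inv β∈ , A-inv α∈ , trans (sym (⁻¹-involutive g)) (trans (⁻¹-cong e) (⁻¹-anti-homo-∙ α β))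

    -- Itô's theorem: in a product of two abelian subgroups A and B the commutators [α , β]
    -- are permuted by conjugation and commute with each other.
    conj-commutator-A : ∀ {α β α₁ α₂ β₂} → InA α → InA α₁ → InA α₂ → conj β α₁ ≈ α₂ ∙ β₂ →
      conj [ α , β ] α₁ ≈ [ α , β₂ ]
    conj-commutator-A {α} {β} {α₁} {α₂} {β₂} α∈ α₁∈ α₂∈ eq = begin
      conj [ α , β ] α₁
        ≈⟨ solve (α ∷ β ∷ α₁ ∷ []) (v2 ⁻ ⊙ (v0 ⁻ ⊙ v1 ⁻ ⊙ v0 ⊙ v1) ⊙ v2)
             ((v2 ⁻ ⊙ v0 ⊙ v2) ⁻ ⊙ (v2 ⁻ ⊙ v1 ⊙ v2) ⁻ ⊙ (v2 ⁻ ⊙ v0 ⊙ v2) ⊙ (v2 ⁻ ⊙ v1 ⊙ v2)) ≡.refl ⟩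
      [ conj α α₁ , conj β α₁ ]              ≈⟨ [,]-cong (commute⇒conj (A-comm α∈ α₁∈)) eq ⟩
      [ α , α₂ ∙ β₂ ]
        ≈⟨ solve (α ∷ α₂ ∷ β₂ ∷ []) (v0 ⁻ ⊙ (v1 ⊙ v2) ⁻ ⊙ v0 ⊙ (v1 ⊙ v2)) (v0 ⁻ ⊙ v2 ⁻ ⊙ (v1 ⁻ ⊙ v0 ⊙ v1) ⊙ v2) ≡.refl ⟩
      α ⁻¹ ∙ β₂ ⁻¹ ∙ conj α α₂ ∙ β₂          ≈⟨ ∙-congʳ (∙-congˡ (commute⇒conj (A-comm α∈ α₂∈))) ⟩
      [ α , β₂ ]                             ∎

    conj-commutator-B : ∀ {α β β₁ β₃ α₃} → InB β → InB β₁ → InB β₃ → conj α β₁ ≈ β₃ ∙ α₃ →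
      conj [ α , β ] β₁ ≈ [ α₃ , β ]
    conj-commutator-B {α} {β} {β₁} {β₃} {α₃} β∈ β₁∈ β₃∈ eq = begin
      conj [ α , β ] β₁
        ≈⟨ solve (α ∷ β ∷ β₁ ∷ []) (v2 ⁻ ⊙ (v0 ⁻ ⊙ v1 ⁻ ⊙ v0 ⊙ v1) ⊙ v2)
             ((v2 ⁻ ⊙ v0 ⊙ v2) ⁻ ⊙ (v2 ⁻ ⊙ v1 ⊙ v2) ⁻ ⊙ (v2 ⁻ ⊙ v0 ⊙ v2) ⊙ (v2 ⁻ ⊙ v1 ⊙ v2)) ≡.refl ⟩
      [ conj α β₁ , conj β β₁ ]              ≈⟨ [,]-cong eq (commute⇒conj (B-comm β∈ β₁∈)) ⟩
      [ β₃ ∙ α₃ , β ]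
        ≈⟨ solve (β₃ ∷ α₃ ∷ β ∷ []) ((v0 ⊙ v1) ⁻ ⊙ v2 ⁻ ⊙ (v0 ⊙ v1) ⊙ v2) (v1 ⁻ ⊙ (v0 ⁻ ⊙ v2 ⊙ v0) ⁻ ⊙ v1 ⊙ v2) ≡.refl ⟩
      α₃ ⁻¹ ∙ conj β β₃ ⁻¹ ∙ α₃ ∙ β          ≈⟨ ∙-congʳ (∙-congʳ (∙-congˡ (⁻¹-cong (commute⇒conj (B-comm β∈ β₃∈))))) ⟩
      [ α₃ , β ]                             ∎

    -- Conjugation of `[ α , β ]` by `α₁` only replaces `β`, and conjugation by `β₁` only replaces
    -- `α`; the two replacements do not interfere.
    conj-swap : ∀ {α β α₁ β₁} → InA α → InB β → InA α₁ → InB β₁ →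
      conj (conj [ α , β ] α₁) β₁ ≈ conj (conj [ α , β ] β₁) α₁
    conj-swap {α} {β} {α₁} {β₁} α∈ β∈ α₁∈ β₁∈ with factor-AB (conj β α₁) | factor-BA (conj α β₁)
    ... | α₂ , β₂ , α₂∈ , β₂∈ , e₂ | β₃ , α₃ , β₃∈ , α₃∈ , e₃ = begin
      conj (conj [ α , β ] α₁) β₁  ≈⟨ conj-cong (conj-commutator-A α∈ α₁∈ α₂∈ e₂) refl ⟩
      conj [ α , β₂ ] β₁           ≈⟨ conj-commutator-B β₂∈ β₁∈ β₃∈ e₃ ⟩
      [ α₃ , β₂ ]                  ≈⟨ conj-commutator-A α₃∈ α₁∈ α₂∈ e₂ ⟨
      conj [ α₃ , β ] α₁           ≈⟨ conj-cong (conj-commutator-B β∈ β₁∈ β₃∈ e₃) refl ⟨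
      conj (conj [ α , β ] β₁) α₁  ∎

    IsCommutator : Carrier → Set
    IsCommutator g = ∃ λ α → ∃ λ β → InA α × InB β × g ≈ [ α , β ]

    -- Conjugation by `[ α′ , β′ ]` is conjugation by `α′ ⁻¹`, `β′ ⁻¹`, `α′`, `β′` in turn. By
    -- `conj-swap` the first two may be exchanged, and then everything cancels.
    commutators-commute : ∀ {g h} → IsCommutator g → IsCommutator h → g ∙ h ≈ h ∙ g
    commutators-commute {g} {h} (α , β , α∈ , β∈ , g≈) (α′ , β′ , α′∈ , β′∈ , h≈) = begin
      g ∙ h                    ≈⟨ ∙-cong g≈ h≈ ⟩
      k ∙ [ α′ , β′ ]
        ≈⟨ solve (k ∷ α′ ∷ β′ ∷ []) (v0 ⊙ (v1 ⁻ ⊙ v2 ⁻ ⊙ v1 ⊙ v2))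
            ((v1 ⁻ ⊙ v2 ⁻) ⊙ (v2 ⁻ ⁻ ⊙ (v1 ⁻ ⁻ ⊙ v0 ⊙ v1 ⁻) ⊙ v2 ⁻) ⊙ (v1 ⊙ v2)) ≡.refl ⟩
      (α′ ⁻¹ ∙ β′ ⁻¹) ∙ conj (conj k (α′ ⁻¹)) (β′ ⁻¹) ∙ (α′ ∙ β′)
        ≈⟨ ∙-congʳ (∙-congˡ (conj-swap α∈ β∈ (A-inv α′∈) (B-inv β′∈))) ⟩
      (α′ ⁻¹ ∙ β′ ⁻¹) ∙ conj (conj k (β′ ⁻¹)) (α′ ⁻¹) ∙ (α′ ∙ β′)
        ≈⟨ solve (k ∷ α′ ∷ β′ ∷ []) ((v1 ⁻ ⊙ v2 ⁻) ⊙ (v1 ⁻ ⁻ ⊙ (v2 ⁻ ⁻ ⊙ v0 ⊙ v2 ⁻) ⊙ v1 ⁻) ⊙ (v1 ⊙ v2))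
            ((v1 ⁻ ⊙ v2 ⁻ ⊙ v1 ⊙ v2) ⊙ v0) ≡.refl ⟩
      [ α′ , β′ ] ∙ k          ≈⟨ ∙-cong (sym h≈) (sym g≈) ⟩
      h ∙ g                    ∎
      where k = [ α , β ]

    conj-A-commutator : ∀ {g α₁} → IsCommutator g → InA α₁ → IsCommutator (conj g α₁)
    conj-A-commutator {g} {α₁} (α , β , α∈ , β∈ , g≈) α₁∈ with factor-AB (conj β α₁)
    ... | α₂ , β₂ , α₂∈ , β₂∈ , e₂ = α , β₂ , α∈ , β₂∈ , trans (conj-cong g≈ refl) (conj-commutator-A α∈ α₁∈ α₂∈ e₂)

    b≈a⁻¹t : b ≈ a ⁻¹ ∙ t
    b≈a⁻¹t = solve (a ∷ b ∷ []) v1 (v0 ⁻ ⊙ (v0 ⊙ v1)) ≡.refl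

    -- This is `[ a , b ]`, written as the product of the involutions `a⁻¹ t a` and `t`, so that `t`
    -- visibly inverts it.
    c : Carrier
    c = a ⁻¹ ∙ t ∙ a ∙ t

    c≈[a,b] : c ≈ [ a , b ]
    c≈[a,b] = trans (solve (a ∷ []) (v0 ⁻ ⊙ τ ⊙ v0 ⊙ τ) (v0 ⁻ ⊙ (v0 ⁻ ⊙ τ) ⁻ ⊙ v0 ⊙ (v0 ⁻ ⊙ τ)) ≡.refl) ([,]-cong refl (sym b≈a⁻¹t))

    c-commutator : IsCommutator c
    c-commutator = a , b , a∈A , b∈B , c≈[a,b]

    -- The commutator subgroup. Only conjugates under powers of `a` are taken as generators;
    -- stability under `b` follows once `t` is known to invert every element.
    data InM : Carrier → Set where
      gen  : ∀ i → InM (conj c (a ^ i))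
      one  : InM ε
      mul  : ∀ {g h} → InM g → InM h → InM (g ∙ h)
      inv  : ∀ {g} → InM g → InM (g ⁻¹)
      resp : ∀ {g h} → g ≈ h → InM g → InM h

    commute-⁻¹ : ∀ {x g} → x ∙ g ≈ g ∙ x → x ∙ g ⁻¹ ≈ g ⁻¹ ∙ x
    commute-⁻¹ {x} {g} eq = begin
      x ∙ g ⁻¹                  ≈⟨ solve (x ∷ g ∷ []) (v0 ⊙ v1 ⁻) (v1 ⁻ ⊙ (v1 ⊙ v0) ⊙ v1 ⁻) ≡.refl ⟩
      g ⁻¹ ∙ (g ∙ x) ∙ g ⁻¹     ≈⟨ ∙-congʳ (∙-congˡ eq) ⟨
      g ⁻¹ ∙ (x ∙ g) ∙ g ⁻¹     ≈⟨ solve (x ∷ g ∷ []) (v1 ⁻ ⊙ (v0 ⊙ v1) ⊙ v1 ⁻) (v1 ⁻ ⊙ v0) ≡.refl ⟩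
      g ⁻¹ ∙ x                  ∎

    centralise : ∀ {x} → (∀ i → x ∙ conj c (a ^ i) ≈ conj c (a ^ i) ∙ x) → ∀ {m} → InM m → x ∙ m ≈ m ∙ x
    centralise h (gen i)         = h i
    centralise h one             = trans (identityʳ _) (sym (identityˡ _))
    centralise {x} h (mul {g} {k} g∈ k∈) = begin
      x ∙ (g ∙ k)   ≈⟨ assoc _ _ _ ⟨
      x ∙ g ∙ k     ≈⟨ ∙-congʳ (centralise h g∈) ⟩
      g ∙ x ∙ k     ≈⟨ assoc _ _ _ ⟩
      g ∙ (x ∙ k)   ≈⟨ ∙-congˡ (centralise h k∈) ⟩
      g ∙ (k ∙ x)   ≈⟨ assoc _ _ _ ⟨
      g ∙ k ∙ x     ∎
    centralise h (inv g∈)        = commute-⁻¹ (centralise h g∈)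
    centralise h (resp g≈ g∈)    = trans (∙-congˡ (sym g≈)) (trans (centralise h g∈) (∙-congʳ g≈))

    M-comm : ∀ {m m′} → InM m → InM m′ → m ∙ m′ ≈ m′ ∙ m
    M-comm m∈ m′∈ = centralise (λ i → sym (centralise (λ j →
      commutators-commute (conj-A-commutator c-commutator (i , refl)) (conj-A-commutator c-commutator (j , refl))) m∈)) m′∈

    M-conj-a : ∀ {m} → InM m → InM (conj m a)
    M-conj-a (gen i)       = resp (sym (trans (conj-conj c (a ^ i) a) (conj-cong refl (sym (^-suc′ a i))))) (gen (suc i))
    M-conj-a one           = resp (sym (conj-ε a)) one
    M-conj-a (mul g∈ h∈)   = resp (sym (conj-∙ _ _ a)) (mul (M-conj-a g∈) (M-conj-a h∈))
    M-conj-a (inv g∈)      = resp (sym (conj-⁻¹ _ a)) (inv (M-conj-a g∈))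
    M-conj-a (resp g≈ g∈)  = resp (conj-cong g≈ refl) (M-conj-a g∈)

    M-conj-a^ : ∀ i {m} → InM m → InM (conj m (a ^ i))
    M-conj-a^ zero    {m} m∈ = resp (solve (m ∷ []) v0 (𝕖 ⁻ ⊙ v0 ⊙ 𝕖) ≡.refl) m∈
    M-conj-a^ (suc i) {m} m∈ = resp (conj-conj m a (a ^ i)) (M-conj-a^ i (M-conj-a m∈))

    M-conj-A : ∀ {m α} → InA α → InM m → InM (conj m α)
    M-conj-A (i , α≈) m∈ = resp (conj-cong refl (sym α≈)) (M-conj-a^ i m∈)

    c∈M : InM c
    c∈M = resp (solve (c ∷ []) (𝕖 ⁻ ⊙ v0 ⊙ 𝕖) v0 ≡.refl) (gen 0)

    -- Moving `t` past `α = a ^ i` costs the element `k`, a commutator of `α` with `t`. It is a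
    -- conjugate of a commutator of an element of `⟨a⟩` with one of `⟨b⟩`, so by Itô's theorem it
    -- centralises `c`, and `t` inverts `c`.
    t-inverts-gen : ∀ i → t ∙ conj c (a ^ i) ∙ t ≈ conj c (a ^ i) ⁻¹
    t-inverts-gen i = begin
      t ∙ (α ⁻¹ ∙ c ∙ α) ∙ t
        ≈⟨ solve (α ∷ c ∷ []) (τ ⊙ (v0 ⁻ ⊙ v1 ⊙ v0) ⊙ τ) ((v0 ⁻ ⊙ τ) ⊙ ((v0 ⊙ τ ⊙ v0 ⁻ ⊙ τ) ⁻ ⊙ v1 ⊙ (v0 ⊙ τ ⊙ v0 ⁻ ⊙ τ)) ⊙ (τ ⊙ v0)) ≡.refl ⟩
      (α ⁻¹ ∙ t) ∙ conj c k ∙ (t ∙ α) ≈⟨ ∙-congʳ (∙-congˡ (commute⇒conj (commutators-commute c-commutator k-commutator))) ⟩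
      (α ⁻¹ ∙ t) ∙ (a ⁻¹ ∙ t ∙ a ∙ t) ∙ (t ∙ α)
        ≈⟨ solve (α ∷ a ∷ []) ((v0 ⁻ ⊙ τ) ⊙ (v1 ⁻ ⊙ τ ⊙ v1 ⊙ τ) ⊙ (τ ⊙ v0)) ((v0 ⁻ ⊙ (v1 ⁻ ⊙ τ ⊙ v1 ⊙ τ) ⊙ v0) ⁻) ≡.refl ⟩
      conj c α ⁻¹ ∎
      where
      α k : Carrier
      α = a ^ i
      k = α ∙ t ∙ α ⁻¹ ∙ t
      k≈ : k ≈ conj [ α ⁻¹ , b ⁻¹ ] (a ⁻¹)
      k≈ = begin
        α ∙ t ∙ α ⁻¹ ∙ t                  ≈⟨ solve (α ∷ []) (v0 ⊙ τ ⊙ v0 ⁻ ⊙ τ) (v0 ⊙ τ ⊙ v0 ⁻ ⊙ τ ⁻) ≡.refl ⟩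
        α ∙ (a ∙ b) ∙ α ⁻¹ ∙ (a ∙ b) ⁻¹   ≈⟨ solve (α ∷ a ∷ b ∷ []) (v0 ⊙ (v1 ⊙ v2) ⊙ v0 ⁻ ⊙ (v1 ⊙ v2) ⁻) ((v0 ⊙ v1) ⊙ (v2 ⊙ v0 ⁻ ⊙ v2 ⁻ ⊙ v1 ⁻)) ≡.refl ⟩
        (α ∙ a) ∙ (b ∙ α ⁻¹ ∙ b ⁻¹ ∙ a ⁻¹) ≈⟨ ∙-congʳ (A-comm (i , refl) a∈A) ⟩
        (a ∙ α) ∙ (b ∙ α ⁻¹ ∙ b ⁻¹ ∙ a ⁻¹)
          ≈⟨ solve (α ∷ a ∷ b ∷ []) ((v1 ⊙ v0) ⊙ (v2 ⊙ v0 ⁻ ⊙ v2 ⁻ ⊙ v1 ⁻)) (v1 ⁻ ⁻ ⊙ (v0 ⁻ ⁻ ⊙ v2 ⁻ ⁻ ⊙ v0 ⁻ ⊙ v2 ⁻) ⊙ v1 ⁻) ≡.refl ⟩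
        conj [ α ⁻¹ , b ⁻¹ ] (a ⁻¹) ∎
      k-commutator : IsCommutator k
      k-commutator with conj-A-commutator (α ⁻¹ , b ⁻¹ , A-inv (i , refl) , B-inv b∈B , refl) (A-inv a∈A)
      ... | x , y , x∈ , y∈ , eq = x , y , x∈ , y∈ , trans k≈ eq

    t-inverts : ∀ {m} → InM m → t ∙ m ∙ t ≈ m ⁻¹
    t-inverts (gen i)      = t-inverts-gen i
    t-inverts one          = solve [] (τ ⊙ 𝕖 ⊙ τ) (𝕖 ⁻) ≡.refl
    t-inverts (mul {g} {h} g∈ h∈) = begin
      t ∙ (g ∙ h) ∙ t              ≈⟨ solve (g ∷ h ∷ []) (τ ⊙ (v0 ⊙ v1) ⊙ τ) ((τ ⊙ v0 ⊙ τ) ⊙ (τ ⊙ v1 ⊙ τ)) ≡.refl ⟩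
      (t ∙ g ∙ t) ∙ (t ∙ h ∙ t)    ≈⟨ ∙-cong (t-inverts g∈) (t-inverts h∈) ⟩
      g ⁻¹ ∙ h ⁻¹                  ≈⟨ ⁻¹-anti-homo-∙ h g ⟨
      (h ∙ g) ⁻¹                   ≈⟨ ⁻¹-cong (M-comm h∈ g∈) ⟩
      (g ∙ h) ⁻¹                   ∎
    t-inverts (inv {g} g∈) = trans (solve (g ∷ []) (τ ⊙ v0 ⁻ ⊙ τ) ((τ ⊙ v0 ⊙ τ) ⁻) ≡.refl) (⁻¹-cong (t-inverts g∈))
    t-inverts (resp g≈ g∈) = trans (∙-congʳ (∙-congˡ (sym g≈))) (trans (t-inverts g∈) (⁻¹-cong g≈))

    -- Because `b = a⁻¹ t` and `t` inverts `M`, the two generators act on `M` by the same operator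
    -- up to sign.
    b-conj : ∀ {m} → InM m → b ∙ m ∙ b ⁻¹ ≈ conj m a ⁻¹
    b-conj {m} m∈ = begin
      b ∙ m ∙ b ⁻¹                            ≈⟨ ∙-cong (∙-congʳ b≈a⁻¹t) (⁻¹-cong b≈a⁻¹t) ⟩
      (a ⁻¹ ∙ t) ∙ m ∙ (a ⁻¹ ∙ t) ⁻¹          ≈⟨ solve (a ∷ m ∷ []) ((v0 ⁻ ⊙ τ) ⊙ v1 ⊙ (v0 ⁻ ⊙ τ) ⁻) (v0 ⁻ ⊙ (τ ⊙ v1 ⊙ τ) ⊙ v0) ≡.refl ⟩
      conj (t ∙ m ∙ t) a                      ≈⟨ conj-cong (t-inverts m∈) refl ⟩
      conj (m ⁻¹) a                           ≈⟨ conj-⁻¹ m a ⟩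
      conj m a ⁻¹                             ∎

    M-conj-b : ∀ {m} → InM m → InM (b ∙ m ∙ b ⁻¹)
    M-conj-b m∈ = resp (sym (b-conj m∈)) (inv (M-conj-a m∈))

    b²-conj : ∀ {m} → InM m → b ∙ (b ∙ m ∙ b ⁻¹) ∙ b ⁻¹ ≈ conj (conj m a) a
    b²-conj {m} m∈ = begin
      b ∙ (b ∙ m ∙ b ⁻¹) ∙ b ⁻¹  ≈⟨ b-conj (M-conj-b m∈) ⟩
      conj (b ∙ m ∙ b ⁻¹) a ⁻¹   ≈⟨ ⁻¹-cong (conj-cong (b-conj m∈) refl) ⟩
      conj (conj m a ⁻¹) a ⁻¹    ≈⟨ ⁻¹-cong (conj-⁻¹ _ a) ⟩
      conj (conj m a) a ⁻¹ ⁻¹    ≈⟨ ⁻¹-involutive _ ⟩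
      conj (conj m a) a          ∎

    conj-M : ∀ {m m′} → InM m → InM m′ → conj m m′ ≈ m
    conj-M m∈ m′∈ = commute⇒conj (M-comm m∈ m′∈)

    -- `K` ranges over subgroups of the whole group, so that equality is taken modulo `M ∩ K`. It
    -- will be `⟨a⟩` when `q` is even and trivial when `q` is odd.
    module Quotient (K : Carrier → Set)
      (K-resp : ∀ {g h} → g ≈ h → K g → K h) (K-ε : K ε)
      (K-mul : ∀ {g h} → K g → K h → K (g ∙ h)) (K-inv : ∀ {g} → K g → K (g ⁻¹)) where

      M/K : AbelianGroup 0ℓ 0ℓ
      M/K = record
        { Carrier = Σ Carrier InM
        ; _≈_ = λ (g , _) (h , _) → K (g ∙ h ⁻¹)
        ; _∙_ = λ (g , g∈) (h , h∈) → g ∙ h , mul g∈ h∈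
        ; ε = ε , one
        ; _⁻¹ = λ (g , g∈) → g ⁻¹ , inv g∈
        ; isAbelianGroup = record
          { isGroup = record
            { isMonoid = record
              { isSemigroup = record
                { isMagma = record
                  { isEquivalence = record
                    { refl = lift refl
                    ; sym = λ {(g , _)} {(h , _)} k → K-resp (solve (g ∷ h ∷ []) ((v0 ⊙ v1 ⁻) ⁻) (v1 ⊙ v0 ⁻) ≡.refl) (K-inv k)
                    ; trans = λ {(g , _)} {(h , _)} {(k , _)} r s → K-resp (solve (g ∷ h ∷ k ∷ []) ((v0 ⊙ v1 ⁻) ⊙ (v1 ⊙ v2 ⁻)) (v0 ⊙ v2 ⁻) ≡.refl) (K-mul r s)
                    }
                  ; ∙-cong = λ {(g , g∈)} {(g′ , g′∈)} {(h , h∈)} {(h′ , h′∈)} r s → K-resp (begin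
                      (g ∙ g′ ⁻¹) ∙ (h ∙ h′ ⁻¹)    ≈⟨ assoc _ _ _ ⟩
                      g ∙ (g′ ⁻¹ ∙ (h ∙ h′ ⁻¹))    ≈⟨ ∙-congˡ (M-comm (inv g′∈) (mul h∈ (inv h′∈))) ⟩
                      g ∙ ((h ∙ h′ ⁻¹) ∙ g′ ⁻¹)    ≈⟨ solve (g ∷ g′ ∷ h ∷ h′ ∷ []) (v0 ⊙ ((v2 ⊙ v3 ⁻) ⊙ v1 ⁻)) ((v0 ⊙ v2) ⊙ (v1 ⊙ v3) ⁻) ≡.refl ⟩
                      (g ∙ h) ∙ (g′ ∙ h′) ⁻¹       ∎) (K-mul r s)
                  }
                ; assoc = λ (g , _) (h , _) (k , _) → lift (assoc g h k) }
              ; identity = (λ (g , _) → lift (identityˡ g)) , (λ (g , _) → lift (identityʳ g)) }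
            ; inverse = (λ (g , _) → lift (inverseˡ g)) , (λ (g , _) → lift (inverseʳ g))
            ; ⁻¹-cong = λ {(g , g∈)} {(h , h∈)} r → K-resp (begin
                (g ∙ h ⁻¹) ⁻¹       ≈⟨ solve (g ∷ h ∷ []) ((v0 ⊙ v1 ⁻) ⁻) (v1 ⊙ v0 ⁻) ≡.refl ⟩
                h ∙ g ⁻¹            ≈⟨ M-comm h∈ (inv g∈) ⟩
                g ⁻¹ ∙ h            ≈⟨ ∙-congˡ (⁻¹-involutive h) ⟨
                g ⁻¹ ∙ (h ⁻¹) ⁻¹    ∎) (K-inv r)
            }
          ; comm = λ (g , g∈) (h , h∈) → lift (M-comm g∈ h∈)
          }
        }
        where
        lift : ∀ {g h} → g ≈ h → K (g ∙ h ⁻¹)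
        lift {g} {h} e = K-resp (trans (sym (inverseʳ h)) (∙-congʳ (sym e))) K-ε

-- Even `q`: the ring `M / (M ∩ ⟨a⟩)`.

module EvenType where
  open import Algebra.Bundles using (AbelianGroup; CommutativeRing)
  open import Data.Nat.Base as ℕ using (ℕ; zero; suc; NonZero)
  import Data.Nat.Properties as ℕₚ
  open import Data.Nat.Divisibility using (_∣_; divides; *-cancelˡ-∣)
  open import Data.Nat.Primality using (Prime)
  open import Data.Fin.Patterns
  open import Data.Vec.Base using ([]; _∷_)
  open import Data.Product using (∃; _,_; proj₁; proj₂)
  open import Data.Sum using (_⊎_; inj₁; inj₂)
  open import Data.Empty using (⊥; ⊥-elim)
  open import Relation.Binary.PropositionalEquality as ≡ using (_≡_)
  open GroupWords
  open TightGroups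
  open PolynomialAction
  open CommutatorSubgroup
  open GeometricSums

  module Even {p q} {{p≢0 : NonZero p}} {{q≢0 : NonZero q}} (T : TightGroup p q)
    (N : ℕ) {{N≢0 : NonZero N}} (q≡2N : q ≡ 2 ℕ.* N)
    (b∉MA : ∀ {m α} → Commutators.InM T m → Commutators.InA T α →
              TightGroup._≈_ T (TightGroup.b T) (TightGroup._∙_ T m α) → ⊥) where
    open Commutators T
    open import Relation.Binary.Reasoning.Setoid setoid

    private
      pattern v0 = var 0F
      pattern v1 = var 1F
      pattern v2 = var 2F
      pattern v3 = var 3F

    A-resp : ∀ {g h} → g ≈ h → InA g → InA h
    A-resp e (i , g≈) = i , trans (sym e) g≈

    A-ε : InA ε
    A-ε = 0 , refl

    A-pow : ∀ k {g} → InA g → InA (g ^ k)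
    A-pow zero    _  = A-ε
    A-pow (suc k) g∈ = A-mul g∈ (A-pow k g∈)

    open Quotient InA A-resp A-ε A-mul A-inv public
    module 𝓜 = AbelianGroup M/K

    X : 𝓜.Carrier → 𝓜.Carrier
    X (g , g∈) = conj g a , M-conj-a g∈

    X-cong : ∀ {x y} → x 𝓜.≈ y → X x 𝓜.≈ X y
    X-cong {x , _} {y , _} xy∈ = A-resp (begin
      x ∙ y ⁻¹                 ≈⟨ commute⇒conj (A-comm xy∈ a∈A) ⟨
      conj (x ∙ y ⁻¹) a        ≈⟨ conj-∙ x (y ⁻¹) a ⟩
      conj x a ∙ conj (y ⁻¹) a ≈⟨ ∙-congˡ (conj-⁻¹ y a) ⟩
      conj x a ∙ conj y a ⁻¹   ∎) xy∈

    lift : ∀ {x y} → proj₁ x ≈ proj₁ y → x 𝓜.≈ y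
    lift {x , _} {y , _} x≈y = A-resp (sym (trans (∙-congʳ x≈y) (inverseʳ y))) A-ε

    X-homo : ∀ x y → X (x 𝓜.∙ y) 𝓜.≈ X x 𝓜.∙ X y
    X-homo x y = lift {X (x 𝓜.∙ y)} {X x 𝓜.∙ X y} (conj-∙ _ _ a)

    -- The component of `b²` in `M`: by `b²≈` one has `b² = n a⁻²`, so the powers of `b²` trace out
    -- the geometric sums applied to `n`.
    n : Carrier
    n = conj (c ⁻¹) a

    n̂ : 𝓜.Carrier
    n̂ = n , M-conj-a (inv c∈M)

    open CyclicModule M/K X (λ {x} {y} → X-cong {x} {y}) X-homo n̂ using (𝕏; ⟦_⟧; ring; _⊛_)
    module R = CommutativeRing ring
    open Sums ring using (geo; nat; module Transitive; ×-homo-+)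

    sum : ℕ → Carrier
    sum j = proj₁ (⟦ geo (𝕏 ⊛ 𝕏) j ⟧ n̂)

    sum∈M : ∀ j → InM (sum j)
    sum∈M j = proj₂ (⟦ geo (𝕏 ⊛ 𝕏) j ⟧ n̂)

    b²≈ : b ^ 2 ≈ n ∙ (a ^ 2) ⁻¹
    b²≈ = begin
      b ∙ (b ∙ ε)                          ≈⟨ ∙-cong b≈a⁻¹t (∙-congʳ b≈a⁻¹t) ⟩
      (a ⁻¹ ∙ t) ∙ ((a ⁻¹ ∙ t) ∙ ε)
        ≈⟨ solve (a ∷ []) ((v0 ⁻ ⊙ τ) ⊙ ((v0 ⁻ ⊙ τ) ⊙ 𝕖)) ((v0 ⁻ ⊙ (v0 ⁻ ⊙ τ ⊙ v0 ⊙ τ) ⁻ ⊙ v0) ⊙ (v0 ⊙ (v0 ⊙ 𝕖)) ⁻) ≡.refl ⟩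
      n ∙ (a ^ 2) ⁻¹                       ∎

    a⁻² : Carrier
    a⁻² = (a ^ 2) ⁻¹

    a⁻²∈A : InA a⁻²
    a⁻²∈A = A-inv (2 , refl)

    -- Moving `a⁻²` to the right across `sum j` conjugates it by `a²`, that is, applies `X` twice;
    -- this is the recursion of `geo`.
    b^2j : ∀ j → (b ^ 2) ^ j ≈ sum j ∙ a⁻² ^ j
    b^2j zero    = sym (identityˡ ε)
    b^2j (suc j) = begin
      b ^ 2 ∙ (b ^ 2) ^ j                               ≈⟨ ∙-cong b²≈ (b^2j j) ⟩
      (n ∙ a⁻²) ∙ (sum j ∙ a⁻² ^ j)
        ≈⟨ solve (n ∷ a ∷ sum j ∷ a⁻² ^ j ∷ []) ((v0 ⊙ (v1 ⊙ (v1 ⊙ 𝕖)) ⁻) ⊙ (v2 ⊙ v3))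
             ((v0 ⊙ (v1 ⁻ ⊙ (v1 ⁻ ⊙ v2 ⊙ v1) ⊙ v1)) ⊙ ((v1 ⊙ (v1 ⊙ 𝕖)) ⁻ ⊙ v3)) ≡.refl ⟩
      (n ∙ conj (conj (sum j) a) a) ∙ (a⁻² ∙ a⁻² ^ j)   ∎

    sum≈ : ∀ j → sum j ≈ (b ^ 2) ^ j ∙ (a⁻² ^ j) ⁻¹
    sum≈ j = trans (solve (sum j ∷ a⁻² ^ j ∷ []) v0 ((v0 ⊙ v1) ⊙ v1 ⁻) ≡.refl) (∙-congʳ (sym (b^2j j)))

    b^2j≈b^[j*2] : ∀ j → (b ^ 2) ^ j ≈ b ^ (j ℕ.* 2)
    b^2j≈b^[j*2] j = ^-* b j 2

    q∣⇒N∣ : ∀ j → q ∣ j ℕ.* 2 → N ∣ j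
    q∣⇒N∣ j q∣ = *-cancelˡ-∣ 2 (≡.subst₂ _∣_ q≡2N (ℕₚ.*-comm j 2) q∣)

    -- If `sum j` lies in `⟨a⟩`, then `b^(2j)` lies in `⟨a⟩ ∩ ⟨b⟩`, which is trivial.
    faithful : ∀ j → geo (𝕏 ⊛ 𝕏) j R.≈ R.0# → N ∣ j
    faithful j sum∈A = q∣⇒N∣ j (b-order _ (trans (sym a≈b) (A∩B (proj₁ b∈A) (j ℕ.* 2) a≈b)))
      where
      b∈A : InA ((b ^ 2) ^ j)
      b∈A = A-resp (trans (∙-congʳ (trans (∙-congˡ ε⁻¹≈ε) (identityʳ _))) (sym (b^2j j))) (A-mul sum∈A (A-pow j a⁻²∈A))
      a≈b : a ^ proj₁ b∈A ≈ b ^ (j ℕ.* 2)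
      a≈b = trans (sym (proj₂ b∈A)) (b^2j≈b^[j*2] j)

    period : geo (𝕏 ⊛ 𝕏) N R.≈ R.0#
    period = A-resp (sym (trans (∙-congˡ ε⁻¹≈ε) (trans (identityʳ _) (trans (sum≈ N) (trans (∙-congʳ b^2N≈ε) (identityˡ _))))))
      (A-inv (A-pow N a⁻²∈A))
      where
      b^2N≈ε : (b ^ 2) ^ N ≈ ε
      b^2N≈ε = trans (b^2j≈b^[j*2] N) (trans (^-≡ b (≡.trans (ℕₚ.*-comm N 2) (≡.sym q≡2N))) b^q≈ε)

    b^2k : ∀ k → b ^ (2 ℕ.* k) ≈ sum k ∙ a⁻² ^ k
    b^2k k = trans (^-≡ b (ℕₚ.*-comm 2 k)) (trans (sym (b^2j≈b^[j*2] k)) (b^2j k))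

    span-even : ∀ {m α} k → InM m → InA α → m ≈ b ^ (2 ℕ.* k) ∙ α → InA (m ∙ sum k ⁻¹)
    span-even {m} {α} k m∈ α∈ m≈ = A-resp (begin
      a⁻² ^ k ∙ α                           ≈⟨ cancel (sum k) (a⁻² ^ k) α ⟩
      sum k ⁻¹ ∙ ((sum k ∙ a⁻² ^ k) ∙ α)    ≈⟨ ∙-congˡ (∙-congʳ (b^2k k)) ⟨
      sum k ⁻¹ ∙ (b ^ (2 ℕ.* k) ∙ α)        ≈⟨ ∙-congˡ m≈ ⟨
      sum k ⁻¹ ∙ m                          ≈⟨ M-comm (inv (sum∈M k)) m∈ ⟩
      m ∙ sum k ⁻¹                          ∎) (A-mul (A-pow k a⁻²∈A) α∈)
      where
      cancel : ∀ x y z → y ∙ z ≈ x ⁻¹ ∙ ((x ∙ y) ∙ z)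
      cancel x y z = solve (x ∷ y ∷ z ∷ []) (v1 ⊙ v2) (v0 ⁻ ⊙ ((v0 ⊙ v1) ⊙ v2)) ≡.refl

    span-odd : ∀ {m α} k → InM m → InA α → m ≈ b ^ suc (2 ℕ.* k) ∙ α → ⊥
    span-odd {m} {α} k m∈ α∈ m≈ = b∉MA (mul m∈ (M-conj-A (A-inv γ∈) (inv (sum∈M k)))) γ∈ (begin
      b                                               ≈⟨ cancel b (sum k) (a⁻² ^ k) α ⟩
      (b ∙ (sum k ∙ a⁻² ^ k) ∙ α) ∙ (γ ∙ sum k ⁻¹)    ≈⟨ ∙-congʳ (∙-congʳ (∙-congˡ (b^2k k))) ⟨
      (b ^ suc (2 ℕ.* k) ∙ α) ∙ (γ ∙ sum k ⁻¹)        ≈⟨ ∙-congʳ m≈ ⟨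
      m ∙ (γ ∙ sum k ⁻¹)                              ≈⟨ shuffle m γ (sum k) ⟩
      (m ∙ conj (sum k ⁻¹) (γ ⁻¹)) ∙ γ                ∎)
      where
      γ : Carrier
      γ = α ⁻¹ ∙ (a⁻² ^ k) ⁻¹
      γ∈ : InA γ
      γ∈ = A-mul (A-inv α∈) (A-inv (A-pow k a⁻²∈A))
      cancel : ∀ w x y z → w ≈ (w ∙ (x ∙ y) ∙ z) ∙ ((z ⁻¹ ∙ y ⁻¹) ∙ x ⁻¹)
      cancel w x y z = solve (w ∷ x ∷ y ∷ z ∷ []) v0 ((v0 ⊙ (v1 ⊙ v2) ⊙ v3) ⊙ ((v3 ⁻ ⊙ v2 ⁻) ⊙ v1 ⁻)) ≡.refl
      shuffle : ∀ x y z → x ∙ (y ∙ z ⁻¹) ≈ (x ∙ conj (z ⁻¹) (y ⁻¹)) ∙ y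
      shuffle x y z = solve (x ∷ y ∷ z ∷ []) (v0 ⊙ (v1 ⊙ v2 ⁻)) ((v0 ⊙ (v1 ⁻ ⁻ ⊙ v2 ⁻ ⊙ v1 ⁻)) ⊙ v1) ≡.refl

    -- Write `m = b^j α`. For even `j` this is a `sum` times an element of `⟨a⟩`. For odd `j` the
    -- even part of `b^j` is absorbed into `M⟨a⟩`, and `b` would lie there too.
    span-M : ∀ {m} → InM m → ∃ λ j → InA (m ∙ sum j ⁻¹)
    span-M {m} m∈ = let β , α , (j , β≈) , α∈ , m≈ = factor-BA m in
      cases α∈ (parity j) (trans m≈ (∙-congʳ β≈))
      where
      cases : ∀ {j α} → InA α → (∃ λ k → j ≡ 2 ℕ.* k ⊎ j ≡ suc (2 ℕ.* k)) → m ≈ b ^ j ∙ α → ∃ λ j → InA (m ∙ sum j ⁻¹)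
      cases α∈ (k , inj₁ ≡.refl) m≈ = k , span-even k m∈ α∈ m≈
      cases α∈ (k , inj₂ ≡.refl) m≈ = ⊥-elim (span-odd k m∈ α∈ m≈)

    module Tr = Transitive N 𝕏 (λ f → span-M (proj₂ (⟦ f ⟧ n̂))) period faithful

    -- Adding `N`, which is zero in the ring, makes `r` positive, so that `r * r - 1` is a natural
    -- number.
    r : ℕ
    r = N ℕ.+ proj₁ (Tr.natural 𝕏)

    𝕏≈r : 𝕏 R.≈ nat r
    𝕏≈r = R.trans {𝕏} {nat s} {nat r} (proj₂ (Tr.natural 𝕏))
      (R.sym {nat r} {nat s} (R.trans {nat r} {nat N R.+ nat s} {nat s} (×-homo-+ R.1# N s)
        (R.trans {nat N R.+ nat s} {R.0# R.+ nat s} {nat s} (R.+-cong {nat N} {R.0#} {nat s} {nat s} Tr.nat-N≈0 (R.refl {nat s})) (R.+-identityˡ (nat s)))))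
      where
      s : ℕ
      s = proj₁ (Tr.natural 𝕏)

    private
      D : ℕ
      D = ℕ.pred (r ℕ.* r)

    instance
      r≢0 : NonZero r
      r≢0 = ℕ.>-nonZero (ℕₚ.≤-trans (ℕ.>-nonZero⁻¹ N) (ℕₚ.m≤m+n N _))

    r*r≡1+D : r ℕ.* r ≡ suc D
    r*r≡1+D = ≡.sym (ℕₚ.suc-pred (r ℕ.* r) {{ℕₚ.m*n≢0 r r}})

    prime∣D : ∀ {l} → Prime l → l ∣ N → l ∣ D
    prime∣D = Tr.prime-divides r D 𝕏≈r r*r≡1+D

    nat-power : ∀ k x → proj₁ (⟦ nat k ⟧ x) ≡ proj₁ x ^ k
    nat-power zero    x = ≡.refl
    nat-power (suc k) x = ≡.cong (proj₁ x ∙_) (nat-power k x)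

    -- Since `a^p = 1`, the element `m = b^p` lies in `M`. It commutes with `b`, so `a` inverts it;
    -- but modulo `⟨a⟩` conjugation by `a` also raises it to the power `r`. Hence `m^(1 + r)` lies
    -- in `⟨a⟩ ∩ ⟨b⟩`.
    q∣p*[1+r] : ∀ P → p ≡ 2 ℕ.* P → q ∣ p ℕ.* suc r
    q∣p*[1+r] P p≡2P = b-order _ (begin
      b ^ (p ℕ.* suc r)       ≈⟨ ^-≡ b (ℕₚ.*-comm p (suc r)) ⟩
      b ^ (suc r ℕ.* p)       ≈⟨ proj₂ b∈A ⟩
      a ^ proj₁ b∈A           ≈⟨ A∩B (proj₁ b∈A) (suc r ℕ.* p) (sym (proj₂ b∈A)) ⟩
      ε                       ∎)
      where
      m : Carrier
      m = sum P
      b^p≈m : b ^ p ≈ m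
      b^p≈m = begin
        b ^ p               ≈⟨ ^-≡ b p≡2P ⟩
        b ^ (2 ℕ.* P)       ≈⟨ b^2k P ⟩
        m ∙ a⁻² ^ P         ≈⟨ ∙-congˡ (trans (^-⁻¹ (a ^ 2) P) (⁻¹-cong (trans (^-* a P 2) (trans (^-≡ a (≡.trans (ℕₚ.*-comm P 2) (≡.sym p≡2P))) a^p≈ε)))) ⟩
        m ∙ ε ⁻¹            ≈⟨ trans (∙-congˡ ε⁻¹≈ε) (identityʳ m) ⟩
        m                   ∎
      Xm≈m⁻¹ : conj m a ≈ m ⁻¹
      Xm≈m⁻¹ = ⁻¹-injective (begin
        conj m a ⁻¹         ≈⟨ b-conj (sum∈M P) ⟨
        b ∙ m ∙ b ⁻¹        ≈⟨ ∙-congʳ (trans (∙-congˡ (sym b^p≈m)) (trans (^-suc′ b p) (∙-congʳ b^p≈m))) ⟩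
        m ∙ b ∙ b ⁻¹        ≈⟨ solve (m ∷ b ∷ []) (v0 ⊙ v1 ⊙ v1 ⁻) (v0 ⁻ ⁻) ≡.refl ⟩
        (m ⁻¹) ⁻¹           ∎)
      step : InA (conj m a ∙ (m ^ r) ⁻¹)
      step = A-resp (∙-congˡ (⁻¹-cong (reflexive (nat-power r _))))
        (R.*-cong {𝕏} {nat r} {geo (𝕏 ⊛ 𝕏) P} {geo (𝕏 ⊛ 𝕏) P} 𝕏≈r (R.refl {geo (𝕏 ⊛ 𝕏) P}))
      b∈A : InA (b ^ (suc r ℕ.* p))
      b∈A = A-resp (begin
        (conj m a ∙ (m ^ r) ⁻¹) ⁻¹   ≈⟨ ⁻¹-cong (∙-congʳ Xm≈m⁻¹) ⟩
        (m ⁻¹ ∙ (m ^ r) ⁻¹) ⁻¹       ≈⟨ ⁻¹-cong (⁻¹-anti-homo-∙ _ _) ⟨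
        (m ^ r ∙ m) ⁻¹ ⁻¹            ≈⟨ ⁻¹-involutive _ ⟩
        m ^ r ∙ m                    ≈⟨ ^-suc′ m r ⟨
        m ^ suc r                    ≈⟨ ^-cong (suc r) b^p≈m ⟨
        (b ^ p) ^ suc r              ≈⟨ ^-* b (suc r) p ⟩
        b ^ (suc r ℕ.* p)            ∎) (A-inv step)

    private
      Fixed : Carrier → Set
      Fixed m = InA (conj (conj m a) a ∙ m ⁻¹)

    Fixed-resp : ∀ {m m′} → m ≈ m′ → Fixed m → Fixed m′
    Fixed-resp m≈ = A-resp (∙-cong (conj-cong (conj-cong m≈ refl) refl) (⁻¹-cong m≈))

    Fixed-mul : ∀ {m m′} → InM m → InM m′ → Fixed m → Fixed m′ → Fixed (m ∙ m′)
    Fixed-mul {m} {m′} m∈ m′∈ f f′ = A-resp (begin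
      (u ∙ m ⁻¹) ∙ (u′ ∙ m′ ⁻¹)    ≈⟨ assoc _ _ _ ⟩
      u ∙ (m ⁻¹ ∙ (u′ ∙ m′ ⁻¹))    ≈⟨ ∙-congˡ (M-comm (inv m∈) (mul (M-conj-a (M-conj-a m′∈)) (inv m′∈))) ⟩
      u ∙ ((u′ ∙ m′ ⁻¹) ∙ m ⁻¹)    ≈⟨ shuffle u u′ m m′ ⟩
      (u ∙ u′) ∙ (m ∙ m′) ⁻¹       ≈⟨ ∙-congʳ (trans (conj-cong (conj-∙ m m′ a) refl) (conj-∙ _ _ a)) ⟨
      conj (conj (m ∙ m′) a) a ∙ (m ∙ m′) ⁻¹ ∎) (A-mul f f′)
      where
      u u′ : Carrier
      u  = conj (conj m a) a
      u′ = conj (conj m′ a) a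
      shuffle : ∀ x y z w → x ∙ ((y ∙ w ⁻¹) ∙ z ⁻¹) ≈ (x ∙ y) ∙ (z ∙ w) ⁻¹
      shuffle x y z w = solve (x ∷ y ∷ z ∷ w ∷ []) (v0 ⊙ ((v1 ⊙ v3 ⁻) ⊙ v2 ⁻)) ((v0 ⊙ v1) ⊙ (v2 ⊙ v3) ⁻) ≡.refl

    Fixed-inv : ∀ {m} → InM m → Fixed m → Fixed (m ⁻¹)
    Fixed-inv {m} m∈ f = A-resp (begin
      (u ∙ m ⁻¹) ⁻¹              ≈⟨ ⁻¹-cong (M-comm (M-conj-a (M-conj-a m∈)) (inv m∈)) ⟩
      (m ⁻¹ ∙ u) ⁻¹              ≈⟨ ⁻¹-anti-homo-∙ _ _ ⟩
      u ⁻¹ ∙ (m ⁻¹) ⁻¹           ≈⟨ ∙-congʳ (trans (conj-cong (conj-⁻¹ m a) refl) (conj-⁻¹ _ a)) ⟨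
      conj (conj (m ⁻¹) a) a ∙ (m ⁻¹) ⁻¹ ∎) (A-inv f)
      where
      u : Carrier
      u = conj (conj m a) a

    Fixed-conj : ∀ i {m} → Fixed m → Fixed (conj m (a ^ i))
    Fixed-conj zero    {m} f = Fixed-resp (solve (m ∷ []) v0 (𝕖 ⁻ ⊙ v0 ⊙ 𝕖) ≡.refl) f
    Fixed-conj (suc i) {m} f = Fixed-resp (conj-conj m a (a ^ i)) (Fixed-conj i (A-resp (begin
      conj (conj m a) a ∙ m ⁻¹                 ≈⟨ commute⇒conj (A-comm f a∈A) ⟨
      conj (conj (conj m a) a ∙ m ⁻¹) a        ≈⟨ conj-∙ _ _ a ⟩
      conj (conj (conj m a) a) a ∙ conj (m ⁻¹) a ≈⟨ ∙-congˡ (conj-⁻¹ m a) ⟩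
      conj (conj (conj m a) a) a ∙ conj m a ⁻¹ ∎) f))

    c≈ : c ≈ conj (n ⁻¹) (a ^ ℕ.pred p)
    c≈ = begin
      c                                         ≈⟨ solve (c ∷ []) v0 (𝕖 ⁻ ⊙ v0 ⊙ 𝕖) ≡.refl ⟩
      conj c ε                                  ≈⟨ conj-cong refl (trans (sym a^p≈ε) (^-≡ a (≡.sym (ℕₚ.suc-pred p)))) ⟩
      conj c (a ∙ a ^ ℕ.pred p)                 ≈⟨ conj-conj c a _ ⟨
      conj (conj c a) (a ^ ℕ.pred p)            ≈⟨ conj-cong (trans (sym (⁻¹-involutive _)) (⁻¹-cong (sym (conj-⁻¹ c a)))) refl ⟩
      conj (n ⁻¹) (a ^ ℕ.pred p)                ∎

    -- `N ∣ r² - 1` makes `a²` fix `n` modulo `⟨a⟩`. The property passes to inverses, products and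
    -- conjugates under `a`, and `c` is such a conjugate of `n ⁻¹`.
    a²-central : N ∣ D → ∀ {m} → InM m → Fixed m
    a²-central N∣D = all
      where
      natD≈0 : nat D R.≈ R.0#
      natD≈0 = natD≈0′ N∣D
        where
        natD≈0′ : ∀ {d} → N ∣ d → nat d R.≈ R.0#
        natD≈0′ (divides k ≡.refl) = R.trans {nat (k ℕ.* N)} {nat k R.* nat N} {R.0#} (Sums.×1-homo-* ring k N)
          (R.trans {nat k R.* nat N} {nat k R.* R.0#} {R.0#} (R.*-cong {nat k} {nat k} {nat N} {R.0#} (R.refl {nat k}) Tr.nat-N≈0) (R.zeroʳ (nat k)))
      𝕏²≈1 : 𝕏 ⊛ 𝕏 R.≈ R.1#
      𝕏²≈1 = R.trans {𝕏 ⊛ 𝕏} {nat r R.* nat r} {R.1#} (R.*-cong {𝕏} {nat r} {𝕏} {nat r} 𝕏≈r 𝕏≈r)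
        (R.trans {nat r R.* nat r} {nat (r ℕ.* r)} {R.1#} (R.sym {nat (r ℕ.* r)} {nat r R.* nat r} (Sums.×1-homo-* ring r r))
        (R.trans {nat (r ℕ.* r)} {R.1# R.+ nat D} {R.1#} (R.reflexive (≡.cong nat r*r≡1+D))
        (R.trans {R.1# R.+ nat D} {R.1# R.+ R.0#} {R.1#} (R.+-cong {R.1#} {R.1#} {nat D} {R.0#} (R.refl {R.1#}) natD≈0) (R.+-identityʳ R.1#))))
      base : Fixed n
      base = 𝕏²≈1
      all : ∀ {m} → InM m → Fixed m
      all (gen i)      = Fixed-conj i (Fixed-resp (sym c≈) (Fixed-conj (ℕ.pred p) (Fixed-inv (proj₂ n̂) base)))
      all one          = A-resp (sym (solve (a ∷ []) ((v0 ⁻ ⊙ (v0 ⁻ ⊙ 𝕖 ⊙ v0) ⊙ v0) ⊙ 𝕖 ⁻) 𝕖 ≡.refl)) A-ε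
      all (mul g∈ h∈)  = Fixed-mul g∈ h∈ (all g∈) (all h∈)
      all (inv g∈)     = Fixed-inv g∈ (all g∈)
      all (resp g≈ g∈) = Fixed-resp g≈ (all g∈)

-- Duality of `M` and explicit reflections.

module Reflections where
  open import Data.Nat.Base as ℕ using (ℕ; zero; suc; NonZero)
  import Data.Nat.Properties as ℕₚ
  open import Data.Bool.Base using (Bool; true; false; if_then_else_)
  open import Data.Fin.Patterns
  open import Data.Vec.Base using ([]; _∷_)
  open import Data.Product using (∃; _×_; _,_; proj₂)
  open import Data.Empty using (⊥; ⊥-elim)
  open import Relation.Binary.PropositionalEquality as ≡ using (_≡_)
  open GroupWords
  open TightGroups
  open CommutatorSubgroup

  module Duality {p q} {{p≢0 : NonZero p}} {{q≢0 : NonZero q}} (T : TightGroup p q) where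
    open Commutators T
    open import Relation.Binary.Reasoning.Setoid setoid
    module C* = Commutators (dual T)

    private
      pattern v0 = var 0F
      pattern v1 = var 1F

    reflexible-dual : Reflexible (dual T) → Reflexible T
    reflexible-dual (θ , θ-cong , θ-ε , θ-b , θ-a) = θ , θ-cong , θ-ε , step a (λ g → θ-a g) , step b (λ g → θ-b g)
      where
      step : ∀ x → (∀ g → θ (g ∙ x ⁻¹) ≈ θ g ∙ (x ⁻¹) ⁻¹) → ∀ g → θ (g ∙ x) ≈ θ g ∙ x ⁻¹
      step x h g = begin
        θ (g ∙ x)                         ≈⟨ solve (θ (g ∙ x) ∷ x ∷ []) v0 ((v0 ⊙ v1 ⁻ ⁻) ⊙ v1 ⁻) ≡.refl ⟩
        (θ (g ∙ x) ∙ (x ⁻¹) ⁻¹) ∙ x ⁻¹    ≈⟨ ∙-congʳ (h (g ∙ x)) ⟨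
        θ (g ∙ x ∙ x ⁻¹) ∙ x ⁻¹           ≈⟨ ∙-congʳ (θ-cong (solve (g ∷ x ∷ []) (v0 ⊙ v1 ⊙ v1 ⁻) v0 ≡.refl)) ⟩
        θ g ∙ x ⁻¹                        ∎

    c≈c* : c ≈ C*.c
    c≈c* = sym (begin
      (b ⁻¹) ⁻¹ ∙ (b ⁻¹ ∙ a ⁻¹) ∙ b ⁻¹ ∙ (b ⁻¹ ∙ a ⁻¹)
        ≈⟨ solve (a ∷ b ∷ []) (v1 ⁻ ⁻ ⊙ (v1 ⁻ ⊙ v0 ⁻) ⊙ v1 ⁻ ⊙ (v1 ⁻ ⊙ v0 ⁻)) (v1 ⊙ (v0 ⊙ v1) ⁻ ⊙ v1 ⁻ ⊙ (v0 ⊙ v1) ⁻) ≡.refl ⟩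
      b ∙ t ⁻¹ ∙ b ⁻¹ ∙ t ⁻¹                              ≈⟨ ∙-congʳ (∙-cong (∙-congʳ b≈a⁻¹t) (⁻¹-cong b≈a⁻¹t)) ⟩
      (a ⁻¹ ∙ t) ∙ t ⁻¹ ∙ (a ⁻¹ ∙ t) ⁻¹ ∙ t ⁻¹            ≈⟨ solve (a ∷ []) ((v0 ⁻ ⊙ τ) ⊙ τ ⁻ ⊙ (v0 ⁻ ⊙ τ) ⁻ ⊙ τ ⁻) (v0 ⁻ ⊙ τ ⊙ v0 ⊙ τ) ≡.refl ⟩
      c                                                   ∎)

    -- Both subgroups start from the same `c`, and stability of the dual one under its second
    -- generator `a⁻¹` is stability under conjugation by `a`.
    M⊆M* : ∀ {m} → InM m → C*.InM m
    M⊆M* (gen i)      = powers i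
      where
      conj-a∈ : ∀ {m} → C*.InM m → C*.InM (conj m a)
      conj-a∈ m∈ = C*.resp (∙-congˡ (⁻¹-involutive a)) (C*.M-conj-b m∈)
      powers : ∀ i → C*.InM (conj c (a ^ i))
      powers zero    = C*.resp (trans (sym c≈c*) (solve (c ∷ []) v0 (𝕖 ⁻ ⊙ v0 ⊙ 𝕖) ≡.refl)) C*.c∈M
      powers (suc i) = C*.resp (trans (conj-conj c (a ^ i) a) (conj-cong refl (sym (^-suc′ a i)))) (conj-a∈ (powers i))
    M⊆M* one          = C*.one
    M⊆M* (mul g∈ h∈)  = C*.mul (M⊆M* g∈) (M⊆M* h∈)
    M⊆M* (inv g∈)     = C*.inv (M⊆M* g∈)
    M⊆M* (resp g≈ g∈) = C*.resp g≈ (M⊆M* g∈)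

  module ProductMA {p q} {{p≢0 : NonZero p}} {{q≢0 : NonZero q}} (T : TightGroup p q) where
    open Commutators T
    open import Relation.Binary.Reasoning.Setoid setoid

    private
      pattern v0 = var 0F
      pattern v1 = var 1F
      pattern v2 = var 2F

    -- Two factorisations differ by an element of `M ∩ ⟨a⟩`, which commutes with both factors, so
    -- inverting the factors separately is well defined on the product.
    unique : ∀ {m m′} i i′ → InM m → InM m′ → m ∙ a ^ i ≈ m′ ∙ a ^ i′ → m ⁻¹ ∙ (a ^ i) ⁻¹ ≈ m′ ⁻¹ ∙ (a ^ i′) ⁻¹
    unique {m} {m′} i i′ m∈ m′∈ eq = begin
      m ⁻¹ ∙ α ⁻¹                        ≈⟨ solve (m ∷ α ∷ m′ ∷ []) (v0 ⁻ ⊙ v1 ⁻) ((v0 ⁻ ⊙ v2) ⊙ v2 ⁻ ⊙ v1 ⁻) ≡.refl ⟩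
      (m ⁻¹ ∙ m′) ∙ m′ ⁻¹ ∙ α ⁻¹         ≈⟨ ∙-congʳ (M-comm (mul (inv m∈) m′∈) (inv m′∈)) ⟩
      m′ ⁻¹ ∙ (m ⁻¹ ∙ m′) ∙ α ⁻¹         ≈⟨ ∙-congʳ (∙-congˡ u≈) ⟩
      m′ ⁻¹ ∙ (α ∙ α′ ⁻¹) ∙ α ⁻¹         ≈⟨ ∙-congʳ (∙-congˡ (A-comm (i , refl) (A-inv (i′ , refl)))) ⟩
      m′ ⁻¹ ∙ (α′ ⁻¹ ∙ α) ∙ α ⁻¹         ≈⟨ solve (m′ ∷ α ∷ α′ ∷ []) (v0 ⁻ ⊙ (v2 ⁻ ⊙ v1) ⊙ v1 ⁻) (v0 ⁻ ⊙ v2 ⁻) ≡.refl ⟩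
      m′ ⁻¹ ∙ α′ ⁻¹                      ∎
      where
      α α′ : Carrier
      α  = a ^ i
      α′ = a ^ i′
      u≈ : m ⁻¹ ∙ m′ ≈ α ∙ α′ ⁻¹
      u≈ = begin
        m ⁻¹ ∙ m′                        ≈⟨ solve (m ∷ m′ ∷ α′ ∷ []) (v0 ⁻ ⊙ v1) (v0 ⁻ ⊙ (v1 ⊙ v2) ⊙ v2 ⁻) ≡.refl ⟩
        m ⁻¹ ∙ (m′ ∙ α′) ∙ α′ ⁻¹         ≈⟨ ∙-congʳ (∙-congˡ eq) ⟨
        m ⁻¹ ∙ (m ∙ α) ∙ α′ ⁻¹           ≈⟨ solve (m ∷ α ∷ α′ ∷ []) (v0 ⁻ ⊙ (v0 ⊙ v1) ⊙ v2 ⁻) (v1 ⊙ v2 ⁻) ≡.refl ⟩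
        α ∙ α′ ⁻¹                        ∎

  module SquareCentral {p q} {{p≢0 : NonZero p}} {{q≢0 : NonZero q}} (T : TightGroup p q)
    (a²-central : ∀ {m} → Commutators.InM T m → TightGroup._≈_ T (Commutators.conj T (Commutators.conj T m (TightGroup.a T)) (TightGroup.a T)) m)
    where
    open Commutators T
    open import Relation.Binary.Reasoning.Setoid setoid

    private
      pattern v0 = var 0F
      pattern v1 = var 1F
      pattern v2 = var 2F

    conj-a^-twice : ∀ k {m} → InM m → conj (conj m (a ^ k)) (a ^ k) ≈ m
    conj-a^-twice zero    {m} m∈ = solve (m ∷ []) (𝕖 ⁻ ⊙ (𝕖 ⁻ ⊙ v0 ⊙ 𝕖) ⊙ 𝕖) v0 ≡.refl
    conj-a^-twice (suc k) {m} m∈ = begin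
      conj (conj m (a ^ suc k)) (a ^ suc k)      ≈⟨ conj-cong (conj-cong refl (^-suc′ a k)) refl ⟩
      conj (conj m (a ^ k ∙ a)) (a ∙ a ^ k)      ≈⟨ solve (m ∷ a ∷ a ^ k ∷ []) ((v1 ⊙ v2) ⁻ ⊙ ((v2 ⊙ v1) ⁻ ⊙ v0 ⊙ (v2 ⊙ v1)) ⊙ (v1 ⊙ v2))
                                                       (v2 ⁻ ⊙ (v1 ⁻ ⊙ (v1 ⁻ ⊙ (v2 ⁻ ⊙ v0 ⊙ v2) ⊙ v1) ⊙ v1) ⊙ v2) ≡.refl ⟩
      conj (conj (conj (conj m (a ^ k)) a) a) (a ^ k) ≈⟨ conj-cong (a²-central (M-conj-a^ k m∈)) refl ⟩
      conj (conj m (a ^ k)) (a ^ k)              ≈⟨ conj-a^-twice k m∈ ⟩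
      m                                          ∎

    -- `a^(2k)` centralises `M`, so conjugations by `a^k` from the two sides agree. This is how
    -- `r² = 1` enters the construction of a reflection.
    conj-a^ : ∀ k {m} → InM m → conj m (a ^ k) ≈ a ^ k ∙ m ∙ (a ^ k) ⁻¹
    conj-a^ k {m} m∈ = begin
      conj m β                            ≈⟨ solve (m ∷ β ∷ []) (v1 ⁻ ⊙ v0 ⊙ v1) (v1 ⊙ (v1 ⁻ ⊙ (v1 ⁻ ⊙ v0 ⊙ v1) ⊙ v1) ⊙ v1 ⁻) ≡.refl ⟩
      β ∙ conj (conj m β) β ∙ β ⁻¹        ≈⟨ ∙-congʳ (∙-congˡ (conj-a^-twice k m∈)) ⟩
      β ∙ m ∙ β ⁻¹                        ∎
      where
      β : Carrier
      β = a ^ k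

  module EvenReflection {p q} {{p≢0 : NonZero p}} {{q≢0 : NonZero q}} (T : TightGroup p q)
    (b∉MA : ∀ {m α} → Commutators.InM T m → Commutators.InA T α →
              TightGroup._≈_ T (TightGroup.b T) (TightGroup._∙_ T m α) → ⊥)
    (a²-central : ∀ {m} → Commutators.InM T m → TightGroup._≈_ T (Commutators.conj T (Commutators.conj T m (TightGroup.a T)) (TightGroup.a T)) m)
    where
    open Commutators T
    open ProductMA T
    open SquareCentral T a²-central
    open import Relation.Binary.Reasoning.Setoid setoid

    private
      pattern v0 = var 0F
      pattern v1 = var 1F
      pattern v2 = var 2F
      pattern v3 = var 3F

    -- The required image of `t` under a reflection: `a⁻¹ b⁻¹ = a⁻¹ t a`.
    s : Carrier
    s = a ⁻¹ ∙ t ∙ a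

    t^ s^ : Bool → Carrier
    t^ f = if f then t else ε
    s^ f = if f then s else ε

    -- Every element is of the form `m a^i t^f`; a reflection must invert `M` and `a` and take `t`
    -- to `s`.
    _↦_ : Carrier → Carrier → Set
    g ↦ h = ∃ λ m → InM m × ∃ λ i → ∃ λ f → g ≈ m ∙ a ^ i ∙ t^ f × h ≈ m ⁻¹ ∙ (a ^ i) ⁻¹ ∙ s^ f

    step-a : ∀ {g h} → g ↦ h → (g ∙ a) ↦ (h ∙ a ⁻¹)
    step-a {g} {h} (m , m∈ , i , false , g≈ , h≈) = m , m∈ , suc i , false ,
      (begin
        g ∙ a                      ≈⟨ ∙-congʳ g≈ ⟩
        m ∙ a ^ i ∙ ε ∙ a          ≈⟨ solve (m ∷ a ^ i ∷ a ∷ []) (v0 ⊙ v1 ⊙ 𝕖 ⊙ v2) (v0 ⊙ (v1 ⊙ v2) ⊙ 𝕖) ≡.refl ⟩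
        m ∙ (a ^ i ∙ a) ∙ ε        ≈⟨ ∙-congʳ (∙-congˡ (^-suc′ a i)) ⟨
        m ∙ a ^ suc i ∙ ε          ∎) ,
      (begin
        h ∙ a ⁻¹                        ≈⟨ ∙-congʳ h≈ ⟩
        m ⁻¹ ∙ (a ^ i) ⁻¹ ∙ ε ∙ a ⁻¹    ≈⟨ solve (m ∷ a ^ i ∷ a ∷ []) (v0 ⁻ ⊙ v1 ⁻ ⊙ 𝕖 ⊙ v2 ⁻) (v0 ⁻ ⊙ (v2 ⊙ v1) ⁻ ⊙ 𝕖) ≡.refl ⟩
        m ⁻¹ ∙ (a ^ suc i) ⁻¹ ∙ ε       ∎)
    -- Passing `a` across `t` produces `c`, as `t a = a c t`. In the word and in its mirror image
    -- this `c` is conjugated by `β` from opposite sides, which `conj-a^` reconciles.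
    step-a {g} {h} (m , m∈ , i , true , g≈ , h≈) = m ∙ conj c β , mul m∈ (gen (suc i)) , suc i , true ,
      (begin
        g ∙ a                              ≈⟨ ∙-congʳ g≈ ⟩
        m ∙ a ^ i ∙ t ∙ a                  ≈⟨ solve (m ∷ a ^ i ∷ a ∷ []) (v0 ⊙ v1 ⊙ τ ⊙ v2) (v0 ⊙ (v1 ⊙ v2) ⊙ (v2 ⁻ ⊙ τ ⊙ v2 ⊙ τ) ⊙ τ) ≡.refl ⟩
        m ∙ (a ^ i ∙ a) ∙ c ∙ t            ≈⟨ ∙-congʳ (∙-congʳ (∙-congˡ (^-suc′ a i))) ⟨
        m ∙ β ∙ c ∙ t                      ≈⟨ solve (m ∷ β ∷ c ∷ []) (v0 ⊙ v1 ⊙ v2 ⊙ τ) (v0 ⊙ (v1 ⊙ v2 ⊙ v1 ⁻) ⊙ v1 ⊙ τ) ≡.refl ⟩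
        m ∙ (β ∙ c ∙ β ⁻¹) ∙ β ∙ t         ≈⟨ ∙-congʳ (∙-congʳ (∙-congˡ (conj-a^ (suc i) c∈M))) ⟨
        m ∙ conj c β ∙ β ∙ t               ∎) ,
      (begin
        h ∙ a ⁻¹                                   ≈⟨ ∙-congʳ h≈ ⟩
        m ⁻¹ ∙ (a ^ i) ⁻¹ ∙ s ∙ a ⁻¹
          ≈⟨ solve (m ∷ a ^ i ∷ a ∷ []) (v0 ⁻ ⊙ v1 ⁻ ⊙ (v2 ⁻ ⊙ τ ⊙ v2) ⊙ v2 ⁻) (v0 ⁻ ⊙ (v2 ⊙ v1) ⁻ ⊙ (v2 ⁻ ⊙ τ ⊙ v2 ⊙ τ) ⁻ ⊙ (v2 ⁻ ⊙ τ ⊙ v2)) ≡.refl ⟩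
        m ⁻¹ ∙ β ⁻¹ ∙ c ⁻¹ ∙ s                     ≈⟨ solve (m ∷ β ∷ c ∷ s ∷ []) (v0 ⁻ ⊙ v1 ⁻ ⊙ v2 ⁻ ⊙ v3) (v0 ⁻ ⊙ (v1 ⁻ ⊙ v2 ⊙ v1) ⁻ ⊙ v1 ⁻ ⊙ v3) ≡.refl ⟩
        m ⁻¹ ∙ conj c β ⁻¹ ∙ β ⁻¹ ∙ s              ≈⟨ ∙-congʳ (∙-congʳ (⁻¹-anti-homo-∙ _ _)) ⟨
        (conj c β ∙ m) ⁻¹ ∙ β ⁻¹ ∙ s               ≈⟨ ∙-congʳ (∙-congʳ (⁻¹-cong (M-comm (gen (suc i)) m∈))) ⟩
        (m ∙ conj c β) ⁻¹ ∙ β ⁻¹ ∙ s               ∎)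
      where
      β : Carrier
      β = a ^ suc i

    step-t : ∀ {g h} → g ↦ h → (g ∙ t) ↦ (h ∙ s)
    step-t {g} {h} (m , m∈ , i , false , g≈ , h≈) = m , m∈ , i , true ,
      trans (∙-congʳ (trans g≈ (identityʳ _))) refl , trans (∙-congʳ (trans h≈ (identityʳ _))) refl
    step-t {g} {h} (m , m∈ , i , true , g≈ , h≈) = m , m∈ , i , false ,
      trans (∙-congʳ g≈) (solve (m ∷ a ^ i ∷ []) (v0 ⊙ v1 ⊙ τ ⊙ τ) (v0 ⊙ v1 ⊙ 𝕖) ≡.refl) ,
      trans (∙-congʳ h≈) (solve (m ∷ a ^ i ∷ a ∷ []) (v0 ⁻ ⊙ v1 ⁻ ⊙ (v2 ⁻ ⊙ τ ⊙ v2) ⊙ (v2 ⁻ ⊙ τ ⊙ v2)) (v0 ⁻ ⊙ v1 ⁻ ⊙ 𝕖) ≡.refl)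

    ↦-resp : ∀ {g g′ h h′} → g ↦ h → g ≈ g′ → h ≈ h′ → g′ ↦ h′
    ↦-resp (m , m∈ , i , f , g≈ , h≈) e e′ = m , m∈ , i , f , trans (sym e) g≈ , trans (sym e′) h≈

    steps-a : ∀ i {g h} → g ↦ h → (g ∙ a ^ i) ↦ (h ∙ (a ⁻¹) ^ i)
    steps-a zero    r = ↦-resp r (sym (identityʳ _)) (sym (identityʳ _))
    steps-a (suc i) r = ↦-resp (steps-a i (step-a r)) (assoc _ _ _) (assoc _ _ _)

    a⁻¹≈ : a ^ ℕ.pred p ≈ a ⁻¹
    a⁻¹≈ = sym (trans (⁻¹-cong (sym (^-1 a))) (trans (^-inverse a p a^p≈ε 1) (^-≡ a (ℕₚ.*-identityʳ (ℕ.pred p)))))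

    -- `b = a⁻¹ t = a^(p - 1) t`, so the steps for `a` and `t` suffice.
    step-b : ∀ {g h} → g ↦ h → (g ∙ b) ↦ (h ∙ b ⁻¹)
    step-b {g} {h} r = ↦-resp (step-t (steps-a (ℕ.pred p) r))
      (trans (assoc _ _ _) (∙-congˡ (trans (∙-congʳ a⁻¹≈) (sym b≈a⁻¹t))))
      (trans (assoc _ _ _) (∙-congˡ (begin
        (a ⁻¹) ^ ℕ.pred p ∙ s      ≈⟨ ∙-congʳ (trans (^-⁻¹ a (ℕ.pred p)) (⁻¹-cong a⁻¹≈)) ⟩
        (a ⁻¹) ⁻¹ ∙ s              ≈⟨ solve (a ∷ []) (v0 ⁻ ⁻ ⊙ (v0 ⁻ ⊙ τ ⊙ v0)) ((v0 ⁻ ⊙ τ) ⁻) ≡.refl ⟩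
        (a ⁻¹ ∙ t) ⁻¹              ≈⟨ ⁻¹-cong b≈a⁻¹t ⟨
        b ⁻¹                       ∎)))

    -- If m α t ≈ m′ α′ then t, hence b, lies in M A.
    t∉MA : ∀ {m m′} i i′ → InM m → InM m′ → m ∙ a ^ i ∙ t ≈ m′ ∙ a ^ i′ → ⊥
    t∉MA {m} {m′} i i′ m∈ m′∈ eq = b∉MA (M-conj-A (A-mul (i , refl) a∈A) (mul (inv m∈) m′∈))
      (A-mul (A-mul (A-inv a∈A) (A-inv (i , refl))) (i′ , refl)) (begin
      b                                          ≈⟨ b≈a⁻¹t ⟩
      a ⁻¹ ∙ t                                   ≈⟨ solve (m ∷ a ^ i ∷ a ∷ []) (v2 ⁻ ⊙ τ) ((v2 ⁻ ⊙ v1 ⁻ ⊙ v0 ⁻) ⊙ (v0 ⊙ v1 ⊙ τ)) ≡.refl ⟩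
      (a ⁻¹ ∙ (a ^ i) ⁻¹ ∙ m ⁻¹) ∙ (m ∙ a ^ i ∙ t) ≈⟨ ∙-congˡ eq ⟩
      (a ⁻¹ ∙ (a ^ i) ⁻¹ ∙ m ⁻¹) ∙ (m′ ∙ a ^ i′) ≈⟨ shuffle a (a ^ i) m m′ (a ^ i′) ⟩
      conj (m ⁻¹ ∙ m′) (a ^ i ∙ a) ∙ (a ⁻¹ ∙ (a ^ i) ⁻¹ ∙ a ^ i′) ∎)
      where
      pattern v4 = var 4F
      shuffle : ∀ x y m m′ z → (x ⁻¹ ∙ y ⁻¹ ∙ m ⁻¹) ∙ (m′ ∙ z) ≈ conj (m ⁻¹ ∙ m′) (y ∙ x) ∙ (x ⁻¹ ∙ y ⁻¹ ∙ z)
      shuffle x y m m′ z = solve (x ∷ y ∷ m ∷ m′ ∷ z ∷ []) ((v0 ⁻ ⊙ v1 ⁻ ⊙ v2 ⁻) ⊙ (v3 ⊙ v4))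
        (((v1 ⊙ v0) ⁻ ⊙ (v2 ⁻ ⊙ v3) ⊙ (v1 ⊙ v0)) ⊙ (v0 ⁻ ⊙ v1 ⁻ ⊙ v4)) ≡.refl

    functional : ∀ {g g′ h h′} → g ↦ h → g′ ↦ h′ → g ≈ g′ → h ≈ h′
    functional (m , m∈ , i , false , g≈ , h≈) (m′ , m′∈ , i′ , false , g′≈ , h′≈) e =
      trans h≈ (trans (∙-congʳ (unique i i′ m∈ m′∈ (trans (sym (identityʳ _)) (trans (sym g≈) (trans e (trans g′≈ (identityʳ _))))))) (sym h′≈))
    functional (m , m∈ , i , true , g≈ , h≈) (m′ , m′∈ , i′ , true , g′≈ , h′≈) e =
      trans h≈ (trans (∙-congʳ (unique i i′ m∈ m′∈ (∙-cancelʳ t _ _ (trans (sym g≈) (trans e g′≈))))) (sym h′≈))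
    functional (m , m∈ , i , true , g≈ , h≈) (m′ , m′∈ , i′ , false , g′≈ , h′≈) e =
      ⊥-elim (t∉MA i i′ m∈ m′∈ (trans (sym g≈) (trans e (trans g′≈ (identityʳ _)))))
    functional (m , m∈ , i , false , g≈ , h≈) (m′ , m′∈ , i′ , true , g′≈ , h′≈) e =
      ⊥-elim (t∉MA i′ i m′∈ m∈ (trans (sym g′≈) (trans (sym e) (trans g≈ (identityʳ _)))))

    ε↦ε : ε ↦ ε
    ε↦ε = ε , one , 0 , false , solve [] 𝕖 (𝕖 ⊙ 𝕖 ⊙ 𝕖) ≡.refl , solve [] 𝕖 (𝕖 ⁻ ⊙ 𝕖 ⁻ ⊙ 𝕖) ≡.refl

    reflexible : Reflexible T
    reflexible = Mirror.respects T _↦_ ε↦ε step-a step-b functional ↦-resp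

-- `b` in `M⟨a⟩`: the ring is `M` itself.

module OddType where
  open import Algebra.Bundles using (AbelianGroup; CommutativeRing)
  open import Data.Nat.Base as ℕ using (ℕ; zero; suc; NonZero)
  import Data.Nat.Properties as ℕₚ
  open import Data.Nat.Divisibility using (_∣_; divides; ∣⇒≤; *-cancelˡ-∣; n∣m*n; ∣1⇒≡1; ∣m+n∣m⇒∣n; ∣m⇒∣m*n)
  open import Data.Nat.Coprimality using (Coprime; coprime-divisor)
  open import Data.Nat.Primality using (Prime)
  open import Data.Fin.Patterns
  open import Data.Vec.Base using ([]; _∷_)
  open import Data.Product using (∃; _×_; _,_; proj₁; proj₂)
  open import Data.Sum using (_⊎_; inj₁; inj₂)
  open import Data.Empty using (⊥-elim)
  open import Relation.Nullary using (¬_)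
  open import Relation.Binary.PropositionalEquality as ≡ using (_≡_)
  open GroupWords
  open TightGroups
  open PolynomialAction
  open CommutatorSubgroup
  open GeometricSums
  open Reflections

  -- The premise is a factorisation of `b` along `M⟨a⟩`. That `q` is odd is a conclusion, applied in
  -- contrapositive form when `q` is even.
  module Odd {p q} {{p≢0 : NonZero p}} {{q≢0 : NonZero q}} (T : TightGroup p q)
    (n α₀ : TightGroup.Carrier T) (n∈M : Commutators.InM T n) (α₀∈A : Commutators.InA T α₀)
    (b≈nα₀ : TightGroup._≈_ T (TightGroup.b T) (TightGroup._∙_ T n α₀)) where
    open Commutators T
    open import Relation.Binary.Reasoning.Setoid setoid

    private
      pattern v0 = var 0F
      pattern v1 = var 1F
      pattern v2 = var 2F
      pattern v3 = var 3F

    A-resp : ∀ {g h} → g ≈ h → InA g → InA h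
    A-resp e (i , g≈) = i , trans (sym e) g≈

    A-pow : ∀ k {g} → InA g → InA (g ^ k)
    A-pow zero    _  = 0 , refl
    A-pow (suc k) g∈ = A-mul g∈ (A-pow k g∈)

    open Quotient (_≈ ε) (λ e g≈ε → trans (sym e) g≈ε) refl
      (λ g≈ h≈ → trans (∙-cong g≈ h≈) (identityˡ ε)) (λ g≈ → trans (⁻¹-cong g≈) ε⁻¹≈ε)
    module 𝓜 = AbelianGroup M/K

    lift : ∀ {x y} → proj₁ x ≈ proj₁ y → x 𝓜.≈ y
    lift {x , _} {y , _} x≈y = trans (∙-congʳ x≈y) (inverseʳ y)

    lower : ∀ {x y} → x 𝓜.≈ y → proj₁ x ≈ proj₁ y
    lower {x , _} {y , _} e = x∙y⁻¹≈ε⇒x≈y x y e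

    X : 𝓜.Carrier → 𝓜.Carrier
    X (g , g∈) = b ∙ g ∙ b ⁻¹ , M-conj-b g∈

    X-cong : ∀ {x y} → x 𝓜.≈ y → X x 𝓜.≈ X y
    X-cong {x} {y} e = lift {X x} {X y} (∙-congʳ (∙-congˡ (lower {x} {y} e)))

    X-homo : ∀ x y → X (x 𝓜.∙ y) 𝓜.≈ X x 𝓜.∙ X y
    X-homo (x , x∈) (y , y∈) = lift {X ((x , x∈) 𝓜.∙ (y , y∈))} {X (x , x∈) 𝓜.∙ X (y , y∈)}
      (solve (x ∷ y ∷ b ∷ []) (v2 ⊙ (v0 ⊙ v1) ⊙ v2 ⁻) ((v2 ⊙ v0 ⊙ v2 ⁻) ⊙ (v2 ⊙ v1 ⊙ v2 ⁻)) ≡.refl)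

    n̂ : 𝓜.Carrier
    n̂ = n , n∈M

    module P = CyclicModule M/K X (λ {x} {y} → X-cong {x} {y}) X-homo n̂
    open P using (Poly; 𝕏; 𝟙; 𝟘; ⊝_; ⟦_⟧; ring; _⊛_; _⊕_)
    module R = CommutativeRing ring
    open Sums ring using (geo; nat; module Transitive; module Spanned; ×-homo-+; ×1-homo-*; geo-cong) renaming (_^_ to _^ᵣ_)

    at : Poly → Carrier
    at f = proj₁ (⟦ f ⟧ n̂)

    at∈M : ∀ f → InM (at f)
    at∈M f = proj₂ (⟦ f ⟧ n̂)

    -- The component `n` acts trivially, because `M` is abelian.
    conj-b : ∀ {m} → InM m → b ∙ m ∙ b ⁻¹ ≈ α₀ ∙ m ∙ α₀ ⁻¹
    conj-b {m} m∈ = begin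
      b ∙ m ∙ b ⁻¹                      ≈⟨ ∙-cong (∙-congʳ b≈nα₀) (⁻¹-cong b≈nα₀) ⟩
      (n ∙ α₀) ∙ m ∙ (n ∙ α₀) ⁻¹        ≈⟨ solve (n ∷ α₀ ∷ m ∷ []) ((v0 ⊙ v1) ⊙ v2 ⊙ (v0 ⊙ v1) ⁻) (v0 ⁻ ⁻ ⊙ (v1 ⁻ ⁻ ⊙ v2 ⊙ v1 ⁻) ⊙ v0 ⁻) ≡.refl ⟩
      conj (conj m (α₀ ⁻¹)) (n ⁻¹)      ≈⟨ conj-M (M-conj-A (A-inv α₀∈A) m∈) (inv n∈M) ⟩
      conj m (α₀ ⁻¹)                    ≈⟨ ∙-congʳ (∙-congʳ (⁻¹-involutive α₀)) ⟩
      α₀ ∙ m ∙ α₀ ⁻¹                    ∎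

    sum : ℕ → Carrier
    sum j = at (geo 𝕏 j)

    b^≈ : ∀ j → b ^ j ≈ sum j ∙ α₀ ^ j
    b^≈ zero    = sym (identityˡ ε)
    b^≈ (suc j) = begin
      b ∙ b ^ j                                       ≈⟨ ∙-cong b≈nα₀ (b^≈ j) ⟩
      (n ∙ α₀) ∙ (sum j ∙ α₀ ^ j)                     ≈⟨ solve (n ∷ α₀ ∷ sum j ∷ α₀ ^ j ∷ []) ((v0 ⊙ v1) ⊙ (v2 ⊙ v3)) ((v0 ⊙ (v1 ⊙ v2 ⊙ v1 ⁻)) ⊙ (v1 ⊙ v3)) ≡.refl ⟩
      (n ∙ (α₀ ∙ sum j ∙ α₀ ⁻¹)) ∙ (α₀ ∙ α₀ ^ j)      ≈⟨ ∙-congʳ (∙-congˡ (conj-b (at∈M (geo 𝕏 j)))) ⟨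
      (n ∙ (b ∙ sum j ∙ b ⁻¹)) ∙ (α₀ ∙ α₀ ^ j)        ∎

    -- M is generated by the conjugates of c, and X c = (1 + X) n, so M = (1 + X) ℤ[X] n.
    Multiple : Carrier → Set
    Multiple m = ∃ λ f → m ≈ at ((𝟙 ⊕ 𝕏) ⊛ f)

    multiple-X : ∀ {m} → Multiple m → Multiple (b ∙ m ∙ b ⁻¹)
    multiple-X (f , m≈) = 𝕏 ⊛ f , trans (∙-congʳ (∙-congˡ m≈)) (lower {⟦ 𝕏 ⊛ ((𝟙 ⊕ 𝕏) ⊛ f) ⟧ n̂} {⟦ (𝟙 ⊕ 𝕏) ⊛ (𝕏 ⊛ f) ⟧ n̂}
      (P.⟦⟧-comm 𝕏 (𝟙 ⊕ 𝕏) (⟦ f ⟧ n̂)))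

    multiple-mul : ∀ {m m′} → Multiple m → Multiple m′ → Multiple (m ∙ m′)
    multiple-mul (f , m≈) (g , m′≈) = f ⊕ g , trans (∙-cong m≈ m′≈)
      (sym (lower {⟦ (𝟙 ⊕ 𝕏) ⊛ (f ⊕ g) ⟧ n̂} {⟦ (𝟙 ⊕ 𝕏) ⊛ f ⟧ n̂ 𝓜.∙ ⟦ (𝟙 ⊕ 𝕏) ⊛ g ⟧ n̂} (P.⟦⟧-homo (𝟙 ⊕ 𝕏) (⟦ f ⟧ n̂) (⟦ g ⟧ n̂))))

    multiple-inv : ∀ {m} → Multiple m → Multiple (m ⁻¹)
    multiple-inv (f , m≈) = ⊝ f , trans (⁻¹-cong m≈)
      (sym (lower {⟦ (𝟙 ⊕ 𝕏) ⊛ (⊝ f) ⟧ n̂} {⟦ (𝟙 ⊕ 𝕏) ⊛ f ⟧ n̂ 𝓜.⁻¹} (P.⟦⟧-⁻¹ (𝟙 ⊕ 𝕏) (⟦ f ⟧ n̂))))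

    multiple-resp : ∀ {m m′} → m ≈ m′ → Multiple m → Multiple m′
    multiple-resp e (f , m≈) = f , trans (sym e) m≈

    multiple-b^ : ∀ k {m} → Multiple m → Multiple (b ^ k ∙ m ∙ (b ^ k) ⁻¹)
    multiple-b^ zero    {m} w = multiple-resp (solve (m ∷ []) v0 (𝕖 ⊙ v0 ⊙ 𝕖 ⁻) ≡.refl) w
    multiple-b^ (suc k) {m} w = multiple-resp (solve (b ∷ b ^ k ∷ m ∷ []) (v0 ⊙ (v1 ⊙ v2 ⊙ v1 ⁻) ⊙ v0 ⁻) ((v0 ⊙ v1) ⊙ v2 ⊙ (v0 ⊙ v1) ⁻) ≡.refl)
      (multiple-X (multiple-b^ k w))

    -- On `M`, `b` acts as `α₀`, which commutes with `a`; expanding `[ a , n ∙ α₀ ]` then leaves `n`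
    -- and its image under `b`. So this image of the generator `c` is `(1 + 𝕏) n`.
    Xc : b ∙ c ∙ b ⁻¹ ≈ n ∙ (b ∙ n ∙ b ⁻¹)
    Xc = begin
      b ∙ c ∙ b ⁻¹                             ≈⟨ conj-b c∈M ⟩
      α₀ ∙ c ∙ α₀ ⁻¹                           ≈⟨ ∙-congʳ (∙-congˡ (trans c≈[a,b] ([,]-cong refl b≈nα₀))) ⟩
      α₀ ∙ [ a , n ∙ α₀ ] ∙ α₀ ⁻¹
        ≈⟨ solve (α₀ ∷ a ∷ n ∷ []) (v0 ⊙ (v1 ⁻ ⊙ (v2 ⊙ v0) ⁻ ⊙ v1 ⊙ (v2 ⊙ v0)) ⊙ v0 ⁻) ((v0 ⊙ v1 ⁻ ⊙ v0 ⁻) ⊙ v2 ⁻ ⊙ v1 ⊙ v2) ≡.refl ⟩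
      (α₀ ∙ a ⁻¹ ∙ α₀ ⁻¹) ∙ n ⁻¹ ∙ a ∙ n       ≈⟨ ∙-congʳ (∙-congʳ (∙-congʳ (∙-congʳ (A-comm α₀∈A (A-inv a∈A))))) ⟩
      (a ⁻¹ ∙ α₀ ∙ α₀ ⁻¹) ∙ n ⁻¹ ∙ a ∙ n       ≈⟨ solve (α₀ ∷ a ∷ n ∷ []) ((v1 ⁻ ⊙ v0 ⊙ v0 ⁻) ⊙ v2 ⁻ ⊙ v1 ⊙ v2) ((v1 ⁻ ⊙ v2 ⊙ v1) ⁻ ⊙ v2) ≡.refl ⟩
      conj n a ⁻¹ ∙ n                          ≈⟨ ∙-congʳ (b-conj n∈M) ⟨
      (b ∙ n ∙ b ⁻¹) ∙ n                       ≈⟨ M-comm (M-conj-b n∈M) n∈M ⟩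
      n ∙ (b ∙ n ∙ b ⁻¹)                       ∎

    -- `Xc` settles the image of `c` under `b`; `q - 1` further conjugations by `b` lead back to
    -- `c`.
    multiple-c : Multiple c
    multiple-c = multiple-resp (begin
      b ^ k ∙ (b ∙ c ∙ b ⁻¹) ∙ (b ^ k) ⁻¹    ≈⟨ solve (b ∷ b ^ k ∷ c ∷ []) (v1 ⊙ (v0 ⊙ v2 ⊙ v0 ⁻) ⊙ v1 ⁻) ((v1 ⊙ v0) ⊙ v2 ⊙ (v1 ⊙ v0) ⁻) ≡.refl ⟩
      (b ^ k ∙ b) ∙ c ∙ (b ^ k ∙ b) ⁻¹       ≈⟨ ∙-cong (∙-congʳ b^q) (⁻¹-cong b^q) ⟩
      ε ∙ c ∙ ε ⁻¹                           ≈⟨ solve (c ∷ []) (𝕖 ⊙ v0 ⊙ 𝕖 ⁻) v0 ≡.refl ⟩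
      c                                      ∎)
      (multiple-b^ k (𝟙 , Xc))
      where
      k : ℕ
      k = ℕ.pred q
      b^q : b ^ k ∙ b ≈ ε
      b^q = trans (sym (^-suc′ b k)) (trans (^-≡ b (ℕₚ.suc-pred q)) b^q≈ε)

    multiple-conj-a : ∀ {m} → InM m → Multiple m → Multiple (conj m a)
    multiple-conj-a m∈ w = multiple-resp (trans (⁻¹-cong (b-conj m∈)) (⁻¹-involutive _)) (multiple-inv (multiple-X w))

    multiple : ∀ {m} → InM m → Multiple m
    multiple (gen i)      = powers i
      where
      powers : ∀ i → Multiple (conj c (a ^ i))
      powers zero    = multiple-resp (solve (c ∷ []) v0 (𝕖 ⁻ ⊙ v0 ⊙ 𝕖) ≡.refl) multiple-c
      powers (suc i) = multiple-resp (trans (conj-conj c (a ^ i) a) (conj-cong refl (sym (^-suc′ a i)))) (multiple-conj-a (gen i) (powers i))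
    multiple one          = 𝟘 , solve (b ∷ []) 𝕖 (𝕖 ⊙ (v0 ⊙ 𝕖 ⊙ v0 ⁻)) ≡.refl
    multiple (mul g∈ h∈)  = multiple-mul (multiple g∈) (multiple h∈)
    multiple (inv g∈)     = multiple-inv (multiple g∈)
    multiple (resp g≈ g∈) = multiple-resp g≈ (multiple g∈)

    -- `n` itself lies in `M`, hence equals `(1 + 𝕏) f n` for some `f`, and equality at `n` is
    -- equality in the ring.
    1+𝕏-unit : ∃ λ f → (𝟙 ⊕ 𝕏) ⊛ f R.≈ 𝟙
    1+𝕏-unit = let f , n≈ = multiple n∈M in f , lift {⟦ (𝟙 ⊕ 𝕏) ⊛ f ⟧ n̂} {n̂} (sym n≈)

    -- An element `u` of both is fixed by `a`, hence inverted by `b`, so `1 + 𝕏` annihilates it; but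
    -- `1 + 𝕏` is a unit.
    M∩A : ∀ {u} → InM u → InA u → u ≈ ε
    M∩A {u} u∈M u∈A = trans u≈ (trans (lower {⟦ g ⟧ n̂} {⟦ 𝟘 ⟧ n̂} g≈0) refl)
      where
      f g : Poly
      f = proj₁ 1+𝕏-unit
      g = (𝟙 ⊕ 𝕏) ⊛ proj₁ (multiple u∈M)
      u≈ : u ≈ at g
      u≈ = proj₂ (multiple u∈M)
      annihilated : (𝟙 ⊕ 𝕏) ⊛ g R.≈ 𝟘
      annihilated = lift {⟦ (𝟙 ⊕ 𝕏) ⊛ g ⟧ n̂} {⟦ 𝟘 ⟧ n̂} (begin
        at g ∙ (b ∙ at g ∙ b ⁻¹)   ≈⟨ ∙-cong u≈ (∙-congʳ (∙-congˡ u≈)) ⟨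
        u ∙ (b ∙ u ∙ b ⁻¹)         ≈⟨ ∙-congˡ (trans (b-conj u∈M) (⁻¹-cong (commute⇒conj (A-comm u∈A a∈A)))) ⟩
        u ∙ u ⁻¹                   ≈⟨ inverseʳ u ⟩
        ε                          ∎)
      g≈0 : g R.≈ 𝟘
      g≈0 = R.trans {g} {𝟙 ⊛ g} {𝟘} (R.refl {g})
        (R.trans {𝟙 ⊛ g} {((𝟙 ⊕ 𝕏) ⊛ f) ⊛ g} {𝟘} (R.*-cong {𝟙} {(𝟙 ⊕ 𝕏) ⊛ f} {g} {g} (R.sym {(𝟙 ⊕ 𝕏) ⊛ f} {𝟙} (proj₂ 1+𝕏-unit)) (R.refl {g}))
        (R.trans {((𝟙 ⊕ 𝕏) ⊛ f) ⊛ g} {f ⊛ ((𝟙 ⊕ 𝕏) ⊛ g)} {𝟘} (R.*-cong {(𝟙 ⊕ 𝕏) ⊛ f} {f ⊛ (𝟙 ⊕ 𝕏)} {g} {g} (R.*-comm (𝟙 ⊕ 𝕏) f) (R.refl {g}))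
        (R.trans {f ⊛ ((𝟙 ⊕ 𝕏) ⊛ g)} {f ⊛ 𝟘} {𝟘} (R.*-cong {f} {f} {(𝟙 ⊕ 𝕏) ⊛ g} {𝟘} (R.refl {f}) annihilated) (R.zeroʳ f))))

    span-M : ∀ {m} → InM m → ∃ λ j → m ≈ sum j
    span-M {m} m∈ = let β , α , (j , β≈) , α∈ , m≈ = factor-BA m in j , x∙y⁻¹≈ε⇒x≈y m (sum j)
      (trans (M-comm m∈ (inv (at∈M (geo 𝕏 j)))) (M∩A (mul (inv (at∈M (geo 𝕏 j))) m∈) (A-resp (begin
        α₀ ^ j ∙ α                           ≈⟨ cancel (sum j) (α₀ ^ j) α ⟩
        sum j ⁻¹ ∙ ((sum j ∙ α₀ ^ j) ∙ α)    ≈⟨ ∙-congˡ (∙-congʳ (b^≈ j)) ⟨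
        sum j ⁻¹ ∙ (b ^ j ∙ α)               ≈⟨ ∙-congˡ (trans m≈ (∙-congʳ β≈)) ⟨
        sum j ⁻¹ ∙ m                         ∎) (A-mul (A-pow j α₀∈A) α∈))))
      where
      cancel : ∀ x y z → y ∙ z ≈ x ⁻¹ ∙ ((x ∙ y) ∙ z)
      cancel x y z = solve (x ∷ y ∷ z ∷ []) (v1 ⊙ v2) (v0 ⁻ ⊙ ((v0 ⊙ v1) ⊙ v2)) ≡.refl

    span : ∀ f → ∃ λ j → f R.≈ geo 𝕏 j
    span f = let j , e = span-M (at∈M f) in j , lift {⟦ f ⟧ n̂} {⟦ geo 𝕏 j ⟧ n̂} e

    faithful : ∀ j → geo 𝕏 j R.≈ 𝟘 → q ∣ j
    faithful j e = b-order j (trans b≈a (A∩B (proj₁ b∈A) j (sym b≈a)))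
      where
      b∈A : InA (b ^ j)
      b∈A = A-resp (sym (trans (b^≈ j) (trans (∙-congʳ (lower {⟦ geo 𝕏 j ⟧ n̂} {⟦ 𝟘 ⟧ n̂} e)) (identityˡ _)))) (A-pow j α₀∈A)
      b≈a : b ^ j ≈ a ^ proj₁ b∈A
      b≈a = proj₂ b∈A

    sum-q : sum q ≈ ε
    sum-q = M∩A (at∈M (geo 𝕏 q)) (A-resp (begin
      (α₀ ^ q) ⁻¹                          ≈⟨ identityˡ _ ⟨
      ε ∙ (α₀ ^ q) ⁻¹                      ≈⟨ ∙-congʳ (trans (sym b^q≈ε) (b^≈ q)) ⟩
      (sum q ∙ α₀ ^ q) ∙ (α₀ ^ q) ⁻¹       ≈⟨ solve (sum q ∷ α₀ ^ q ∷ []) ((v0 ⊙ v1) ⊙ v1 ⁻) v0 ≡.refl ⟩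
      sum q                                ∎) (A-inv (A-pow q α₀∈A)))

    period : geo 𝕏 q R.≈ 𝟘
    period = lift {⟦ geo 𝕏 q ⟧ n̂} {⟦ 𝟘 ⟧ n̂} sum-q

    module S = Spanned q 𝕏 span period

    half : ∃ λ h → (R.1# R.+ R.1#) R.* h R.≈ R.1#
    half = S.2-unit (proj₁ 1+𝕏-unit) (proj₂ 1+𝕏-unit)

    -- 2 is a unit because `1 + 𝕏` is. If `q = 2k`, the vanishing of the sum of length `q` would
    -- descend to length `k`, against `faithful`.
    q-odd : ∀ k → ¬ q ≡ 2 ℕ.* k
    q-odd k q≡2k = contra k q≡2k (faithful k (S.halve (proj₁ half) (proj₂ half) k
      (R.trans {geo 𝕏 (k ℕ.+ k)} {geo 𝕏 q} {𝟘} (R.reflexive (≡.cong (geo 𝕏) (≡.trans (≡.cong (k ℕ.+_) (≡.sym (ℕₚ.+-identityʳ k))) (≡.sym q≡2k)))) period)))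
      where
      contra : ∀ k → q ≡ 2 ℕ.* k → ¬ q ∣ k
      contra zero    e _   = ℕ.≢-nonZero⁻¹ q e
      contra (suc k) e q∣k = ℕₚ.<⇒≱ (ℕₚ.m<m+n (suc k) {suc k ℕ.+ 0} (ℕ.s≤s ℕ.z≤n)) (ℕₚ.≤-trans (ℕₚ.≤-reflexive (≡.sym e)) (∣⇒≤ q∣k))

    2-torsion-free : ∀ {m} → InM m → m ∙ m ≈ ε → m ≈ ε
    2-torsion-free {m} m∈ mm≈ε = trans m≈ (lower {⟦ g ⟧ n̂} {⟦ 𝟘 ⟧ n̂} g≈0)
      where
      h g two : Poly
      h = proj₁ half
      two = R.1# R.+ R.1#
      g = (𝟙 ⊕ 𝕏) ⊛ proj₁ (multiple m∈)
      m≈ : m ≈ at g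
      m≈ = proj₂ (multiple m∈)
      2g≈0 : two ⊛ g R.≈ 𝟘
      2g≈0 = lift {⟦ two ⊛ g ⟧ n̂} {⟦ 𝟘 ⟧ n̂} (trans (∙-cong (sym m≈) (sym m≈)) mm≈ε)
      g≈0 : g R.≈ 𝟘
      g≈0 = R.trans {g} {(two ⊛ h) ⊛ g} {𝟘} (R.*-cong {𝟙} {two ⊛ h} {g} {g} (R.sym {two ⊛ h} {𝟙} (proj₂ half)) (R.refl {g}))
        (R.trans {(two ⊛ h) ⊛ g} {h ⊛ (two ⊛ g)} {𝟘} (R.*-cong {two ⊛ h} {h ⊛ two} {g} {g} (R.*-comm two h) (R.refl {g}))
        (R.trans {h ⊛ (two ⊛ g)} {h ⊛ 𝟘} {𝟘} (R.*-cong {h} {h} {two ⊛ g} {𝟘} (R.refl {h}) 2g≈0) (R.zeroʳ h)))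

    q≡1+2k : ∃ λ k → q ≡ suc (2 ℕ.* k)
    q≡1+2k = cases (parity q)
      where
      cases : (∃ λ k → q ≡ 2 ℕ.* k ⊎ q ≡ suc (2 ℕ.* k)) → ∃ λ k → q ≡ suc (2 ℕ.* k)
      cases (k , inj₁ e) = ⊥-elim (q-odd k e)
      cases (k , inj₂ e) = k , e

    -- Since q is odd, 𝕏 has a square root.
    √𝕏 : Poly
    √𝕏 = 𝕏 ^ᵣ suc (proj₁ q≡1+2k)

    -- The exponents add up to `q + 1`, and `𝕏^q = 1`.
    √𝕏² : √𝕏 ⊛ √𝕏 R.≈ 𝕏
    √𝕏² = R.trans {√𝕏 ⊛ √𝕏} {𝕏 ^ᵣ (suc k ℕ.+ suc k)} {𝕏} (R.sym {𝕏 ^ᵣ (suc k ℕ.+ suc k)} {√𝕏 ⊛ √𝕏} (Sums.^-homo-* ring 𝕏 (suc k) (suc k)))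
      (R.trans {𝕏 ^ᵣ (suc k ℕ.+ suc k)} {𝕏 ⊛ 𝕏 ^ᵣ q} {𝕏} (R.reflexive (≡.cong (𝕏 ^ᵣ_) exponent))
      (R.trans {𝕏 ⊛ 𝕏 ^ᵣ q} {𝕏 ⊛ 𝟙} {𝕏} (R.*-cong {𝕏} {𝕏} {𝕏 ^ᵣ q} {𝟙} (R.refl {𝕏}) S.y^N≈1) (R.*-identityʳ 𝕏)))
      where
      k : ℕ
      k = proj₁ q≡1+2k
      exponent : suc k ℕ.+ suc k ≡ suc q
      exponent = ≡.cong suc (≡.trans (ℕₚ.+-suc k k) (≡.trans (≡.cong (λ i → suc (k ℕ.+ i)) (≡.sym (ℕₚ.+-identityʳ k))) (≡.sym (proj₂ q≡1+2k))))

    geo-√ : ∀ j → geo 𝕏 j R.≈ geo (√𝕏 ⊛ √𝕏) j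
    geo-√ j = geo-cong {𝕏} {√𝕏 ⊛ √𝕏} (R.sym {√𝕏 ⊛ √𝕏} {𝕏} √𝕏²) j

    module Tr = Transitive q √𝕏
      (λ f → proj₁ (span f) , R.trans {f} {geo 𝕏 (proj₁ (span f))} {geo (√𝕏 ⊛ √𝕏) (proj₁ (span f))} (proj₂ (span f)) (geo-√ (proj₁ (span f))))
      (R.trans {geo (√𝕏 ⊛ √𝕏) q} {geo 𝕏 q} {𝟘} (R.sym {geo 𝕏 q} {geo (√𝕏 ⊛ √𝕏) q} (geo-√ q)) period)
      (λ j e → faithful j (R.trans {geo 𝕏 j} {geo (√𝕏 ⊛ √𝕏) j} {𝟘} (geo-√ j) e))

    r : ℕ
    r = q ℕ.+ proj₁ (Tr.natural √𝕏)

    √𝕏≈r : √𝕏 R.≈ nat r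
    √𝕏≈r = R.trans {√𝕏} {nat s} {nat r} (proj₂ (Tr.natural √𝕏))
      (R.sym {nat r} {nat s} (R.trans {nat r} {nat q R.+ nat s} {nat s} (×-homo-+ R.1# q s)
        (R.trans {nat q R.+ nat s} {R.0# R.+ nat s} {nat s} (R.+-cong {nat q} {R.0#} {nat s} {nat s} Tr.nat-N≈0 (R.refl {nat s})) (R.+-identityˡ (nat s)))))
      where
      s : ℕ
      s = proj₁ (Tr.natural √𝕏)

    D : ℕ
    D = ℕ.pred (r ℕ.* r)

    instance
      r≢0 : NonZero r
      r≢0 = ℕ.>-nonZero (ℕₚ.≤-trans (ℕ.>-nonZero⁻¹ q) (ℕₚ.m≤m+n q _))

    r*r≡1+D : r ℕ.* r ≡ suc D
    r*r≡1+D = ≡.sym (ℕₚ.suc-pred (r ℕ.* r) {{ℕₚ.m*n≢0 r r}})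

    prime∣D : ∀ {l} → Prime l → l ∣ q → l ∣ D
    prime∣D = Tr.prime-divides r D √𝕏≈r r*r≡1+D

    𝕏≈1+D : 𝕏 R.≈ nat (suc D)
    𝕏≈1+D = R.trans {𝕏} {√𝕏 ⊛ √𝕏} {nat (suc D)} (R.sym {√𝕏 ⊛ √𝕏} {𝕏} √𝕏²)
      (R.trans {√𝕏 ⊛ √𝕏} {nat r ⊛ nat r} {nat (suc D)} (R.*-cong {√𝕏} {nat r} {√𝕏} {nat r} √𝕏≈r √𝕏≈r)
      (R.trans {nat r ⊛ nat r} {nat (r ℕ.* r)} {nat (suc D)} (R.sym {nat (r ℕ.* r)} {nat r ⊛ nat r} (×1-homo-* r r)) (R.reflexive (≡.cong nat r*r≡1+D))))

    -- The components of the involution `t` in `⟨a⟩` and in `M`.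
    α₁ m₁ : Carrier
    α₁ = a ∙ α₀
    m₁ = a ∙ n ∙ a ⁻¹

    α₁∈A : InA α₁
    α₁∈A = A-mul a∈A α₀∈A

    m₁∈M : InM m₁
    m₁∈M = resp (∙-congʳ (∙-congʳ (⁻¹-involutive a))) (M-conj-A (A-inv a∈A) n∈M)

    t≈m₁α₁ : t ≈ m₁ ∙ α₁
    t≈m₁α₁ = trans (∙-congˡ b≈nα₀) (solve (a ∷ n ∷ α₀ ∷ []) (v0 ⊙ (v1 ⊙ v2)) ((v0 ⊙ v1 ⊙ v0 ⁻) ⊙ (v0 ⊙ v2)) ≡.refl)

    -- `t² = 1` forces `α₁²` into `M ∩ ⟨a⟩`, which is trivial.
    α₁²≈ε : α₁ ∙ α₁ ≈ ε
    α₁²≈ε = M∩A (resp α₁²≈ (mul (inv (M-conj-A (A-inv α₁∈A) m₁∈M)) (inv m₁∈M))) (A-mul α₁∈A α₁∈A)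
      where
      α₁²≈ : conj m₁ (α₁ ⁻¹) ⁻¹ ∙ m₁ ⁻¹ ≈ α₁ ∙ α₁
      α₁²≈ = begin
        conj m₁ (α₁ ⁻¹) ⁻¹ ∙ m₁ ⁻¹                ≈⟨ solve (m₁ ∷ α₁ ∷ []) ((v1 ⁻ ⁻ ⊙ v0 ⊙ v1 ⁻) ⁻ ⊙ v0 ⁻) ((v1 ⊙ v1) ⊙ ((v0 ⊙ v1) ⊙ (v0 ⊙ v1)) ⁻) ≡.refl ⟩
        (α₁ ∙ α₁) ∙ ((m₁ ∙ α₁) ∙ (m₁ ∙ α₁)) ⁻¹    ≈⟨ ∙-congˡ (⁻¹-cong (trans (sym (∙-cong t≈m₁α₁ t≈m₁α₁)) involution)) ⟩
        (α₁ ∙ α₁) ∙ ε ⁻¹                          ≈⟨ trans (∙-congˡ ε⁻¹≈ε) (identityʳ _) ⟩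
        α₁ ∙ α₁                                   ∎

    t≉ε : 2 ℕ.≤ p → ¬ t ≈ ε
    t≉ε 2≤p t≈ε = ℕₚ.<⇒≱ 2≤p (∣⇒≤ (a-order 1 (A∩B 1 (ℕ.pred q) (begin
      a ^ 1                ≈⟨ ^-1 a ⟩
      a                    ≈⟨ inverseˡ-unique a b t≈ε ⟩
      b ⁻¹                 ≈⟨ ⁻¹-cong (^-1 b) ⟨
      (b ^ 1) ⁻¹           ≈⟨ ^-inverse b q b^q≈ε 1 ⟩
      b ^ (ℕ.pred q ℕ.* 1) ≈⟨ ^-≡ b (ℕₚ.*-identityʳ (ℕ.pred q)) ⟩
      b ^ ℕ.pred q         ∎))))

    -- Otherwise `t` would lie in `M`, which has no 2-torsion. Thus `α₁` is an element of order two
    -- in the cyclic group `⟨a⟩`, and `p` is even.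
    α₁≉ε : 2 ℕ.≤ p → ¬ α₁ ≈ ε
    α₁≉ε 2≤p α₁≈ε = t≉ε 2≤p (2-torsion-free (resp (sym t≈m₁) m₁∈M) involution)
      where
      t≈m₁ : t ≈ m₁
      t≈m₁ = trans t≈m₁α₁ (trans (∙-congˡ α₁≈ε) (identityʳ m₁))

    private
      k₁ : ℕ
      k₁ = proj₁ α₁∈A
      α₁≈ : α₁ ≈ a ^ k₁
      α₁≈ = proj₂ α₁∈A

    p∣2k₁ : p ∣ 2 ℕ.* k₁
    p∣2k₁ = a-order _ (trans (sym (^-* a 2 k₁)) (trans (∙-cong (sym α₁≈) (trans (identityʳ _) (sym α₁≈))) α₁²≈ε))

    p∤k₁ : 2 ℕ.≤ p → ¬ p ∣ k₁
    p∤k₁ 2≤p p∣k₁ = α₁≉ε 2≤p (trans α₁≈ (^-multiple a a^p≈ε p∣k₁))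

    p-even : 2 ℕ.≤ p → ∃ λ P → p ≡ 2 ℕ.* P
    p-even 2≤p = cases (parity p)
      where
      cases : (∃ λ k → p ≡ 2 ℕ.* k ⊎ p ≡ suc (2 ℕ.* k)) → ∃ λ k → p ≡ 2 ℕ.* k
      cases (k , inj₁ e) = k , e
      cases (k , inj₂ e) = ⊥-elim (p∤k₁ 2≤p (coprime-divisor coprime p∣2k₁))
        where
        coprime : Coprime p 2
        coprime {d} (d∣p , d∣2) = ∣1⇒≡1 (∣m+n∣m⇒∣n (≡.subst (d ∣_) (≡.trans e (ℕₚ.+-comm 1 (2 ℕ.* k))) d∣p) (∣m⇒∣m*n k d∣2))

    α₀^q≈ε : α₀ ^ q ≈ ε
    α₀^q≈ε = begin
      α₀ ^ q              ≈⟨ identityˡ _ ⟨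
      ε ∙ α₀ ^ q          ≈⟨ ∙-congʳ sum-q ⟨
      sum q ∙ α₀ ^ q      ≈⟨ b^≈ q ⟨
      b ^ q               ≈⟨ b^q≈ε ⟩
      ε                   ∎

    -- `b^q = 1` gives `α₀^q = 1`, and `α₁² = 1` gives `α₀² = a⁻²`.
    p∣2q : p ∣ 2 ℕ.* q
    p∣2q = a-order (2 ℕ.* q) (⁻¹-injective (begin
      (a ^ (2 ℕ.* q)) ⁻¹        ≈⟨ ⁻¹-cong (trans (^-≡ a (ℕₚ.*-comm 2 q)) (sym (^-* a q 2))) ⟩
      ((a ^ 2) ^ q) ⁻¹          ≈⟨ ^-⁻¹ (a ^ 2) q ⟨
      ((a ^ 2) ⁻¹) ^ q          ≈⟨ ^-cong q α₀²≈ ⟨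
      (α₀ ^ 2) ^ q              ≈⟨ trans (^-* α₀ q 2) (trans (^-≡ α₀ (ℕₚ.*-comm q 2)) (sym (^-* α₀ 2 q))) ⟩
      (α₀ ^ q) ^ 2              ≈⟨ trans (^-cong 2 α₀^q≈ε) (ε^ 2) ⟩
      ε                         ≈⟨ ε⁻¹≈ε ⟨
      ε ⁻¹                      ∎))
      where
      α₀²≈ : α₀ ^ 2 ≈ (a ^ 2) ⁻¹
      α₀²≈ = begin
        α₀ ∙ (α₀ ∙ ε)                            ≈⟨ solve (a ∷ α₀ ∷ []) (v1 ⊙ (v1 ⊙ 𝕖)) (v1 ⊙ v0 ⁻ ⊙ (v0 ⊙ v1)) ≡.refl ⟩
        α₀ ∙ a ⁻¹ ∙ (a ∙ α₀)                     ≈⟨ ∙-congʳ (A-comm α₀∈A (A-inv a∈A)) ⟩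
        a ⁻¹ ∙ α₀ ∙ (a ∙ α₀)                     ≈⟨ solve (a ∷ α₀ ∷ []) (v0 ⁻ ⊙ v1 ⊙ (v0 ⊙ v1)) (v0 ⁻ ⊙ v0 ⁻ ⊙ ((v0 ⊙ v1) ⊙ (v0 ⊙ v1))) ≡.refl ⟩
        a ⁻¹ ∙ a ⁻¹ ∙ (α₁ ∙ α₁)                  ≈⟨ ∙-congˡ α₁²≈ε ⟩
        a ⁻¹ ∙ a ⁻¹ ∙ ε                          ≈⟨ solve (a ∷ []) (v0 ⁻ ⊙ v0 ⁻ ⊙ 𝕖) ((v0 ⊙ (v0 ⊙ 𝕖)) ⁻) ≡.refl ⟩
        (a ^ 2) ⁻¹                               ∎

    module _ (2≤p : 2 ℕ.≤ p) (P : ℕ) (p≡2P : p ≡ 2 ℕ.* P) where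

      P∣q : P ∣ q
      P∣q = *-cancelˡ-∣ 2 (≡.subst (_∣ 2 ℕ.* q) p≡2P p∣2q)

      P-odd : ∃ λ h → P ≡ suc (2 ℕ.* h)
      P-odd = cases (parity P) P∣q
        where
        cases : (∃ λ k → P ≡ 2 ℕ.* k ⊎ P ≡ suc (2 ℕ.* k)) → P ∣ q → ∃ λ k → P ≡ suc (2 ℕ.* k)
        cases (k , inj₂ e) _                 = k , e
        cases (k , inj₁ e) (divides z q≡zP) = ⊥-elim (q-odd (k ℕ.* z) (≡.trans q≡zP (≡.trans (ℕₚ.*-comm z P) (≡.trans (≡.cong (ℕ._* z) e) (ℕₚ.*-assoc 2 k z)))))

      α₁≈a^P : α₁ ≈ a ^ P
      α₁≈a^P = cases (*-cancelˡ-∣ 2 (≡.subst (_∣ 2 ℕ.* k₁) p≡2P p∣2k₁))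
        where
        cases : P ∣ k₁ → α₁ ≈ a ^ P
        cases (divides j k₁≡jP) = cases′ (parity j)
          where
          cases′ : (∃ λ k → j ≡ 2 ℕ.* k ⊎ j ≡ suc (2 ℕ.* k)) → α₁ ≈ a ^ P
          cases′ (i , inj₁ j≡2i) = ⊥-elim (p∤k₁ 2≤p (divides i (≡.trans k₁≡jP (≡.trans (≡.cong (ℕ._* P) (≡.trans j≡2i (ℕₚ.*-comm 2 i)))
                (≡.trans (ℕₚ.*-assoc i 2 P) (≡.cong (i ℕ.*_) (≡.sym p≡2P)))))))
          cases′ (i , inj₂ j≡1+2i) = begin
            α₁                    ≈⟨ α₁≈ ⟩
            a ^ k₁                ≈⟨ ^-≡ a (≡.trans k₁≡jP (≡.trans (≡.cong (ℕ._* P) (≡.trans j≡1+2i (≡.cong suc (ℕₚ.*-comm 2 i))))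
                                       (≡.cong (P ℕ.+_) (≡.trans (ℕₚ.*-assoc i 2 P) (≡.cong (i ℕ.*_) (≡.sym p≡2P)))))) ⟩
            a ^ (P ℕ.+ i ℕ.* p)   ≈⟨ ^-+ a P (i ℕ.* p) ⟩
            a ^ P ∙ a ^ (i ℕ.* p) ≈⟨ ∙-congˡ (^-multiple a a^p≈ε (n∣m*n i)) ⟩
            a ^ P ∙ ε             ≈⟨ identityʳ _ ⟩
            a ^ P                 ∎

      α₀^P≈ε : α₀ ^ P ≈ ε
      α₀^P≈ε = begin
        α₀ ^ P                            ≈⟨ ^-cong P α₀≈ ⟩
        (a ^ (ℕ.pred p ℕ.+ P)) ^ P        ≈⟨ ^-* a P _ ⟩
        -- With `P = 2h + 1` the exponent is `P (3P - 1) = (3h + 1) 2P`; here the oddness of `P` is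
        -- essential.
        a ^ (P ℕ.* (ℕ.pred p ℕ.+ P))      ≈⟨ ^-multiple a a^p≈ε (divides (suc (3 ℕ.* h)) exponent) ⟩
        ε                                 ∎
        where
        h : ℕ
        h = proj₁ P-odd
        P≡ : P ≡ suc (2 ℕ.* h)
        P≡ = proj₂ P-odd
        α₀≈ : α₀ ≈ a ^ (ℕ.pred p ℕ.+ P)
        α₀≈ = begin
          α₀                              ≈⟨ solve (a ∷ α₀ ∷ []) v1 (v0 ⁻ ⊙ (v0 ⊙ v1)) ≡.refl ⟩
          a ⁻¹ ∙ α₁                       ≈⟨ ∙-cong (trans (⁻¹-cong (sym (^-1 a))) (trans (^-inverse a p a^p≈ε 1) (^-≡ a (ℕₚ.*-identityʳ (ℕ.pred p))))) α₁≈a^P ⟩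
          a ^ ℕ.pred p ∙ a ^ P            ≈⟨ ^-+ a (ℕ.pred p) P ⟨
          a ^ (ℕ.pred p ℕ.+ P)            ∎
        exponent : P ℕ.* (ℕ.pred p ℕ.+ P) ≡ suc (3 ℕ.* h) ℕ.* p
        exponent = ≡.trans (≡.cong (λ i → P ℕ.* (ℕ.pred i ℕ.+ P)) p≡2P) (≡.trans (closed P P≡) (≡.cong (suc (3 ℕ.* h) ℕ.*_) (≡.sym p≡2P)))
          where
          open import Data.Nat.Tactic.RingSolver using (solve-∀)
          closed-form : ∀ h → suc (2 ℕ.* h) ℕ.* (2 ℕ.* h ℕ.+ (suc (2 ℕ.* h) ℕ.+ 0) ℕ.+ suc (2 ℕ.* h)) ≡ suc (3 ℕ.* h) ℕ.* (2 ℕ.* suc (2 ℕ.* h))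
          closed-form = solve-∀
          closed : ∀ P → P ≡ suc (2 ℕ.* h) → P ℕ.* (ℕ.pred (2 ℕ.* P) ℕ.+ P) ≡ suc (3 ℕ.* h) ℕ.* (2 ℕ.* P)
          closed _ ≡.refl = closed-form h

      𝕏^P≈1 : 𝕏 ^ᵣ P R.≈ 𝟙
      𝕏^P≈1 = lift {⟦ 𝕏 ^ᵣ P ⟧ n̂} {n̂} (begin
        at (𝕏 ^ᵣ P)                      ≈⟨ powers P ⟩
        α₀ ^ P ∙ n ∙ (α₀ ^ P) ⁻¹         ≈⟨ ∙-cong (∙-congʳ α₀^P≈ε) (⁻¹-cong α₀^P≈ε) ⟩
        ε ∙ n ∙ ε ⁻¹                     ≈⟨ solve (n ∷ []) (𝕖 ⊙ v0 ⊙ 𝕖 ⁻) v0 ≡.refl ⟩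
        n                                ∎)
        where
        powers : ∀ k → at (𝕏 ^ᵣ k) ≈ α₀ ^ k ∙ n ∙ (α₀ ^ k) ⁻¹
        powers zero    = solve (n ∷ []) v0 (𝕖 ⊙ v0 ⊙ 𝕖 ⁻) ≡.refl
        powers (suc k) = begin
          b ∙ at (𝕏 ^ᵣ k) ∙ b ⁻¹                        ≈⟨ conj-b (at∈M (𝕏 ^ᵣ k)) ⟩
          α₀ ∙ at (𝕏 ^ᵣ k) ∙ α₀ ⁻¹                      ≈⟨ ∙-congʳ (∙-congˡ (powers k)) ⟩
          α₀ ∙ (α₀ ^ k ∙ n ∙ (α₀ ^ k) ⁻¹) ∙ α₀ ⁻¹       ≈⟨ solve (α₀ ∷ α₀ ^ k ∷ n ∷ []) (v0 ⊙ (v1 ⊙ v2 ⊙ v1 ⁻) ⊙ v0 ⁻) ((v0 ⊙ v1) ⊙ v2 ⊙ (v0 ⊙ v1) ⁻) ≡.refl ⟩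
          (α₀ ∙ α₀ ^ k) ∙ n ∙ (α₀ ∙ α₀ ^ k) ⁻¹          ∎

      q∣[1+D]^P-1 : ∀ E → suc D ℕ.^ P ≡ suc E → q ∣ E
      q∣[1+D]^P-1 E eq = Tr.char-multiple E (Tr.move0 {𝟙} {nat E} (R.sym {𝟙 ⊕ nat E} {𝟙}
        (R.trans {nat (suc E)} {nat (suc D) ^ᵣ P} {𝟙} (R.trans {nat (suc E)} {nat (suc D ℕ.^ P)} {nat (suc D) ^ᵣ P} (R.reflexive (≡.cong nat (≡.sym eq))) (nat-^ P))
        (R.trans {nat (suc D) ^ᵣ P} {𝕏 ^ᵣ P} {𝟙} (Sums.^-congˡ ring P {nat (suc D)} {𝕏} (R.sym {𝕏} {nat (suc D)} 𝕏≈1+D)) 𝕏^P≈1))))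
        where
        nat-^ : ∀ k → nat (suc D ℕ.^ k) R.≈ nat (suc D) ^ᵣ k
        nat-^ zero    = R.+-identityʳ R.1#
        nat-^ (suc k) = R.trans {nat (suc D ℕ.* suc D ℕ.^ k)} {nat (suc D) ⊛ nat (suc D ℕ.^ k)} {nat (suc D) ⊛ nat (suc D) ^ᵣ k} (×1-homo-* (suc D) (suc D ℕ.^ k))
          (R.*-cong {nat (suc D)} {nat (suc D)} {nat (suc D ℕ.^ k)} {nat (suc D) ^ᵣ k} (R.refl {nat (suc D)}) (nat-^ k))

    -- Now `r² = 1`, so `𝕏 = 1`: `b` centralises `M` and `a` inverts it. The reflection inverts the
    -- two factors of `m a^i` separately.
    module _ (q∣D : q ∣ D) where

      b-centralises : ∀ {m} → InM m → b ∙ m ∙ b ⁻¹ ≈ m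
      b-centralises {m} m∈ = begin
        b ∙ m ∙ b ⁻¹          ≈⟨ ∙-congʳ (∙-congˡ m≈) ⟩
        b ∙ at g ∙ b ⁻¹       ≈⟨ lower {⟦ 𝕏 ⊛ g ⟧ n̂} {⟦ g ⟧ n̂} (R.*-cong {𝕏} {𝟙} {g} {g} 𝕏≈1 (R.refl {g})) ⟩
        at g                  ≈⟨ m≈ ⟨
        m                     ∎
        where
        g : Poly
        g = (𝟙 ⊕ 𝕏) ⊛ proj₁ (multiple m∈)
        m≈ : m ≈ at g
        m≈ = proj₂ (multiple m∈)
        natD≈0 : ∀ {d} → q ∣ d → nat d R.≈ R.0#
        natD≈0 (divides k ≡.refl) = R.trans {nat (k ℕ.* q)} {nat k R.* nat q} {R.0#} (×1-homo-* k q)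
          (R.trans {nat k R.* nat q} {nat k R.* R.0#} {R.0#} (R.*-cong {nat k} {nat k} {nat q} {R.0#} (R.refl {nat k}) Tr.nat-N≈0) (R.zeroʳ (nat k)))
        𝕏≈1 : 𝕏 R.≈ 𝟙
        𝕏≈1 = R.trans {𝕏} {nat (suc D)} {𝟙} 𝕏≈1+D
          (R.trans {R.1# R.+ nat D} {R.1# R.+ R.0#} {R.1#} (R.+-cong {R.1#} {R.1#} {nat D} {R.0#} (R.refl {R.1#}) (natD≈0 q∣D)) (R.+-identityʳ R.1#))

      a-inverts : ∀ {m} → InM m → conj m a ≈ m ⁻¹
      a-inverts m∈ = ⁻¹-injective (trans (sym (b-conj m∈)) (trans (b-centralises m∈) (sym (⁻¹-involutive _))))

      open ProductMA T
      open SquareCentral T (λ m∈ → trans (conj-cong (a-inverts m∈) refl) (trans (a-inverts (inv m∈)) (⁻¹-involutive _)))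

      _↦_ : Carrier → Carrier → Set
      g ↦ h = ∃ λ m → InM m × ∃ λ i → g ≈ m ∙ a ^ i × h ≈ m ⁻¹ ∙ (a ^ i) ⁻¹

      α₀-centralises : ∀ {m} → InM m → α₀ ∙ m ∙ α₀ ⁻¹ ≈ m
      α₀-centralises m∈ = trans (sym (conj-b m∈)) (b-centralises m∈)

      step-a : ∀ {g h} → g ↦ h → (g ∙ a) ↦ (h ∙ a ⁻¹)
      step-a (m , m∈ , i , g≈ , h≈) = m , m∈ , suc i ,
        trans (∙-congʳ g≈) (trans (assoc _ _ _) (∙-congˡ (sym (^-suc′ a i)))) ,
        trans (∙-congʳ h≈) (solve (m ∷ a ^ i ∷ a ∷ []) (v0 ⁻ ⊙ v1 ⁻ ⊙ v2 ⁻) (v0 ⁻ ⊙ (v2 ⊙ v1) ⁻) ≡.refl)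

      step-b : ∀ {g h} → g ↦ h → (g ∙ b) ↦ (h ∙ b ⁻¹)
      step-b {g} {h} (m , m∈ , i , g≈ , h≈) = m ∙ conj n α , mul m∈ n^α∈ , i ℕ.+ proj₁ α₀∈A ,
        (begin
          g ∙ b                                  ≈⟨ ∙-cong g≈ b≈nα₀ ⟩
          (m ∙ α) ∙ (n ∙ α₀)                     ≈⟨ solve (m ∷ α ∷ n ∷ α₀ ∷ []) ((v0 ⊙ v1) ⊙ (v2 ⊙ v3)) ((v0 ⊙ (v1 ⊙ v2 ⊙ v1 ⁻)) ⊙ (v1 ⊙ v3)) ≡.refl ⟩
          (m ∙ (α ∙ n ∙ α ⁻¹)) ∙ (α ∙ α₀)        ≈⟨ ∙-cong (∙-congˡ (sym (conj-a^ i n∈M))) αα₀ ⟩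
          (m ∙ conj n α) ∙ a ^ (i ℕ.+ proj₁ α₀∈A) ∎) ,
        (begin
          h ∙ b ⁻¹                                      ≈⟨ ∙-cong h≈ (⁻¹-cong b≈nα₀) ⟩
          (m ⁻¹ ∙ α ⁻¹) ∙ (n ∙ α₀) ⁻¹
            ≈⟨ solve (m ∷ α ∷ n ∷ α₀ ∷ []) ((v0 ⁻ ⊙ v1 ⁻) ⊙ (v2 ⊙ v3) ⁻) (v0 ⁻ ⊙ (v1 ⁻ ⊙ (v3 ⁻ ⊙ v2 ⊙ v3) ⁻ ⊙ v1) ⊙ (v3 ⊙ v1) ⁻) ≡.refl ⟩
          m ⁻¹ ∙ conj (conj n α₀ ⁻¹) α ∙ (α₀ ∙ α) ⁻¹    ≈⟨ ∙-cong (∙-congˡ (conj-cong (⁻¹-cong conj-α₀) refl)) (⁻¹-cong (A-comm α₀∈A (i , refl))) ⟩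
          m ⁻¹ ∙ conj (n ⁻¹) α ∙ (α ∙ α₀) ⁻¹            ≈⟨ ∙-cong (∙-congˡ (conj-⁻¹ n α)) (⁻¹-cong αα₀) ⟩
          m ⁻¹ ∙ conj n α ⁻¹ ∙ (a ^ (i ℕ.+ proj₁ α₀∈A)) ⁻¹ ≈⟨ ∙-congʳ (⁻¹-anti-homo-∙ _ _) ⟨
          (conj n α ∙ m) ⁻¹ ∙ (a ^ (i ℕ.+ proj₁ α₀∈A)) ⁻¹ ≈⟨ ∙-congʳ (⁻¹-cong (M-comm n^α∈ m∈)) ⟩
          (m ∙ conj n α) ⁻¹ ∙ (a ^ (i ℕ.+ proj₁ α₀∈A)) ⁻¹ ∎)
        where
        α : Carrier
        α = a ^ i
        n^α∈ : InM (conj n α)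
        n^α∈ = M-conj-a^ i n∈M
        αα₀ : α ∙ α₀ ≈ a ^ (i ℕ.+ proj₁ α₀∈A)
        αα₀ = trans (∙-congˡ (proj₂ α₀∈A)) (sym (^-+ a i (proj₁ α₀∈A)))
        conj-α₀ : conj n α₀ ≈ n
        conj-α₀ = begin
          α₀ ⁻¹ ∙ n ∙ α₀                         ≈⟨ ∙-congʳ (∙-congˡ (α₀-centralises n∈M)) ⟨
          α₀ ⁻¹ ∙ (α₀ ∙ n ∙ α₀ ⁻¹) ∙ α₀          ≈⟨ solve (n ∷ α₀ ∷ []) (v1 ⁻ ⊙ (v1 ⊙ v0 ⊙ v1 ⁻) ⊙ v1) v0 ≡.refl ⟩
          n                                      ∎

      reflexible : Reflexible T
      reflexible = Mirror.respects T _↦_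
        (ε , one , 0 , sym (identityˡ ε) , solve [] 𝕖 (𝕖 ⁻ ⊙ 𝕖 ⁻) ≡.refl) step-a step-b
        (λ (m , m∈ , i , g≈ , h≈) (m′ , m′∈ , i′ , g′≈ , h′≈) e → trans h≈ (trans (unique i i′ m∈ m′∈ (trans (sym g≈) (trans e g′≈))) (sym h′≈)))
        (λ (m , m∈ , i , g≈ , h≈) e e′ → m , m∈ , i , trans (sym e) g≈ , trans (sym e′) h≈)

-- The divisibility conditions from a prime in excess.

module Arithmetic where
  open import Data.Nat.Base using (ℕ; zero; suc; _+_; _*_; _^_; NonZero; ≢-nonZero; ≢-nonZero⁻¹)
  import Data.Nat.Properties as ℕₚ
  open import Data.Nat.Divisibility
  open import Data.Nat.Coprimality using (Coprime; coprime-divisor)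
  open import Data.Nat.GCD using (gcd; gcd[m,n]∣m; gcd[m,n]∣n; gcd-greatest)
  open import Data.Nat.Primality using (Prime; prime⇒irreducible; euclidsLemma; ¬prime[1]; prime[2])
  open import Data.Nat.Primality.Factorisation using (factorise; PrimeFactorisation)
  open import Data.Nat.Tactic.RingSolver using (solve-∀)
  open import Data.List.Base using ([]; _∷_)
  open import Data.Nat.ListAction using (product)
  open import Data.List.Relation.Unary.All using (All; []; _∷_)
  open import Data.Product using (∃; _×_; _,_; proj₁; proj₂)
  open import Data.Sum using (_⊎_; inj₁; inj₂)
  open import Data.Empty using (⊥-elim)
  open import Relation.Nullary using (¬_; Dec; yes; no)
  open import Relation.Binary.PropositionalEquality
  open GeometricSums using (parity)

  prime-divisor : ∀ n .{{_ : NonZero n}} → n ≢ 1 → ∃ λ l → Prime l × l ∣ n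
  prime-divisor n n≢1 = from (factors F) (factorsPrime F) (isFactorisation F)
    where
    open PrimeFactorisation
    F : PrimeFactorisation n
    F = factorise n
    from : ∀ ps → All Prime ps → n ≡ product ps → ∃ λ l → Prime l × l ∣ n
    from []       _            e = ⊥-elim (n≢1 e)
    from (l ∷ ps) (l-prime ∷ _) e = l , l-prime , subst (l ∣_) (sym e) (m∣m*n (product ps))

  -- A witness that `N` does not divide `D`: with `d` their gcd, the prime `l` survives in `N / d`
  -- and is absent from `D / d`, so it divides `N` to a higher power than `D`.
  record Excess (N D : ℕ) : Set where
    field
      l d n d′  : ℕ
      l-prime   : Prime l
      N≡        : N ≡ n * d
      D≡        : D ≡ d′ * d
      l∣n       : l ∣ n
      l∤d′      : ¬ l ∣ d′
      {{d≢0}}   : NonZero d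

  excess : ∀ N D .{{_ : NonZero N}} → ¬ N ∣ D → Excess N D
  excess N D N∤D = from (gcd[m,n]∣m N D) (gcd[m,n]∣n N D)
    where
    from : gcd N D ∣ N → gcd N D ∣ D → Excess N D
    from (divides n N≡nd) (divides d′ D≡d′d) = record
      { l = proj₁ prime ; l-prime = proj₁ (proj₂ prime) ; d = d ; n = n ; d′ = d′ ; N≡ = N≡nd ; D≡ = D≡d′d
      ; l∣n = proj₂ (proj₂ prime)
      ; l∤d′ = λ l∣d′ → ¬prime[1] (subst Prime (coprime (proj₂ (proj₂ prime) , l∣d′)) (proj₁ (proj₂ prime)))
      }
      where
      d : ℕ
      d = gcd N D
      instance
        nd≢0 : NonZero (n * d)
        nd≢0 = subst NonZero N≡nd (≢-nonZero (≢-nonZero⁻¹ N))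
        n≢0 : NonZero n
        n≢0 = ℕₚ.m*n≢0⇒m≢0 n
        d≢0 : NonZero d
        d≢0 = ℕₚ.m*n≢0⇒n≢0 n
      coprime : Coprime n d′
      coprime {e} (e∣n , e∣d′) = ∣1⇒≡1 (*-cancelʳ-∣ d (subst (e * d ∣_) (sym (ℕₚ.*-identityˡ d))
        (gcd-greatest (subst (e * d ∣_) (sym N≡nd) (*-monoˡ-∣ d e∣n)) (subst (e * d ∣_) (sym D≡d′d) (*-monoˡ-∣ d e∣d′)))))
      prime : ∃ λ l → Prime l × l ∣ n
      prime = prime-divisor n λ n≡1 → N∤D (subst (_∣ D) (sym (trans N≡nd (trans (cong (_* d) n≡1) (ℕₚ.*-identityˡ d)))) (gcd[m,n]∣n N D))

  2∣prime⇒≡2 : ∀ {l} → Prime l → 2 ∣ l → l ≡ 2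
  2∣prime⇒≡2 l-prime 2∣l with prime⇒irreducible l-prime 2∣l
  ... | inj₁ ()
  ... | inj₂ e = sym e

  odd-coprime-2 : ∀ {n} → ¬ 2 ∣ n → Coprime 2 n
  odd-coprime-2 2∤n {d} (d∣2 , d∣n) with prime⇒irreducible prime[2] d∣2
  ... | inj₁ d≡1 = d≡1
  ... | inj₂ refl = ⊥-elim (2∤n d∣n)

  cancel-odd-2 : ∀ k {n m} → ¬ 2 ∣ n → 2 ^ k ∣ n * m → 2 ^ k ∣ m
  cancel-odd-2 zero    {n} {m} 2∤n h = 1∣ m
  cancel-odd-2 (suc k) {n} {m} 2∤n h with coprime-divisor {2} {n} {m} (odd-coprime-2 2∤n) (∣-trans (m∣m*n (2 ^ k)) h)
  ... | divides m′ refl = subst (2 ^ suc k ∣_) (ℕₚ.*-comm 2 m′) (*-monoʳ-∣ 2 (cancel-odd-2 k 2∤n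
          (*-cancelˡ-∣ 2 (subst (2 ^ suc k ∣_) (trans (sym (ℕₚ.*-assoc n m′ 2)) (ℕₚ.*-comm (n * m′) 2)) h))))

  Outcome : ℕ → ℕ → Set
  Outcome p q = (∃ λ m → OddPrime m × m ∣ p × m * m ∣ q) ⊎ (8 ∣ p × 32 ∣ q)

  -- N ∣ P (1 + r) and D = r² - 1; the excess prime of N over D divides P.
  even-outcome : ∀ P N r D .{{_ : NonZero N}} → r * r ≡ suc D →
    (∀ {l} → Prime l → l ∣ N → l ∣ D) → 2 * N ∣ 2 * P * suc r → ¬ N ∣ D → Outcome (2 * P) (2 * N)
  even-outcome P N zero    D () _ _ _
  even-outcome P N (suc s) D rr≡ prime∣D 2N∣ N∤D = conclude (excess N D N∤D)
    where
    D≡s*[s+2] : D ≡ s * (2 + s)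
    D≡s*[s+2] = ℕₚ.suc-injective (trans (sym rr≡) (expand s))
      where
      expand : ∀ s → suc s * suc s ≡ suc (s * (2 + s))
      expand = solve-∀
    N∣P*[2+s] : N ∣ P * (2 + s)
    N∣P*[2+s] = *-cancelˡ-∣ 2 (subst (2 * N ∣_) (ℕₚ.*-assoc 2 P (2 + s)) 2N∣)
    conclude : Excess N D → Outcome (2 * P) (2 * N)
    conclude X = cases (2 ∣? l)
      where
      open Excess X
      l∣N : l ∣ N
      l∣N = subst (l ∣_) (sym N≡) (∣m⇒∣m*n d l∣n)
      l∣D : l ∣ D
      l∣D = prime∣D l-prime l∣N
      l∣d : l ∣ d
      l∣d with euclidsLemma d′ d l-prime (subst (l ∣_) D≡ l∣D)
      ... | inj₁ l∣d′ = ⊥-elim (l∤d′ l∣d′)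
      ... | inj₂ h = h
      l²∣N : l * l ∣ N
      l²∣N = subst (l * l ∣_) (sym N≡) (*-pres-∣ l∣n l∣d)
      -- `D = (r - 1) (r + 1)` and `N ∣ P (r + 1)` give `N ∣ P D`; then `d` is cancelled.
      n∣P*d′ : n ∣ P * d′
      n∣P*d′ = *-cancelʳ-∣ d (subst₂ _∣_ N≡ (trans (cong (P *_) D≡) (sym (ℕₚ.*-assoc P d′ d)))
        (subst (N ∣_) (trans (rearrange P s) (cong (P *_) (sym D≡s*[s+2]))) (∣m⇒∣m*n s N∣P*[2+s])))
        where
        rearrange : ∀ P s → P * (2 + s) * s ≡ P * (s * (2 + s))
        rearrange = solve-∀
      l∣P : l ∣ P
      l∣P with euclidsLemma P d′ l-prime (∣-trans l∣n n∣P*d′)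
      ... | inj₁ h = h
      ... | inj₂ l∣d′ = ⊥-elim (l∤d′ l∣d′)
      cases : Dec (2 ∣ l) → Outcome (2 * P) (2 * N)
      cases (no 2∤l) = inj₁ (l , (l-prime , 2∤l) , ∣n⇒∣m*n 2 l∣P , ∣n⇒∣m*n 2 l²∣N)
      -- For `l = 2` the number `r` is odd, so 8 divides `D = 4 h (h + 1)`, hence also `d`, and
      -- `N = n d` is divisible by 16. The even factor `r - 1 = 2h` contributes an extra 2 to
      -- `n ∣ P d′`, whence `4 ∣ P`. Doubling gives 8 and 32.
      cases (yes 2∣l) = inj₂ (*-monoʳ-∣ 2 4∣P , *-monoʳ-∣ 2 16∣N)
        where
        2∣ : ∀ {x} → l ∣ x → 2 ∣ x
        2∣ = ∣-trans 2∣l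
        2∤d′ : ¬ 2 ∣ d′
        2∤d′ h = l∤d′ (subst (_∣ d′) (sym (2∣prime⇒≡2 l-prime 2∣l)) h)
        s-even : ∃ λ h → s ≡ 2 * h
        s-even with euclidsLemma s (2 + s) prime[2] (subst (2 ∣_) D≡s*[s+2] (2∣ l∣D))
        ... | inj₁ (divides h e) = h , trans e (ℕₚ.*-comm h 2)
        ... | inj₂ 2∣2+s with ∣m+n∣m⇒∣n 2∣2+s ∣-refl
        ... | divides h e = h , trans e (ℕₚ.*-comm h 2)
        h : ℕ
        h = proj₁ s-even
        2∣h*[1+h] : 2 ∣ h * suc h
        2∣h*[1+h] with parity h
        ... | k , inj₁ e = subst (λ x → 2 ∣ x * suc x) (sym e) (∣m⇒∣m*n (suc (2 * k)) (m∣m*n k))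
        ... | k , inj₂ e = subst (λ x → 2 ∣ x * suc x) (sym e) (∣n⇒∣m*n (suc (2 * k)) (divides (suc k) (double k)))
          where
          double : ∀ k → suc (suc (2 * k)) ≡ suc k * 2
          double = solve-∀
        D≡4 : D ≡ 4 * (h * suc h)
        D≡4 = trans D≡s*[s+2] (trans (cong (λ s → s * (2 + s)) (proj₂ s-even)) (expand h))
          where
          expand : ∀ h → 2 * h * (2 + 2 * h) ≡ 4 * (h * suc h)
          expand = solve-∀
        8∣d : 8 ∣ d
        8∣d = cancel-odd-2 3 2∤d′ (subst (8 ∣_) (trans (sym D≡4) D≡) (*-monoʳ-∣ 4 2∣h*[1+h]))
        16∣N : 16 ∣ N
        16∣N = subst (16 ∣_) (sym N≡) (*-pres-∣ (2∣ l∣n) 8∣d)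
        2n∣P*d′ : 2 * n ∣ d′ * P
        2n∣P*d′ = *-cancelʳ-∣ d (subst₂ _∣_ (trans (cong (2 *_) N≡) (sym (ℕₚ.*-assoc 2 n d))) (trans (cong (P *_) D≡) (rearrange′ P d′ d))
          (subst (2 * N ∣_) (trans (rearrange h P s) (trans (cong (λ x → P * (x * (2 + s))) (sym (proj₂ s-even))) (cong (P *_) (sym D≡s*[s+2]))))
            (*-monoʳ-∣ 2 (∣n⇒∣m*n h N∣P*[2+s]))))
          where
          rearrange : ∀ h P s → 2 * (h * (P * (2 + s))) ≡ P * (2 * h * (2 + s))
          rearrange = solve-∀
          rearrange′ : ∀ P d′ d → P * (d′ * d) ≡ d′ * P * d
          rearrange′ = solve-∀
        4∣P : 4 ∣ P
        4∣P = cancel-odd-2 2 2∤d′ (∣-trans (*-monoʳ-∣ 2 (2∣ l∣n)) 2n∣P*d′)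

  -- The binomial expansion of `(1 + D)^P` up to order `D²`.
  binomial : ∀ D P → ∃ λ k → suc D ^ P ≡ suc (D * (P + D * k))
  binomial D zero    = 0 , cong suc (sym (trans (cong (D *_) (ℕₚ.*-zeroʳ D)) (ℕₚ.*-zeroʳ D)))
  binomial D (suc P) with binomial D P
  ... | k , e = P + D * k + k , trans (cong (suc D *_) e) (expand D P k)
    where
    expand : ∀ D P k → suc D * suc (D * (P + D * k)) ≡ suc (D * (suc P + D * (P + D * k + k)))
    expand = solve-∀

  -- `q` divides `(1 + D)^P - 1 = D (P + D k)`. Cancelling the gcd `d` leaves `l ∣ P + D k`, and `l`
  -- divides `D`, hence `P`. As `l` divides both `q / d` and `d`, its square divides `q`.
  odd-outcome : ∀ P q D .{{_ : NonZero q}} → ¬ 2 ∣ q → (∀ {l} → Prime l → l ∣ q → l ∣ D) →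
    (∀ E → suc D ^ P ≡ suc E → q ∣ E) → ¬ q ∣ D → ∃ λ m → OddPrime m × m ∣ 2 * P × m * m ∣ q
  odd-outcome P q D 2∤q prime∣D q∣ q∤D = conclude (excess q D q∤D) (binomial D P)
    where
    conclude : Excess q D → (∃ λ k → suc D ^ P ≡ suc (D * (P + D * k))) → ∃ λ m → OddPrime m × m ∣ 2 * P × m * m ∣ q
    conclude X (k , power) = l , (l-prime , λ 2∣l → 2∤q (∣-trans 2∣l l∣q)) , ∣n⇒∣m*n 2 l∣P , subst (l * l ∣_) (sym N≡) (*-pres-∣ l∣n l∣d)
      where
      open Excess X
      l∣q : l ∣ q
      l∣q = subst (l ∣_) (sym N≡) (∣m⇒∣m*n d l∣n)
      l∣D : l ∣ D
      l∣D = prime∣D l-prime l∣q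
      l∣d : l ∣ d
      l∣d with euclidsLemma d′ d l-prime (subst (l ∣_) D≡ l∣D)
      ... | inj₁ l∣d′ = ⊥-elim (l∤d′ l∣d′)
      ... | inj₂ h = h
      n∣ : n ∣ d′ * (P + D * k)
      n∣ = *-cancelʳ-∣ d (subst₂ _∣_ N≡ (trans (cong (_* (P + D * k)) D≡) (rearrange d′ d (P + D * k))) (q∣ _ power))
        where
        rearrange : ∀ x y z → x * y * z ≡ x * z * y
        rearrange = solve-∀
      l∣P : l ∣ P
      l∣P with euclidsLemma d′ (P + D * k) l-prime (∣-trans l∣n n∣)
      ... | inj₁ l∣d′ = ⊥-elim (l∤d′ l∣d′)
      ... | inj₂ h = ∣m+n∣m⇒∣n (subst (l ∣_) (ℕₚ.+-comm P (D * k)) h) (∣m⇒∣m*n k l∣D)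

-- From chiral tight groups to the six conditions.

module Necessity where
  open import Data.Nat.Base as ℕ using (ℕ; zero; suc; NonZero)
  import Data.Nat.Properties as ℕₚ
  open import Data.Nat.Divisibility using (_∣_; divides; _∣?_; m∣m*n; ∣m+n∣m⇒∣n; ∣1⇒≡1)
  open import Data.Fin.Patterns
  open import Data.Vec.Base using ([]; _∷_)
  open import Data.Product using (∃; _×_; _,_; proj₁; proj₂)
  open import Data.Sum using (_⊎_; inj₁; inj₂)
  open import Data.Empty using (⊥; ⊥-elim)
  open import Relation.Nullary using (¬_; Dec; yes; no)
  open import Relation.Binary.PropositionalEquality as ≡ using (_≡_)
  open GeometricSums using (parity)
  open TightGroups
  open CommutatorSubgroup
  open EvenType
  open OddType
  open Reflections
  open Arithmetic

  1+2k-odd : ∀ {n} k → n ≡ suc (2 ℕ.* k) → ¬ 2 ∣ n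
  1+2k-odd k e 2∣n with () ← ∣1⇒≡1 (∣m+n∣m⇒∣n (≡.subst (2 ∣_) (≡.trans e (ℕₚ.+-comm 1 (2 ℕ.* k))) 2∣n) (m∣m*n k))

  OddCondition : ℕ → ℕ → Set
  OddCondition p q = Odd q × Even p × p ∣ 2 ℕ.* q × ∃ λ m → OddPrime m × m ∣ p × m ℕ.* m ∣ q

  module _ {p q} {{p≢0 : NonZero p}} {{q≢0 : NonZero q}} (T : TightGroup p q) where
    open Commutators T

    InMA : Carrier → Set
    InMA g = ∃ λ m → ∃ λ α → InM m × InA α × g ≈ m ∙ α

    private
      pattern v0 = var 0F
      pattern v1 = var 1F
      pattern v2 = var 2F
      pattern v3 = var 3F

    MA-mul : ∀ {g h} → InMA g → InMA h → InMA (g ∙ h)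
    MA-mul (m , α , m∈ , α∈ , g≈) (m′ , α′ , m′∈ , α′∈ , h≈) =
      m ∙ conj m′ (α ⁻¹) , α ∙ α′ , mul m∈ (M-conj-A (A-inv α∈) m′∈) , A-mul α∈ α′∈ ,
      trans (∙-cong g≈ h≈) (solve (m ∷ α ∷ m′ ∷ α′ ∷ []) ((v0 ⊙ v1) ⊙ (v2 ⊙ v3)) ((v0 ⊙ (v1 ⁻ ⁻ ⊙ v2 ⊙ v1 ⁻)) ⊙ (v1 ⊙ v3)) ≡.refl)

    MA-pow : ∀ k {g} → InMA g → InMA (g ^ k)
    MA-pow zero    _ = ε , ε , one , (0 , refl) , sym (identityˡ ε)
    MA-pow (suc k) w = MA-mul w (MA-pow k w)

    b²∈MA : InMA (b ^ 2)
    b²∈MA = conj (c ⁻¹) a , (a ^ 2) ⁻¹ , M-conj-a (inv c∈M) , A-inv (2 , refl) ,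
      trans (∙-cong b≈a⁻¹t (∙-congʳ b≈a⁻¹t))
        (solve (a ∷ []) ((v0 ⁻ ⊙ τ) ⊙ ((v0 ⁻ ⊙ τ) ⊙ 𝕖)) ((v0 ⁻ ⊙ (v0 ⁻ ⊙ τ ⊙ v0 ⊙ τ) ⁻ ⊙ v0) ⊙ (v0 ⊙ (v0 ⊙ 𝕖)) ⁻) ≡.refl)

    -- `b²` always lies in the subgroup `M⟨a⟩`, and for `q = 2k + 1` the element `b` is its power
    -- `(b²)^(k + 1)`.
    b∈MA : ∀ k → q ≡ suc (2 ℕ.* k) → InMA b
    b∈MA k q≡ = let m , α , m∈ , α∈ , e = MA-pow (suc k) b²∈MA in m , α , m∈ , α∈ , trans (sym b^2[1+k]≈b) e
      where
      b^2[1+k]≈b : (b ^ 2) ^ suc k ≈ b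
      b^2[1+k]≈b = trans (^-* b (suc k) 2) (trans (^-≡ b (≡.trans (≡.cong (2 ℕ.+_) (ℕₚ.*-comm k 2)) (≡.cong suc (≡.sym q≡)))) (trans (∙-congˡ b^q≈ε) (identityʳ b)))

    odd-type : ¬ Reflexible T → 2 ℕ.≤ p → ∀ k → q ≡ suc (2 ℕ.* k) → OddCondition p q
    odd-type chiral 2≤p k q≡ = from (b∈MA k q≡)
      where
      2∤q : ¬ 2 ∣ q
      2∤q = 1+2k-odd k q≡
      from : InMA b → OddCondition p q
      from (n , α₀ , n∈ , α₀∈ , b≈) = even (O.p-even 2≤p)
        where
        module O = OddType.Odd T n α₀ n∈ α₀∈ b≈
        even : (∃ λ P → p ≡ 2 ℕ.* P) → OddCondition p q
        even (P , p≡2P) = 2∤q , divides P (≡.trans p≡2P (ℕₚ.*-comm 2 P)) , O.p∣2q ,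
          ≡.subst (λ x → ∃ λ m → OddPrime m × m ∣ x × m ℕ.* m ∣ q) (≡.sym p≡2P)
            (odd-outcome P q O.D 2∤q O.prime∣D (O.q∣[1+D]^P-1 2≤p P p≡2P) (λ q∣D → chiral (O.reflexible q∣D)))

    b∉MA : ∀ N → q ≡ 2 ℕ.* N → ∀ {m α} → InM m → InA α → b ≈ m ∙ α → ⊥
    b∉MA N q≡2N {m} {α} m∈ α∈ b≈ = OddType.Odd.q-odd T m α m∈ α∈ b≈ N q≡2N

  half-nonZero : ∀ {n} k .{{_ : NonZero n}} → n ≡ 2 ℕ.* k → NonZero k
  half-nonZero {n} zero    e = ⊥-elim (ℕ.≢-nonZero⁻¹ n e)
  half-nonZero     (suc k) e = _

  module EvenBoth {p q} {{p≢0 : NonZero p}} {{q≢0 : NonZero q}} (T : TightGroup p q) (chiral : ¬ Reflexible T)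
    (P N : ℕ) (p≡2P : p ≡ 2 ℕ.* P) (q≡2N : q ≡ 2 ℕ.* N) where

    open Commutators T
    open Duality T
    instance
      P≢0 : NonZero P
      P≢0 = half-nonZero P p≡2P
      N≢0 : NonZero N
      N≢0 = half-nonZero N q≡2N

    module E  = EvenType.Even T N q≡2N (b∉MA T N q≡2N)
    module E* = EvenType.Even (dual T) P p≡2P (b∉MA (dual T) P p≡2P)

    D D* : ℕ
    D  = ℕ.pred (E.r ℕ.* E.r)
    D* = ℕ.pred (E*.r ℕ.* E*.r)

    -- The displacement of `m` under `a²` lies in `⟨a⟩` by the quotient for this group. Since `b²`
    -- acts on `M` as `a²` does, the quotient for the dual group puts the same element into `⟨b⟩`.
    a²-central : N ∣ D → P ∣ D* → ∀ {m} → InM m → conj (conj m a) a ≈ m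
    a²-central N∣D P∣D* {m} m∈ = x∙y⁻¹≈ε⇒x≈y _ m (trans (proj₂ in-A) (A∩B (proj₁ in-A) (proj₁ in-B) (trans (sym (proj₂ in-A)) (proj₂ in-B))))
      where
      in-A : InA (conj (conj m a) a ∙ m ⁻¹)
      in-A = E.a²-central N∣D m∈
      in-A* : C*.InA (C*.conj (C*.conj m (b ⁻¹)) (b ⁻¹) ∙ m ⁻¹)
      in-A* = E*.a²-central P∣D* (M⊆M* m∈)
      conj*≈ : ∀ g → C*.conj g (b ⁻¹) ≈ b ∙ g ∙ b ⁻¹
      conj*≈ g = ∙-congʳ (∙-congʳ (⁻¹-involutive b))
      in-B : InB (conj (conj m a) a ∙ m ⁻¹)
      in-B = let i , e = in-A* ; j , e′ = B-inv (i , refl) in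
        j , trans (∙-congʳ (sym (b²-conj m∈))) (trans (∙-congʳ (sym (trans (conj*≈ _) (∙-congʳ (∙-congˡ (conj*≈ m)))))) (trans e (trans (^-⁻¹ b i) e′)))

    outcome : Outcome p q ⊎ Outcome q p
    outcome = cases (N ∣? D) (P ∣? D*)
      where
      cases : Dec (N ∣ D) → Dec (P ∣ D*) → Outcome p q ⊎ Outcome q p
      cases (no N∤D) _ = inj₁ (≡.subst₂ Outcome (≡.sym p≡2P) (≡.sym q≡2N) (even-outcome P N E.r D E.r*r≡1+D E.prime∣D
        (≡.subst₂ (λ q p → q ∣ p ℕ.* suc E.r) q≡2N p≡2P (E.q∣p*[1+r] P p≡2P)) N∤D))
      cases _ (no P∤D*) = inj₂ (≡.subst₂ Outcome (≡.sym q≡2N) (≡.sym p≡2P) (even-outcome N P E*.r D* E*.r*r≡1+D E*.prime∣D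
        (≡.subst₂ (λ q p → q ∣ p ℕ.* suc E*.r) p≡2P q≡2N (E*.q∣p*[1+r] N q≡2N)) P∤D*))
      cases (yes N∣D) (yes P∣D*) = ⊥-elim (chiral (EvenReflection.reflexible T (b∉MA T N q≡2N) (a²-central N∣D P∣D*)))

  necessity : ∀ {p q} → 2 ℕ.≤ p → 2 ℕ.≤ q → (T : TightGroup p q) → ¬ Reflexible T → Conditions p q
  necessity {p} {q} 2≤p 2≤q T chiral = cases (parity p) (parity q)
    where
    instance
      p≢0 : NonZero p
      p≢0 = ℕ.>-nonZero (ℕₚ.<⇒≤ 2≤p)
      q≢0 : NonZero q
      q≢0 = ℕ.>-nonZero (ℕₚ.<⇒≤ 2≤q)
    even : ∀ {n} k → n ≡ 2 ℕ.* k → Even n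
    even k e = divides k (≡.trans e (ℕₚ.*-comm 2 k))
    conclude : Even p → Even q → Outcome p q ⊎ Outcome q p → Conditions p q
    conclude ep eq (inj₁ (inj₁ x)) = inj₂ (inj₂ (inj₁ (ep , eq , x)))
    conclude ep eq (inj₂ (inj₁ x)) = inj₂ (inj₂ (inj₂ (inj₁ (ep , eq , x))))
    conclude ep eq (inj₁ (inj₂ x)) = inj₂ (inj₂ (inj₂ (inj₂ (inj₁ x))))
    conclude ep eq (inj₂ (inj₂ x)) = inj₂ (inj₂ (inj₂ (inj₂ (inj₂ x))))
    cases : (∃ λ k → p ≡ 2 ℕ.* k ⊎ p ≡ suc (2 ℕ.* k)) → (∃ λ k → q ≡ 2 ℕ.* k ⊎ q ≡ suc (2 ℕ.* k)) → Conditions p q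
    -- Both parities of `p` arrive here: `odd-type` derives that `p` is even.
    cases _              (k , inj₂ q≡) = inj₁ (odd-type T chiral 2≤p k q≡)
    cases (k , inj₂ p≡)  _             = inj₂ (inj₁ (odd-type (dual T) (λ ρ → chiral (Duality.reflexible-dual T ρ)) 2≤q k p≡))
    cases (P , inj₁ p≡)  (N , inj₁ q≡) = conclude (even P p≡) (even N q≡) (EvenBoth.outcome T chiral P N p≡ q≡)

-- Double counting in a tight polyhedron.

module Counting where
  open import Data.Nat.Base using (ℕ; zero; suc; _+_; _*_; _≤_; s≤s; z≤n; NonZero)
  import Data.Nat.Properties as ℕₚ
  open import Data.Nat.Tactic.RingSolver using (solve-∀)
  open import Data.Bool.Base using (Bool; true; false; T; _∧_; if_then_else_)
  open import Data.Fin.Base using (Fin; zero; suc)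
  open import Data.Fin.Properties using (suc-injective; injective⇒≤)
  open import Data.Fin.Patterns
  open import Data.Product using (∃; _,_; proj₁; proj₂)
  open import Data.Sum using (_⊎_; inj₁; inj₂)
  open import Data.Unit using (tt)
  open import Data.Empty using (⊥-elim)
  open import Relation.Binary.PropositionalEquality

  record Enumeration {n : ℕ} (k : ℕ) (b : Fin n → Bool) : Set where
    field
      element   : Fin k → Fin n
      injective : ∀ {i j} → element i ≡ element j → i ≡ j
      valid     : ∀ i → T (b (element i))
      index     : ∀ j → T (b j) → ∃ λ i → element i ≡ j

  private
    enumerate-step : ∀ {n k} (b : Fin (suc n) → Bool) → Enumeration k (λ i → b (suc i)) →
      Enumeration ((if b zero then 1 else 0) + k) b
    enumerate-step {n} {k} b E with b zero in eq
    ... | true  = record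
      { element   = element
      ; injective = injective
      ; valid     = λ { zero → subst T (sym eq) tt ; (suc i) → E.valid i }
      ; index     = λ { zero _ → zero , refl ; (suc j) t → let i , e = E.index j t in suc i , cong suc e }
      }
      where
      module E = Enumeration E
      element : Fin (suc k) → Fin (suc n)
      element zero    = zero
      element (suc i) = suc (E.element i)
      injective : ∀ {i j} → element i ≡ element j → i ≡ j
      injective {zero}  {zero}  _ = refl
      injective {suc i} {suc j} e = cong suc (E.injective (suc-injective e))
    ... | false = record
      { element   = λ i → suc (E.element i)
      ; injective = λ e → E.injective (suc-injective e)
      ; valid     = E.valid
      ; index     = λ { zero t → ⊥-elim (subst T eq t) ; (suc j) t → let i , e = E.index j t in i , cong suc e }
      }
      where module E = Enumeration E

  enumerate : ∀ n b → Enumeration (count n b) b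
  enumerate zero    b = record { element = λ () ; injective = λ { {()} } ; valid = λ () ; index = λ () }
  enumerate (suc n) b = enumerate-step b (enumerate n (λ i → b (suc i)))

  enumerated : ∀ {n k b} → count n b ≡ k → Enumeration k b
  enumerated {n} {b = b} refl = enumerate n b

  private
    enumerations-≤ : ∀ {n k l} {b : Fin n → Bool} → Enumeration k b → Enumeration l b → k ≤ l
    enumerations-≤ {b = b} E F = injective⇒≤ {f = λ i → proj₁ (F.index (E.element i) (E.valid i))} λ {i} {j} e →
      E.injective (trans (sym (proj₂ (F.index (E.element i) (E.valid i)))) (trans (cong F.element e) (proj₂ (F.index (E.element j) (E.valid j)))))
      where
      module E = Enumeration E
      module F = Enumeration F

  count-unique : ∀ {n k} {b : Fin n → Bool} → Enumeration k b → count n b ≡ k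
  count-unique {n} {b = b} E = ℕₚ.≤-antisym (enumerations-≤ (enumerate n b) E) (enumerations-≤ E (enumerate n b))

  record Other {n : ℕ} (b : Fin n → Bool) (i : Fin n) : Set where
    field
      other    : Fin n
      distinct : i ≢ other
      holds    : T (b other)
      only     : ∀ k → T (b k) → k ≡ i ⊎ k ≡ other

  the-other : ∀ {n} {b : Fin n → Bool} → count n b ≡ 2 → ∀ i → T (b i) → Other b i
  the-other {n} {b} c≡2 i bi = from (E.index i bi)
    where
    module E = Enumeration (enumerated {n} {2} {b} c≡2)
    only : ∀ k → T (b k) → k ≡ E.element 0F ⊎ k ≡ E.element 1F
    only k bk with E.index k bk
    ... | 0F , e = inj₁ (sym e)
    ... | 1F , e = inj₂ (sym e)
    swap : ∀ {A B : Set} → A ⊎ B → B ⊎ A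
    swap (inj₁ x) = inj₂ x
    swap (inj₂ y) = inj₁ y
    distinct : E.element 0F ≢ E.element 1F
    distinct e with () ← E.injective e
    from : (∃ λ j → E.element j ≡ i) → Other b i
    from (0F , refl) = record { other = E.element 1F ; distinct = distinct ; holds = E.valid 1F ; only = only }
    from (1F , refl) = record { other = E.element 0F ; distinct = λ e → distinct (sym e) ; holds = E.valid 0F ; only = λ k t → swap (only k t) }

  count-two : ∀ {n} {b : Fin n → Bool} i j → i ≢ j → T (b i) → T (b j) → (∀ k → T (b k) → k ≡ i ⊎ k ≡ j) → count n b ≡ 2
  count-two {n} {b} i j i≢j bi bj only = count-unique record
    { element   = element
    ; injective = injective
    ; valid     = λ { 0F → bi ; 1F → bj }
    ; index     = index
    }
    where
    element : Fin 2 → Fin n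
    element 0F = i
    element 1F = j
    injective : ∀ {k l} → element k ≡ element l → k ≡ l
    injective {0F} {0F} e = refl
    injective {1F} {1F} e = refl
    injective {0F} {1F} e = ⊥-elim (i≢j e)
    injective {1F} {0F} e = ⊥-elim (i≢j (sym e))
    index : ∀ k → T (b k) → ∃ λ l → element l ≡ k
    index k t with only k t
    ... | inj₁ refl = 0F , refl
    ... | inj₂ refl = 1F , refl

  indicator : Bool → ℕ
  indicator x = if x then 1 else 0

  sum-cong : ∀ n {f g : Fin n → ℕ} → (∀ i → f i ≡ g i) → sumFin n f ≡ sumFin n g
  sum-cong zero    h = refl
  sum-cong (suc n) h = cong₂ _+_ (h zero) (sum-cong n (λ i → h (suc i)))

  sum-const : ∀ n c → sumFin n (λ _ → c) ≡ n * c
  sum-const zero    c = refl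
  sum-const (suc n) c = cong (c +_) (sum-const n c)

  sum-+ : ∀ n (f g : Fin n → ℕ) → sumFin n (λ i → f i + g i) ≡ sumFin n f + sumFin n g
  sum-+ zero    f g = refl
  sum-+ (suc n) f g = trans (cong (f zero + g zero +_) (sum-+ n (λ i → f (suc i)) (λ i → g (suc i)))) (shuffle (f zero) (g zero) _ _)
    where
    shuffle : ∀ w x y z → w + x + (y + z) ≡ w + y + (x + z)
    shuffle = solve-∀

  sum-swap : ∀ m n (f : Fin m → Fin n → ℕ) → sumFin m (λ i → sumFin n (f i)) ≡ sumFin n (λ j → sumFin m (λ i → f i j))
  sum-swap zero    n f = sym (trans (sum-const n 0) (ℕₚ.*-zeroʳ n))
  sum-swap (suc m) n f = trans (cong (sumFin n (f zero) +_) (sum-swap m n (λ i → f (suc i))))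
    (sym (sum-+ n (f zero) (λ j → sumFin m (λ i → f (suc i) j))))

  count≡sum : ∀ n b → count n b ≡ sumFin n (λ i → indicator (b i))
  count≡sum zero    b = refl
  count≡sum (suc n) b = cong (indicator (b zero) +_) (count≡sum n (λ i → b (suc i)))

  count-cong : ∀ n {b c : Fin n → Bool} → (∀ i → b i ≡ c i) → count n b ≡ count n c
  count-cong n {b} {c} h = trans (count≡sum n b) (trans (sum-cong n (λ i → cong indicator (h i))) (sym (count≡sum n c)))

  count-false : ∀ n → count n (λ _ → false) ≡ 0
  count-false n = trans (count≡sum n _) (trans (sum-const n 0) (ℕₚ.*-zeroʳ n))

  sum-*2 : ∀ n (f : Fin n → ℕ) → sumFin n (λ i → 2 * f i) ≡ 2 * sumFin n f
  sum-*2 zero    f = refl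
  sum-*2 (suc n) f = trans (cong (2 * f zero +_) (sum-*2 n (λ i → f (suc i)))) (sym (ℕₚ.*-distribˡ-+ 2 (f zero) _))

  sum-double-count : ∀ n (f : Fin n → ℕ) (b : Fin n → Bool) → (∀ i → f i ≡ 2 * indicator (b i)) → sumFin n f ≡ 2 * count n b
  sum-double-count n f b h = trans (sum-cong n h) (trans (sum-*2 n _) (cong (2 *_) (sym (count≡sum n b))))

  count-swap : ∀ m n (r : Fin m → Fin n → Bool) → sumFin m (λ i → count n (r i)) ≡ sumFin n (λ j → count m (λ i → r i j))
  count-swap m n r = trans (sum-cong m (λ i → count≡sum n (r i))) (trans (sum-swap m n _) (sum-cong n (λ j → sym (count≡sum m (λ i → r i j)))))

  count≤n : ∀ n b → count n b ≤ n
  count≤n zero    b = z≤n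
  count≤n (suc n) b with b zero
  ... | true  = s≤s (count≤n n _)
  ... | false = ℕₚ.m≤n⇒m≤1+n (count≤n n _)

  count-full : ∀ n b → count n b ≡ n → ∀ i → T (b i)
  count-full (suc n) b e i with b zero in eq
  count-full (suc n) b e zero    | true  = subst T (sym eq) tt
  count-full (suc n) b e (suc i) | true  = count-full n (λ j → b (suc j)) (ℕₚ.suc-injective e) i
  count-full (suc n) b e i       | false = ⊥-elim (ℕₚ.1+n≰n (subst (_≤ n) e (count≤n n (λ j → b (suc j)))))

  T-ext : ∀ {x y} → (T x → T y) → (T y → T x) → x ≡ y
  T-ext {true}  {true}  f g = refl
  T-ext {false} {false} f g = refl
  T-ext {true}  {false} f g = ⊥-elim (f tt)
  T-ext {false} {true}  f g = ⊥-elim (g tt)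

  module _ (P : RankedPoset) (isPolyhedron : IsPolyhedron P) {p q} (type : HasType P p q) where
    open RankedPoset P
    open IsPolyhedron isPolyhedron

    -- Each vertex is on `q` edges and each edge on two faces; `trans012` supplies the remaining
    -- incidence. Comparison with tightness leaves exactly `p` vertices.
    numFlags≡ : numFlags ≡ nv * (2 * q)
    numFlags≡ = trans (sum-cong nv at-vertex) (sum-const nv (2 * q))
      where
      at-edge : ∀ v e → count nf (λ f → I01 v e ∧ I12 e f ∧ I02 v f) ≡ 2 * indicator (I01 v e)
      at-edge v e with I01 v e in eq
      ... | false = count-false nf
      ... | true  = trans (count-cong nf λ f → drop f (trans012 v e f (subst T (sym eq) tt))) (edge-faces e)
        where
        drop : ∀ f → (T (I12 e f) → T (I02 v f)) → I12 e f ∧ I02 v f ≡ I12 e f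
        drop f h with I12 e f | I02 v f
        ... | false | _     = refl
        ... | true  | true  = refl
        ... | true  | false = ⊥-elim (h tt)
      at-vertex : ∀ v → sumFin ne (λ e → count nf λ f → I01 v e ∧ I12 e f ∧ I02 v f) ≡ 2 * q
      at-vertex v = trans (sum-double-count ne _ (I01 v) (at-edge v)) (cong (2 *_) (proj₂ type v))

    module _ (tight : Tight P p q) .{{_ : NonZero q}} where

      nv≡p : nv ≡ p
      nv≡p = ℕₚ.*-cancelʳ-≡ nv p (2 * q) {{ℕₚ.m*n≢0 2 q}} (trans (sym numFlags≡) (trans tight (shuffle p q)))
        where
        shuffle : ∀ p q → 2 * p * q ≡ p * (2 * q)
        shuffle = solve-∀

      corner : ∀ v f → count ne (λ e → I01 v e ∧ I12 e f) ≡ 2 * indicator (I02 v f)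
      corner v f with I02 v f in eq
      ... | true  = diamond v f (subst T (sym eq) tt)
      ... | false = trans (count-cong ne λ e → no-edge e) (count-false ne)
        where
        no-edge : ∀ e → I01 v e ∧ I12 e f ≡ false
        no-edge e with I01 v e in eq₁ | I12 e f in eq₂
        ... | false | _     = refl
        ... | true  | false = refl
        ... | true  | true  = ⊥-elim (subst T eq (trans012 v e f (subst T (sym eq₁) tt) (subst T (sym eq₂) tt)))

      -- For a fixed face, incident pairs of a vertex and an edge of that face are counted twice:
      -- two for each vertex on the face, two for each of its `p` edges. So the face has `p`
      -- vertices, and there are no more.
      all-incident : ∀ v f → T (I02 v f)
      all-incident v f = count-full nv (λ v → I02 v f) (trans (ℕₚ.*-cancelˡ-≡ _ _ 2 doubled) (sym nv≡p)) v
        where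
        at-edge : ∀ e → count nv (λ v → I01 v e ∧ I12 e f) ≡ 2 * indicator (I12 e f)
        at-edge e with I12 e f
        ... | true  = trans (count-cong nv (λ v → ∧-identityʳ (I01 v e))) (edge-vertices e)
          where open import Data.Bool.Properties using (∧-identityʳ)
        ... | false = trans (count-cong nv (λ v → ∧-zeroʳ (I01 v e))) (count-false nv)
          where open import Data.Bool.Properties using (∧-zeroʳ)
        doubled : 2 * count nv (λ v → I02 v f) ≡ 2 * p
        doubled = trans (sym (sum-double-count nv _ (λ v → I02 v f) (λ v → corner v f)))
          (trans (count-swap nv ne (λ v e → I01 v e ∧ I12 e f))
          (trans (sum-double-count ne _ (λ e → I12 e f) at-edge) (cong (2 *_) (proj₁ type f))))

      nf≡q : Fin nv → nf ≡ q
      nf≡q v = ℕₚ.*-cancelˡ-≡ nf q 2 (trans (ℕₚ.*-comm 2 nf) (trans (sym (trans (sum-cong nf (λ f → diamond v f (all-incident v f))) (sum-const nf 2)))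
        (trans (count-swap nf ne (λ f e → I01 v e ∧ I12 e f)) (trans (sum-double-count ne _ (I01 v) at-edge) (cong (2 *_) (proj₂ type v))))))
        where
        at-edge : ∀ e → count nf (λ f → I01 v e ∧ I12 e f) ≡ 2 * indicator (I01 v e)
        at-edge e with I01 v e
        ... | true  = edge-faces e
        ... | false = count-false nf

-- Iterates and exact periods.

module Iteration where
  open import Data.Nat.Base using (ℕ; zero; suc; _+_; _*_; _≤_; _<_; NonZero)
  import Data.Nat.Properties as ℕₚ
  open import Data.Nat.DivMod using (_%_; _/_; m≡m%n+[m/n]*n; m%n<n)
  open import Data.Nat.Divisibility using (_∣_; m%n≡0⇒n∣m)
  open import Data.Fin.Base using (Fin; toℕ; fromℕ<)
  open import Data.Fin.Properties using (pigeonhole; toℕ<n; injective⇒≤; fromℕ<-injective)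
  open import Data.Product using (∃; _,_; proj₁; proj₂)
  open import Data.Empty using (⊥-elim)
  open import Relation.Binary.PropositionalEquality

  iter : {A : Set} → (A → A) → ℕ → A → A
  iter f zero    x = x
  iter f (suc n) x = f (iter f n x)

  iter-+ : {A : Set} (f : A → A) → ∀ m n x → iter f (m + n) x ≡ iter f m (iter f n x)
  iter-+ f zero    n x = refl
  iter-+ f (suc m) n x = cong f (iter-+ f m n x)

  iter-injective : {A : Set} (f : A → A) → (∀ {x y} → f x ≡ f y → x ≡ y) → ∀ n {x y} → iter f n x ≡ iter f n y → x ≡ y
  iter-injective f inj zero    e = e
  iter-injective f inj (suc n) e = iter-injective f inj n (inj e)

  -- If the first p values of a sequence with periods E exhaust p objects, the periods are the multiples of p.
  module CyclicOrder (p : ℕ) {{p≢0 : NonZero p}} (E : ℕ → Set) (f : ℕ → Fin p)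
    (surjective : ∀ v → ∃ λ i → f i ≡ v)
    (coincide : ∀ d i → f (d + i) ≡ f i → E d)
    (periodic : ∀ d → E d → ∀ i → f (d + i) ≡ f i) where

    f-mod : ∀ d {{_ : NonZero d}} → E d → ∀ i → f i ≡ f (i % d)
    f-mod d Ed i = trans (cong f (trans (m≡m%n+[m/n]*n i d) (ℕₚ.+-comm (i % d) _))) (reduce (i / d) (i % d))
      where
      reduce : ∀ k r → f (k * d + r) ≡ f r
      reduce zero    r = refl
      reduce (suc k) r = trans (cong f (ℕₚ.+-assoc d (k * d) r)) (trans (periodic d Ed (k * d + r)) (reduce k r))

    p≤period : ∀ d → E (suc d) → p ≤ suc d
    p≤period d Ed = injective⇒≤ {f = g} λ {v} {w} e → trans (sym (g-section v)) (trans (cong f (fromℕ<-injective _ _ _ _ e)) (g-section w))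
      where
      g : Fin p → Fin (suc d)
      g v = fromℕ< (m%n<n (proj₁ (surjective v)) (suc d))
      g-section : ∀ v → f (proj₁ (surjective v) % suc d) ≡ v
      g-section v = trans (sym (f-mod (suc d) Ed (proj₁ (surjective v)))) (proj₂ (surjective v))

    -- The pigeonhole principle on `p + 1` values yields a period at most `p`, while surjectivity
    -- excludes anything shorter.
    E-p : E p
    E-p with pigeonhole (ℕₚ.n<1+n p) (λ (i : Fin (suc p)) → f (toℕ i))
    ... | i , j , i<j , e with ℕₚ.m≤n⇒∃[o]m+o≡n i<j
    ... | o , eq = subst E (ℕₚ.≤-antisym o≤p (p≤period o E-o)) E-o
      where
      j≡ : suc o + toℕ i ≡ toℕ j
      j≡ = trans (cong suc (ℕₚ.+-comm o (toℕ i))) eq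
      E-o : E (suc o)
      E-o = coincide (suc o) (toℕ i) (trans (cong f j≡) (sym e))
      o≤p : suc o ≤ p
      o≤p = ℕₚ.≤-trans (ℕₚ.m≤m+n (suc o) (toℕ i)) (ℕₚ.≤-trans (ℕₚ.≤-reflexive j≡) (ℕₚ.≤-pred (toℕ<n j)))

    period⇒∣ : ∀ d → E d → p ∣ d
    period⇒∣ d Ed = m%n≡0⇒n∣m d p (remainder (d % p) refl)
      where
      E-remainder : E (d % p)
      E-remainder = coincide (d % p) 0 (trans (cong f (ℕₚ.+-identityʳ (d % p))) (trans (sym (f-mod p E-p d))
        (trans (cong f (sym (ℕₚ.+-identityʳ d))) (periodic d Ed 0))))
      remainder : ∀ r → d % p ≡ r → d % p ≡ 0
      remainder zero    e = e
      remainder (suc r) e = ⊥-elim (ℕₚ.<⇒≱ (subst (_< p) e (m%n<n d p)) (p≤period r (subst E e E-remainder)))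

-- Groups generated by two permutations of finite order.

module WordGroups where
  open import Algebra.Bundles using (Group)
  open import Level using (0ℓ)
  open import Data.Nat.Base as ℕ using (ℕ; zero; suc; NonZero)
  import Data.Nat.Properties as ℕₚ
  open import Data.Bool.Base using (Bool; true; false)
  open import Data.List.Base using (List; []; _∷_; _++_; replicate)
  open import Data.List.Properties using (++-assoc; ++-identityʳ)
  open import Data.Product using (_,_)
  open import Relation.Binary.Bundles using (Setoid)
  open import Relation.Binary.PropositionalEquality as ≡ using (_≡_)
  open Iteration

  -- The group generated by two permutations α and β of finite order, as words acting from the left.
  module WordGroup (S : Setoid 0ℓ 0ℓ) (α β : Setoid.Carrier S → Setoid.Carrier S)
    (α-cong : ∀ {x y} → Setoid._≈_ S x y → Setoid._≈_ S (α x) (α y))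
    (β-cong : ∀ {x y} → Setoid._≈_ S x y → Setoid._≈_ S (β x) (β y))
    (p q : ℕ) {{p≢0 : NonZero p}} {{q≢0 : NonZero q}}
    (α^p : ∀ x → Setoid._≈_ S (iter α p x) x) (β^q : ∀ x → Setoid._≈_ S (iter β q x) x) where

    open Setoid S

    letter : Bool → Carrier → Carrier
    letter true  = α
    letter false = β

    letter-cong : ∀ s {x y} → x ≈ y → letter s x ≈ letter s y
    letter-cong true  = α-cong
    letter-cong false = β-cong

    act : List Bool → Carrier → Carrier
    act []      x = x
    act (s ∷ w) x = letter s (act w x)

    act-cong : ∀ w {x y} → x ≈ y → act w x ≈ act w y
    act-cong []      e = e
    act-cong (s ∷ w) e = letter-cong s (act-cong w e)

    act-++ : ∀ v w x → act (v ++ w) x ≡ act v (act w x)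
    act-++ []      w x = ≡.refl
    act-++ (s ∷ v) w x = ≡.cong (letter s) (act-++ v w x)

    -- Finite order lets a positive power serve as inverse, so words have no inverse letters.
    inverse-letter : Bool → List Bool
    inverse-letter true  = replicate (ℕ.pred p) true
    inverse-letter false = replicate (ℕ.pred q) false

    act-replicate : ∀ s k x → act (replicate k s) x ≡ iter (letter s) k x
    act-replicate s zero    x = ≡.refl
    act-replicate s (suc k) x = ≡.cong (letter s) (act-replicate s k x)

    letter-inverse : ∀ s x → letter s (act (inverse-letter s) x) ≈ x
    letter-inverse true  x = trans (reflexive (≡.trans (≡.cong α (act-replicate true (ℕ.pred p) x)) (≡.cong (λ k → iter α k x) (ℕₚ.suc-pred p)))) (α^p x)
    letter-inverse false x = trans (reflexive (≡.trans (≡.cong β (act-replicate false (ℕ.pred q) x)) (≡.cong (λ k → iter β k x) (ℕₚ.suc-pred q)))) (β^q x)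

    iter-comm : {A : Set} (f : A → A) → ∀ k x → iter f k (f x) ≡ f (iter f k x)
    iter-comm f zero    x = ≡.refl
    iter-comm f (suc k) x = ≡.cong f (iter-comm f k x)

    inverse-letter-act : ∀ s x → act (inverse-letter s) (letter s x) ≈ x
    inverse-letter-act true  x = trans (reflexive (≡.trans (act-replicate true (ℕ.pred p) (α x)) (≡.trans (iter-comm α (ℕ.pred p) x) (≡.cong (λ k → iter α k x) (ℕₚ.suc-pred p))))) (α^p x)
    inverse-letter-act false x = trans (reflexive (≡.trans (act-replicate false (ℕ.pred q) (β x)) (≡.trans (iter-comm β (ℕ.pred q) x) (≡.cong (λ k → iter β k x) (ℕₚ.suc-pred q))))) (β^q x)

    inverse : List Bool → List Bool
    inverse []      = []
    inverse (s ∷ w) = inverse w ++ inverse-letter s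

    act-inverseˡ : ∀ w x → act (inverse w ++ w) x ≈ x
    act-inverseˡ w x = trans (reflexive (act-++ (inverse w) w x)) (cancel w x)
      where
      cancel : ∀ w x → act (inverse w) (act w x) ≈ x
      cancel []      x = refl
      cancel (s ∷ w) x = trans (reflexive (act-++ (inverse w) (inverse-letter s) _))
        (trans (act-cong (inverse w) (inverse-letter-act s (act w x))) (cancel w x))

    act-inverseʳ : ∀ w x → act (w ++ inverse w) x ≈ x
    act-inverseʳ w x = trans (reflexive (act-++ w (inverse w) x)) (cancel w x)
      where
      cancel : ∀ w x → act w (act (inverse w) x) ≈ x
      cancel []      x = refl
      cancel (s ∷ w) x = trans (letter-cong s (trans (act-cong w (reflexive (act-++ (inverse w) (inverse-letter s) x))) (cancel w _)))
        (letter-inverse s x)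

    group : Group 0ℓ 0ℓ
    group = record
      { Carrier = List Bool
      ; _≈_ = λ v w → ∀ x → act v x ≈ act w x
      ; _∙_ = _++_
      ; ε = []
      ; _⁻¹ = inverse
      ; isGroup = record
        { isMonoid = record
          { isSemigroup = record
            { isMagma = record
              { isEquivalence = record
                { refl  = λ x → refl
                ; sym   = λ e x → sym (e x)
                ; trans = λ e e′ x → trans (e x) (e′ x)
                }
              ; ∙-cong = λ {v} {v′} {w} {w′} e e′ x → trans (reflexive (act-++ v w x))
                  (trans (act-cong v (e′ x)) (trans (e (act w′ x)) (sym (reflexive (act-++ v′ w′ x)))))
              }
            ; assoc = λ u v w x → reflexive (≡.cong (λ z → act z x) (++-assoc u v w))
            }
          ; identity = (λ w x → refl) , (λ w x → reflexive (≡.cong (λ z → act z x) (++-identityʳ w)))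
          }
        ; inverse = act-inverseˡ , act-inverseʳ
        ; ⁻¹-cong = λ {v} {w} e x → trans (sym (act-inverseˡ w (act (inverse v) x)))
            (trans (reflexive (act-++ (inverse w) w _)) (trans (act-cong (inverse w) (sym (e _)))
            (act-cong (inverse w) (trans (sym (reflexive (act-++ v (inverse v) x))) (act-inverseʳ v x)))))
        }
      }

    open TightGroups.Powers group using (_^_)

    act-^ : ∀ s k x → act ((s ∷ []) ^ k) x ≡ iter (letter s) k x
    act-^ s zero    x = ≡.refl
    act-^ s (suc k) x = ≡.cong (letter s) (act-^ s k x)

-- From a tight chiral polyhedron to its rotation group.

module FlagGroup where
  open import Level using (0ℓ)
  open import Data.Nat.Base as ℕ using (ℕ; zero; suc; NonZero)
  import Data.Nat.Properties as ℕₚ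
  open import Data.Nat.Divisibility using (_∣_)
  open import Data.Bool.Base using (Bool; true; false; T; _∧_; not)
  open import Data.Bool.Properties using (T-irrelevant; T-∧; ¬-not; not-¬; not-involutive) renaming (_≟_ to _≟ᵇ_)
  open import Data.Fin.Base using (Fin; toℕ)
  open import Data.Fin.Patterns
  open import Data.Fin.Properties using (pigeonhole) renaming (_≟_ to _≟ᶠ_)
  open import Algebra.Bundles using (Group)
  open import Data.List.Base using (List; []; _∷_; _++_)
  open import Data.Product using (Σ; ∃; _×_; _,_; proj₁; proj₂)
  open import Data.Sum using (_⊎_; inj₁; inj₂)
  open import Data.Empty using (⊥-elim)
  open import Relation.Nullary using (¬_; yes; no)
  open import Relation.Binary.Bundles using (Setoid)
  open import Relation.Binary.Construct.Closure.ReflexiveTransitive using (Star) renaming (ε to nil; _◅_ to _◅_)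
  open import Relation.Binary.PropositionalEquality
  open import Function.Bundles using (_↔_; Inverse; Equivalence; mk↔ₛ′)
  open import Function.Properties.Inverse using (↔-trans)
  open TightGroups
  open Counting
  open Iteration
  open WordGroups

  module Flags (P : RankedPoset) (isPolyhedron : IsPolyhedron P) where
    open RankedPoset P
    open IsPolyhedron isPolyhedron

    flag : ∀ v e f → T (I01 v e) → T (I12 e f) → Flag
    flag v e f i j = v , e , f , i , j , trans012 v e f i j

    flag-≡ : ∀ {Φ Ψ : Flag} → fv Φ ≡ fv Ψ → fe Φ ≡ fe Ψ → ff Φ ≡ ff Ψ → Φ ≡ Ψ
    flag-≡ {v , e , f , i , j , k} {v , e , f , i′ , j′ , k′} refl refl refl
      with refl ← T-irrelevant i i′ | refl ← T-irrelevant j j′ | refl ← T-irrelevant k k′ = refl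

    both : ∀ {x y} → T x → T y → T (x ∧ y)
    both s t = Equivalence.from T-∧ (s , t)

    left : ∀ {x y} → T (x ∧ y) → T x
    left t = proj₁ (Equivalence.to T-∧ t)

    right : ∀ {x} {y} → T (x ∧ y) → T y
    right {x} t = proj₂ (Equivalence.to (T-∧ {x}) t)

    module V (Φ : Flag) where
      open Other (the-other {b = λ v → I01 v (fe Φ)} (edge-vertices (fe Φ)) (fv Φ) (proj₁ (proj₂ (proj₂ (proj₂ Φ))))) public
    module E (Φ : Flag) where
      open Other (the-other {b = λ e → I01 (fv Φ) e ∧ I12 e (ff Φ)} (diamond (fv Φ) (ff Φ) (proj₂ (proj₂ (proj₂ (proj₂ (proj₂ Φ)))))) (fe Φ)
        (both (proj₁ (proj₂ (proj₂ (proj₂ Φ)))) (proj₁ (proj₂ (proj₂ (proj₂ (proj₂ Φ))))))) public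
    module F (Φ : Flag) where
      open Other (the-other {b = λ f → I12 (fe Φ) f} (edge-faces (fe Φ)) (ff Φ) (proj₁ (proj₂ (proj₂ (proj₂ (proj₂ Φ)))))) public

    abstract
      -- The adjacent flag, usually written `Φ^n`.
      r : Fin 3 → Flag → Flag
      r 0F Φ@(v , e , f , i , j , k) = flag (V.other Φ) e f (V.holds Φ) j
      r 1F Φ@(v , e , f , i , j , k) = flag v (E.other Φ) f (left (E.holds Φ)) (right {I01 v (E.other Φ)} (E.holds Φ))
      r 2F Φ@(v , e , f , i , j , k) = flag v e (F.other Φ) i (F.holds Φ)

      r-adjacent : ∀ n Φ → Adjacent n Φ (r n Φ)
      r-adjacent 0F Φ = V.distinct Φ , refl , refl
      r-adjacent 1F Φ = refl , E.distinct Φ , refl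
      r-adjacent 2F Φ = refl , refl , F.distinct Φ

      r-unique : ∀ n Φ Ψ → Adjacent n Φ Ψ → Ψ ≡ r n Φ
      r-unique 0F Φ (v′ , e , f , i , j , k) (v≢ , refl , refl) with V.only Φ v′ i
      ... | inj₁ v′≡v = ⊥-elim (v≢ (sym v′≡v))
      ... | inj₂ v′≡  = flag-≡ v′≡ refl refl
      r-unique 1F Φ (v , e′ , f , i , j , k) (refl , e≢ , refl) with E.only Φ e′ (both i j)
      ... | inj₁ e′≡e = ⊥-elim (e≢ (sym e′≡e))
      ... | inj₂ e′≡  = flag-≡ refl e′≡ refl
      r-unique 2F Φ (v , e , f′ , i , j , k) (refl , refl , f≢) with F.only Φ f′ j
      ... | inj₁ f′≡f = ⊥-elim (f≢ (sym f′≡f))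
      ... | inj₂ f′≡  = flag-≡ refl refl f′≡

    adjacent-sym : ∀ n {Φ Ψ} → Adjacent n Φ Ψ → Adjacent n Ψ Φ
    adjacent-sym 0F (x , y , z) = (λ e → x (sym e)) , sym y , sym z
    adjacent-sym 1F (x , y , z) = sym x , (λ e → y (sym e)) , sym z
    adjacent-sym 2F (x , y , z) = sym x , sym y , (λ e → z (sym e))

    r-involutive : ∀ n Φ → r n (r n Φ) ≡ Φ
    r-involutive n Φ = sym (r-unique n (r n Φ) Φ (adjacent-sym n {Φ} (r-adjacent n Φ)))

    r-injective : ∀ n {Φ Ψ} → r n Φ ≡ r n Ψ → Φ ≡ Ψ
    r-injective n {Φ} {Ψ} e = trans (sym (r-involutive n Φ)) (trans (cong (r n) e) (r-involutive n Ψ))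

    abstract
      same-other-face : ∀ Φ Ψ → fe Φ ≡ fe Ψ → ff Φ ≡ ff Ψ → F.other Φ ≡ F.other Ψ
      same-other-face Φ Ψ@(v , e , f , i , j , k) refl refl with F.only Φ (F.other Ψ) (F.holds Ψ)
      ... | inj₁ eq = ⊥-elim (F.distinct Ψ (sym eq))
      ... | inj₂ eq = sym eq

      -- The second face of an edge does not depend on the vertex chosen on that edge, so vertex and
      -- face can be changed independently.
      r0r2-comm : ∀ Φ → r 0F (r 2F Φ) ≡ r 2F (r 0F Φ)
      r0r2-comm Φ = sym (r-unique 0F (r 2F Φ) (r 2F (r 0F Φ)) (V.distinct Φ , refl , same-other-face Φ (r 0F Φ) refl refl))

    fe-r0 : ∀ Φ → fe (r 0F Φ) ≡ fe Φ
    fe-r0 Φ = sym (proj₁ (proj₂ (r-adjacent 0F Φ)))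
    ff-r0 : ∀ Φ → ff (r 0F Φ) ≡ ff Φ
    ff-r0 Φ = sym (proj₂ (proj₂ (r-adjacent 0F Φ)))
    fv-r1 : ∀ Φ → fv (r 1F Φ) ≡ fv Φ
    fv-r1 Φ = sym (proj₁ (r-adjacent 1F Φ))
    ff-r1 : ∀ Φ → ff (r 1F Φ) ≡ ff Φ
    ff-r1 Φ = sym (proj₂ (proj₂ (r-adjacent 1F Φ)))
    fv-r2 : ∀ Φ → fv (r 2F Φ) ≡ fv Φ
    fv-r2 Φ = sym (proj₁ (r-adjacent 2F Φ))
    fe-r2 : ∀ Φ → fe (r 2F Φ) ≡ fe Φ
    fe-r2 Φ = sym (proj₁ (proj₂ (r-adjacent 2F Φ)))

    mapFlag : Automorphism → Flag → Flag
    mapFlag α (v , e , f , i , j , k) = flag (a0 v) (a1 e) (a2 f) (subst T (sym (pres01 v e)) i) (subst T (sym (pres12 e f)) j)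
      where open Automorphism α

    ↔-injective : ∀ {n} (σ : Fin n ↔ Fin n) {x y} → Inverse.to σ x ≡ Inverse.to σ y → x ≡ y
    ↔-injective σ {x} {y} e = trans (sym (Inverse.strictlyInverseʳ σ x)) (trans (cong (Inverse.from σ) e) (Inverse.strictlyInverseʳ σ y))

    map-adjacent : ∀ α n Φ Ψ → Adjacent n Φ Ψ → Adjacent n (mapFlag α Φ) (mapFlag α Ψ)
    map-adjacent α 0F Φ Ψ (x , y , z) = (λ e → x (↔-injective (Automorphism.σ0 α) e)) , cong (Automorphism.a1 α) y , cong (Automorphism.a2 α) z
    map-adjacent α 1F Φ Ψ (x , y , z) = cong (Automorphism.a0 α) x , (λ e → y (↔-injective (Automorphism.σ1 α) e)) , cong (Automorphism.a2 α) z
    map-adjacent α 2F Φ Ψ (x , y , z) = cong (Automorphism.a0 α) x , cong (Automorphism.a1 α) y , (λ e → z (↔-injective (Automorphism.σ2 α) e))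

    Natural : (Flag → Flag) → Set
    Natural f = ∀ α Φ → mapFlag α (f Φ) ≡ f (mapFlag α Φ)

    r-natural : ∀ n → Natural (r n)
    r-natural n α Φ = r-unique n (mapFlag α Φ) (mapFlag α (r n Φ)) (map-adjacent α n Φ (r n Φ) (r-adjacent n Φ))

    maps⇒≡ : ∀ α Φ Ψ → Maps α Φ Ψ → mapFlag α Φ ≡ Ψ
    maps⇒≡ α Φ Ψ (x , y , z) = flag-≡ x y z

    -- Connectedness of the neighbourhood of a face: a walk alternates between vertices and edges of
    -- the face, and each of its steps is realised by `r 0F` or `r 1F`.
    face-induction : ∀ (Q : Flag → Set) → (∀ {Φ} → Q Φ → Q (r 0F Φ)) → (∀ {Φ} → Q Φ → Q (r 1F Φ)) →
      ∀ Φ Ψ → ff Φ ≡ ff Ψ → Q Φ → Q Ψ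
    face-induction Q q0 q1 (v , e , f , i , j , k) Ψ@(v′ , e′ , .f , i′ , j′ , k′) refl QΦ =
      walk (face-conn f (edg e , j) (edg e′ , j′)) start Ψ refl refl
      where
      -- A walk names neighbours rather than flags, so the property is carried for every flag of `f`
      -- through the current vertex or edge.
      At : Nbr (fac f) → Set
      At (vtx x , _) = ∀ Ψ → ff Ψ ≡ f → fv Ψ ≡ x → Q Ψ
      At (edg x , _) = ∀ Ψ → ff Ψ ≡ f → fe Ψ ≡ x → Q Ψ
      extend-e : ∀ Φ → Q Φ → ff Φ ≡ f → ∀ Ψ → ff Ψ ≡ f → fe Ψ ≡ fe Φ → Q Ψ
      extend-e Φ QΦ f≡ Ψ f≡′ e≡ with fv Φ ≟ᶠ fv Ψ
      ... | yes v≡ = subst Q (flag-≡ v≡ (sym e≡) (trans f≡ (sym f≡′))) QΦ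
      ... | no  v≢ = subst Q (sym (r-unique 0F Φ Ψ (v≢ , sym e≡ , trans f≡ (sym f≡′)))) (q0 QΦ)
      extend-v : ∀ Φ → Q Φ → ff Φ ≡ f → ∀ Ψ → ff Ψ ≡ f → fv Ψ ≡ fv Φ → Q Ψ
      extend-v Φ QΦ f≡ Ψ f≡′ v≡ with fe Φ ≟ᶠ fe Ψ
      ... | yes e≡ = subst Q (flag-≡ (sym v≡) e≡ (trans f≡ (sym f≡′))) QΦ
      ... | no  e≢ = subst Q (sym (r-unique 1F Φ Ψ (sym v≡ , e≢ , trans f≡ (sym f≡′)))) (q1 QΦ)
      start : At (edg e , j)
      start = extend-e (v , e , f , i , j , k) QΦ refl
      step : ∀ x y → NbrAdj (fac f) x y → At x → At y
      step (vtx x , s) (edg y , t) xy at = extend-e (flag x y f xy t) (at _ refl refl) refl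
      step (edg x , s) (vtx y , t) xy at = extend-v (flag y x f xy s) (at _ refl refl) refl
      step (vtx x , s) (vtx y , t) ()
      step (edg x , s) (edg y , t) ()
      step (fac x , ())
      step (vtx x , s) (fac y , ())
      step (edg x , s) (fac y , ())
      walk : ∀ {x y} → Star (NbrAdj (fac f)) x y → At x → At y
      walk nil at = at
      walk {x} (_◅_ {j = z} s ss) at = walk ss (step x z s at)

    vertex-induction : ∀ (Q : Flag → Set) → (∀ {Φ} → Q Φ → Q (r 1F Φ)) → (∀ {Φ} → Q Φ → Q (r 2F Φ)) →
      ∀ Φ Ψ → fv Φ ≡ fv Ψ → Q Φ → Q Ψ
    vertex-induction Q q1 q2 (v , e , f , i , j , k) Ψ@(.v , e′ , f′ , i′ , j′ , k′) refl QΦ =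
      walk (vertex-conn v (edg e , i) (edg e′ , i′)) start Ψ refl refl
      where
      At : Nbr (vtx v) → Set
      At (fac x , _) = ∀ Ψ → fv Ψ ≡ v → ff Ψ ≡ x → Q Ψ
      At (edg x , _) = ∀ Ψ → fv Ψ ≡ v → fe Ψ ≡ x → Q Ψ
      extend-e : ∀ Φ → Q Φ → fv Φ ≡ v → ∀ Ψ → fv Ψ ≡ v → fe Ψ ≡ fe Φ → Q Ψ
      extend-e Φ QΦ v≡ Ψ v≡′ e≡ with ff Φ ≟ᶠ ff Ψ
      ... | yes f≡ = subst Q (flag-≡ (trans v≡ (sym v≡′)) (sym e≡) f≡) QΦ
      ... | no  f≢ = subst Q (sym (r-unique 2F Φ Ψ (trans v≡ (sym v≡′) , sym e≡ , f≢))) (q2 QΦ)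
      extend-f : ∀ Φ → Q Φ → fv Φ ≡ v → ∀ Ψ → fv Ψ ≡ v → ff Ψ ≡ ff Φ → Q Ψ
      extend-f Φ QΦ v≡ Ψ v≡′ f≡ with fe Φ ≟ᶠ fe Ψ
      ... | yes e≡ = subst Q (flag-≡ (trans v≡ (sym v≡′)) e≡ (sym f≡)) QΦ
      ... | no  e≢ = subst Q (sym (r-unique 1F Φ Ψ (trans v≡ (sym v≡′) , e≢ , sym f≡))) (q1 QΦ)
      start : At (edg e , i)
      start = extend-e (v , e , f , i , j , k) QΦ refl
      step : ∀ x y → NbrAdj (vtx v) x y → At x → At y
      step (fac x , s) (edg y , t) xy at = extend-e (flag v y x t xy) (at _ refl refl) refl
      step (edg x , s) (fac y , t) xy at = extend-f (flag v x y s xy) (at _ refl refl) refl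
      step (fac x , s) (fac y , t) ()
      step (edg x , s) (edg y , t) ()
      step (vtx x , ())
      step (fac x , s) (vtx y , ())
      step (edg x , s) (vtx y , ())
      walk : ∀ {x y} → Star (NbrAdj (vtx v)) x y → At x → At y
      walk nil at = at
      walk {x} (_◅_ {j = z} s ss) at = walk ss (step x z s at)

  subst-Fin-injective : ∀ {m n} (e : m ≡ n) {x y : Fin m} → subst Fin e x ≡ subst Fin e y → x ≡ y
  subst-Fin-injective refl h = h

  subst-Fin-surjective : ∀ {m n} (e : m ≡ n) (y : Fin n) → ∃ λ x → subst Fin e x ≡ y
  subst-Fin-surjective refl y = y , refl

  module ChiralFlags (P : RankedPoset) (isPolyhedron : IsPolyhedron P) {p q : ℕ} (type : HasType P p q) (tight : Tight P p q)
    {{p≢0 : NonZero p}} {{q≢0 : NonZero q}}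
    (cls : RankedPoset.Flag P → Bool)
    (separates : ∀ i Φ Ψ → RankedPoset.Adjacent P i Φ Ψ → cls Φ ≢ cls Ψ)
    (transitive : ∀ Φ Ψ → cls Φ ≡ cls Ψ → Σ (RankedPoset.Automorphism P) λ α → RankedPoset.Maps P α Φ Ψ)
    (Φ₀ : RankedPoset.Flag P) where

    open RankedPoset P
    open IsPolyhedron isPolyhedron
    open Flags P isPolyhedron

    κ : Bool
    κ = cls Φ₀

    cls-r : ∀ n Φ → cls (r n Φ) ≡ not (cls Φ)
    cls-r n Φ = ¬-not λ e → separates n Φ (r n Φ) (r-adjacent n Φ) (sym e)

    -- Automorphisms commute with `f` and `g` and are transitive on a class, so one coincidence
    -- spreads over the class.
    regular : ∀ {f g} → Natural f → Natural g → ∀ {Φ Ψ} → cls Φ ≡ cls Ψ → f Φ ≡ g Φ → f Ψ ≡ g Ψ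
    regular {f} {g} nf ng {Φ} {Ψ} c e = let α , m = transitive Φ Ψ c in
      subst (λ Θ → f Θ ≡ g Θ) (maps⇒≡ α Φ Ψ m) (trans (sym (nf α Φ)) (trans (cong (mapFlag α) e) (ng α Φ)))

    -- Distinct flags with common vertex and face are adjacent, hence in opposite classes.
    same-corner : ∀ {Φ Ψ} → cls Φ ≡ cls Ψ → fv Φ ≡ fv Ψ → ff Φ ≡ ff Ψ → Φ ≡ Ψ
    same-corner {Φ} {Ψ} c v≡ f≡ with fe Φ ≟ᶠ fe Ψ
    ... | yes e≡ = flag-≡ v≡ e≡ f≡
    ... | no  e≢ = ⊥-elim (separates 1F Φ Ψ (v≡ , e≢ , f≡) c)

    rot : Fin 3 → Fin 3 → Flag → Flag
    rot x y Φ = r x (r y Φ)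

    A B : Flag → Flag
    A = rot 0F 1F
    B = rot 1F 2F

    cls-rot : ∀ x y Φ → cls (rot x y Φ) ≡ cls Φ
    cls-rot x y Φ = trans (cls-r x (r y Φ)) (trans (cong not (cls-r y Φ)) (not-involutive (cls Φ)))

    cls-iter : ∀ x y k Φ → cls (iter (rot x y) k Φ) ≡ cls Φ
    cls-iter x y zero    Φ = refl
    cls-iter x y (suc k) Φ = trans (cls-rot x y _) (cls-iter x y k Φ)

    rot-injective : ∀ x y {Φ Ψ} → rot x y Φ ≡ rot x y Ψ → Φ ≡ Ψ
    rot-injective x y e = r-injective y (r-injective x e)

    -- `key` embeds the orbit of the rotation into a finite set. The orbit together with its image
    -- under `r y` is then closed under `r x` and `r y`, and the class separates the two halves.
    module Orbit (x y : Fin 3) (Φ : Flag) {n} (key : Flag → Fin n)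
      (faithful : ∀ i j → key (iter (rot x y) i Φ) ≡ key (iter (rot x y) j Φ) → iter (rot x y) i Φ ≡ iter (rot x y) j Φ) where

      finite : ∃ λ d → iter (rot x y) (suc d) Φ ≡ Φ
      finite with pigeonhole (ℕₚ.n<1+n n) (λ (i : Fin (suc n)) → key (iter (rot x y) (toℕ i) Φ))
      ... | i , j , i<j , e with ℕₚ.m≤n⇒∃[o]m+o≡n i<j
      ... | o , eq = o , iter-injective (rot x y) (rot-injective x y) (toℕ i)
        (trans (sym (iter-+ (rot x y) (toℕ i) (suc o) Φ)) (trans (cong (λ k → iter (rot x y) k Φ) (trans (ℕₚ.+-suc (toℕ i) o) eq)) (sym (faithful (toℕ i) (toℕ j) e))))

      Reach : Flag → Set
      Reach Ψ = ∃ λ i → Ψ ≡ iter (rot x y) i Φ ⊎ Ψ ≡ r y (iter (rot x y) i Φ)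

      reach-y : ∀ {Ψ} → Reach Ψ → Reach (r y Ψ)
      reach-y (i , inj₁ e) = i , inj₂ (cong (r y) e)
      reach-y (i , inj₂ e) = i , inj₁ (trans (cong (r y) e) (r-involutive y _))

      reach-x : ∀ {Ψ} → Reach Ψ → Reach (r x Ψ)
      reach-x (i     , inj₂ e) = suc i , inj₁ (cong (r x) e)
      reach-x (suc i , inj₁ e) = i , inj₂ (trans (cong (r x) e) (r-involutive x _))
      -- At the start of the orbit `r x` leads backwards; finiteness turns this into a forward step
      -- around the cycle.
      reach-x (zero  , inj₁ e) = proj₁ finite , inj₂ (trans (cong (r x) (trans e (sym (proj₂ finite)))) (r-involutive x _))

      reach-class : ∀ {Ψ} → cls Φ ≡ cls Ψ → Reach Ψ → ∃ λ i → Ψ ≡ iter (rot x y) i Φ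
      reach-class c (i , inj₁ e) = i , e
      reach-class {Ψ} c (i , inj₂ e) = ⊥-elim (not-¬ {cls Φ} refl (trans c (trans (cong cls e) (trans (cls-r y _) (cong not (cls-iter x y i Φ))))))

    ff-A : ∀ k Φ → ff (iter A k Φ) ≡ ff Φ
    ff-A zero    Φ = refl
    ff-A (suc k) Φ = trans (ff-r0 _) (trans (ff-r1 _) (ff-A k Φ))

    fv-B : ∀ k Φ → fv (iter B k Φ) ≡ fv Φ
    fv-B zero    Φ = refl
    fv-B (suc k) Φ = trans (fv-r1 _) (trans (fv-r2 _) (fv-B k Φ))

    abstract
      face-orbit : ∀ {Φ Ψ} → cls Φ ≡ cls Ψ → ff Φ ≡ ff Ψ → ∃ λ i → Ψ ≡ iter A i Φ
      face-orbit {Φ} {Ψ} c f≡ = reach-class c (face-induction Reach reach-x reach-y Φ Ψ f≡ (0 , inj₁ refl))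
        where
        open Orbit 0F 1F Φ fv (λ i j e → same-corner (trans (cls-iter 0F 1F i Φ) (sym (cls-iter 0F 1F j Φ))) e (trans (ff-A i Φ) (sym (ff-A j Φ))))

      vertex-orbit : ∀ {Φ Ψ} → cls Φ ≡ cls Ψ → fv Φ ≡ fv Ψ → ∃ λ i → Ψ ≡ iter B i Φ
      vertex-orbit {Φ} {Ψ} c v≡ = reach-class c (vertex-induction Reach reach-x reach-y Φ Ψ v≡ (0 , inj₁ refl))
        where
        open Orbit 1F 2F Φ ff (λ i j e → same-corner (trans (cls-iter 1F 2F i Φ) (sym (cls-iter 1F 2F j Φ))) (trans (fv-B i Φ) (sym (fv-B j Φ))) e)

    -- Changing the element of rank `n` changes the class, so elements of the other two ranks can
    -- always be completed to a flag of class `κ`.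
    in-class : ∀ n Φ → ∃ λ Ψ → cls Ψ ≡ κ × (Ψ ≡ Φ ⊎ Ψ ≡ r n Φ)
    in-class n Φ with cls Φ ≟ᵇ κ
    ... | yes c = Φ , c , inj₁ refl
    ... | no ¬c = r n Φ , trans (cls-r n Φ) (sym (¬-not (λ e → ¬c (sym e)))) , inj₂ refl

    abstract
      corner-flag : ∀ v f → ∃ λ Ψ → cls Ψ ≡ κ × fv Ψ ≡ v × ff Ψ ≡ f
      corner-flag v f = from (in-class 1F Φ)
        where
        v-f : T (I02 v f)
        v-f = all-incident P isPolyhedron type tight v f
        module En = Enumeration (enumerated {ne} {2} {λ e → I01 v e ∧ I12 e f} (diamond v f v-f))
        e : Fin ne
        e = En.element 0F
        Φ : Flag
        Φ = flag v e f (left (En.valid 0F)) (right {I01 v e} (En.valid 0F))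
        from : (∃ λ Ψ → cls Ψ ≡ κ × (Ψ ≡ Φ ⊎ Ψ ≡ r 1F Φ)) → ∃ λ Ψ → cls Ψ ≡ κ × fv Ψ ≡ v × ff Ψ ≡ f
        from (Ψ , c , inj₁ refl) = Ψ , c , refl , refl
        from (Ψ , c , inj₂ refl) = Ψ , c , fv-r1 Φ , ff-r1 Φ

    abstract
      vertices≡p : nv ≡ p
      vertices≡p = nv≡p P isPolyhedron type tight

      faces≡q : nf ≡ q
      faces≡q = nf≡q P isPolyhedron type tight (fv Φ₀)

    -- The rotation `A` about the base face runs through all `p` vertices, since every vertex is on
    -- every face, so its order is exactly `p`. `faceB` is the dual counterpart for `B`.
    vertexA : ℕ → Fin p
    vertexA i = subst Fin vertices≡p (fv (iter A i Φ₀))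

    faceB : ℕ → Fin q
    faceB i = subst Fin faces≡q (ff (iter B i Φ₀))

    abstract
      vertexA-surjective : ∀ v → ∃ λ i → vertexA i ≡ v
      vertexA-surjective v =
        let v′ , e = subst-Fin-surjective vertices≡p v
            Ψ , c , v≡ , f≡ = corner-flag v′ (ff Φ₀)
            i , e′ = face-orbit (sym c) (sym f≡)
        in i , trans (cong (subst Fin vertices≡p) (trans (cong fv (sym e′)) v≡)) e

      vertexA-coincide : ∀ d i → vertexA (d ℕ.+ i) ≡ vertexA i → iter A d Φ₀ ≡ Φ₀
      vertexA-coincide d i e = iter-injective A (rot-injective 0F 1F) i (trans (sym (iter-+ A i d Φ₀)) (trans (cong (λ k → iter A k Φ₀) (ℕₚ.+-comm i d))
        (same-corner (trans (cls-iter 0F 1F (d ℕ.+ i) Φ₀) (sym (cls-iter 0F 1F i Φ₀))) (subst-Fin-injective vertices≡p e) (trans (ff-A (d ℕ.+ i) Φ₀) (sym (ff-A i Φ₀))))))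

      vertexA-periodic : ∀ d → iter A d Φ₀ ≡ Φ₀ → ∀ i → vertexA (d ℕ.+ i) ≡ vertexA i
      vertexA-periodic d e i = cong (λ Ψ → subst Fin vertices≡p (fv Ψ)) (trans (cong (λ k → iter A k Φ₀) (ℕₚ.+-comm d i)) (trans (iter-+ A i d Φ₀) (cong (iter A i) e)))

      faceB-surjective : ∀ f → ∃ λ i → faceB i ≡ f
      faceB-surjective f =
        let f′ , e = subst-Fin-surjective faces≡q f
            Ψ , c , v≡ , f≡ = corner-flag (fv Φ₀) f′
            i , e′ = vertex-orbit (sym c) (sym v≡)
        in i , trans (cong (subst Fin faces≡q) (trans (cong ff (sym e′)) f≡)) e

      faceB-coincide : ∀ d i → faceB (d ℕ.+ i) ≡ faceB i → iter B d Φ₀ ≡ Φ₀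
      faceB-coincide d i e = iter-injective B (rot-injective 1F 2F) i (trans (sym (iter-+ B i d Φ₀)) (trans (cong (λ k → iter B k Φ₀) (ℕₚ.+-comm i d))
        (same-corner (trans (cls-iter 1F 2F (d ℕ.+ i) Φ₀) (sym (cls-iter 1F 2F i Φ₀))) (trans (fv-B (d ℕ.+ i) Φ₀) (sym (fv-B i Φ₀))) (subst-Fin-injective faces≡q e))))

      faceB-periodic : ∀ d → iter B d Φ₀ ≡ Φ₀ → ∀ i → faceB (d ℕ.+ i) ≡ faceB i
      faceB-periodic d e i = cong (λ Ψ → subst Fin faces≡q (ff Ψ)) (trans (cong (λ k → iter B k Φ₀) (ℕₚ.+-comm d i)) (trans (iter-+ B i d Φ₀) (cong (iter B i) e)))

    module OrderA = CyclicOrder p (λ d → iter A d Φ₀ ≡ Φ₀) vertexA vertexA-surjective vertexA-coincide vertexA-periodic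
    module OrderB = CyclicOrder q (λ d → iter B d Φ₀ ≡ Φ₀) faceB faceB-surjective faceB-coincide faceB-periodic

    natural-∘ : ∀ {f g} → Natural f → Natural g → Natural (λ Φ → f (g Φ))
    natural-∘ {f} nf ng α Φ = trans (nf α _) (cong f (ng α Φ))

    natural-iter : ∀ {f} → Natural f → ∀ k → Natural (iter f k)
    natural-iter nf zero    α Φ = refl
    natural-iter {f} nf (suc k) = natural-∘ {f} {iter f k} nf (natural-iter nf k)

    A-natural : Natural A
    A-natural = natural-∘ {r 0F} {r 1F} (r-natural 0F) (r-natural 1F)
    B-natural : Natural B
    B-natural = natural-∘ {r 1F} {r 2F} (r-natural 1F) (r-natural 2F)

    S : Setoid 0ℓ 0ℓ
    S = record
      { Carrier = Σ Flag λ Φ → cls Φ ≡ κ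
      ; _≈_ = λ x y → proj₁ x ≡ proj₁ y
      ; isEquivalence = record { refl = refl ; sym = sym ; trans = trans }
      }

    module S = Setoid S

    rotS : Fin 3 → Fin 3 → S.Carrier → S.Carrier
    rotS x y (Φ , c) = rot x y Φ , trans (cls-rot x y Φ) c

    iter-rotS : ∀ x y k s → proj₁ (iter (rotS x y) k s) ≡ iter (rot x y) k (proj₁ s)
    iter-rotS x y zero    s = refl
    iter-rotS x y (suc k) s = cong (rot x y) (iter-rotS x y k s)

    A^p : ∀ s → iter (rotS 0F 1F) p s S.≈ s
    A^p s@(Φ , c) = trans (iter-rotS 0F 1F p s) (regular {iter A p} {λ Ψ → Ψ} (natural-iter {A} A-natural p) (λ α Φ → refl) {Φ₀} {Φ} (sym c) OrderA.E-p)

    B^q : ∀ s → iter (rotS 1F 2F) q s S.≈ s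
    B^q s@(Φ , c) = trans (iter-rotS 1F 2F q s) (regular {iter B q} {λ Ψ → Ψ} (natural-iter {B} B-natural q) (λ α Φ → refl) {Φ₀} {Φ} (sym c) OrderB.E-p)

    open WordGroup S (rotS 0F 1F) (rotS 1F 2F) (cong A) (cong B) p q A^p B^q public using (act; act-^; act-++) renaming (group to wordGroup)

    s₀ : S.Carrier
    s₀ = Φ₀ , refl

    actF : List Bool → Flag → Flag
    actF []          Φ = Φ
    actF (true ∷ w)  Φ = A (actF w Φ)
    actF (false ∷ w) Φ = B (actF w Φ)

    act≡actF : ∀ w s → proj₁ (act w s) ≡ actF w (proj₁ s)
    act≡actF []          s = refl
    act≡actF (true ∷ w)  s = cong A (act≡actF w s)
    act≡actF (false ∷ w) s = cong B (act≡actF w s)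

    actF-natural : ∀ w → Natural (actF w)
    actF-natural []          α Φ = refl
    actF-natural (true ∷ w)  = natural-∘ {A} {actF w} A-natural (actF-natural w)
    actF-natural (false ∷ w) = natural-∘ {B} {actF w} B-natural (actF-natural w)

    act-regular : ∀ v w → actF v Φ₀ ≡ actF w Φ₀ → ∀ s → act v s S.≈ act w s
    act-regular v w e s@(Φ , c) = trans (act≡actF v s) (trans (regular {actF v} {actF w} (actF-natural v) (actF-natural w) {Φ₀} {Φ} (sym c) e) (sym (act≡actF w s)))

    open Powers wordGroup using (_^_)

    actF-^a : ∀ k Φ → actF ((true ∷ []) ^ k) Φ ≡ iter A k Φ
    actF-^a zero    Φ = refl
    actF-^a (suc k) Φ = cong A (actF-^a k Φ)

    actF-^b : ∀ k Φ → actF ((false ∷ []) ^ k) Φ ≡ iter B k Φ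
    actF-^b zero    Φ = refl
    actF-^b (suc k) Φ = cong B (actF-^b k Φ)

    actF-++ : ∀ v w Φ → actF (v ++ w) Φ ≡ actF v (actF w Φ)
    actF-++ []          w Φ = refl
    actF-++ (true ∷ v)  w Φ = cong A (actF-++ v w Φ)
    actF-++ (false ∷ v) w Φ = cong B (actF-++ v w Φ)

    cls-actF : ∀ w Φ → cls (actF w Φ) ≡ cls Φ
    cls-actF []          Φ = refl
    cls-actF (true ∷ w)  Φ = trans (cls-rot 0F 1F _) (cls-actF w Φ)
    cls-actF (false ∷ w) Φ = trans (cls-rot 1F 2F _) (cls-actF w Φ)

    -- The intermediate flag `Θ` has the vertex of `Φ₀` and the face of `Ψ`. A power of `B` turns
    -- `Φ₀` into `Θ` about the vertex, and a power of `A` turns `Θ` into `Ψ` about the face.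
    word-to : ∀ Ψ → cls Ψ ≡ κ → ∃ λ i → ∃ λ j → actF ((true ∷ []) ^ i ++ (false ∷ []) ^ j) Φ₀ ≡ Ψ
    word-to Ψ c =
      let Θ , cΘ , v≡ , f≡ = corner-flag (fv Φ₀) (ff Ψ)
          j , eⱼ = vertex-orbit (sym cΘ) (sym v≡)
          i , eᵢ = face-orbit (trans cΘ (sym c)) f≡
      in i , j , trans (actF-++ ((true ∷ []) ^ i) ((false ∷ []) ^ j) Φ₀)
           (trans (cong (actF ((true ∷ []) ^ i)) (trans (actF-^b j Φ₀) (sym eⱼ))) (trans (actF-^a i Θ) (sym eᵢ)))

    abstract
      AB≡r0r2 : ∀ Φ → A (B Φ) ≡ r 0F (r 2F Φ)
      AB≡r0r2 Φ = cong (r 0F) (r-involutive 1F (r 2F Φ))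

    AB : Flag → Flag
    AB Φ = A (B Φ)

    abstract
      AB-involutive : ∀ Φ → AB (AB Φ) ≡ Φ
      AB-involutive Φ = trans (AB≡r0r2 (AB Φ)) (trans (cong (λ Ψ → r 0F (r 2F Ψ)) (AB≡r0r2 Φ)) (trans (cong (r 0F) (sym (r0r2-comm (r 2F Φ))))
        (trans (r-involutive 0F (r 2F (r 2F Φ))) (r-involutive 2F Φ))))

    module W = Group wordGroup

    aʷ bʷ : List Bool
    aʷ = true ∷ []
    bʷ = false ∷ []

    abstract
      at-base-a : ∀ i → proj₁ (act (aʷ ^ i) s₀) ≡ iter A i Φ₀
      at-base-a i = trans (act≡actF (aʷ ^ i) s₀) (actF-^a i Φ₀)

      at-base-b : ∀ j → proj₁ (act (bʷ ^ j) s₀) ≡ iter B j Φ₀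
      at-base-b j = trans (act≡actF (bʷ ^ j) s₀) (actF-^b j Φ₀)

      a^≈ε : ∀ i → iter A i Φ₀ ≡ Φ₀ → aʷ ^ i W.≈ W.ε
      a^≈ε i e = act-regular (aʷ ^ i) [] (trans (actF-^a i Φ₀) e)

      b^≈ε : ∀ j → iter B j Φ₀ ≡ Φ₀ → bʷ ^ j W.≈ W.ε
      b^≈ε j e = act-regular (bʷ ^ j) [] (trans (actF-^b j Φ₀) e)

      a-period : ∀ i → aʷ ^ i W.≈ W.ε → p ∣ i
      a-period i e = OrderA.period⇒∣ i (trans (sym (at-base-a i)) (e s₀))

      b-period : ∀ j → bʷ ^ j W.≈ W.ε → q ∣ j
      b-period j e = OrderB.period⇒∣ j (trans (sym (at-base-b j)) (e s₀))

      A∩B-trivial : ∀ i j → aʷ ^ i W.≈ bʷ ^ j → aʷ ^ i W.≈ W.ε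
      A∩B-trivial i j e = a^≈ε i (same-corner (cls-iter 0F 1F i Φ₀)
        (trans (cong fv (trans (sym (at-base-a i)) (trans (e s₀) (at-base-b j)))) (fv-B j Φ₀)) (ff-A i Φ₀))

      factorisation : ∀ w → ∃ λ i → ∃ λ j → w W.≈ aʷ ^ i W.∙ bʷ ^ j
      factorisation w = let i , j , e = word-to (actF w Φ₀) (cls-actF w Φ₀) in i , j , act-regular w (aʷ ^ i ++ bʷ ^ j) (sym e)

      actF-ab : ∀ Φ → actF (aʷ W.∙ bʷ) Φ ≡ AB Φ
      actF-ab Φ = refl

      abab : (aʷ W.∙ bʷ) W.∙ (aʷ W.∙ bʷ) W.≈ W.ε
      abab = act-regular ((aʷ W.∙ bʷ) W.∙ (aʷ W.∙ bʷ)) W.ε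
        (trans (actF-++ (aʷ W.∙ bʷ) (aʷ W.∙ bʷ) Φ₀) (trans (cong (actF (aʷ W.∙ bʷ)) (actF-ab Φ₀)) (trans (actF-ab (AB Φ₀)) (AB-involutive Φ₀))))

    tightGroup : TightGroup p q
    tightGroup = record
      { group = wordGroup ; a = aʷ ; b = bʷ
      ; a^p≈ε = a^≈ε p OrderA.E-p ; b^q≈ε = b^≈ε q OrderB.E-p
      ; a-order = a-period ; b-order = b-period ; A∩B = A∩B-trivial
      ; factor = factorisation ; involution = abab
      }

    same-edge : ∀ {Φ Ψ} → cls Φ ≡ cls Ψ → fe Φ ≡ fe Ψ → Ψ ≡ Φ ⊎ Ψ ≡ r 0F (r 2F Φ)
    same-edge {Φ} {Ψ} c e≡ with fv Φ ≟ᶠ fv Ψ | ff Φ ≟ᶠ ff Ψ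
    ... | yes v≡ | yes f≡ = inj₁ (flag-≡ (sym v≡) (sym e≡) (sym f≡))
    ... | yes v≡ | no  f≢ = ⊥-elim (separates 2F Φ Ψ (v≡ , e≡ , f≢) c)
    ... | no  v≢ | yes f≡ = ⊥-elim (separates 0F Φ Ψ (v≢ , e≡ , f≡) c)
    ... | no  v≢ | no  f≢ = inj₂ (r-unique 0F (r 2F Φ) Ψ ((λ e → v≢ (trans (sym (fv-r2 Φ)) e)) , trans (fe-r2 Φ) e≡ , other-face))
      where
      other-face : ff (r 2F Φ) ≡ ff Ψ
      other-face = trans (cong ff (sym (r-unique 2F Φ (flag (fv Φ) (fe Φ) (ff Ψ) (proj₁ (proj₂ (proj₂ (proj₂ Φ))))
        (subst (λ e → T (I12 e (ff Ψ))) (sym e≡) (proj₁ (proj₂ (proj₂ (proj₂ (proj₂ Ψ))))))) (refl , refl , f≢)))) refl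

    -- An automorphism taking `Φ₀` to `r 1F Φ₀` must take the flag of a word `w` to `r 1F (μ w)`,
    -- because moving `A` or `B` past `r 1F` inverts it. As `r 1F` keeps vertices and faces, it
    -- shows up only in `m1`.
    module Reflected (ρ : Reflexible tightGroup) where
      open Reflection tightGroup ρ using (θ; θ-cong; θ-ε; θ-homo; θ-a; θ-b; θ-involutive)

      μ : List Bool → Flag
      μ w = actF (θ w) Φ₀

      at-base : ∀ {v w} → v W.≈ w → actF v Φ₀ ≡ actF w Φ₀
      at-base {v} {w} e = trans (sym (act≡actF v s₀)) (trans (e s₀) (act≡actF w s₀))

      μ-cong : ∀ v w → actF v Φ₀ ≡ actF w Φ₀ → μ v ≡ μ w
      μ-cong v w e = at-base {θ v} {θ w} (θ-cong {v} {w} (act-regular v w e))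

      μ-letter : ∀ x → θ x W.≈ x W.⁻¹ → ∀ w → actF (x W.∙ θ (x W.∙ w)) Φ₀ ≡ μ w
      μ-letter x h w = at-base {x W.∙ θ (x W.∙ w)} {θ w}
        (W.trans {x W.∙ θ (x W.∙ w)} {x W.∙ (θ x W.∙ θ w)} {θ w} (W.∙-congˡ {x} {θ (x W.∙ w)} {θ x W.∙ θ w} (θ-homo x w))
        (W.trans {x W.∙ (θ x W.∙ θ w)} {x W.∙ (x W.⁻¹ W.∙ θ w)} {θ w} (W.∙-congˡ {x} {θ x W.∙ θ w} {x W.⁻¹ W.∙ θ w} (W.∙-congʳ {θ w} {θ x} {x W.⁻¹} h))
        (W.trans {x W.∙ (x W.⁻¹ W.∙ θ w)} {(x W.∙ x W.⁻¹) W.∙ θ w} {θ w} (W.sym {(x W.∙ x W.⁻¹) W.∙ θ w} {x W.∙ (x W.⁻¹ W.∙ θ w)} (W.assoc x (x W.⁻¹) (θ w)))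
        (W.trans {(x W.∙ x W.⁻¹) W.∙ θ w} {W.ε W.∙ θ w} {θ w} (W.∙-congʳ {θ w} {x W.∙ x W.⁻¹} {W.ε} (W.inverseʳ x)) (W.identityˡ (θ w))))))

      μ-A : ∀ w → A (μ (true ∷ w)) ≡ μ w
      μ-A w = μ-letter aʷ θ-a w

      μ-B : ∀ w → B (μ (false ∷ w)) ≡ μ w
      μ-B w = μ-letter bʷ θ-b w

      μ-μ : ∀ w → μ (θ w) ≡ actF w Φ₀
      μ-μ w = at-base {θ (θ w)} {w} (θ-involutive w)

      cls-base : ∀ v w → cls (actF v Φ₀) ≡ cls (actF w Φ₀)
      cls-base v w = trans (cls-actF v Φ₀) (sym (cls-actF w Φ₀))

      fv-μ : ∀ v w → fv (actF v Φ₀) ≡ fv (actF w Φ₀) → fv (μ v) ≡ fv (μ w)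
      fv-μ v w e = let i , eᵢ = vertex-orbit (cls-base v w) e in
        sym (trans (cong fv (μ-cong w (bʷ ^ i ++ v) (trans eᵢ (sym (trans (actF-++ (bʷ ^ i) v Φ₀) (actF-^b i _)))))) (invariant i))
        where
        invariant : ∀ i → fv (μ (bʷ ^ i ++ v)) ≡ fv (μ v)
        invariant zero    = refl
        invariant (suc i) = trans (sym (trans (fv-r1 _) (fv-r2 _))) (trans (cong fv (μ-B (bʷ ^ i ++ v))) (invariant i))

      ff-μ : ∀ v w → ff (actF v Φ₀) ≡ ff (actF w Φ₀) → ff (μ v) ≡ ff (μ w)
      ff-μ v w e = let i , eᵢ = face-orbit (cls-base v w) e in
        sym (trans (cong ff (μ-cong w (aʷ ^ i ++ v) (trans eᵢ (sym (trans (actF-++ (aʷ ^ i) v Φ₀) (actF-^a i _)))))) (invariant i))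
        where
        invariant : ∀ i → ff (μ (aʷ ^ i ++ v)) ≡ ff (μ v)
        invariant zero    = refl
        invariant (suc i) = trans (sym (trans (ff-r0 _) (ff-r1 _))) (trans (cong ff (μ-A (aʷ ^ i ++ v))) (invariant i))

      fe-μ : ∀ v w → fe (actF v Φ₀) ≡ fe (actF w Φ₀) → fe (r 1F (μ v)) ≡ fe (r 1F (μ w))
      fe-μ v w e = cases (same-edge (cls-base v w) e)
        where
        cases : actF w Φ₀ ≡ actF v Φ₀ ⊎ actF w Φ₀ ≡ r 0F (r 2F (actF v Φ₀)) → fe (r 1F (μ v)) ≡ fe (r 1F (μ w))
        cases (inj₁ w≡v) = cong (λ Ψ → fe (r 1F Ψ)) (sym (μ-cong w v w≡v))
        -- Here `μ v` is `B (A (μ w))`: the leading `r 1F` cancels against the one in `B`, and the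
        -- remaining `r 2F` and `r 0F` keep the edge.
        cases (inj₂ w≡)  = trans (cong (λ Ψ → fe (r 1F Ψ)) (trans (sym (μ-B v)) (cong B (sym (μ-A (false ∷ v))))))
          (trans (cong fe (r-involutive 1F _)) (trans (fe-r2 _) (trans (fe-r0 _)
            (cong (λ Ψ → fe (r 1F Ψ)) (μ-cong (true ∷ false ∷ v) w (trans (AB≡r0r2 (actF v Φ₀)) (sym w≡)))))))

      word : ∀ Ψ → cls Ψ ≡ κ → List Bool
      word Ψ c = let i , j , _ = word-to Ψ c in aʷ ^ i ++ bʷ ^ j

      word≡ : ∀ Ψ c → actF (word Ψ c) Φ₀ ≡ Ψ
      word≡ Ψ c = proj₂ (proj₂ (word-to Ψ c))

      edge-flag : ∀ e → ∃ λ Ψ → cls Ψ ≡ κ × fe Ψ ≡ e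
      edge-flag e = from (in-class 0F Φ)
        where
        module Vs = Enumeration (enumerated {nv} {2} {λ v → I01 v e} (edge-vertices e))
        module Fs = Enumeration (enumerated {nf} {2} {I12 e} (edge-faces e))
        Φ : Flag
        Φ = flag (Vs.element 0F) e (Fs.element 0F) (Vs.valid 0F) (Fs.valid 0F)
        from : (∃ λ Ψ → cls Ψ ≡ κ × (Ψ ≡ Φ ⊎ Ψ ≡ r 0F Φ)) → ∃ λ Ψ → cls Ψ ≡ κ × fe Ψ ≡ e
        from (Ψ , c , inj₁ x) = Ψ , c , cong fe x
        from (Ψ , c , inj₂ x) = Ψ , c , trans (cong fe x) (fe-r0 Φ)

      incident-ve : ∀ v e → T (I01 v e) → ∃ λ Ψ → cls Ψ ≡ κ × fv Ψ ≡ v × fe Ψ ≡ e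
      incident-ve v e i = from (in-class 2F Φ)
        where
        module Fs = Enumeration (enumerated {nf} {2} {I12 e} (edge-faces e))
        Φ : Flag
        Φ = flag v e (Fs.element 0F) i (Fs.valid 0F)
        from : (∃ λ Ψ → cls Ψ ≡ κ × (Ψ ≡ Φ ⊎ Ψ ≡ r 2F Φ)) → ∃ λ Ψ → cls Ψ ≡ κ × fv Ψ ≡ v × fe Ψ ≡ e
        from (Ψ , c , inj₁ x) = Ψ , c , cong fv x , cong fe x
        from (Ψ , c , inj₂ x) = Ψ , c , trans (cong fv x) (fv-r2 Φ) , trans (cong fe x) (fe-r2 Φ)

      incident-ef : ∀ e f → T (I12 e f) → ∃ λ Ψ → cls Ψ ≡ κ × fe Ψ ≡ e × ff Ψ ≡ f
      incident-ef e f i = from (in-class 0F Φ)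
        where
        module Vs = Enumeration (enumerated {nv} {2} {λ v → I01 v e} (edge-vertices e))
        Φ : Flag
        Φ = flag (Vs.element 0F) e f (Vs.valid 0F) i
        from : (∃ λ Ψ → cls Ψ ≡ κ × (Ψ ≡ Φ ⊎ Ψ ≡ r 0F Φ)) → ∃ λ Ψ → cls Ψ ≡ κ × fe Ψ ≡ e × ff Ψ ≡ f
        from (Ψ , c , inj₁ x) = Ψ , c , cong fe x , cong ff x
        from (Ψ , c , inj₂ x) = Ψ , c , trans (cong fe x) (fe-r0 Φ) , trans (cong ff x) (ff-r0 Φ)

      vertex-word : Fin nv → List Bool
      vertex-word v = let Ψ , c , _ = corner-flag v (ff Φ₀) in word Ψ c
      face-word : Fin nf → List Bool
      face-word f = let Ψ , c , _ = corner-flag (fv Φ₀) f in word Ψ c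
      edge-word : Fin ne → List Bool
      edge-word e = let Ψ , c , _ = edge-flag e in word Ψ c

      fv-vertex-word : ∀ v → fv (actF (vertex-word v) Φ₀) ≡ v
      fv-vertex-word v = let Ψ , c , v≡ , _ = corner-flag v (ff Φ₀) in trans (cong fv (word≡ Ψ c)) v≡
      ff-face-word : ∀ f → ff (actF (face-word f) Φ₀) ≡ f
      ff-face-word f = let Ψ , c , _ , f≡ = corner-flag (fv Φ₀) f in trans (cong ff (word≡ Ψ c)) f≡
      fe-edge-word : ∀ e → fe (actF (edge-word e) Φ₀) ≡ e
      fe-edge-word e = let Ψ , c , e≡ = edge-flag e in trans (cong fe (word≡ Ψ c)) e≡

      m0 : Fin nv → Fin nv
      m0 v = fv (μ (vertex-word v))
      m1 : Fin ne → Fin ne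
      m1 e = fe (r 1F (μ (edge-word e)))
      m2 : Fin nf → Fin nf
      m2 f = ff (μ (face-word f))

      m0-at : ∀ w → m0 (fv (actF w Φ₀)) ≡ fv (μ w)
      m0-at w = fv-μ (vertex-word (fv (actF w Φ₀))) w (fv-vertex-word _)
      m1-at : ∀ w → m1 (fe (actF w Φ₀)) ≡ fe (r 1F (μ w))
      m1-at w = fe-μ (edge-word (fe (actF w Φ₀))) w (fe-edge-word _)
      m2-at : ∀ w → m2 (ff (actF w Φ₀)) ≡ ff (μ w)
      m2-at w = ff-μ (face-word (ff (actF w Φ₀))) w (ff-face-word _)

      m0-involutive : ∀ v → m0 (m0 v) ≡ v
      m0-involutive v = trans (m0-at (θ (vertex-word v))) (trans (cong fv (μ-μ (vertex-word v))) (fv-vertex-word v))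
      m2-involutive : ∀ f → m2 (m2 f) ≡ f
      m2-involutive f = trans (m2-at (θ (face-word f))) (trans (cong ff (μ-μ (face-word f))) (ff-face-word f))
      -- The flag `r 1F (μ w)` is in the wrong class for `m1-at`; its neighbour `A (μ w)` is in the
      -- right one and has the same edge.
      m1-involutive : ∀ e → m1 (m1 e) ≡ e
      m1-involutive e = trans (cong m1 (sym (fe-r0 (r 1F (μ w))))) (trans (m1-at (true ∷ θ w))
        (trans (sym (fe-r0 _)) (trans (cong fe (trans (μ-A (θ w)) (μ-μ w))) (fe-edge-word e))))
        where
        w : List Bool
        w = edge-word e

      pres-ve : ∀ v e → T (I01 v e) → T (I01 (m0 v) (m1 e))
      pres-ve v e i = let Ψ , c , v≡ , e≡ = incident-ve v e i ; w = word Ψ c in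
        subst₂ (λ v e → T (I01 v e))
          (trans (fv-r1 (μ w)) (trans (sym (m0-at w)) (cong m0 (trans (cong fv (word≡ Ψ c)) v≡))))
          (trans (sym (m1-at w)) (cong m1 (trans (cong fe (word≡ Ψ c)) e≡)))
          (proj₁ (proj₂ (proj₂ (proj₂ (r 1F (μ w))))))

      pres-ef : ∀ e f → T (I12 e f) → T (I12 (m1 e) (m2 f))
      pres-ef e f i = let Ψ , c , e≡ , f≡ = incident-ef e f i ; w = word Ψ c in
        subst₂ (λ e f → T (I12 e f))
          (trans (sym (m1-at w)) (cong m1 (trans (cong fe (word≡ Ψ c)) e≡)))
          (trans (ff-r1 (μ w)) (trans (sym (m2-at w)) (cong m2 (trans (cong ff (word≡ Ψ c)) f≡))))
          (proj₁ (proj₂ (proj₂ (proj₂ (proj₂ (r 1F (μ w)))))))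

      mirror : Automorphism
      mirror = record
        { σ0 = mk↔ₛ′ m0 m0 m0-involutive m0-involutive
        ; σ1 = mk↔ₛ′ m1 m1 m1-involutive m1-involutive
        ; σ2 = mk↔ₛ′ m2 m2 m2-involutive m2-involutive
        ; pres01 = λ v e → T-ext (λ i → subst₂ (λ v e → T (I01 v e)) (m0-involutive v) (m1-involutive e) (pres-ve _ _ i)) (pres-ve v e)
        ; pres12 = λ e f → T-ext (λ i → subst₂ (λ e f → T (I12 e f)) (m1-involutive e) (m2-involutive f) (pres-ef _ _ i)) (pres-ef e f)
        ; pres02 = λ v f → T-ext (λ _ → all-incident P isPolyhedron type tight v f) (λ _ → all-incident P isPolyhedron type tight (m0 v) (m2 f))
        }

      mirror-maps : Maps mirror Φ₀ (r 1F Φ₀)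
      mirror-maps = trans (m0-at []) (trans (cong fv μ-ε) (sym (fv-r1 Φ₀))) , trans (m1-at []) (cong (λ Ψ → fe (r 1F Ψ)) μ-ε) ,
        trans (m2-at []) (trans (cong ff μ-ε) (sym (ff-r1 Φ₀)))
        where
        μ-ε : μ [] ≡ Φ₀
        μ-ε = at-base {θ []} {[]} θ-ε

    compose : Automorphism → Automorphism → Automorphism
    compose α β = record
      { σ0 = ↔-trans (σ0 β) (σ0 α) ; σ1 = ↔-trans (σ1 β) (σ1 α) ; σ2 = ↔-trans (σ2 β) (σ2 α)
      ; pres01 = λ v e → trans (pres01 α _ _) (pres01 β v e)
      ; pres12 = λ e f → trans (pres12 α _ _) (pres12 β e f)
      ; pres02 = λ v f → trans (pres02 α _ _) (pres02 β v f)
      }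
      where open Automorphism

    -- `Ψ` cannot lie in the class of `Φ₀`, so it lies in that of `r 1F Φ₀`. A mirror followed by an
    -- automorphism within that class would reach it.
    not-reflexible : ∀ Ψ → ¬ (Σ Automorphism λ α → Maps α Φ₀ Ψ) → ¬ Reflexible tightGroup
    not-reflexible Ψ none ρ with cls Ψ ≟ᵇ κ
    ... | yes c = none (transitive Φ₀ Ψ (sym c))
    ... | no ¬c = none (compose β mirror ,
          trans (cong (Automorphism.a0 β) (proj₁ mirror-maps)) (proj₁ β-maps) ,
          trans (cong (Automorphism.a1 β) (proj₁ (proj₂ mirror-maps))) (proj₁ (proj₂ β-maps)) ,
          trans (cong (Automorphism.a2 β) (proj₂ (proj₂ mirror-maps))) (proj₂ (proj₂ β-maps)))
      where
      open Reflected ρ using (mirror; mirror-maps)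
      onward : Σ Automorphism λ α → Maps α (r 1F Φ₀) Ψ
      onward = transitive (r 1F Φ₀) Ψ (trans (cls-r 1F Φ₀) (sym (¬-not ¬c)))
      β : Automorphism
      β = proj₁ onward
      β-maps : Maps β (r 1F Φ₀) Ψ
      β-maps = proj₂ onward

  polyhedron⇒group : ∀ {p q} {{_ : NonZero p}} {{_ : NonZero q}} → TightChiralPolyhedronOfType p q → Σ (TightGroup p q) λ T → ¬ Reflexible T
  polyhedron⇒group (P , isPolyhedron , type , tight , cls , separates , transitive , Φ , Ψ , none) =
    tightGroup , not-reflexible Ψ none
    where open ChiralFlags P isPolyhedron type tight cls separates transitive Φ

-- Quotients of finite sets by a free involution.

module InvolutionQuotients where
  open import Data.Nat.Base using (ℕ; _<_)
  import Data.Nat.Properties as ℕₚ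
  open import Data.Bool.Base using (Bool; T)
  open import Data.Fin.Base using (Fin; toℕ)
  open import Data.Fin.Properties using (toℕ-injective; _<?_)
  open import Data.Product using (_,_; proj₁; proj₂)
  open import Data.Sum using (_⊎_; inj₁; inj₂)
  open import Data.Empty using (⊥-elim)
  open import Relation.Nullary using (¬_; Dec; yes; no)
  open import Relation.Nullary.Decidable using (toWitness; fromWitness; ⌊_⌋)
  open import Relation.Binary.PropositionalEquality
  open Counting hiding (corner)

  module InvolutionQuotient {n : ℕ} (τ : Fin n → Fin n) (τ-involutive : ∀ k → τ (τ k) ≡ k) (τ-free : ∀ k → τ k ≢ k) where

    lower : Fin n → Bool
    lower k = ⌊ k <? τ k ⌋

    size : ℕ
    size = count n lower

    module E = Enumeration (enumerate n lower)

    lower-swap : ∀ k → ¬ T (lower k) → T (lower (τ k))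
    lower-swap k ¬l = fromWitness (subst (toℕ (τ k) <_) (cong toℕ (sym (τ-involutive k)))
      (ℕₚ.≤∧≢⇒< (ℕₚ.≮⇒≥ λ k<τk → ¬l (fromWitness k<τk)) λ e → τ-free k (toℕ-injective e)))

    lower-one : ∀ k → T (lower k) → ¬ T (lower (τ k))
    lower-one k l l′ = ℕₚ.<-asym (toWitness l) (subst (toℕ (τ k) <_) (cong toℕ (τ-involutive k)) (toWitness l′))

    private
      class-dec : ∀ k → Dec (toℕ k < toℕ (τ k)) → Fin size
      class-dec k (yes k<) = proj₁ (E.index k (fromWitness k<))
      class-dec k (no  k≮) = proj₁ (E.index (τ k) (lower-swap k λ l → k≮ (toWitness l)))

    class : Fin n → Fin size
    class k = class-dec k (k <? τ k)

    rep : Fin size → Fin n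
    rep = E.element

    private
      rep-class-dec : ∀ k d → rep (class-dec k d) ≡ k ⊎ rep (class-dec k d) ≡ τ k
      rep-class-dec k (yes k<) = inj₁ (proj₂ (E.index k (fromWitness k<)))
      rep-class-dec k (no  k≮) = inj₂ (proj₂ (E.index (τ k) (lower-swap k λ l → k≮ (toWitness l))))

    rep-class : ∀ k → rep (class k) ≡ k ⊎ rep (class k) ≡ τ k
    rep-class k = rep-class-dec k (k <? τ k)

    class-sound : ∀ k l → class k ≡ class l → l ≡ k ⊎ l ≡ τ k
    class-sound k l e with rep-class k | rep-class l
    ... | inj₁ x | inj₁ y = inj₁ (trans (sym y) (trans (cong rep (sym e)) x))
    ... | inj₂ x | inj₁ y = inj₂ (trans (sym y) (trans (cong rep (sym e)) x))
    ... | inj₁ x | inj₂ y = inj₂ (trans (sym (τ-involutive l)) (cong τ (trans (sym y) (trans (cong rep (sym e)) x))))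
    ... | inj₂ x | inj₂ y = inj₁ (trans (sym (τ-involutive l)) (trans (cong τ (trans (sym y) (trans (cong rep (sym e)) x))) (τ-involutive k)))

    rep-unique : ∀ i j → rep i ≡ rep j ⊎ rep i ≡ τ (rep j) → i ≡ j
    rep-unique i j (inj₁ e) = E.injective e
    rep-unique i j (inj₂ e) = ⊥-elim (lower-one (rep j) (E.valid j) (subst (λ k → T (lower k)) e (E.valid i)))

    class-rep : ∀ i → class (rep i) ≡ i
    class-rep i = rep-unique _ i (rep-class (rep i))

    class-τ : ∀ k → class (τ k) ≡ class k
    class-τ k = rep-unique _ _ (cases (rep-class (τ k)) (rep-class k))
      where
      cases : ∀ {x y} → x ≡ τ k ⊎ x ≡ τ (τ k) → y ≡ k ⊎ y ≡ τ k → x ≡ y ⊎ x ≡ τ y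
      cases (inj₁ refl) (inj₁ refl) = inj₂ refl
      cases (inj₁ refl) (inj₂ refl) = inj₁ refl
      cases (inj₂ refl) (inj₁ refl) = inj₁ (τ-involutive k)
      cases (inj₂ refl) (inj₂ refl) = inj₂ refl

-- The coset polyhedron of a tight group.

module CosetGeometry where
  open import Data.Nat.Base as ℕ using (ℕ; zero; suc; NonZero)
  import Data.Nat.Properties as ℕₚ
  open import Data.Nat.DivMod using (_%_; _/_; m≡m%n+[m/n]*n; m%n<n; m<n⇒m%n≡m)
  open import Data.Nat.Divisibility using (divides; ∣⇒≤)
  open import Data.Nat.Tactic.RingSolver using (solve-∀)
  open import Data.Bool.Base using (Bool; true; false; T; _∧_; _∨_; if_then_else_)
  open import Data.Bool.Properties using (T-∨; T-∧; T-irrelevant)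
  open import Data.Fin.Base using (Fin; toℕ; fromℕ<; combine; remQuot)
  open import Data.Fin.Properties using (_≟_; toℕ-injective; toℕ<n; toℕ-fromℕ<; fromℕ<-injective; fromℕ<-cong; combine-injective; combine-remQuot)
  open import Data.Fin.Patterns
  open import Data.Product using (Σ; ∃; _×_; _,_; proj₁; proj₂)
  open import Data.Sum using (_⊎_; inj₁; inj₂)
  open import Data.Unit using (tt)
  open import Data.Empty using (⊥; ⊥-elim)
  open import Data.Vec.Base using ([]; _∷_)
  open import Relation.Nullary using (¬_; yes; no)
  open import Relation.Nullary.Decidable using (toWitness; fromWitness; ⌊_⌋)
  open import Relation.Binary.Construct.Closure.ReflexiveTransitive using (Star; _◅◅_) renaming (ε to nil; _◅_ to _◅_)
  import Relation.Binary.Construct.Closure.ReflexiveTransitive as Star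
  open import Relation.Binary.PropositionalEquality as ≡ using (_≡_; _≢_)
  open import Function.Bundles using (Inverse; Equivalence; mk↔ₛ′)
  open Counting hiding (corner)
  open InvolutionQuotients
  open GroupWords
  open TightGroups

  module Cosets {p q} {{p≢0 : NonZero p}} {{q≢0 : NonZero q}} (T : TightGroup p q) where
    open TightGroup T
    open import Algebra.Properties.Group group
    open import Relation.Binary.Reasoning.Setoid setoid

    a^-mod : ∀ i → a ^ i ≈ a ^ (i % p)
    a^-mod i = begin
      a ^ i                              ≈⟨ ^-≡ a (m≡m%n+[m/n]*n i p) ⟩
      a ^ (i % p ℕ.+ i / p ℕ.* p)        ≈⟨ ^-+ a (i % p) _ ⟩
      a ^ (i % p) ∙ a ^ (i / p ℕ.* p)    ≈⟨ ∙-congˡ (^-multiple a a^p≈ε (divides (i / p) ≡.refl)) ⟩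
      a ^ (i % p) ∙ ε                    ≈⟨ identityʳ _ ⟩
      a ^ (i % p)                        ∎

    a^-injective-≤ : ∀ i j → i ℕ.≤ j → j ℕ.< p → a ^ i ≈ a ^ j → i ≡ j
    a^-injective-≤ i j i≤j j<p e with ℕₚ.m≤n⇒∃[o]m+o≡n i≤j
    ... | zero  , eq = ≡.trans (≡.sym (ℕₚ.+-identityʳ i)) eq
    ... | suc o , ≡.refl = ⊥-elim (ℕₚ.<⇒≱ (ℕₚ.≤-<-trans (ℕₚ.m≤n+m (suc o) i) j<p)
          (∣⇒≤ (a-order (suc o) (sym (∙-cancelˡ (a ^ i) ε _ (trans (identityʳ _) (trans e (^-+ a i (suc o)))))))))

    a^-injective : ∀ i j → i ℕ.< p → j ℕ.< p → a ^ i ≈ a ^ j → i ≡ j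
    a^-injective i j i<p j<p e with ℕₚ.≤-total i j
    ... | inj₁ i≤j = a^-injective-≤ i j i≤j j<p e
    ... | inj₂ j≤i = ≡.sym (a^-injective-≤ j i j≤i i<p (sym e))

    -- The coset of `g` modulo `⟨b⟩`, numbered by the exponent of `a` in a factorisation, which is
    -- unique modulo `p`.
    vert : Carrier → Fin p
    vert g = fromℕ< (m%n<n (proj₁ (factor g)) p)

    vert-sound : ∀ g h → vert g ≡ vert h → ∃ λ j → h ≈ g ∙ b ^ j
    vert-sound g h e = let i , j , g≈ = factor g ; i′ , j′ , h≈ = factor h in
      ℕ.pred q ℕ.* j ℕ.+ j′ , (begin
        h                                              ≈⟨ h≈ ⟩
        a ^ i′ ∙ b ^ j′                                ≈⟨ ∙-congʳ (trans (a^-mod i′) (trans (^-≡ a (≡.sym (fromℕ<-injective _ _ _ _ e))) (sym (a^-mod i)))) ⟩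
        a ^ i ∙ b ^ j′                                 ≈⟨ ∙-congʳ (identityʳ _) ⟨
        a ^ i ∙ ε ∙ b ^ j′                             ≈⟨ ∙-congʳ (∙-congˡ (inverseʳ (b ^ j))) ⟨
        a ^ i ∙ (b ^ j ∙ (b ^ j) ⁻¹) ∙ b ^ j′          ≈⟨ ∙-congʳ (assoc _ _ _) ⟨
        a ^ i ∙ b ^ j ∙ (b ^ j) ⁻¹ ∙ b ^ j′            ≈⟨ assoc _ _ _ ⟩
        a ^ i ∙ b ^ j ∙ ((b ^ j) ⁻¹ ∙ b ^ j′)          ≈⟨ ∙-cong (sym g≈) (∙-congʳ (^-inverse b q b^q≈ε j)) ⟩
        g ∙ (b ^ (ℕ.pred q ℕ.* j) ∙ b ^ j′)            ≈⟨ ∙-congˡ (^-+ b (ℕ.pred q ℕ.* j) j′) ⟨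
        g ∙ b ^ (ℕ.pred q ℕ.* j ℕ.+ j′)                ∎)

    factor-unique : ∀ i j i′ j′ → a ^ i ∙ b ^ j ≈ a ^ i′ ∙ b ^ j′ → i % p ≡ i′ % p
    factor-unique i j i′ j′ e = a^-injective _ _ (m%n<n i p) (m%n<n i′ p) (trans (sym (a^-mod i)) (trans (x∙y⁻¹≈ε⇒x≈y _ _ quotient) (a^-mod i′)))
      where
      shifted : (a ^ i′) ⁻¹ ∙ a ^ i ≈ b ^ j′ ∙ (b ^ j) ⁻¹
      shifted = begin
        (a ^ i′) ⁻¹ ∙ a ^ i                               ≈⟨ identityʳ _ ⟨
        (a ^ i′) ⁻¹ ∙ a ^ i ∙ ε                           ≈⟨ ∙-congˡ (inverseʳ (b ^ j)) ⟨
        (a ^ i′) ⁻¹ ∙ a ^ i ∙ (b ^ j ∙ (b ^ j) ⁻¹)        ≈⟨ trans (assoc _ _ _) (∙-congˡ (sym (assoc _ _ _))) ⟩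
        (a ^ i′) ⁻¹ ∙ (a ^ i ∙ b ^ j ∙ (b ^ j) ⁻¹)        ≈⟨ ∙-congˡ (∙-congʳ e) ⟩
        (a ^ i′) ⁻¹ ∙ (a ^ i′ ∙ b ^ j′ ∙ (b ^ j) ⁻¹)      ≈⟨ ∙-congˡ (assoc _ _ _) ⟩
        (a ^ i′) ⁻¹ ∙ (a ^ i′ ∙ (b ^ j′ ∙ (b ^ j) ⁻¹))    ≈⟨ assoc _ _ _ ⟨
        (a ^ i′) ⁻¹ ∙ a ^ i′ ∙ (b ^ j′ ∙ (b ^ j) ⁻¹)      ≈⟨ trans (∙-congʳ (inverseˡ _)) (identityˡ _) ⟩
        b ^ j′ ∙ (b ^ j) ⁻¹                               ∎
      in-A : (a ^ i′) ⁻¹ ∙ a ^ i ≈ a ^ (ℕ.pred p ℕ.* i′ ℕ.+ i)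
      in-A = trans (∙-congʳ (^-inverse a p a^p≈ε i′)) (sym (^-+ a (ℕ.pred p ℕ.* i′) i))
      in-B : b ^ j′ ∙ (b ^ j) ⁻¹ ≈ b ^ (j′ ℕ.+ ℕ.pred q ℕ.* j)
      in-B = trans (∙-congˡ (^-inverse b q b^q≈ε j)) (sym (^-+ b j′ (ℕ.pred q ℕ.* j)))
      quotient : a ^ i ∙ (a ^ i′) ⁻¹ ≈ ε
      quotient = begin
        a ^ i ∙ (a ^ i′) ⁻¹                    ≈⟨ ∙-congˡ (^-inverse a p a^p≈ε i′) ⟩
        a ^ i ∙ a ^ (ℕ.pred p ℕ.* i′)          ≈⟨ ^-comm a i (ℕ.pred p ℕ.* i′) ⟩
        a ^ (ℕ.pred p ℕ.* i′) ∙ a ^ i          ≈⟨ ^-+ a (ℕ.pred p ℕ.* i′) i ⟨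
        a ^ (ℕ.pred p ℕ.* i′ ℕ.+ i)            ≈⟨ A∩B (ℕ.pred p ℕ.* i′ ℕ.+ i) (j′ ℕ.+ ℕ.pred q ℕ.* j) (trans (sym in-A) (trans shifted in-B)) ⟩
        ε                                      ∎

    vert-factored : ∀ g i j → g ≈ a ^ i ∙ b ^ j → vert g ≡ fromℕ< (m%n<n i p)
    vert-factored g i j g≈ = let i′ , j′ , g≈′ = factor g in fromℕ<-cong _ _ (factor-unique i′ j′ i j (trans (sym g≈′) g≈)) _ _

    vert-cong : ∀ {g h} → g ≈ h → vert g ≡ vert h
    vert-cong {g} {h} e = let i , j , h≈ = factor h in vert-factored g i j (trans e h≈)

    vert-∙b^ : ∀ g k → vert (g ∙ b ^ k) ≡ vert g
    vert-∙b^ g k = let i , j , g≈ = factor g in vert-factored (g ∙ b ^ k) i (j ℕ.+ k)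
      (trans (∙-congʳ g≈) (trans (assoc _ _ _) (∙-congˡ (sym (^-+ b j k)))))

    vert-a^ : ∀ (v : Fin p) → vert (a ^ toℕ v) ≡ v
    vert-a^ v = ≡.trans (vert-factored (a ^ toℕ v) (toℕ v) 0 (sym (identityʳ _)))
      (toℕ-injective (≡.trans (toℕ-fromℕ< _) (m<n⇒m%n≡m (toℕ<n v))))

    vert-left : ∀ h {g g′} → vert g ≡ vert g′ → vert (h ∙ g) ≡ vert (h ∙ g′)
    vert-left h {g} {g′} e = let j , g′≈ = vert-sound g g′ e in
      ≡.sym (≡.trans (vert-cong (trans (∙-congˡ g′≈) (sym (assoc h g _)))) (vert-∙b^ (h ∙ g) j))

  module Geometry {p q} {{p≢0 : NonZero p}} {{q≢0 : NonZero q}} (2≤p : 2 ℕ.≤ p) (2≤q : 2 ℕ.≤ q) (G : TightGroup p q) where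
    open TightGroup G
    open import Algebra.Properties.Group group
    open import Relation.Binary.Reasoning.Setoid setoid

    t : Carrier
    t = a ∙ b

    open Words group t involution using (solve; var; τ; _⊙_; _⁻)

    private
      pattern v0 = var 0F
      pattern v1 = var 1F
      pattern v2 = var 2F

    module V = Cosets G
    module F = Cosets (dual G)

    abstract
      vert : Carrier → Fin p
      vert = V.vert

      face : Carrier → Fin q
      face = F.vert

      vert-sound : ∀ g h → vert g ≡ vert h → ∃ λ j → h ≈ g ∙ b ^ j
      vert-sound = V.vert-sound

      face-sound : ∀ g h → face g ≡ face h → ∃ λ i → h ≈ g ∙ a ^ i
      face-sound g h e = let i , h≈ = F.vert-sound g h e in
        ℕ.pred p ℕ.* i , trans h≈ (∙-congˡ (trans (^-⁻¹ a i) (^-inverse a p a^p≈ε i)))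

      vert-cong : ∀ {g h} → g ≈ h → vert g ≡ vert h
      vert-cong = V.vert-cong

      face-cong : ∀ {g h} → g ≈ h → face g ≡ face h
      face-cong = F.vert-cong

      vert-∙b^ : ∀ g k → vert (g ∙ b ^ k) ≡ vert g
      vert-∙b^ = V.vert-∙b^

      face-∙a^ : ∀ g k → face (g ∙ a ^ k) ≡ face g
      face-∙a^ g k = ≡.trans (≡.sym (F.vert-∙b^ (g ∙ a ^ k) k)) (F.vert-cong (trans (assoc _ _ _) (trans (∙-congˡ (trans (∙-congˡ (^-⁻¹ a k)) (inverseʳ _))) (identityʳ g))))

      vert-left : ∀ h {g g′} → vert g ≡ vert g′ → vert (h ∙ g) ≡ vert (h ∙ g′)
      vert-left = V.vert-left

      face-left : ∀ h {g g′} → face g ≡ face g′ → face (h ∙ g) ≡ face (h ∙ g′)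
      face-left = F.vert-left

      vert-surjective : ∀ v → ∃ λ g → vert g ≡ v
      vert-surjective v = a ^ toℕ v , V.vert-a^ v

      face-surjective : ∀ f → ∃ λ g → face g ≡ f
      face-surjective f = (b ⁻¹) ^ toℕ f , F.vert-a^ f

    a^-injective : ∀ i j → i ℕ.< p → j ℕ.< p → a ^ i ≈ a ^ j → i ≡ j
    a^-injective = V.a^-injective

    b^-injective : ∀ i j → i ℕ.< q → j ℕ.< q → b ^ i ≈ b ^ j → i ≡ j
    b^-injective i j i<q j<q e = F.a^-injective i j i<q j<q (trans (^-⁻¹ b i) (trans (⁻¹-cong e) (sym (^-⁻¹ b j))))

    b^-mod : ∀ i → b ^ i ≈ b ^ (i % q)
    b^-mod i = ⁻¹-injective (trans (sym (^-⁻¹ b i)) (trans (F.a^-mod i) (^-⁻¹ b (i % q))))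

    vert-b : ∀ g → vert (g ∙ b) ≡ vert g
    vert-b g = ≡.trans (vert-cong (∙-congˡ (sym (^-1 b)))) (vert-∙b^ g 1)

    face-a : ∀ g → face (g ∙ a) ≡ face g
    face-a g = ≡.trans (face-cong (∙-congˡ (sym (^-1 a)))) (face-∙a^ g 1)

    vert-b⁻¹ : ∀ g → vert (g ∙ b ⁻¹) ≡ vert g
    vert-b⁻¹ g = ≡.trans (≡.sym (vert-b (g ∙ b ⁻¹))) (vert-cong (solve (g ∷ b ∷ []) (v0 ⊙ v1 ⁻ ⊙ v1) v0 ≡.refl))

    face-a⁻¹ : ∀ g → face (g ∙ a ⁻¹) ≡ face g
    face-a⁻¹ g = ≡.trans (≡.sym (face-a (g ∙ a ⁻¹))) (face-cong (solve (g ∷ a ∷ []) (v0 ⊙ v1 ⁻ ⊙ v1) v0 ≡.refl))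

    b≈a⁻¹t : b ≈ a ⁻¹ ∙ t
    b≈a⁻¹t = solve (a ∷ b ∷ []) v1 (v0 ⁻ ⊙ (v0 ⊙ v1)) ≡.refl

    b⁻¹≈ta : b ⁻¹ ≈ t ∙ a
    b⁻¹≈ta = trans (⁻¹-cong b≈a⁻¹t) (solve (a ∷ []) ((v0 ⁻ ⊙ τ) ⁻) (τ ⊙ v0) ≡.refl)

    vert-t : ∀ g → vert (g ∙ t) ≡ vert (g ∙ a)
    vert-t g = ≡.trans (vert-cong (sym (assoc g a b))) (vert-b (g ∙ a))

    face-t : ∀ g → face (g ∙ t) ≡ face (g ∙ b ⁻¹)
    face-t g = ≡.trans (≡.sym (face-a (g ∙ t))) (face-cong (trans (assoc _ _ _) (∙-congˡ (sym b⁻¹≈ta))))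

    a∉B : ∀ j → ¬ a ≈ b ^ j
    a∉B j e = ℕₚ.<⇒≱ 2≤p (∣⇒≤ (a-order 1 (A∩B 1 j (trans (^-1 a) e))))

    b∉A : ∀ i → ¬ b ≈ a ^ i
    b∉A i e = ℕₚ.<⇒≱ 2≤q (∣⇒≤ (b-order 1 (trans (^-1 b) (trans e (A∩B i 1 (trans (sym e) (sym (^-1 b))))))))

    vert-a≢ : ∀ g → vert g ≢ vert (g ∙ a)
    vert-a≢ g e = let j , ga≈ = vert-sound g (g ∙ a) e in a∉B j (∙-cancelˡ g _ _ ga≈)

    face-b≢ : ∀ g → face g ≢ face (g ∙ b)
    face-b≢ g e = let i , gb≈ = face-sound g (g ∙ b) e in b∉A i (∙-cancelˡ g _ _ gb≈)

    vert-a⁻¹≢ : ∀ g → vert g ≢ vert (g ∙ a ⁻¹)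
    vert-a⁻¹≢ g e = vert-a≢ (g ∙ a ⁻¹) (≡.trans (≡.sym e) (vert-cong (solve (g ∷ a ∷ []) v0 (v0 ⊙ v1 ⁻ ⊙ v1) ≡.refl)))

    face-b⁻¹≢ : ∀ g → face g ≢ face (g ∙ b ⁻¹)
    face-b⁻¹≢ g e = face-b≢ (g ∙ b ⁻¹) (≡.trans (≡.sym e) (face-cong (solve (g ∷ b ∷ []) v0 (v0 ⊙ v1 ⁻ ⊙ v1) ≡.refl)))

    same-corner : ∀ g h → vert g ≡ vert h → face g ≡ face h → g ≈ h
    same-corner g h v≡ f≡ = let j , h≈ = vert-sound g h v≡ ; i , h≈′ = face-sound g h f≡
                                a≈b = ∙-cancelˡ g _ _ (trans (sym h≈′) h≈) in
      sym (trans h≈′ (trans (∙-congˡ (A∩B i j a≈b)) (identityʳ g)))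

    abstract
      -- The common element of a vertex coset and a face coset: `h⁻¹ g = a^i b^j` gives
      -- `g (b^j)⁻¹ = h a^i`. It is unique by `same-corner`.
      corner : Fin p → Fin q → Carrier
      corner v f = let g , _ = vert-surjective v ; h , _ = face-surjective f ; i , j , _ = factor (h ⁻¹ ∙ g) in g ∙ (b ^ j) ⁻¹

      private
        h∙a^i : ∀ g h → let i , j , _ = factor (h ⁻¹ ∙ g) in g ∙ (b ^ j) ⁻¹ ≈ h ∙ a ^ i
        h∙a^i g h = let i , j , e = factor (h ⁻¹ ∙ g) in begin
          g ∙ (b ^ j) ⁻¹                      ≈⟨ solve (g ∷ h ∷ b ^ j ∷ []) (v0 ⊙ v2 ⁻) (v1 ⊙ (v1 ⁻ ⊙ v0) ⊙ v2 ⁻) ≡.refl ⟩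
          h ∙ (h ⁻¹ ∙ g) ∙ (b ^ j) ⁻¹         ≈⟨ ∙-congʳ (∙-congˡ e) ⟩
          h ∙ (a ^ i ∙ b ^ j) ∙ (b ^ j) ⁻¹    ≈⟨ solve (h ∷ a ^ i ∷ b ^ j ∷ []) (v0 ⊙ (v1 ⊙ v2) ⊙ v2 ⁻) (v0 ⊙ v1) ≡.refl ⟩
          h ∙ a ^ i                           ∎

      vert-corner : ∀ v f → vert (corner v f) ≡ v
      vert-corner v f = let g , g≡ = vert-surjective v ; h , _ = face-surjective f ; i , j , _ = factor (h ⁻¹ ∙ g) in
        ≡.trans (≡.sym (vert-∙b^ (g ∙ (b ^ j) ⁻¹) j)) (≡.trans (vert-cong (solve (g ∷ b ^ j ∷ []) (v0 ⊙ v1 ⁻ ⊙ v1) v0 ≡.refl)) g≡)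

      face-corner : ∀ v f → face (corner v f) ≡ f
      face-corner v f = let g , _ = vert-surjective v ; h , h≡ = face-surjective f ; i , j , _ = factor (h ⁻¹ ∙ g) in
        ≡.trans (face-cong (h∙a^i g h)) (≡.trans (face-∙a^ h i) h≡)

    corner-of : ∀ g → corner (vert g) (face g) ≈ g
    corner-of g = same-corner _ g (vert-corner _ _) (face-corner _ _)

    abstract
      index : Carrier → Fin (p ℕ.* q)
      index g = combine (vert g) (face g)

      element : Fin (p ℕ.* q) → Carrier
      element k = corner (proj₁ (remQuot {p} q k)) (proj₂ (remQuot {p} q k))

      index-cong : ∀ {g h} → g ≈ h → index g ≡ index h
      index-cong e = ≡.cong₂ combine (vert-cong e) (face-cong e)

      index-injective : ∀ g h → index g ≡ index h → g ≈ h
      index-injective g h e = let v≡ , f≡ = combine-injective (vert g) (face g) (vert h) (face h) e in same-corner g h v≡ f≡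

      index-element : ∀ k → index (element k) ≡ k
      index-element k = ≡.trans (≡.cong₂ combine (vert-corner v f) (face-corner v f)) (combine-remQuot {p} q k)
        where
        v : Fin p
        v = proj₁ (remQuot {p} q k)
        f : Fin q
        f = proj₂ (remQuot {p} q k)

    element-index : ∀ g → element (index g) ≈ g
    element-index g = index-injective _ g (index-element (index g))

    t≉ε : ¬ t ≈ ε
    t≉ε e = a∉B (ℕ.pred q ℕ.* 1) (trans (inverseˡ-unique a b e) (trans (⁻¹-cong (sym (^-1 b))) (^-inverse b q b^q≈ε 1)))

    flip : Fin (p ℕ.* q) → Fin (p ℕ.* q)
    flip k = index (element k ∙ t)

    flip-involutive : ∀ k → flip (flip k) ≡ k
    flip-involutive k = ≡.trans (index-cong (trans (∙-congʳ (element-index _)) (solve (element k ∷ []) (v0 ⊙ τ ⊙ τ) v0 ≡.refl))) (index-element k)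

    flip-free : ∀ k → flip k ≢ k
    flip-free k e = t≉ε (∙-cancelˡ (element k) _ _ (trans (index-injective _ _ (≡.trans e (≡.sym (index-element k)))) (sym (identityʳ _))))

    module Q = InvolutionQuotient flip flip-involutive flip-free

    ne : ℕ
    ne = Q.size

    abstract
      edge : Carrier → Fin ne
      edge g = Q.class (index g)

      edge-cong : ∀ {g h} → g ≈ h → edge g ≡ edge h
      edge-cong e = ≡.cong Q.class (index-cong e)

      edge-t : ∀ g → edge (g ∙ t) ≡ edge g
      edge-t g = ≡.trans (≡.cong Q.class (index-cong (∙-congʳ (sym (element-index g))))) (Q.class-τ (index g))

      edge-sound : ∀ g h → edge g ≡ edge h → h ≈ g ⊎ h ≈ g ∙ t
      edge-sound g h e = cases (Q.class-sound (index g) (index h) e)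
        where
        cases : index h ≡ index g ⊎ index h ≡ flip (index g) → h ≈ g ⊎ h ≈ g ∙ t
        cases (inj₁ x) = inj₁ (index-injective h g x)
        cases (inj₂ x) = inj₂ (trans (index-injective h _ x) (∙-congʳ (element-index g)))

      edge-rep : Fin ne → Carrier
      edge-rep e = element (Q.rep e)

      edge-of-rep : ∀ e → edge (edge-rep e) ≡ e
      edge-of-rep e = ≡.trans (≡.cong Q.class (index-element _)) (Q.class-rep e)

      -- Incidence is nonempty intersection of cosets; an edge coset has the two elements listed
      -- here.
      I01 : Fin p → Fin ne → Bool
      I01 v e = ⌊ vert (edge-rep e) ≟ v ⌋ ∨ ⌊ vert (edge-rep e ∙ t) ≟ v ⌋

      I12 : Fin ne → Fin q → Bool
      I12 e f = ⌊ face (edge-rep e) ≟ f ⌋ ∨ ⌊ face (edge-rep e ∙ t) ≟ f ⌋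

      private
        elim : ∀ {n} (φ : Carrier → Fin n) e x → T (⌊ φ (edge-rep e) ≟ x ⌋ ∨ ⌊ φ (edge-rep e ∙ t) ≟ x ⌋) → ∃ λ g → edge g ≡ e × φ g ≡ x
        elim φ e x h = cases (Equivalence.to (T-∨ {⌊ φ (edge-rep e) ≟ x ⌋}) h)
          where
          cases : T ⌊ φ (edge-rep e) ≟ x ⌋ ⊎ T ⌊ φ (edge-rep e ∙ t) ≟ x ⌋ → ∃ λ g → edge g ≡ e × φ g ≡ x
          cases (inj₁ y) = edge-rep e , edge-of-rep e , toWitness y
          cases (inj₂ y) = edge-rep e ∙ t , ≡.trans (edge-t (edge-rep e)) (edge-of-rep e) , toWitness y

        intro : ∀ {n} (φ : Carrier → Fin n) → (∀ {g h} → g ≈ h → φ g ≡ φ h) → ∀ g e x → edge g ≡ e → φ g ≡ x →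
          T (⌊ φ (edge-rep e) ≟ x ⌋ ∨ ⌊ φ (edge-rep e ∙ t) ≟ x ⌋)
        intro φ φ-cong g e x e≡ x≡ = Equivalence.from (T-∨ {⌊ φ (edge-rep e) ≟ x ⌋}) (cases (edge-sound (edge-rep e) g (≡.trans (edge-of-rep e) (≡.sym e≡))))
          where
          cases : g ≈ edge-rep e ⊎ g ≈ edge-rep e ∙ t → T ⌊ φ (edge-rep e) ≟ x ⌋ ⊎ T ⌊ φ (edge-rep e ∙ t) ≟ x ⌋
          cases (inj₁ g≈) = inj₁ (fromWitness (≡.trans (φ-cong (sym g≈)) x≡))
          cases (inj₂ g≈) = inj₂ (fromWitness (≡.trans (φ-cong (sym g≈)) x≡))

      I01-elim : ∀ v e → T (I01 v e) → ∃ λ g → edge g ≡ e × vert g ≡ v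
      I01-elim v e = elim vert e v
      I01-intro : ∀ {v e} g → edge g ≡ e → vert g ≡ v → T (I01 v e)
      I01-intro {v} {e} g = intro vert vert-cong g e v
      I12-elim : ∀ e f → T (I12 e f) → ∃ λ g → edge g ≡ e × face g ≡ f
      I12-elim e f = elim face e f
      I12-intro : ∀ {e f} g → edge g ≡ e → face g ≡ f → T (I12 e f)
      I12-intro {e} {f} g = intro face face-cong g e f

    -- Every vertex coset meets every face coset, so vertices and faces are all incident.
    poset : RankedPoset
    poset = record
      { nv = p ; ne = ne ; nf = q ; I01 = I01 ; I12 = I12 ; I02 = λ _ _ → true ; trans012 = λ _ _ _ _ _ → tt }

    module P = RankedPoset poset
    open P using (vtx; edg; fac; Inc; Nbr; NbrAdj; Flag; fv; fe; ff; Adjacent; Automorphism; Maps)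

    b·t : ∀ g → g ∙ b ∙ t ≈ g ∙ a ⁻¹
    b·t g = begin
      g ∙ b ∙ t                ≈⟨ ∙-congʳ (∙-congˡ b≈a⁻¹t) ⟩
      g ∙ (a ⁻¹ ∙ t) ∙ t       ≈⟨ solve (g ∷ a ∷ []) (v0 ⊙ (v1 ⁻ ⊙ τ) ⊙ τ) (v0 ⊙ v1 ⁻) ≡.refl ⟩
      g ∙ a ⁻¹                 ∎

    edge-b : ∀ g → edge (g ∙ b) ≡ edge (g ∙ a ⁻¹)
    edge-b g = ≡.trans (≡.sym (edge-t (g ∙ b))) (edge-cong (b·t g))

    edge-b≢ : ∀ g → edge g ≢ edge (g ∙ b)
    edge-b≢ g e = cases (edge-sound g (g ∙ b) e)
      where
      cases : g ∙ b ≈ g ⊎ g ∙ b ≈ g ∙ t → ⊥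
      cases (inj₁ x) = b∉A 0 (∙-cancelˡ g _ _ (trans x (sym (identityʳ g))))
      cases (inj₂ x) = a∉B 0 (∙-cancelʳ b _ _ (trans (sym (∙-cancelˡ g _ _ x)) (sym (identityˡ b))))

    -- The edge coset meets the vertex in some `h₁` and the face in some `h₂`. If they agree, this
    -- is the corner; otherwise `h₂ = h₁ t` lies in the same face coset as `h₁ b⁻¹`, and that
    -- element is the corner.
    corner-edges : ∀ v f e → T (I01 v e) → T (I12 e f) → e ≡ edge (corner v f) ⊎ e ≡ edge (corner v f ∙ b)
    corner-edges v f e i j = from (I01-elim v e i) (I12-elim e f j)
      where
      from : (∃ λ g → edge g ≡ e × vert g ≡ v) → (∃ λ g → edge g ≡ e × face g ≡ f) → e ≡ edge (corner v f) ⊎ e ≡ edge (corner v f ∙ b)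
      from (h₁ , e₁ , v₁) (h₂ , e₂ , f₂) = cases (edge-sound h₁ h₂ (≡.trans e₁ (≡.sym e₂)))
        where
        cases : h₂ ≈ h₁ ⊎ h₂ ≈ h₁ ∙ t → e ≡ edge (corner v f) ⊎ e ≡ edge (corner v f ∙ b)
        cases (inj₁ x) = inj₁ (≡.trans (≡.sym e₁) (edge-cong (same-corner h₁ _ (≡.trans v₁ (≡.sym (vert-corner v f)))
          (≡.trans (face-cong (sym x)) (≡.trans f₂ (≡.sym (face-corner v f)))))))
        cases (inj₂ x) = inj₂ (≡.trans (≡.sym e₁) (edge-cong (trans (solve (h₁ ∷ b ∷ []) v0 (v0 ⊙ v1 ⁻ ⊙ v1) ≡.refl)
          (∙-congʳ (same-corner (h₁ ∙ b ⁻¹) _ (≡.trans (vert-b⁻¹ h₁) (≡.trans v₁ (≡.sym (vert-corner v f))))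
            (≡.trans (≡.sym (face-t h₁)) (≡.trans (face-cong (sym x)) (≡.trans f₂ (≡.sym (face-corner v f))))))))))

    I12-b : ∀ g → T (I12 (edge (g ∙ b)) (face g))
    I12-b g = I12-intro (g ∙ a ⁻¹) (≡.sym (edge-b g)) (face-a⁻¹ g)

    I01-a : ∀ g → T (I01 (vert (g ∙ a)) (edge g))
    I01-a g = I01-intro (g ∙ t) (edge-t g) (vert-t g)

    edge-vertices : ∀ e → count p (λ v → I01 v e) ≡ 2
    edge-vertices e = count-two (vert g) (vert (g ∙ a)) (vert-a≢ g) (I01-intro g (edge-of-rep e) ≡.refl)
      (≡.subst (λ e → T (I01 (vert (g ∙ a)) e)) (edge-of-rep e) (I01-a g)) λ v i → cases v (I01-elim v e i)
      where
      g : Carrier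
      g = edge-rep e
      cases : ∀ v → (∃ λ h → edge h ≡ e × vert h ≡ v) → v ≡ vert g ⊎ v ≡ vert (g ∙ a)
      cases v (h , e≡ , v≡) with edge-sound g h (≡.trans (edge-of-rep e) (≡.sym e≡))
      ... | inj₁ x = inj₁ (≡.trans (≡.sym v≡) (vert-cong x))
      ... | inj₂ x = inj₂ (≡.trans (≡.sym v≡) (≡.trans (vert-cong x) (vert-t g)))

    edge-faces : ∀ e → count q (λ f → I12 e f) ≡ 2
    edge-faces e = count-two (face g) (face (g ∙ b ⁻¹)) (face-b⁻¹≢ g) (I12-intro g (edge-of-rep e) ≡.refl)
      (I12-intro (g ∙ t) (≡.trans (edge-t g) (edge-of-rep e)) (face-t g)) λ f i → cases f (I12-elim e f i)
      where
      g : Carrier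
      g = edge-rep e
      cases : ∀ f → (∃ λ h → edge h ≡ e × face h ≡ f) → f ≡ face g ⊎ f ≡ face (g ∙ b ⁻¹)
      cases f (h , e≡ , f≡) with edge-sound g h (≡.trans (edge-of-rep e) (≡.sym e≡))
      ... | inj₁ x = inj₁ (≡.trans (≡.sym f≡) (face-cong x))
      ... | inj₂ x = inj₂ (≡.trans (≡.sym f≡) (≡.trans (face-cong x) (face-t g)))

    diamond : ∀ v f → count ne (λ e → I01 v e ∧ I12 e f) ≡ 2
    diamond v f = count-two (edge g) (edge (g ∙ b)) (edge-b≢ g)
      (Equivalence.from T-∧ (I01-intro g ≡.refl (vert-corner v f) , I12-intro g ≡.refl (face-corner v f)))
      (Equivalence.from T-∧ (I01-intro (g ∙ b) ≡.refl (≡.trans (vert-b g) (vert-corner v f)) ,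
        ≡.subst (λ f → T (I12 (edge (g ∙ b)) f)) (face-corner v f) (I12-b g)))
      λ e i → let i₁ , i₂ = Equivalence.to (T-∧ {I01 v e}) i in corner-edges v f e i₁ i₂
      where
      g : Carrier
      g = corner v f

    face-size : ∀ f → count ne (λ e → I12 e f) ≡ p
    face-size f = count-unique record
      { element = λ i → edge (g ∙ a ^ toℕ i)
      ; injective = λ {i} {j} e → toℕ-injective (cases i j (edge-sound _ _ e))
      ; valid = λ i → I12-intro (g ∙ a ^ toℕ i) ≡.refl (≡.trans (face-∙a^ g (toℕ i)) g≡)
      ; index = λ e i → find e (I12-elim e f i)
      }
      where
      g : Carrier
      g = proj₁ (face-surjective f)
      g≡ : face g ≡ f
      g≡ = proj₂ (face-surjective f)
      cases : ∀ (i j : Fin p) → g ∙ a ^ toℕ j ≈ g ∙ a ^ toℕ i ⊎ g ∙ a ^ toℕ j ≈ g ∙ a ^ toℕ i ∙ t → toℕ i ≡ toℕ j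
      cases i j (inj₁ x) = a^-injective _ _ (toℕ<n i) (toℕ<n j) (sym (∙-cancelˡ g _ _ x))
      cases i j (inj₂ x) = ⊥-elim (face-b⁻¹≢ (g ∙ a ^ toℕ i) (≡.trans (face-∙a^ g (toℕ i)) (≡.trans (≡.sym (face-∙a^ g (toℕ j)))
        (≡.trans (face-cong x) (face-t (g ∙ a ^ toℕ i))))))
      find : ∀ e → (∃ λ h → edge h ≡ e × face h ≡ f) → ∃ λ i → edge (g ∙ a ^ toℕ i) ≡ e
      find e (h , e≡ , f≡) = let k , h≈ = face-sound g h (≡.trans g≡ (≡.sym f≡)) in fromℕ< (m%n<n k p) ,
        ≡.trans (edge-cong (trans (∙-congˡ (trans (^-≡ a (toℕ-fromℕ< (m%n<n k p))) (sym (V.a^-mod k)))) (sym h≈))) e≡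

    vertex-size : ∀ v → count ne (λ e → I01 v e) ≡ q
    vertex-size v = count-unique record
      { element = λ i → edge (g ∙ b ^ toℕ i)
      ; injective = λ {i} {j} e → toℕ-injective (cases i j (edge-sound _ _ e))
      ; valid = λ i → I01-intro (g ∙ b ^ toℕ i) ≡.refl (≡.trans (vert-∙b^ g (toℕ i)) g≡)
      ; index = λ e i → find e (I01-elim v e i)
      }
      where
      g : Carrier
      g = proj₁ (vert-surjective v)
      g≡ : vert g ≡ v
      g≡ = proj₂ (vert-surjective v)
      cases : ∀ (i j : Fin q) → g ∙ b ^ toℕ j ≈ g ∙ b ^ toℕ i ⊎ g ∙ b ^ toℕ j ≈ g ∙ b ^ toℕ i ∙ t → toℕ i ≡ toℕ j
      cases i j (inj₁ x) = b^-injective _ _ (toℕ<n i) (toℕ<n j) (sym (∙-cancelˡ g _ _ x))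
      cases i j (inj₂ x) = ⊥-elim (vert-a≢ (g ∙ b ^ toℕ i) (≡.trans (vert-∙b^ g (toℕ i)) (≡.trans (≡.sym (vert-∙b^ g (toℕ j)))
        (≡.trans (vert-cong x) (vert-t (g ∙ b ^ toℕ i))))))
      find : ∀ e → (∃ λ h → edge h ≡ e × vert h ≡ v) → ∃ λ i → edge (g ∙ b ^ toℕ i) ≡ e
      find e (h , e≡ , v≡) = let k , h≈ = vert-sound g h (≡.trans g≡ (≡.sym v≡)) in fromℕ< (m%n<n k q) ,
        ≡.trans (edge-cong (trans (∙-congˡ (trans (^-≡ b (toℕ-fromℕ< (m%n<n k q))) (sym (b^-mod k)))) (sym h≈))) e≡

    Inc-sym : ∀ x y → Inc x y → Inc y x
    Inc-sym (vtx v) (edg e) i = i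
    Inc-sym (edg e) (vtx v) i = i
    Inc-sym (edg e) (fac f) i = i
    Inc-sym (fac f) (edg e) i = i
    Inc-sym (vtx v) (fac f) i = i
    Inc-sym (fac f) (vtx v) i = i

    connected : ∀ x y → Star Inc x y
    connected x y = Star.reverse (λ {x} {y} → Inc-sym x y) (from-base x) ◅◅ from-base y
      where
      base : P.Elem
      base = vtx (vert ε)
      from-base : ∀ x → Star Inc base x
      from-base (fac f) = _◅_ {j = fac f} tt nil
      from-base (vtx v) = _◅_ {j = fac (face ε)} tt (_◅_ {j = vtx v} tt nil)
      from-base (edg e) = from-base (vtx (vert (edge-rep e))) ◅◅ (_◅_ {j = edg e} (I01-intro (edge-rep e) (edge-of-rep e) ≡.refl) nil)

    NbrAdj-sym : ∀ x {m n} → NbrAdj x m n → NbrAdj x n m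
    NbrAdj-sym x {m , _} {n , _} = Inc-sym m n

    vertex-conn : ∀ v (m n : Nbr (vtx v)) → Star (NbrAdj (vtx v)) m n
    vertex-conn v m n = Star.reverse (λ {x} {y} → NbrAdj-sym (vtx v) {x} {y}) (from-base m) ◅◅ from-base n
      where
      g : Carrier
      g = proj₁ (vert-surjective v)
      g≡ : vert g ≡ v
      g≡ = proj₂ (vert-surjective v)
      at : ∀ k → T (I01 v (edge (g ∙ b ^ k)))
      at k = I01-intro (g ∙ b ^ k) ≡.refl (≡.trans (vert-∙b^ g k) g≡)
      nbr : ℕ → Nbr (vtx v)
      nbr k = edg (edge (g ∙ b ^ k)) , at k
      walk : ∀ k → Star (NbrAdj (vtx v)) (nbr 0) (nbr k)
      walk zero    = nil
      walk (suc k) = walk k ◅◅ (_◅_ {j = fac (face (g ∙ b ^ k)) , tt} (I12-intro (g ∙ b ^ k) ≡.refl ≡.refl)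
        (_◅_ {j = nbr (suc k)} (≡.subst (λ e → T (I12 e (face (g ∙ b ^ k)))) (edge-cong (trans (assoc _ _ _) (∙-congˡ (sym (^-suc′ b k))))) (I12-b (g ∙ b ^ k))) nil))
      reach : ∀ h → vert h ≡ v → ∃ λ k → g ∙ b ^ k ≈ h
      reach h v≡ = let k , h≈ = vert-sound g h (≡.trans g≡ (≡.sym v≡)) in k , sym h≈
      from-base : ∀ n → Star (NbrAdj (vtx v)) (nbr 0) n
      from-base (edg e , i) = let h , e≡ , v≡ = I01-elim v e i ; k , gb≈ = reach h v≡ in to-edge k (≡.trans (edge-cong gb≈) e≡)
        where
        to-edge : ∀ k → edge (g ∙ b ^ k) ≡ e → Star (NbrAdj (vtx v)) (nbr 0) (edg e , i)
        to-edge k ≡.refl = ≡.subst (λ j → Star (NbrAdj (vtx v)) (nbr 0) (edg (edge (g ∙ b ^ k)) , j)) (T-irrelevant (at k) i) (walk k)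
      from-base (fac f , _) = let k , gb≈ = reach (corner v f) (vert-corner v f) in
        walk k ◅◅ (_◅_ {j = fac f , _} (I12-intro (g ∙ b ^ k) ≡.refl (≡.trans (face-cong gb≈) (face-corner v f))) nil)

    face-conn : ∀ f (m n : Nbr (fac f)) → Star (NbrAdj (fac f)) m n
    face-conn f m n = Star.reverse (λ {x} {y} → NbrAdj-sym (fac f) {x} {y}) (from-base m) ◅◅ from-base n
      where
      g : Carrier
      g = proj₁ (face-surjective f)
      g≡ : face g ≡ f
      g≡ = proj₂ (face-surjective f)
      at : ∀ k → T (I12 (edge (g ∙ a ^ k)) f)
      at k = I12-intro (g ∙ a ^ k) ≡.refl (≡.trans (face-∙a^ g k) g≡)
      nbr : ℕ → Nbr (fac f)
      nbr k = edg (edge (g ∙ a ^ k)) , at k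
      walk : ∀ k → Star (NbrAdj (fac f)) (nbr 0) (nbr k)
      walk zero    = nil
      walk (suc k) = walk k ◅◅ (_◅_ {j = vtx (vert (g ∙ a ^ k ∙ a)) , tt} (I01-a (g ∙ a ^ k))
        (_◅_ {j = nbr (suc k)} (I01-intro (g ∙ a ^ suc k) ≡.refl (vert-cong (trans (∙-congˡ (^-suc′ a k)) (sym (assoc _ _ _))))) nil))
      reach : ∀ h → face h ≡ f → ∃ λ k → g ∙ a ^ k ≈ h
      reach h f≡ = let k , h≈ = face-sound g h (≡.trans g≡ (≡.sym f≡)) in k , sym h≈
      from-base : ∀ n → Star (NbrAdj (fac f)) (nbr 0) n
      from-base (edg e , i) = let h , e≡ , f≡ = I12-elim e f i ; k , ga≈ = reach h f≡ in to-edge k (≡.trans (edge-cong ga≈) e≡)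
        where
        to-edge : ∀ k → edge (g ∙ a ^ k) ≡ e → Star (NbrAdj (fac f)) (nbr 0) (edg e , i)
        to-edge k ≡.refl = ≡.subst (λ j → Star (NbrAdj (fac f)) (nbr 0) (edg (edge (g ∙ a ^ k)) , j)) (T-irrelevant (at k) i) (walk k)
      from-base (vtx v , _) = let k , ga≈ = reach (corner v f) (face-corner v f) in
        walk k ◅◅ (_◅_ {j = vtx v , _} (I01-intro (g ∙ a ^ k) ≡.refl (≡.trans (vert-cong ga≈) (vert-corner v f))) nil)

    isPolyhedron : IsPolyhedron poset
    isPolyhedron = record
      { edge-vertices = edge-vertices ; edge-faces = edge-faces ; diamond = λ v f _ → diamond v f
      ; connected = connected ; vertex-conn = vertex-conn ; face-conn = face-conn }

    hasType : HasType poset p q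
    hasType = face-size , vertex-size

    tight : Tight poset p q
    tight = ≡.trans (numFlags≡ poset isPolyhedron hasType) (shuffle p q)
      where
      shuffle : ∀ p q → p ℕ.* (2 ℕ.* q) ≡ 2 ℕ.* p ℕ.* q
      shuffle = solve-∀

    -- The class records whether the three cosets have a common element. Flags for which they do
    -- correspond to the elements of the group.
    cls : Flag → Bool
    cls (v , e , f , _) = ⌊ edge (corner v f) ≟ e ⌋

    edge-cls : ∀ Φ c → cls Φ ≡ c → fe Φ ≡ edge (if c then corner (fv Φ) (ff Φ) else (corner (fv Φ) (ff Φ) ∙ b))
    edge-cls (v , e , f , i , j , _) c c≡ with edge (corner v f) ≟ e
    edge-cls (v , e , f , i , j , _) true  _  | yes x = ≡.sym x
    edge-cls (v , e , f , i , j , _) false _  | no  x with corner-edges v f e i j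
    ... | inj₁ y = ⊥-elim (x (≡.sym y))
    ... | inj₂ y = y

    b·t·b⁻¹ : ∀ g → g ∙ b ∙ t ∙ b ⁻¹ ≈ g ∙ a ⁻¹ ∙ b ⁻¹
    b·t·b⁻¹ g = ∙-congʳ (b·t g)

    -- The corner of the second flag of class `c` on the same edge; in the second case it is
    -- `g b t b⁻¹ = g a⁻¹ b⁻¹`.
    half-turn : Bool → Carrier → Carrier
    half-turn true  g = g ∙ t
    half-turn false g = g ∙ a ⁻¹ ∙ b ⁻¹

    same-edge : ∀ c g h → edge (if c then g else (g ∙ b)) ≡ edge (if c then h else (h ∙ b)) → h ≈ g ⊎ h ≈ half-turn c g
    same-edge true  g h e = edge-sound g h e
    same-edge false g h e = cases (edge-sound (g ∙ b) (h ∙ b) e)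
      where
      cases : h ∙ b ≈ g ∙ b ⊎ h ∙ b ≈ g ∙ b ∙ t → h ≈ g ⊎ h ≈ half-turn false g
      cases (inj₁ x) = inj₁ (∙-cancelʳ b _ _ x)
      cases (inj₂ x) = inj₂ (trans (solve (h ∷ b ∷ []) v0 (v0 ⊙ v1 ⊙ v1 ⁻) ≡.refl) (trans (∙-congʳ x) (b·t·b⁻¹ g)))

    half-turn-vert : ∀ c g → vert g ≢ vert (half-turn c g)
    half-turn-vert true  g e = vert-a≢ g (≡.trans e (vert-t g))
    half-turn-vert false g e = vert-a⁻¹≢ g (≡.trans e (vert-b⁻¹ (g ∙ a ⁻¹)))

    half-turn-face : ∀ c g → face g ≢ face (half-turn c g)
    half-turn-face true  g e = face-b⁻¹≢ g (≡.trans e (face-t g))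
    half-turn-face false g e = face-b⁻¹≢ (g ∙ a ⁻¹) (≡.trans (face-a⁻¹ g) e)

    -- Two flags of one class on a common edge are equal or related by a half-turn, which changes
    -- vertex and face simultaneously, whereas adjacency changes only one element.
    separates : ∀ i Φ Ψ → Adjacent i Φ Ψ → cls Φ ≢ cls Ψ
    separates 0F Φ Ψ (v≢ , e≡ , f≡) c≡ = cases (same-edge (cls Φ) _ _ (≡.trans (≡.sym (edge-cls Φ (cls Φ) ≡.refl)) (≡.trans e≡ (edge-cls Ψ (cls Φ) (≡.sym c≡)))))
      where
      g h : Carrier
      g = corner (fv Φ) (ff Φ)
      h = corner (fv Ψ) (ff Ψ)
      cases : h ≈ g ⊎ h ≈ half-turn (cls Φ) g → ⊥
      cases (inj₁ x) = v≢ (≡.trans (≡.sym (vert-corner _ _)) (≡.trans (vert-cong (sym x)) (vert-corner _ _)))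
      cases (inj₂ x) = half-turn-face (cls Φ) g (≡.trans (face-corner _ _) (≡.trans f≡ (≡.trans (≡.sym (face-corner _ _)) (face-cong x))))
    separates 1F Φ@(v , e , f , _) Ψ@(v , e′ , f , _) (≡.refl , e≢ , ≡.refl) c≡ =
      e≢ (≡.trans (edge-cls Φ (cls Φ) ≡.refl) (≡.sym (edge-cls Ψ (cls Φ) (≡.sym c≡))))
    separates 2F Φ Ψ (v≡ , e≡ , f≢) c≡ = cases (same-edge (cls Φ) _ _ (≡.trans (≡.sym (edge-cls Φ (cls Φ) ≡.refl)) (≡.trans e≡ (edge-cls Ψ (cls Φ) (≡.sym c≡)))))
      where
      g h : Carrier
      g = corner (fv Φ) (ff Φ)
      h = corner (fv Ψ) (ff Ψ)
      cases : h ≈ g ⊎ h ≈ half-turn (cls Φ) g → ⊥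
      cases (inj₁ x) = f≢ (≡.trans (≡.sym (face-corner _ _)) (≡.trans (face-cong (sym x)) (face-corner _ _)))
      cases (inj₂ x) = half-turn-vert (cls Φ) g (≡.trans (vert-corner _ _) (≡.trans v≡ (≡.trans (≡.sym (vert-corner _ _)) (vert-cong x))))

    L0 : Carrier → Fin p → Fin p
    L0 h v = vert (h ∙ proj₁ (vert-surjective v))
    L1 : Carrier → Fin ne → Fin ne
    L1 h e = edge (h ∙ edge-rep e)
    L2 : Carrier → Fin q → Fin q
    L2 h f = face (h ∙ proj₁ (face-surjective f))

    L0-at : ∀ h g → L0 h (vert g) ≡ vert (h ∙ g)
    L0-at h g = vert-left h (proj₂ (vert-surjective (vert g)))
    L2-at : ∀ h g → L2 h (face g) ≡ face (h ∙ g)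
    L2-at h g = face-left h (proj₂ (face-surjective (face g)))
    L1-at : ∀ h g → L1 h (edge g) ≡ edge (h ∙ g)
    L1-at h g = cases (edge-sound (edge-rep (edge g)) g (edge-of-rep (edge g)))
      where
      r : Carrier
      r = edge-rep (edge g)
      cases : g ≈ r ⊎ g ≈ r ∙ t → edge (h ∙ r) ≡ edge (h ∙ g)
      cases (inj₁ x) = edge-cong (∙-congˡ (sym x))
      cases (inj₂ x) = ≡.sym (≡.trans (edge-cong (trans (∙-congˡ x) (sym (assoc h r t)))) (edge-t (h ∙ r)))

    cancelˡ : ∀ h k g → h ∙ k ≈ ε → h ∙ (k ∙ g) ≈ g
    cancelˡ h k g e = trans (sym (assoc h k g)) (trans (∙-congʳ e) (identityˡ g))

    L0-inverse : ∀ h k → h ∙ k ≈ ε → ∀ v → L0 h (L0 k v) ≡ v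
    L0-inverse h k e v = ≡.trans (L0-at h _) (≡.trans (vert-cong (cancelˡ h k _ e)) (proj₂ (vert-surjective v)))
    L1-inverse : ∀ h k → h ∙ k ≈ ε → ∀ x → L1 h (L1 k x) ≡ x
    L1-inverse h k e x = ≡.trans (L1-at h _) (≡.trans (edge-cong (cancelˡ h k _ e)) (edge-of-rep x))
    L2-inverse : ∀ h k → h ∙ k ≈ ε → ∀ f → L2 h (L2 k f) ≡ f
    L2-inverse h k e f = ≡.trans (L2-at h _) (≡.trans (face-cong (cancelˡ h k _ e)) (proj₂ (face-surjective f)))

    L-I01 : ∀ h v e → T (I01 v e) → T (I01 (L0 h v) (L1 h e))
    L-I01 h v e i = let g , e≡ , v≡ = I01-elim v e i in
      I01-intro (h ∙ g) (≡.trans (≡.sym (L1-at h g)) (≡.cong (L1 h) e≡)) (≡.trans (≡.sym (L0-at h g)) (≡.cong (L0 h) v≡))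

    L-I12 : ∀ h e f → T (I12 e f) → T (I12 (L1 h e) (L2 h f))
    L-I12 h e f i = let g , e≡ , f≡ = I12-elim e f i in
      I12-intro (h ∙ g) (≡.trans (≡.sym (L1-at h g)) (≡.cong (L1 h) e≡)) (≡.trans (≡.sym (L2-at h g)) (≡.cong (L2 h) f≡))

    left-mul : Carrier → Automorphism
    left-mul h = record
      { σ0 = mk↔ₛ′ (L0 h) (L0 (h ⁻¹)) (L0-inverse h (h ⁻¹) (inverseʳ h)) (L0-inverse (h ⁻¹) h (inverseˡ h))
      ; σ1 = mk↔ₛ′ (L1 h) (L1 (h ⁻¹)) (L1-inverse h (h ⁻¹) (inverseʳ h)) (L1-inverse (h ⁻¹) h (inverseˡ h))
      ; σ2 = mk↔ₛ′ (L2 h) (L2 (h ⁻¹)) (L2-inverse h (h ⁻¹) (inverseʳ h)) (L2-inverse (h ⁻¹) h (inverseˡ h))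
      ; pres01 = λ v e → T-ext (λ i → ≡.subst₂ (λ v e → T (I01 v e)) (L0-inverse (h ⁻¹) h (inverseˡ h) v) (L1-inverse (h ⁻¹) h (inverseˡ h) e) (L-I01 (h ⁻¹) _ _ i)) (L-I01 h v e)
      ; pres12 = λ e f → T-ext (λ i → ≡.subst₂ (λ e f → T (I12 e f)) (L1-inverse (h ⁻¹) h (inverseˡ h) e) (L2-inverse (h ⁻¹) h (inverseˡ h) f) (L-I12 (h ⁻¹) _ _ i)) (L-I12 h e f)
      ; pres02 = λ _ _ → ≡.refl
      }

    transitive : ∀ Φ Ψ → cls Φ ≡ cls Ψ → Σ Automorphism λ α → Maps α Φ Ψ
    transitive Φ Ψ c≡ = left-mul h ,
      ≡.trans (≡.cong (L0 h) (≡.sym (vert-corner _ _))) (≡.trans (L0-at h g) (≡.trans (vert-cong hg≈k) (vert-corner _ _))) ,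
      ≡.trans (≡.cong (L1 h) (edge-cls Φ (cls Φ) ≡.refl)) (≡.trans (L1-at h _) (≡.trans (edge-cong (at (cls Φ))) (≡.sym (edge-cls Ψ (cls Φ) (≡.sym c≡))))) ,
      ≡.trans (≡.cong (L2 h) (≡.sym (face-corner _ _))) (≡.trans (L2-at h g) (≡.trans (face-cong hg≈k) (face-corner _ _)))
      where
      g k h : Carrier
      g = corner (fv Φ) (ff Φ)
      k = corner (fv Ψ) (ff Ψ)
      h = k ∙ g ⁻¹
      hg≈k : h ∙ g ≈ k
      hg≈k = solve (k ∷ g ∷ []) (v0 ⊙ v1 ⁻ ⊙ v1) v0 ≡.refl
      at : ∀ c → h ∙ (if c then g else (g ∙ b)) ≈ (if c then k else (k ∙ b))
      at true  = hg≈k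
      at false = trans (sym (assoc h g b)) (∙-congʳ hg≈k)

    -- An automorphism taking the first flag at the corner `ε` to the second reverses orientation at
    -- every corner, and the corner to which it moves `g` is the mirror image of `g`.
    module Mirrored (α : Automorphism) (v≡ : Automorphism.a0 α (vert ε) ≡ vert ε)
      (e≡ : Automorphism.a1 α (edge ε) ≡ edge b) (f≡ : Automorphism.a2 α (face ε) ≡ face ε) where
      open Automorphism α using (a0; a1; a2; pres01; pres12; σ1)

      θ : Carrier → Carrier
      θ g = corner (a0 (vert g)) (a2 (face g))

      θ-cong : ∀ {g h} → g ≈ h → θ g ≈ θ h
      θ-cong e = reflexive (≡.cong₂ (λ v f → corner (a0 v) (a2 f)) (vert-cong e) (face-cong e))

      θ-ε : θ ε ≈ ε
      θ-ε = trans (reflexive (≡.cong₂ corner v≡ f≡)) (corner-of ε)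

      a1-injective : ∀ {x y} → a1 x ≡ a1 y → x ≡ y
      a1-injective {x} {y} e = ≡.trans (≡.sym (Inverse.strictlyInverseʳ σ1 x)) (≡.trans (≡.cong (Inverse.from σ1) e) (Inverse.strictlyInverseʳ σ1 y))

      a0-injective : ∀ {x y} → a0 x ≡ a0 y → x ≡ y
      a0-injective {x} {y} e = ≡.trans (≡.sym (Inverse.strictlyInverseʳ (Automorphism.σ0 α) x)) (≡.trans (≡.cong (Inverse.from (Automorphism.σ0 α)) e) (Inverse.strictlyInverseʳ (Automorphism.σ0 α) y))

      a2-injective : ∀ {x y} → a2 x ≡ a2 y → x ≡ y
      a2-injective {x} {y} e = ≡.trans (≡.sym (Inverse.strictlyInverseʳ (Automorphism.σ2 α) x)) (≡.trans (≡.cong (Inverse.from (Automorphism.σ2 α)) e) (Inverse.strictlyInverseʳ (Automorphism.σ2 α) y))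

      map01 : ∀ {v e} → T (I01 v e) → T (I01 (a0 v) (a1 e))
      map01 {v} {e} = ≡.subst T (≡.sym (pres01 v e))

      map12 : ∀ {e f} → T (I12 e f) → T (I12 (a1 e) (a2 f))
      map12 {e} {f} = ≡.subst T (≡.sym (pres12 e f))

      -- The image of the true flag at g is the false flag at θ g.
      Odd-at : Carrier → Set
      Odd-at g = a1 (edge g) ≡ edge (θ g ∙ b)

      vert-θ : ∀ g → vert (θ g) ≡ a0 (vert g)
      vert-θ g = vert-corner _ _

      face-θ : ∀ g → face (θ g) ≡ a2 (face g)
      face-θ g = face-corner _ _

      edge-vert : ∀ h {v} → T (I01 v (edge h)) → v ≢ vert h → v ≡ vert (h ∙ a)
      edge-vert h {v} i v≢ = let g , e , v≡ = I01-elim v (edge h) i in cases g v≡ (edge-sound h g (≡.sym e))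
        where
        cases : ∀ g → vert g ≡ v → g ≈ h ⊎ g ≈ h ∙ t → v ≡ vert (h ∙ a)
        cases g v≡ (inj₁ x) = ⊥-elim (v≢ (≡.trans (≡.sym v≡) (vert-cong x)))
        cases g v≡ (inj₂ x) = ≡.trans (≡.sym v≡) (≡.trans (vert-cong x) (vert-t h))

      edge-face : ∀ h {f} → T (I12 (edge h) f) → f ≢ face h → f ≡ face (h ∙ b ⁻¹)
      edge-face h {f} i f≢ = let g , e , f≡ = I12-elim (edge h) f i in cases g f≡ (edge-sound h g (≡.sym e))
        where
        cases : ∀ g → face g ≡ f → g ≈ h ⊎ g ≈ h ∙ t → f ≡ face (h ∙ b ⁻¹)
        cases g f≡ (inj₁ x) = ⊥-elim (f≢ (≡.trans (≡.sym f≡) (face-cong x)))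
        cases g f≡ (inj₂ x) = ≡.trans (≡.sym f≡) (≡.trans (face-cong x) (face-t h))

      edge-at : ∀ g e → T (I01 (vert g) e) → T (I12 e (face g)) → a1 e ≡ edge (θ g) ⊎ a1 e ≡ edge (θ g ∙ b)
      edge-at g e i j = corner-edges (a0 (vert g)) (a2 (face g)) (a1 e) (map01 i) (map12 j)

      -- `g a` is the corner at the far end of `edge g` on the same face. The image of that edge is
      -- `edge (θ g ∙ b)`, whose ends are the vertices of `θ g` and of `θ g ∙ a ⁻¹`.
      θ-a : ∀ g → Odd-at g → θ (g ∙ a) ≈ θ g ∙ a ⁻¹
      θ-a g odd = same-corner _ _ (≡.trans (vert-θ (g ∙ a)) v-image)
        (≡.trans (face-θ (g ∙ a)) (≡.trans (≡.cong a2 (face-a g)) (≡.trans (≡.sym (face-θ g)) (≡.sym (face-a⁻¹ (θ g))))))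
        where
        v-image : a0 (vert (g ∙ a)) ≡ vert (θ g ∙ a ⁻¹)
        v-image = ≡.trans (edge-vert (θ g ∙ b) (≡.subst (λ e → T (I01 (a0 (vert (g ∙ a))) e)) odd (map01 (I01-a g)))
          (λ e → vert-a≢ g (a0-injective (≡.trans (≡.sym (vert-θ g)) (≡.trans (≡.sym (vert-b (θ g))) (≡.sym e))))))
          (≡.trans (≡.sym (vert-t (θ g ∙ b))) (vert-cong (b·t (θ g))))

      odd-a : ∀ g → Odd-at g → Odd-at (g ∙ a)
      odd-a g odd = cases (edge-at (g ∙ a) (edge (g ∙ a)) (I01-intro (g ∙ a) ≡.refl ≡.refl) (I12-intro (g ∙ a) ≡.refl ≡.refl))
        where
        cases : a1 (edge (g ∙ a)) ≡ edge (θ (g ∙ a)) ⊎ a1 (edge (g ∙ a)) ≡ edge (θ (g ∙ a) ∙ b) → Odd-at (g ∙ a)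
        cases (inj₂ x) = x
        cases (inj₁ x) = ⊥-elim (edge-b≢ (g ∙ a) (≡.trans (a1-injective (≡.trans x (≡.trans (edge-cong (θ-a g odd)) (≡.trans (≡.sym (edge-b (θ g))) (≡.sym odd)))))
          (≡.trans (≡.sym (edge-t g)) (edge-cong (sym (assoc g a b))))))

      swapped : ∀ g → Odd-at g → a1 (edge (g ∙ b)) ≡ edge (θ g)
      swapped g odd = cases (edge-at g (edge (g ∙ b)) (I01-intro (g ∙ b) ≡.refl (vert-b g)) (I12-b g))
        where
        cases : a1 (edge (g ∙ b)) ≡ edge (θ g) ⊎ a1 (edge (g ∙ b)) ≡ edge (θ g ∙ b) → a1 (edge (g ∙ b)) ≡ edge (θ g)
        cases (inj₁ x) = x
        cases (inj₂ x) = ⊥-elim (edge-b≢ g (a1-injective (≡.trans odd (≡.sym x))))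

      θ-b : ∀ g → Odd-at g → θ (g ∙ b) ≈ θ g ∙ b ⁻¹
      θ-b g odd = same-corner _ _
        (≡.trans (vert-θ (g ∙ b)) (≡.trans (≡.cong a0 (vert-b g)) (≡.trans (≡.sym (vert-θ g)) (≡.sym (vert-b⁻¹ (θ g))))))
        (≡.trans (face-θ (g ∙ b)) (edge-face (θ g) (≡.subst (λ e → T (I12 e (a2 (face (g ∙ b))))) (swapped g odd) (map12 (I12-intro (g ∙ b) ≡.refl ≡.refl)))
          (λ e → face-b≢ g (a2-injective (≡.trans (≡.sym (face-θ g)) (≡.sym e))))))

      odd-b : ∀ g → Odd-at g → Odd-at (g ∙ b)
      odd-b g odd = ≡.trans (swapped g odd) (edge-cong (trans (solve (θ g ∷ b ∷ []) v0 (v0 ⊙ v1 ⁻ ⊙ v1) ≡.refl) (∙-congʳ (sym (θ-b g odd)))))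

      odd-cong : ∀ {g h} → g ≈ h → Odd-at g → Odd-at h
      odd-cong e odd = ≡.trans (≡.cong a1 (edge-cong (sym e))) (≡.trans odd (edge-cong (∙-congʳ (θ-cong e))))

      odd-power : ∀ x → (∀ g → Odd-at g → Odd-at (g ∙ x)) → ∀ k g → Odd-at g → Odd-at (g ∙ x ^ k)
      odd-power x h zero    g odd = odd-cong (sym (identityʳ g)) odd
      odd-power x h (suc k) g odd = odd-cong (assoc g x (x ^ k)) (odd-power x h k (g ∙ x) (h g odd))

      odd-everywhere : ∀ g → Odd-at g
      odd-everywhere g = let i , j , g≈ = factor g in
        odd-cong (trans (∙-congʳ (identityˡ _)) (sym g≈)) (odd-power b odd-b j (ε ∙ a ^ i) (odd-power a odd-a i ε
          (≡.trans e≡ (edge-cong (trans (sym (identityˡ b)) (∙-congʳ (sym θ-ε)))))))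

      reflexible : Reflexible G
      reflexible = θ , θ-cong , θ-ε , (λ g → θ-a g (odd-everywhere g)) , (λ g → θ-b g (odd-everywhere g))

    base opposite : Flag
    base     = vert ε , edge ε , face ε , I01-intro ε ≡.refl ≡.refl , I12-intro ε ≡.refl ≡.refl , tt
    opposite = vert ε , edge b , face ε , I01-intro b ≡.refl (≡.trans (vert-cong (sym (identityˡ b))) (vert-b ε)) ,
      ≡.subst (λ e → T (I12 e (face ε))) (edge-cong (identityˡ b)) (I12-b ε) , tt

    chiral : ¬ Reflexible G → Chiral poset
    chiral none = cls , separates , transitive , base , opposite , λ (α , v≡ , e≡ , f≡) → none (Mirrored.reflexible α v≡ e≡ f≡)

  group⇒polyhedron : ∀ {p q} → 2 ℕ.≤ p → 2 ℕ.≤ q → (G : TightGroup p q) → ¬ Reflexible G → TightChiralPolyhedronOfType p q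
  group⇒polyhedron {p} {q} 2≤p 2≤q G none = poset , isPolyhedron , hasType , tight , chiral none
    where
    instance
      p≢0 : NonZero p
      p≢0 = ℕ.>-nonZero (ℕₚ.<⇒≤ 2≤p)
      q≢0 : NonZero q
      q≢0 = ℕ.>-nonZero (ℕₚ.<⇒≤ 2≤q)
    open Geometry 2≤p 2≤q G

-- Tight groups from permutations, and a test for chirality.

module PermutationGroups where
  open import Level using (0ℓ)
  open import Data.Nat.Base as ℕ using (ℕ; zero; suc; NonZero)
  open import Data.Nat.Divisibility using (_∣_)
  open import Data.Bool.Base using (Bool; true; false)
  open import Data.List.Base using (List; []; _∷_)
  open import Data.Product using (∃; _,_)
  open import Relation.Binary.Bundles using (Setoid)
  open import Relation.Binary.PropositionalEquality as ≡ using (_≡_)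
  open Iteration
  open WordGroups
  open TightGroups

  -- Reflection followed by inversion is an anti-automorphism fixing `a` and `b`, so it reverses
  -- words. A relation whose reversal fails therefore proves chirality.
  mirror-relation : ∀ {p q} .{{_ : NonZero p}} .{{_ : NonZero q}} (T : TightGroup p q) → Reflexible T →
    let open TightGroup T in ∀ i j k → a ^ i ∙ b ≈ b ^ j ∙ a ^ k → b ∙ a ^ i ≈ a ^ k ∙ b ^ j
  mirror-relation T ρ i j k e = ⁻¹-injective (begin
      (b ∙ a ^ i) ⁻¹             ≈⟨ ⁻¹-anti-homo-∙ b (a ^ i) ⟩
      (a ^ i) ⁻¹ ∙ b ⁻¹          ≈⟨ ∙-cong (θ-^ a θ-a i) θ-b ⟨
      θ (a ^ i) ∙ θ b            ≈⟨ θ-homo _ _ ⟨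
      θ (a ^ i ∙ b)              ≈⟨ θ-cong e ⟩
      θ (b ^ j ∙ a ^ k)          ≈⟨ θ-homo _ _ ⟩
      θ (b ^ j) ∙ θ (a ^ k)      ≈⟨ ∙-cong (θ-^ b θ-b j) (θ-^ a θ-a k) ⟩
      (b ^ j) ⁻¹ ∙ (a ^ k) ⁻¹    ≈⟨ ⁻¹-anti-homo-∙ (a ^ k) (b ^ j) ⟨
      (a ^ k ∙ b ^ j) ⁻¹         ∎)
    where
    open TightGroup T
    open Reflection T ρ
    open import Algebra.Properties.Group group
    open import Relation.Binary.Reasoning.Setoid setoid
    θ-^ : ∀ x → θ x ≈ x ⁻¹ → ∀ n → θ (x ^ n) ≈ (x ^ n) ⁻¹
    θ-^ x h zero    = trans θ-ε (sym ε⁻¹≈ε)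
    θ-^ x h (suc n) = trans (θ-homo x (x ^ n)) (trans (∙-cong h (θ-^ x h n)) (trans (sym (⁻¹-anti-homo-∙ (x ^ n) x)) (⁻¹-cong (sym (^-suc′ x n)))))

  -- `exchange` moves powers of `a` past a single `b`, so the products `b^j a^i` exhaust the group.
  -- `separated` covers two facts at once: with `i = 0` the order of `b`, and in general the trivial
  -- intersection of `⟨a⟩` and `⟨b⟩`.
  module PermutationGroup (S : Setoid 0ℓ 0ℓ) (α β : Setoid.Carrier S → Setoid.Carrier S)
    (α-cong : ∀ {x y} → Setoid._≈_ S x y → Setoid._≈_ S (α x) (α y))
    (β-cong : ∀ {x y} → Setoid._≈_ S x y → Setoid._≈_ S (β x) (β y))
    (p q : ℕ) {{p≢0 : NonZero p}} {{q≢0 : NonZero q}}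
    (α^p : ∀ x → Setoid._≈_ S (iter α p x) x) (β^q : ∀ x → Setoid._≈_ S (iter β q x) x)
    (α-order : ∀ i → (∀ x → Setoid._≈_ S (iter α i x) x) → p ∣ i)
    (separated : ∀ i j → (∀ x → Setoid._≈_ S (iter α i x) (iter β j x)) → q ∣ j)
    (exchange : ∀ i → ∃ λ j → ∃ λ k → ∀ x → Setoid._≈_ S (iter α i (β x)) (iter β j (iter α k x)))
    (αβ-involutive : ∀ x → Setoid._≈_ S (α (β (α (β x)))) x) where

    open WordGroup S α β α-cong β-cong p q α^p β^q
    module X = Setoid S
    open Powers group
    open import Algebra.Bundles using (Group)
    open Group group using (_≈_; _∙_; ε; _⁻¹; trans; sym; refl; ∙-cong; ∙-congˡ; ∙-congʳ; assoc; identityʳ; identityˡ; ⁻¹-cong)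
    open import Algebra.Properties.Group group using (⁻¹-anti-homo-∙; ⁻¹-involutive)

    a b : List Bool
    a = true ∷ []
    b = false ∷ []

    from-iter : ∀ i j k → (∀ x → iter α i (β x) X.≈ iter β j (iter α k x)) → a ^ i ∙ b ≈ b ^ j ∙ a ^ k
    from-iter i j k h x = X.trans (X.reflexive (≡.trans (act-++ (a ^ i) b x) (act-^ true i (β x))))
      (X.trans (h x) (X.sym (X.reflexive (≡.trans (act-++ (b ^ j) (a ^ k) x) (≡.trans (≡.cong (act (b ^ j)) (act-^ true k x)) (act-^ false j _))))))

    to-iter : ∀ i j k → b ∙ a ^ i ≈ a ^ k ∙ b ^ j → ∀ x → β (iter α i x) X.≈ iter α k (iter β j x)
    to-iter i j k e x = X.trans (X.sym (X.reflexive (≡.trans (act-++ b (a ^ i) x) (≡.cong β (act-^ true i x)))))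
      (X.trans (e x) (X.reflexive (≡.trans (act-++ (a ^ k) (b ^ j) x) (≡.trans (≡.cong (act (a ^ k)) (act-^ false j x)) (act-^ true k _)))))

    a^-b^ : ∀ j i → ∃ λ j′ → ∃ λ i′ → a ^ i ∙ b ^ j ≈ b ^ j′ ∙ a ^ i′
    a^-b^ zero    i = 0 , i , trans {a ^ i ∙ ε} {a ^ i} {ε ∙ a ^ i} (identityʳ (a ^ i)) (sym {ε ∙ a ^ i} {a ^ i} (identityˡ (a ^ i)))
    a^-b^ (suc j) i =
      let j₁ , i₁ , h = exchange i ; j₂ , i₂ , h₂ = a^-b^ j i₁ in
      j₁ ℕ.+ j₂ , i₂ ,
        trans {a ^ i ∙ (b ∙ b ^ j)} {(a ^ i ∙ b) ∙ b ^ j} {b ^ (j₁ ℕ.+ j₂) ∙ a ^ i₂} (sym {(a ^ i ∙ b) ∙ b ^ j} {a ^ i ∙ (b ∙ b ^ j)} (assoc (a ^ i) b (b ^ j)))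
        (trans {(a ^ i ∙ b) ∙ b ^ j} {(b ^ j₁ ∙ a ^ i₁) ∙ b ^ j} {b ^ (j₁ ℕ.+ j₂) ∙ a ^ i₂} (∙-congʳ {b ^ j} {a ^ i ∙ b} {b ^ j₁ ∙ a ^ i₁} (from-iter i j₁ i₁ h))
        (trans {(b ^ j₁ ∙ a ^ i₁) ∙ b ^ j} {b ^ j₁ ∙ (a ^ i₁ ∙ b ^ j)} {b ^ (j₁ ℕ.+ j₂) ∙ a ^ i₂} (assoc (b ^ j₁) (a ^ i₁) (b ^ j))
        (trans {b ^ j₁ ∙ (a ^ i₁ ∙ b ^ j)} {b ^ j₁ ∙ (b ^ j₂ ∙ a ^ i₂)} {b ^ (j₁ ℕ.+ j₂) ∙ a ^ i₂} (∙-congˡ {b ^ j₁} {a ^ i₁ ∙ b ^ j} {b ^ j₂ ∙ a ^ i₂} h₂)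
        (trans {b ^ j₁ ∙ (b ^ j₂ ∙ a ^ i₂)} {(b ^ j₁ ∙ b ^ j₂) ∙ a ^ i₂} {b ^ (j₁ ℕ.+ j₂) ∙ a ^ i₂} (sym {(b ^ j₁ ∙ b ^ j₂) ∙ a ^ i₂} {b ^ j₁ ∙ (b ^ j₂ ∙ a ^ i₂)} (assoc (b ^ j₁) (b ^ j₂) (a ^ i₂)))
        (∙-congʳ {a ^ i₂} {b ^ j₁ ∙ b ^ j₂} {b ^ (j₁ ℕ.+ j₂)} (sym {b ^ (j₁ ℕ.+ j₂)} {b ^ j₁ ∙ b ^ j₂} (^-+ b j₁ j₂)))))))

    factor-BA : ∀ w → ∃ λ j → ∃ λ i → w ≈ b ^ j ∙ a ^ i
    factor-BA [] = 0 , 0 , refl {[]}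
    factor-BA (false ∷ w) = let j , i , e = factor-BA w in suc j , i , ∙-congˡ {b} {w} {b ^ j ∙ a ^ i} e
    factor-BA (true ∷ w) = let j , i , e = factor-BA w ; j′ , i′ , e′ = a^-b^ j 1 in j′ , i′ ℕ.+ i ,
      trans {a ∙ w} {a ∙ (b ^ j ∙ a ^ i)} {b ^ j′ ∙ a ^ (i′ ℕ.+ i)} (∙-congˡ {a} {w} {b ^ j ∙ a ^ i} e)
      (trans {a ∙ (b ^ j ∙ a ^ i)} {(b ^ j′ ∙ a ^ i′) ∙ a ^ i} {b ^ j′ ∙ a ^ (i′ ℕ.+ i)} (∙-congʳ {a ^ i} {a ^ 1 ∙ b ^ j} {b ^ j′ ∙ a ^ i′} e′)
      (trans {(b ^ j′ ∙ a ^ i′) ∙ a ^ i} {b ^ j′ ∙ (a ^ i′ ∙ a ^ i)} {b ^ j′ ∙ a ^ (i′ ℕ.+ i)} (assoc (b ^ j′) (a ^ i′) (a ^ i))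
      (∙-congˡ {b ^ j′} {a ^ i′ ∙ a ^ i} {a ^ (i′ ℕ.+ i)} (sym {a ^ (i′ ℕ.+ i)} {a ^ i′ ∙ a ^ i} (^-+ a i′ i)))))

    act-a : ∀ i x → act (a ^ i) x ≡ iter α i x
    act-a = act-^ true

    act-b : ∀ j x → act (b ^ j) x ≡ iter β j x
    act-b = act-^ false

    a^p≈ε : a ^ p ≈ ε
    a^p≈ε x = X.trans (X.reflexive (act-a p x)) (α^p x)

    b^q≈ε : b ^ q ≈ ε
    b^q≈ε x = X.trans (X.reflexive (act-b q x)) (β^q x)

    factor : ∀ w → ∃ λ i → ∃ λ j → w ≈ a ^ i ∙ b ^ j
    factor w = let j , i , e = factor-BA (w ⁻¹) in
      ℕ.pred p ℕ.* i , ℕ.pred q ℕ.* j ,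
      trans {w} {(w ⁻¹) ⁻¹} {a ^ (ℕ.pred p ℕ.* i) ∙ b ^ (ℕ.pred q ℕ.* j)} (sym {(w ⁻¹) ⁻¹} {w} (⁻¹-involutive w))
      (trans {(w ⁻¹) ⁻¹} {(b ^ j ∙ a ^ i) ⁻¹} {a ^ (ℕ.pred p ℕ.* i) ∙ b ^ (ℕ.pred q ℕ.* j)} (⁻¹-cong {w ⁻¹} {b ^ j ∙ a ^ i} e)
      (trans {(b ^ j ∙ a ^ i) ⁻¹} {(a ^ i) ⁻¹ ∙ (b ^ j) ⁻¹} {a ^ (ℕ.pred p ℕ.* i) ∙ b ^ (ℕ.pred q ℕ.* j)} (⁻¹-anti-homo-∙ (b ^ j) (a ^ i))
      (∙-cong {(a ^ i) ⁻¹} {a ^ (ℕ.pred p ℕ.* i)} {(b ^ j) ⁻¹} {b ^ (ℕ.pred q ℕ.* j)} (^-inverse a p a^p≈ε i) (^-inverse b q b^q≈ε j))))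

    tightGroup : TightGroup p q
    tightGroup = record
      { group = group ; a = a ; b = b ; a^p≈ε = a^p≈ε ; b^q≈ε = b^q≈ε
      ; a-order = λ i e → α-order i λ x → X.trans (X.reflexive (≡.sym (act-a i x))) (e x)
      ; b-order = λ j e → separated 0 j λ x → X.sym (X.trans (X.reflexive (≡.sym (act-b j x))) (e x))
      ; A∩B = λ i j e → trans {a ^ i} {b ^ j} {ε} e (^-multiple b {q} {j} b^q≈ε (separated i j λ x →
          X.trans (X.reflexive (≡.sym (act-a i x))) (X.trans (e x) (X.reflexive (act-b j x)))))
      ; factor = factor ; involution = αβ-involutive
      }

    mirrored : Reflexible tightGroup → ∀ i j k → (∀ x → iter α i (β x) X.≈ iter β j (iter α k x)) →
      ∀ x → β (iter α i x) X.≈ iter α k (iter β j x)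
    mirrored ρ i j k h = to-iter i j k (mirror-relation tightGroup ρ i j k (from-iter i j k h))

-- Congruences of integers.

module Congruences where
  open import Data.Integer.Base using (+_; _+_; _*_; _-_; -_; 0ℤ)
  open import Data.Integer.Properties using (pos-*; +-inverseʳ)
  open import Data.Integer.Divisibility.Signed using (_∣_; divides; ∣m∣n⇒∣m+n; ∣m⇒∣-m; ∣n⇒∣m*n; ∣ᵤ⇒∣; ∣⇒∣ᵤ)
  open import Data.Integer.Tactic.RingSolver using (solve-∀)
  open import Data.Nat.Base as ℕ using (ℕ)
  import Data.Nat.Divisibility as ℕ∣
  open import Relation.Binary.PropositionalEquality hiding (J)

  ∣-via : ∀ {n x y} → x ≡ y → n ∣ y → n ∣ x
  ∣-via refl d = d

  mod-refl : ∀ {n x} → n ∣ x - x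
  mod-refl {n} {x} = divides 0ℤ (+-inverseʳ x)

  mod-≡ : ∀ {n x y} → x ≡ y → n ∣ x - y
  mod-≡ {n} {x} refl = mod-refl {n} {x}

  mod-sym : ∀ {n} x y → n ∣ x - y → n ∣ y - x
  mod-sym x y d = ∣-via (flip x y) (∣m⇒∣-m d)
    where
    flip : ∀ x y → y - x ≡ - (x - y)
    flip = solve-∀

  mod-trans : ∀ {n} x y z → n ∣ x - y → n ∣ y - z → n ∣ x - z
  mod-trans x y z d d′ = ∣-via (split x y z) (∣m∣n⇒∣m+n d d′)
    where
    split : ∀ x y z → x - z ≡ (x - y) + (y - z)
    split = solve-∀

  mod-* : ∀ {n} c x y → n ∣ x - y → n ∣ c * x - c * y
  mod-* c x y d = ∣-via (factor c x y) (∣n⇒∣m*n c d)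
    where
    factor : ∀ c x y → c * x - c * y ≡ c * (x - y)
    factor = solve-∀

  mod-+ : ∀ {n} c x y → n ∣ x - y → n ∣ (x + c) - (y + c)
  mod-+ c x y d = ∣-via (cancel c x y) d
    where
    cancel : ∀ c x y → (x + c) - (y + c) ≡ x - y
    cancel = solve-∀

  pos-∣ : ∀ {m n} → m ℕ∣.∣ n → + m ∣ + n
  pos-∣ = ∣ᵤ⇒∣

  ∣-pos : ∀ {m n} → + m ∣ + n → m ℕ∣.∣ n
  ∣-pos = ∣⇒∣ᵤ

  pos-∣-* : ∀ {m} x y → m ℕ∣.∣ x ℕ.* y → + m ∣ + x * + y
  pos-∣-* {m} x y d = ∣-via (sym (pos-* x y)) (pos-∣ d)

-- Chiral groups for odd `q`.

module OddConstruction where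
  open import Level using (0ℓ)
  open import Data.Integer.Base using (ℤ; +_; _+_; _*_; _-_; -_)
  open import Data.Integer.Properties using (pos-*; *-zeroʳ; +-identityʳ)
  open import Data.Integer.Divisibility.Signed using (_∣_; divides; ∣m∣n⇒∣m+n; ∣m∣n⇒∣m-n; ∣n⇒∣m*n; ∣m⇒∣m*n)
  open import Data.Integer.Tactic.RingSolver using (solve-∀)
  open import Data.Nat.Base as ℕ using (ℕ; zero; suc; NonZero)
  import Data.Nat.Properties as ℕₚ
  import Data.Nat.Divisibility as ℕ∣
  open import Data.Product using (∃; _×_; _,_; proj₁; proj₂)
  open import Data.Sum using (_⊎_; inj₁; inj₂)
  open import Relation.Nullary using (¬_)
  open import Relation.Binary.Bundles using (Setoid)
  open import Relation.Binary.PropositionalEquality hiding (J)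
  open GeometricSums using (parity)
  open Iteration
  open TightGroups
  open PermutationGroups
  open Congruences

  -- a and b act on ℤ/q by s ↦ -(1+u)s and s ↦ (1-u)s+2; the second coordinate records the image in the cyclic group G/M ≅ ℤ/p.
  module _ (q k u : ℕ) {{q≢0 : NonZero q}}
    (q∣u² : q ℕ∣.∣ u ℕ.* u) (q∣Pu : q ℕ∣.∣ suc (k ℕ.* 2) ℕ.* u)
    (p∣q*2k : suc (k ℕ.* 2) ℕ.* 2 ℕ∣.∣ q ℕ.* (k ℕ.* 2))
    (cancel-4 : ∀ j → q ℕ∣.∣ 4 ℕ.* j → q ℕ∣.∣ j) where

    private
      P p : ℕ
      P = suc (k ℕ.* 2)
      p = P ℕ.* 2
      U K Q : ℤ
      U = + u
      K = + k
      Q = + q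

    Q∣U² : Q ∣ U * U
    Q∣U² = pos-∣-* u u q∣u²

    +P≡ : + P ≡ + 1 + K * + 2
    +P≡ = cong (λ x → + 1 + x) (pos-* k 2)

    +p≡ : + p ≡ (+ 1 + K * + 2) * + 2
    +p≡ = trans (pos-* P 2) (cong (_* + 2) +P≡)

    Q∣PU : Q ∣ (+ 1 + K * + 2) * U
    Q∣PU = subst (λ x → Q ∣ x * U) +P≡ (pos-∣-* P u q∣Pu)

    S : Setoid 0ℓ 0ℓ
    S = record
      { Carrier = ℤ × ℤ
      ; _≈_ = λ (s , i) (s′ , i′) → Q ∣ s - s′ × + p ∣ i - i′
      ; isEquivalence = record
        { refl  = λ {(s , i)} → mod-refl {Q} {s} , mod-refl {+ p} {i}
        ; sym   = λ {(s , i)} {(s′ , i′)} (d , e) → mod-sym s s′ d , mod-sym i i′ e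
        ; trans = λ {(s , i)} {(s′ , i′)} {(s″ , i″)} (d , e) (d′ , e′) → mod-trans s s′ s″ d d′ , mod-trans i i′ i″ e e′
        }
      }
    module S = Setoid S

    αs βs : ℤ → ℤ
    αs s = - (+ 1 + U) * s
    βs s = (+ 1 - U) * s + + 2

    α β : ℤ × ℤ → ℤ × ℤ
    α (s , i) = αs s , i + + 1
    β (s , i) = βs s , i + K * + 2

    α-cong : ∀ {x y} → x S.≈ y → α x S.≈ α y
    α-cong {s , i} {s′ , i′} (d , e) = mod-* (- (+ 1 + U)) s s′ d , mod-+ (+ 1) i i′ e

    β-cong : ∀ {x y} → x S.≈ y → β x S.≈ β y
    β-cong {s , i} {s′ , i′} (d , e) = mod-+ (+ 2) ((+ 1 - U) * s) ((+ 1 - U) * s′) (mod-* (+ 1 - U) s s′ d) , mod-+ (K * + 2) i i′ e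

    iter-cong : ∀ {f : ℤ × ℤ → ℤ × ℤ} → (∀ {x y} → x S.≈ y → f x S.≈ f y) → ∀ n {x y} → x S.≈ y → iter f n x S.≈ iter f n y
    iter-cong h zero    e = e
    iter-cong h (suc n) e = h (iter-cong h n e)

    -- Closed forms of `α^(2h)` and `β^j` modulo `u² = 0`; the constant term of the latter is the
    -- sum of `2 (1 - i u)` over `i < j`.
    αᶜ βᶜ : ℤ → ℤ → ℤ
    αᶜ h s = (+ 1 + + 2 * h * U) * s
    βᶜ j s = (+ 1 - j * U) * s + + 2 * j - U * (j * (j - + 1))

    iter-α : ∀ h s i → iter α (h ℕ.* 2) (s , i) S.≈ (αᶜ (+ h) s , i + + h * + 2)
    iter-α zero    s i = mod-≡ {Q} (base U s) , mod-≡ {+ p} (sym (+-identityʳ i))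
      where
      base : ∀ u s → s ≡ (+ 1 + + 2 * + 0 * u) * s
      base = solve-∀
    iter-α (suc h) s i = S.trans {iter α (suc h ℕ.* 2) (s , i)} {α (α (αᶜ (+ h) s , i + + h * + 2))} {αᶜ (+ suc h) s , i + + suc h * + 2}
      (α-cong {α (iter α (h ℕ.* 2) (s , i))} {α (αᶜ (+ h) s , i + + h * + 2)} (α-cong {iter α (h ℕ.* 2) (s , i)} {αᶜ (+ h) s , i + + h * + 2} (iter-α h s i)))
      (∣-via (step U (+ h) s) (∣n⇒∣m*n (s + + 4 * + h * s + + 2 * + h * U * s) Q∣U²) , mod-≡ {+ p} (shift i (+ h)))
      where
      step : ∀ u h s → - (+ 1 + u) * (- (+ 1 + u) * ((+ 1 + + 2 * h * u) * s)) - (+ 1 + + 2 * (+ 1 + h) * u) * s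
        ≡ (s + + 4 * h * s + + 2 * h * u * s) * (u * u)
      step = solve-∀
      shift : ∀ i h → i + h * + 2 + + 1 + + 1 ≡ i + (+ 1 + h) * + 2
      shift = solve-∀

    iter-β : ∀ j s i → iter β j (s , i) S.≈ (βᶜ (+ j) s , i + + j * (K * + 2))
    iter-β zero    s i = mod-≡ {Q} (base U s) , mod-≡ {+ p} (base′ i K)
      where
      base : ∀ u s → s ≡ (+ 1 - + 0 * u) * s + + 2 * + 0 - u * (+ 0 * (+ 0 - + 1))
      base = solve-∀
      base′ : ∀ i k → i ≡ i + + 0 * (k * + 2)
      base′ = solve-∀
    iter-β (suc j) s i = S.trans {iter β (suc j) (s , i)} {β (βᶜ (+ j) s , i + + j * (K * + 2))} {βᶜ (+ suc j) s , i + + suc j * (K * + 2)}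
      (β-cong {iter β j (s , i)} {βᶜ (+ j) s , i + + j * (K * + 2)} (iter-β j s i))
      (∣-via (step U (+ j) s) (∣n⇒∣m*n (+ j * s + + j * (+ j - + 1)) Q∣U²) , mod-≡ {+ p} (shift i (+ j) K))
      where
      step : ∀ u j s → ((+ 1 - u) * ((+ 1 - j * u) * s + + 2 * j - u * (j * (j - + 1))) + + 2)
        - ((+ 1 - (+ 1 + j) * u) * s + + 2 * (+ 1 + j) - u * ((+ 1 + j) * ((+ 1 + j) - + 1))) ≡ (j * s + j * (j - + 1)) * (u * u)
      step = solve-∀
      shift : ∀ i j k → i + j * (k * + 2) + k * + 2 ≡ i + (+ 1 + j) * (k * + 2)
      shift = solve-∀

    α^p : ∀ x → iter α p x S.≈ x
    α^p (s , i) = S.trans {iter α p (s , i)} {αᶜ (+ P) s , i + + P * + 2} {s , i} (iter-α P s i)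
      (∣-via (trans (cong (λ P → (+ 1 + + 2 * P * U) * s - s) +P≡) (close U (+ 1 + K * + 2) s)) (∣n⇒∣m*n (+ 2 * s) Q∣PU) ,
       ∣-via (trans (cancel i (+ P * + 2)) (sym (pos-* P 2))) (divides (+ 1) (sym (one (+ p)))))
      where
      close : ∀ u P s → (+ 1 + + 2 * P * u) * s - s ≡ + 2 * s * (P * u)
      close = solve-∀
      cancel : ∀ i x → i + x - i ≡ x
      cancel = solve-∀
      one : ∀ x → + 1 * x ≡ x
      one = solve-∀

    β^q : ∀ x → iter β q x S.≈ x
    β^q (s , i) = S.trans {iter β q (s , i)} {βᶜ Q s , i + Q * (K * + 2)} {s , i} (iter-β q s i)
      (∣-via (close U Q s) (∣n⇒∣m*n (+ 2 - U * s - U * (Q - + 1)) (divides (+ 1) (sym (one Q)))) ,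
       ∣-via (trans (cancel i (Q * (K * + 2))) (trans (cong (Q *_) (sym (pos-* k 2))) (sym (pos-* q (k ℕ.* 2))))) (pos-∣ p∣q*2k))
      where
      close : ∀ u q s → (+ 1 - q * u) * s + + 2 * q - u * (q * (q - + 1)) - s ≡ (+ 2 - u * s - u * (q - + 1)) * q
      close = solve-∀
      cancel : ∀ i x → i + x - i ≡ x
      cancel = solve-∀
      one : ∀ x → + 1 * x ≡ x
      one = solve-∀

    iter-α-at-0 : ∀ n i → iter α n (+ 0 , i) ≡ (+ 0 , i + + n)
    iter-α-at-0 zero    i = cong (+ 0 ,_) (sym (+-identityʳ i))
    iter-α-at-0 (suc n) i = trans (cong α (iter-α-at-0 n i)) (cong₂ _,_ (*-zeroʳ (- (+ 1 + U))) (shift i (+ n)))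
      where
      shift : ∀ i n → i + n + + 1 ≡ i + (+ 1 + n)
      shift = solve-∀

    α-order : ∀ i → (∀ x → iter α i x S.≈ x) → p ℕ∣.∣ i
    α-order i h = ∣-pos (∣-via (zero-shift (+ i)) (proj₂ (subst (S._≈ (+ 0 , + 0)) (iter-α-at-0 i (+ 0)) (h (+ 0 , + 0)))))
      where
      zero-shift : ∀ x → x ≡ + 0 + x - + 0
      zero-shift = solve-∀

    -- `α` fixes 0, so `β^j` does too, which reads `j (2 - u (j - 1)) = 0`; multiplication by
    -- `2 + u (j - 1)` leaves `4j = 0`.
    separated : ∀ i j → (∀ x → iter α i x S.≈ iter β j x) → q ℕ∣.∣ j
    separated i j h = cancel-4 j (∣-pos (∣-via (trans (pos-* 4 j) (expand U J)) (∣m∣n⇒∣m+n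
      (∣n⇒∣m*n (- (+ 2 + U * (J - + 1))) d) (∣n⇒∣m*n (J * (J - + 1) * (J - + 1)) Q∣U²))))
      where
      J : ℤ
      J = + j
      d : Q ∣ + 0 - βᶜ J (+ 0)
      d = proj₁ (S.trans {+ 0 , + 0 + + i} {iter β j (+ 0 , + 0)} {βᶜ J (+ 0) , + 0 + J * (K * + 2)}
        (subst (S._≈ iter β j (+ 0 , + 0)) (iter-α-at-0 i (+ 0)) (h (+ 0 , + 0))) (iter-β j (+ 0) (+ 0)))
      expand : ∀ u j → + 4 * j ≡ - (+ 2 + u * (j - + 1)) * (+ 0 - ((+ 1 - j * u) * + 0 + + 2 * j - u * (j * (j - + 1)))) + j * (j - + 1) * (j - + 1) * (u * u)
      expand = solve-∀

    αβ-involutive : ∀ x → α (β (α (β x))) S.≈ x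
    αβ-involutive (s , i) = ∣-via (turn U s) (∣n⇒∣m*n (s * (U * U) - + 2 * s - + 2 * U - + 2) Q∣U²) ,
      ∣-via (trans (shift i K) (sym (trans (cong ((+ 1) *_) +p≡) refl))) (divides (+ 1) refl)
      where
      turn : ∀ u s → - (+ 1 + u) * ((+ 1 - u) * (- (+ 1 + u) * ((+ 1 - u) * s + + 2)) + + 2) - s ≡ (s * (u * u) - + 2 * s - + 2 * u - + 2) * (u * u)
      turn = solve-∀
      shift : ∀ i k → (i + k * + 2 + + 1 + k * + 2 + + 1) - i ≡ + 1 * ((+ 1 + k * + 2) * + 2)
      shift = solve-∀

    -- Solves `α^(2h) β = β^j α^(2h′)`. The value at 0 gives `j = 1 + 2hu`. The second coordinate
    -- requires `h′ - h = -2khu` modulo `P`, where `2k` takes the place of `-1` to remain within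
    -- `ℕ`.
    module EvenPower (h : ℕ) where
      j h′ : ℕ
      j  = suc (h ℕ.* 2 ℕ.* u)
      h′ = h ℕ.+ k ℕ.* 2 ℕ.* (h ℕ.* u) ℕ.* (k ℕ.* 2)

      +j≡ : + j ≡ + 1 + + h * + 2 * U
      +j≡ = cong (λ x → + 1 + x) (trans (pos-* (h ℕ.* 2) u) (cong (_* U) (pos-* h 2)))

      +h′≡ : + h′ ≡ + h + K * + 2 * (+ h * U) * (K * + 2)
      +h′≡ = cong (λ x → + h + x) (trans (pos-* (k ℕ.* 2 ℕ.* (h ℕ.* u)) (k ℕ.* 2)) (cong₂ _*_ (trans (pos-* (k ℕ.* 2) (h ℕ.* u)) (cong₂ _*_ (pos-* k 2) (pos-* h u))) (pos-* k 2)))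

      Q∣X : Q ∣ U * (+ j - + 1)
      Q∣X = ∣-via (trans (cong (λ j → U * (j - + 1)) +j≡) (close U (+ h))) (∣n⇒∣m*n (+ 2 * + h) Q∣U²)
        where
        close : ∀ u h → u * (+ 1 + h * + 2 * u - + 1) ≡ + 2 * h * (u * u)
        close = solve-∀

      Q∣Y : Q ∣ U * (+ h′ - + h)
      Q∣Y = ∣-via (trans (cong (λ x → U * (x - + h)) +h′≡) (close U (+ h) K)) (∣n⇒∣m*n (+ 4 * K * K * + h) Q∣U²)
        where
        close : ∀ u h k → u * (h + k * + 2 * (h * u) * (k * + 2) - h) ≡ + 4 * k * k * h * (u * u)
        close = solve-∀

      Q∣Z : Q ∣ + j - + 1 - + 2 * + h * U
      Q∣Z = ∣-via (trans (cong (λ j → j - + 1 - + 2 * + h * U) +j≡) (close U (+ h))) (divides (+ 0) refl)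
        where
        close : ∀ u h → + 1 + h * + 2 * u - + 1 - + 2 * h * u ≡ + 0
        close = solve-∀

      exchanged : ∀ x → iter α (h ℕ.* 2) (β x) S.≈ iter β j (iter α (h′ ℕ.* 2) x)
      exchanged (s , i) = S.trans {iter α (h ℕ.* 2) (β (s , i))} {αᶜ (+ h) (βs s) , i + K * + 2 + + h * + 2} {iter β j (iter α (h′ ℕ.* 2) (s , i))}
        (iter-α h (βs s) (i + K * + 2))
        (S.trans {αᶜ (+ h) (βs s) , i + K * + 2 + + h * + 2} {βᶜ (+ j) (αᶜ (+ h′) s) , i + + h′ * + 2 + + j * (K * + 2)} {iter β j (iter α (h′ ℕ.* 2) (s , i))}
          (∣-via (compare U (+ h) (+ h′) (+ j) s) (∣m∣n⇒∣m+n (∣m∣n⇒∣m-n (∣n⇒∣m*n s (∣m∣n⇒∣m-n (∣m⇒∣m*n (+ 1 + + 2 * + h′ * U) Q∣X) (∣n⇒∣m*n (+ 2 * (+ 1 - U)) Q∣Y))) (∣n⇒∣m*n (+ 2) Q∣Z)) (∣n⇒∣m*n (+ j) Q∣X)) ,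
           ∣-via (trans (cong₂ (λ j h′ → (i + K * + 2 + + h * + 2) - (i + h′ * + 2 + j * (K * + 2))) +j≡ +h′≡) (trans (shift i K (+ h) U) (cong (- (+ 2 * + h * U * K) *_) (sym +p≡)))) (divides (- (+ 2 * + h * U * K)) refl))
          (S.sym {iter β j (iter α (h′ ℕ.* 2) (s , i))} {βᶜ (+ j) (αᶜ (+ h′) s) , i + + h′ * + 2 + + j * (K * + 2)}
            (S.trans {iter β j (iter α (h′ ℕ.* 2) (s , i))} {iter β j (αᶜ (+ h′) s , i + + h′ * + 2)} {βᶜ (+ j) (αᶜ (+ h′) s) , i + + h′ * + 2 + + j * (K * + 2)}
              (iter-cong {β} (λ {x} {y} → β-cong {x} {y}) j {iter α (h′ ℕ.* 2) (s , i)} {αᶜ (+ h′) s , i + + h′ * + 2} (iter-α h′ s i)) (iter-β j (αᶜ (+ h′) s) (i + + h′ * + 2)))))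
        where
        compare : ∀ u h h′ j s → (+ 1 + + 2 * h * u) * ((+ 1 - u) * s + + 2) - ((+ 1 - j * u) * ((+ 1 + + 2 * h′ * u) * s) + + 2 * j - u * (j * (j - + 1)))
          ≡ s * (u * (j - + 1) * (+ 1 + + 2 * h′ * u) - + 2 * (+ 1 - u) * (u * (h′ - h))) - + 2 * (j - + 1 - + 2 * h * u) + j * (u * (j - + 1))
        compare = solve-∀
        shift : ∀ i k h u → (i + k * + 2 + h * + 2) - (i + (h + k * + 2 * (h * u) * (k * + 2)) * + 2 + (+ 1 + h * + 2 * u) * (k * + 2))
          ≡ - (+ 2 * h * u * k) * ((+ 1 + k * + 2) * + 2)
        shift = solve-∀

    -- The analogue for `α^(2h + 1)`: the value at 0 gives `j = -(1 + 2hu)`, with `q - 1` in place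
    -- of the sign, and the second coordinate requires `h′ - h = k - k j` modulo `P`.
    module OddPower (h : ℕ) where
      j h′ : ℕ
      j  = suc (h ℕ.* 2 ℕ.* u) ℕ.* ℕ.pred q
      h′ = h ℕ.+ (k ℕ.+ k ℕ.* j ℕ.* (k ℕ.* 2))

      +pred≡ : + ℕ.pred q ≡ Q - + 1
      +pred≡ = trans (drop (+ ℕ.pred q)) (cong (λ n → + n - + 1) (ℕₚ.suc-pred q))
        where
        drop : ∀ x → x ≡ + 1 + x - + 1
        drop = solve-∀

      +j≡ : + j ≡ (+ 1 + + h * + 2 * U) * (Q - + 1)
      +j≡ = trans (pos-* (suc (h ℕ.* 2 ℕ.* u)) (ℕ.pred q))
        (cong₂ _*_ (cong (λ x → + 1 + x) (trans (pos-* (h ℕ.* 2) u) (cong (_* U) (pos-* h 2)))) +pred≡)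

      +h′≡ : + h′ ≡ + h + (K + K * + j * (K * + 2))
      +h′≡ = cong (λ x → + h + (K + x)) (trans (pos-* (k ℕ.* j) (k ℕ.* 2)) (cong₂ _*_ (pos-* k j) (pos-* k 2)))

      Q∣Z : Q ∣ + j + (+ 1 + + 2 * + h * U)
      Q∣Z = ∣-via (trans (cong (_+ (+ 1 + + 2 * + h * U)) +j≡) (close U (+ h) Q)) (divides (+ 1 + + 2 * + h * U) refl)
        where
        close : ∀ u h q → (+ 1 + h * + 2 * u) * (q - + 1) + (+ 1 + + 2 * h * u) ≡ (+ 1 + + 2 * h * u) * q
        close = solve-∀

      Q∣X : Q ∣ U * (+ j + + 1)
      Q∣X = ∣-via (split U (+ h) (+ j)) (∣m∣n⇒∣m-n (∣n⇒∣m*n U Q∣Z) (∣n⇒∣m*n (+ 2 * + h) Q∣U²))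
        where
        split : ∀ u h j → u * (j + + 1) ≡ u * (j + (+ 1 + + 2 * h * u)) - + 2 * h * (u * u)
        split = solve-∀

      Q∣Y : Q ∣ U * (+ h′ - + h + + 1)
      Q∣Y = ∣-via (trans (cong (λ x → U * (x - + h + + 1)) +h′≡) (split U (+ h) K (+ j)))
        (∣m∣n⇒∣m-n (∣n⇒∣m*n (+ 2 * K * K) Q∣X) (∣n⇒∣m*n (K - + 1) Q∣PU))
        where
        split : ∀ u h k j → u * (h + (k + k * j * (k * + 2)) - h + + 1) ≡ + 2 * k * k * (u * (j + + 1)) - (k - + 1) * ((+ 1 + k * + 2) * u)
        split = solve-∀

      exchanged : ∀ x → iter α (suc (h ℕ.* 2)) (β x) S.≈ iter β j (iter α (suc (h′ ℕ.* 2)) x)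
      exchanged (s , i) = S.trans {iter α (suc (h ℕ.* 2)) (β (s , i))} {α (αᶜ (+ h) (βs s) , i + K * + 2 + + h * + 2)} {iter β j (iter α (suc (h′ ℕ.* 2)) (s , i))}
        (α-cong {iter α (h ℕ.* 2) (β (s , i))} {αᶜ (+ h) (βs s) , i + K * + 2 + + h * + 2} (iter-α h (βs s) (i + K * + 2)))
        (S.trans {α (αᶜ (+ h) (βs s) , i + K * + 2 + + h * + 2)} {βᶜ (+ j) w , i + + h′ * + 2 + + 1 + + j * (K * + 2)} {iter β j (iter α (suc (h′ ℕ.* 2)) (s , i))}
          (∣-via (compare U (+ h) (+ h′) (+ j) s) (∣m∣n⇒∣m+n (∣m∣n⇒∣m-n (∣m∣n⇒∣m-n
             (∣n⇒∣m*n ((+ 1 + U) * s) (∣m∣n⇒∣m+n (∣n⇒∣m*n (+ 2) Q∣Y) (∣n⇒∣m*n (+ 2 * (+ h + + h′)) Q∣U²)))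
             (∣n⇒∣m*n (+ 4 * + h) Q∣U²)) (∣n⇒∣m*n (+ 2) Q∣Z)) (∣m⇒∣m*n (w + + j - + 2) Q∣X)) ,
           ∣-via (trans (cong (λ h′ → (i + K * + 2 + + h * + 2 + + 1) - (i + h′ * + 2 + + 1 + + j * (K * + 2))) +h′≡) (trans (shift i K (+ h) (+ j)) (cong (- (K * + j) *_) (sym +p≡)))) (divides (- (K * + j)) refl))
          (S.sym {iter β j (iter α (suc (h′ ℕ.* 2)) (s , i))} {βᶜ (+ j) w , i + + h′ * + 2 + + 1 + + j * (K * + 2)}
            (S.trans {iter β j (iter α (suc (h′ ℕ.* 2)) (s , i))} {iter β j (w , i + + h′ * + 2 + + 1)} {βᶜ (+ j) w , i + + h′ * + 2 + + 1 + + j * (K * + 2)}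
              (iter-cong {β} (λ {x} {y} → β-cong {x} {y}) j {α (iter α (h′ ℕ.* 2) (s , i))} {w , i + + h′ * + 2 + + 1}
                (α-cong {iter α (h′ ℕ.* 2) (s , i)} {αᶜ (+ h′) s , i + + h′ * + 2} (iter-α h′ s i))) (iter-β j w (i + + h′ * + 2 + + 1)))))
        where
        w : ℤ
        w = αs (αᶜ (+ h′) s)
        compare : ∀ u h h′ j s → - (+ 1 + u) * ((+ 1 + + 2 * h * u) * ((+ 1 - u) * s + + 2))
            - ((+ 1 - j * u) * (- (+ 1 + u) * ((+ 1 + + 2 * h′ * u) * s)) + + 2 * j - u * (j * (j - + 1)))
          ≡ (+ 1 + u) * s * (+ 2 * (u * (h′ - h + + 1)) + + 2 * (h + h′) * (u * u)) - + 4 * h * (u * u) - + 2 * (j + (+ 1 + + 2 * h * u))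
            + u * (j + + 1) * (- (+ 1 + u) * ((+ 1 + + 2 * h′ * u) * s) + j - + 2)
        compare = solve-∀
        shift : ∀ i k h j → (i + k * + 2 + h * + 2 + + 1) - (i + (h + (k + k * j * (k * + 2))) * + 2 + + 1 + j * (k * + 2)) ≡ - (k * j) * ((+ 1 + k * + 2) * + 2)
        shift = solve-∀

    exchange : ∀ i → ∃ λ j → ∃ λ k → ∀ x → iter α i (β x) S.≈ iter β j (iter α k x)
    exchange i = cases (parity i)
      where
      Exchange : ℕ → Set
      Exchange i = ∃ λ j → ∃ λ k → ∀ x → iter α i (β x) S.≈ iter β j (iter α k x)
      cases : (∃ λ h → i ≡ 2 ℕ.* h ⊎ i ≡ suc (2 ℕ.* h)) → Exchange i
      cases (h , inj₁ e) = subst Exchange (trans (ℕₚ.*-comm h 2) (sym e)) (EvenPower.j h , EvenPower.h′ h ℕ.* 2 , EvenPower.exchanged h)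
      cases (h , inj₂ e) = subst Exchange (trans (cong suc (ℕₚ.*-comm h 2)) (sym e)) (OddPower.j h , suc (OddPower.h′ h ℕ.* 2) , OddPower.exchanged h)

    open PermutationGroup S α β (λ {x} {y} → α-cong {x} {y}) (λ {x} {y} → β-cong {x} {y}) p q α^p β^q α-order separated exchange αβ-involutive public
      using (tightGroup; mirrored)

    -- For `h = 1` one has `j = 1 + 2u` and `u h′ = u`. The mirrored relation at 0 says
    -- `2 = (1 + 2u) (2 + 4u)`, that is, `8u = 0`.
    not-reflexible : ¬ q ℕ∣.∣ 8 ℕ.* u → ¬ Reflexible tightGroup
    not-reflexible q∤8u ρ = q∤8u (∣-pos (∣-via (trans (pos-* 8 u) (expand U (+ h′) (+ j)))
      (∣m∣n⇒∣m-n (mod-sym (βs (+ 0)) end d) (∣m∣n⇒∣m-n (∣m∣n⇒∣m+n (∣m∣n⇒∣m+n (∣m∣n⇒∣m-n (∣n⇒∣m*n (+ 2) Q∣Z) (∣n⇒∣m*n (+ j) Q∣X)) (∣n⇒∣m*n (+ 4 * + j) Q∣Y)) (∣n⇒∣m*n (+ 4) Q∣X))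
        (∣n⇒∣m*n (+ 2 * + h′ * U * + j) Q∣X)))))
      where
      open EvenPower 1
      end : ℤ
      end = αᶜ (+ h′) (βᶜ (+ j) (+ 0))
      i′ : ℤ
      i′ = + 0 + + j * (K * + 2)
      relation : β (iter α 2 (+ 0 , + 0)) S.≈ iter α (h′ ℕ.* 2) (iter β j (+ 0 , + 0))
      relation = mirrored ρ 2 j (h′ ℕ.* 2) exchanged (+ 0 , + 0)
      d : Q ∣ βs (+ 0) - end
      d = proj₁ (S.trans {β (+ 0 , + 0 + + 2)} {iter α (h′ ℕ.* 2) (iter β j (+ 0 , + 0))} {end , i′ + + h′ * + 2}
        (subst (λ x → β x S.≈ iter α (h′ ℕ.* 2) (iter β j (+ 0 , + 0))) (iter-α-at-0 2 (+ 0)) relation)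
        (S.trans {iter α (h′ ℕ.* 2) (iter β j (+ 0 , + 0))} {iter α (h′ ℕ.* 2) (βᶜ (+ j) (+ 0) , i′)} {end , i′ + + h′ * + 2}
          (iter-cong {α} (λ {x} {y} → α-cong {x} {y}) (h′ ℕ.* 2) {iter β j (+ 0 , + 0)} {βᶜ (+ j) (+ 0) , i′} (iter-β j (+ 0) (+ 0))) (iter-α h′ (βᶜ (+ j) (+ 0)) i′)))
      expand : ∀ u h′ j → + 8 * u ≡ ((+ 1 + + 2 * h′ * u) * ((+ 1 - j * u) * + 0 + + 2 * j - u * (j * (j - + 1))) - ((+ 1 - u) * + 0 + + 2))
        - (+ 2 * (j - + 1 - + 2 * + 1 * u) - j * (u * (j - + 1)) + + 4 * j * (u * (h′ - + 1)) + + 4 * (u * (j - + 1)) - + 2 * h′ * u * j * (u * (j - + 1)))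
      expand = solve-∀

-- Chiral groups for even `p` and `q`.

module EvenConstruction where
  open import Level using (0ℓ)
  open import Data.Integer.Base using (ℤ; +_; _+_; _*_; _-_; -_)
  open import Data.Integer.Properties using (pos-*; *-zeroʳ; +-identityʳ; neg-involutive)
  open import Data.Integer.Divisibility.Signed using (_∣_; divides; ∣m∣n⇒∣m+n; ∣m∣n⇒∣m-n; ∣m⇒∣-m; ∣n⇒∣m*n; *-monoˡ-∣)
  open import Data.Integer.Tactic.RingSolver using (solve-∀)
  open import Data.Nat.Base as ℕ using (ℕ; zero; suc; NonZero)
  import Data.Nat.Properties as ℕₚ
  import Data.Nat.Divisibility as ℕ∣
  open import Data.Nat.Coprimality using (Coprime; coprime-divisor; coprime-Bézout)
  open import Data.Nat.GCD using (module Bézout)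
  open import Data.Bool.Base using (Bool; true; false; not)
  open import Data.Bool.Properties using (not-involutive)
  open import Data.Product using (∃; _×_; _,_; proj₁; proj₂)
  open import Data.Sum using (_⊎_; inj₁; inj₂)
  open import Data.Empty using (⊥; ⊥-elim)
  open import Relation.Nullary using (¬_)
  open import Relation.Binary.Bundles using (Setoid)
  open import Relation.Binary.PropositionalEquality hiding (J)
  open GeometricSums using (parity)
  open Iteration
  open TightGroups
  open PermutationGroups
  open Congruences

  -- An opaque copy of the embedding of ℕ: the embedding computes on sums and products, and
  -- comparing unfolded integer polynomials is intractable.
  abstract
    ι : ℕ → ℤ
    ι = +_

    ι-0 : ι 0 ≡ + 0
    ι-0 = refl

    ι-suc : ∀ n → ι (suc n) ≡ + 1 + ι n
    ι-suc n = refl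

    ι-+ : ∀ m n → ι (m ℕ.+ n) ≡ ι m + ι n
    ι-+ m n = refl

    ι-* : ∀ m n → ι (m ℕ.* n) ≡ ι m * ι n
    ι-* = pos-*

    ι-*2 : ∀ n → ι (n ℕ.* 2) ≡ ι n * + 2
    ι-*2 n = pos-* n 2

    ι-2* : ∀ n → ι (2 ℕ.* n) ≡ + 2 * ι n
    ι-2* = pos-* 2

    ι-∣ : ∀ {m n} → m ℕ∣.∣ n → ι m ∣ ι n
    ι-∣ = pos-∣

    ∣-ι : ∀ {m n} → ι m ∣ ι n → m ℕ∣.∣ n
    ∣-ι = ∣-pos

    ι-∣-* : ∀ {m} x y → m ℕ∣.∣ x ℕ.* y → ι m ∣ ι x * ι y
    ι-∣-* x y = pos-∣-* x y

  +pred≡ : ∀ n .{{_ : NonZero n}} → ι (ℕ.pred n) ≡ ι n - + 1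
  +pred≡ n = trans (drop (ι (ℕ.pred n))) (cong (_- + 1) (trans (sym (ι-suc (ℕ.pred n))) (cong ι (ℕₚ.suc-pred n))))
    where
    drop : ∀ x → x ≡ + 1 + x - + 1
    drop = solve-∀

  private
    -- `x m` is 0 modulo `m` and 1 modulo `n`. `y n` is 0 modulo `n` and `-1` modulo `m`; the factor
    -- `m - 1` corrects this sign within `ℕ`.
    combine-residues : ∀ m n x y .{{_ : NonZero m}} → 1 ℕ.+ y ℕ.* n ≡ x ℕ.* m →
      ∀ r₁ r₂ → ∃ λ h → ι m ∣ ι h - ι r₁ × ι n ∣ ι h - ι r₂
    combine-residues m n x y bézout r₁ r₂ = h ,
      ∣-via (trans (cong (_- ι r₁) +h≡) (trans (cong (λ z → ι r₂ * (ι x * ι m) + ι r₁ * ((ι m - + 1) * z) - ι r₁) yn≡) (mod-m (ι x) (ι y) (ι m) (ι n) (ι r₁) (ι r₂))))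
        (divides (ι r₂ * ι x + ι r₁ * (ι x * ι m - + 1 - ι x)) refl) ,
      ∣-via (trans (cong (_- ι r₂) +h≡) (trans (cong (λ z → ι r₂ * z + ι r₁ * ((ι m - + 1) * (ι y * ι n)) - ι r₂) (sym xm≡)) (mod-n (ι x) (ι y) (ι m) (ι n) (ι r₁) (ι r₂))))
        (divides (ι r₂ * ι y + ι r₁ * ((ι m - + 1) * ι y)) refl)
      where
      h : ℕ
      h = r₂ ℕ.* (x ℕ.* m) ℕ.+ r₁ ℕ.* (ℕ.pred m ℕ.* (y ℕ.* n))
      +h≡ : ι h ≡ ι r₂ * (ι x * ι m) + ι r₁ * ((ι m - + 1) * (ι y * ι n))
      +h≡ = trans (ι-+ (r₂ ℕ.* (x ℕ.* m)) (r₁ ℕ.* (ℕ.pred m ℕ.* (y ℕ.* n)))) (cong₂ _+_ (trans (ι-* r₂ (x ℕ.* m)) (cong (ι r₂ *_) (ι-* x m)))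
        (trans (ι-* r₁ (ℕ.pred m ℕ.* (y ℕ.* n))) (cong (ι r₁ *_) (trans (ι-* (ℕ.pred m) (y ℕ.* n)) (cong₂ _*_ (+pred≡ m) (ι-* y n))))))
      xm≡ : + 1 + ι y * ι n ≡ ι x * ι m
      xm≡ = trans (cong (λ z → + 1 + z) (sym (ι-* y n))) (trans (sym (ι-suc (y ℕ.* n))) (trans (cong ι bézout) (ι-* x m)))
      yn≡ : ι y * ι n ≡ ι x * ι m - + 1
      yn≡ = trans (drop (ι y * ι n)) (cong (_- + 1) xm≡)
        where
        drop : ∀ z → z ≡ + 1 + z - + 1
        drop = solve-∀
      mod-m : ∀ x y m n r₁ r₂ → r₂ * (x * m) + r₁ * ((m - + 1) * (x * m - + 1)) - r₁ ≡ (r₂ * x + r₁ * (x * m - + 1 - x)) * m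
      mod-m = solve-∀
      mod-n : ∀ x y m n r₁ r₂ → r₂ * (+ 1 + y * n) + r₁ * ((m - + 1) * (y * n)) - r₂ ≡ (r₂ * y + r₁ * ((m - + 1) * y)) * n
      mod-n = solve-∀

  chinese-remainder : ∀ m n .{{_ : NonZero m}} .{{_ : NonZero n}} → Coprime m n →
    ∀ r₁ r₂ → ∃ λ h → ι m ∣ ι h - ι r₁ × ι n ∣ ι h - ι r₂
  chinese-remainder m n coprime r₁ r₂ = from (coprime-Bézout coprime)
    where
    from : Bézout.Identity 1 m n → ∃ λ h → ι m ∣ ι h - ι r₁ × ι n ∣ ι h - ι r₂
    from (Bézout.+- x y eq) = combine-residues m n x y eq r₁ r₂
    from (Bézout.-+ x y eq) = let h , d , d′ = combine-residues n m y x eq r₂ r₁ in h , d′ , d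

  -- The translations form ℤ/Q; a acts on it by u - 1 and t inverts it.  The first two coordinates
  -- parametrise the faces, the third is a dihedral quotient and the last the abelian quotient G/M.
  module _ (g P′ Q′ u : ℕ) {{g≢0 : NonZero g}} {{P′≢0 : NonZero P′}} {{Q≢0 : NonZero Q′}}
    (coprime : Coprime g P′) (g∣Q : g ℕ∣.∣ Q′) (Q∣uu : Q′ ℕ∣.∣ u ℕ.* u) (Q∣gu : Q′ ℕ∣.∣ g ℕ.* u) where

    private
      p q : ℕ
      p = g ℕ.* P′ ℕ.* 2
      q = Q′ ℕ.* 2
      U Q : ℤ
      U = ι u
      Q = ι Q′

    instance
      gP′≢0 : NonZero (g ℕ.* P′)
      gP′≢0 = ℕₚ.m*n≢0 g P′
      p≢0 : NonZero p
      p≢0 = ℕₚ.m*n≢0 (g ℕ.* P′) 2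
      q≢0 : NonZero q
      q≢0 = ℕₚ.m*n≢0 Q′ 2

    Q∣U² : Q ∣ U * U
    Q∣U² = ι-∣-* u u Q∣uu

    Q∣gU : Q ∣ ι g * U
    Q∣gU = ι-∣-* g u Q∣gu

    data X : Set where
      pt : ℤ → Bool → ℤ → ℤ → X

    sₓ kₓ lₓ : X → ℤ
    sₓ (pt s f k l) = s
    kₓ (pt s f k l) = k
    lₓ (pt s f k l) = l
    fₓ : X → Bool
    fₓ (pt s f k l) = f

    record _≋_ (x y : X) : Set where
      constructor ⟨_,_,_,_⟩
      field
        s-mod : Q ∣ sₓ x - sₓ y
        f-eq  : fₓ x ≡ fₓ y
        k-mod : ι (P′ ℕ.* 2) ∣ kₓ x - kₓ y
        l-mod : ι (g ℕ.* 2) ∣ lₓ x - lₓ y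

    ≋-refl : ∀ {x} → x ≋ x
    ≋-refl {pt s f k l} = ⟨ mod-refl {Q} {s} , refl , mod-refl {_} {k} , mod-refl {_} {l} ⟩

    ≋-sym : ∀ {x y} → x ≋ y → y ≋ x
    ≋-sym {pt s f k l} {pt s′ f′ k′ l′} ⟨ d , e , d′ , d″ ⟩ = ⟨ mod-sym s s′ d , sym e , mod-sym k k′ d′ , mod-sym l l′ d″ ⟩

    ≋-trans : ∀ {x y z} → x ≋ y → y ≋ z → x ≋ z
    ≋-trans {pt s f k l} {pt s′ f′ k′ l′} {pt s″ f″ k″ l″} ⟨ d , e , m , n ⟩ ⟨ d′ , e′ , m′ , n′ ⟩ =
      ⟨ mod-trans s s′ s″ d d′ , trans e e′ , mod-trans k k′ k″ m m′ , mod-trans l l′ l″ n n′ ⟩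

    S : Setoid 0ℓ 0ℓ
    S = record { Carrier = X ; _≈_ = _≋_ ; isEquivalence = record { refl = ≋-refl ; sym = ≋-sym ; trans = ≋-trans } }

    abstract
      -- The faces are two copies of `ℤ/Q` exchanged by `β`, the base face being 0 in the copy
      -- `false`. The constants make `αβ` an involution and `β²` equal to `s ↦ (1 + 2u) s + 1` on
      -- both copies.
      αs βs : Bool → ℤ → ℤ
      αs false s = (U - + 1) * s
      αs true  s = (U - + 1) * s + (+ 2 * U - + 1)
      βs false s = s
      βs true  s = (+ 1 + + 2 * U) * s + + 1

      αs₀ : ∀ s → αs false s ≡ (U - + 1) * s
      αs₀ s = refl
      αs₁ : ∀ s → αs true s ≡ (U - + 1) * s + (+ 2 * U - + 1)
      αs₁ s = refl
      βs₀ : ∀ s → βs false s ≡ s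
      βs₀ s = refl
      βs₁ : ∀ s → βs true s ≡ (+ 1 + + 2 * U) * s + + 1
      βs₁ s = refl

      -- The closed form of `α^(2h)` modulo `u² = 0`; `βᶜ` plays the same role for `β^(2j)`, its
      -- constant being the sum of `1 + 2 i u` over `i < j`.
      αᶜ : Bool → ℤ → ℤ → ℤ
      αᶜ false h s = (+ 1 - + 2 * h * U) * s
      αᶜ true  h s = (+ 1 - + 2 * h * U) * s - h * U

      αᶜ₀ : ∀ h s → αᶜ false h s ≡ (+ 1 - + 2 * h * U) * s
      αᶜ₀ h s = refl
      αᶜ₁ : ∀ h s → αᶜ true h s ≡ (+ 1 - + 2 * h * U) * s - h * U
      αᶜ₁ h s = refl

      βᶜ : ℤ → ℤ → ℤ
      βᶜ j s = (+ 1 + + 2 * j * U) * s + j + U * (j * (j - + 1))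

      βᶜ≡ : ∀ j s → βᶜ j s ≡ (+ 1 + + 2 * j * U) * s + j + U * (j * (j - + 1))
      βᶜ≡ j s = refl

    αs₀′ : ∀ {x y} → x ≡ y → αs false x ≡ (U - + 1) * y
    αs₀′ refl = αs₀ _
    αs₁′ : ∀ {x y} → x ≡ y → αs true x ≡ (U - + 1) * y + (+ 2 * U - + 1)
    αs₁′ refl = αs₁ _
    βs₁′ : ∀ {x y} → x ≡ y → βs true x ≡ (+ 1 + + 2 * U) * y + + 1
    βs₁′ refl = βs₁ _
    αᶜ₀′ : ∀ h {x y} → x ≡ y → αᶜ false h x ≡ (+ 1 - + 2 * h * U) * y
    αᶜ₀′ h refl = αᶜ₀ h _
    αᶜ₁′ : ∀ h {x y} → x ≡ y → αᶜ true h x ≡ (+ 1 - + 2 * h * U) * y - h * U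
    αᶜ₁′ h refl = αᶜ₁ h _
    βᶜ′ : ∀ j {x y} → x ≡ y → βᶜ j x ≡ (+ 1 + + 2 * j * U) * y + j + U * (j * (j - + 1))
    βᶜ′ j refl = βᶜ≡ j _

    α β : X → X
    α (pt s f k l) = pt (αs f s) f (k + + 1) (l + + 1)
    β (pt s f k l) = pt (βs f s) (not f) (- k) (l - + 1)

    α-cong : ∀ {x y} → x ≋ y → α x ≋ α y
    α-cong {pt s f k l} {pt s′ .f k′ l′} ⟨ d , refl , m , n ⟩ = ⟨ first f , refl , mod-+ (+ 1) k k′ m , mod-+ (+ 1) l l′ n ⟩
      where
      first : ∀ f → Q ∣ αs f s - αs f s′
      first false = ∣-via (cong₂ _-_ (αs₀ s) (αs₀ s′)) (mod-* (U - + 1) s s′ d)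
      first true  = ∣-via (cong₂ _-_ (αs₁ s) (αs₁ s′)) (mod-+ (+ 2 * U - + 1) ((U - + 1) * s) ((U - + 1) * s′) (mod-* (U - + 1) s s′ d))

    β-cong : ∀ {x y} → x ≋ y → β x ≋ β y
    β-cong {pt s f k l} {pt s′ .f k′ l′} ⟨ d , refl , m , n ⟩ = ⟨ first f , refl , ∣-via (negate k k′) (∣m⇒∣-m m) , mod-+ (- (+ 1)) l l′ n ⟩
      where
      first : ∀ f → Q ∣ βs f s - βs f s′
      first false = ∣-via (cong₂ _-_ (βs₀ s) (βs₀ s′)) d
      first true  = ∣-via (cong₂ _-_ (βs₁ s) (βs₁ s′)) (mod-+ (+ 1) ((+ 1 + + 2 * U) * s) ((+ 1 + + 2 * U) * s′) (mod-* (+ 1 + + 2 * U) s s′ d))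
      negate : ∀ k k′ → - k - - k′ ≡ - (k - k′)
      negate = solve-∀

    iter-cong : ∀ {f : X → X} → (∀ {x y} → x ≋ y → f x ≋ f y) → ∀ n {x y} → x ≋ y → iter f n x ≋ iter f n y
    iter-cong h zero    e = e
    iter-cong h (suc n) e = h (iter-cong h n e)

    iter-α : ∀ h s f k l → iter α (h ℕ.* 2) (pt s f k l) ≋ pt (αᶜ f (ι h) s) f (k + ι h * + 2) (l + ι h * + 2)
    iter-α zero s f k l = subst (λ z → pt s f k l ≋ pt (αᶜ f z s) f (k + z * + 2) (l + z * + 2)) (sym ι-0)
      ⟨ mod-≡ {Q} (base f) , refl , mod-≡ (sym (+-identityʳ k)) , mod-≡ (sym (+-identityʳ l)) ⟩
      where
      base₀ : ∀ u s → s ≡ (+ 1 - + 2 * + 0 * u) * s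
      base₀ = solve-∀
      base₁ : ∀ u s → s ≡ (+ 1 - + 2 * + 0 * u) * s - + 0 * u
      base₁ = solve-∀
      base : ∀ f → s ≡ αᶜ f (+ 0) s
      base false = trans (base₀ U s) (sym (αᶜ₀ (+ 0) s))
      base true  = trans (base₁ U s) (sym (αᶜ₁ (+ 0) s))
    iter-α (suc h) s f k l = subst (λ z → iter α (suc h ℕ.* 2) (pt s f k l) ≋ pt (αᶜ f z s) f (k + z * + 2) (l + z * + 2)) (sym (ι-suc h))
      (≋-trans (α-cong (α-cong (iter-α h s f k l))) ⟨ step f , refl , mod-≡ (shift k (ι h)) , mod-≡ (shift l (ι h)) ⟩)
      where
      step₀ : ∀ u h s → (u - + 1) * ((u - + 1) * ((+ 1 - + 2 * h * u) * s)) - (+ 1 - + 2 * (+ 1 + h) * u) * s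
        ≡ (s + + 4 * h * s - + 2 * h * s * u) * (u * u)
      step₀ = solve-∀
      step₁ : ∀ u h s → ((u - + 1) * ((u - + 1) * ((+ 1 - + 2 * h * u) * s - h * u) + (+ 2 * u - + 1)) + (+ 2 * u - + 1)) - ((+ 1 - + 2 * (+ 1 + h) * u) * s - (+ 1 + h) * u)
        ≡ (+ 2 + + 2 * h + + 4 * h * s - + 2 * h * s * u - h * u + s) * (u * u)
      step₁ = solve-∀
      step : ∀ f → Q ∣ αs f (αs f (αᶜ f (ι h) s)) - αᶜ f (+ 1 + ι h) s
      step false = ∣-via (trans (cong₂ _-_ (αs₀′ (αs₀′ (αᶜ₀ (ι h) s))) (αᶜ₀ (+ 1 + ι h) s)) (step₀ U (ι h) s)) (∣n⇒∣m*n (s + + 4 * ι h * s - + 2 * ι h * s * U) Q∣U²)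
      step true  = ∣-via (trans (cong₂ _-_ (αs₁′ (αs₁′ (αᶜ₁ (ι h) s))) (αᶜ₁ (+ 1 + ι h) s)) (step₁ U (ι h) s)) (∣n⇒∣m*n (+ 2 + + 2 * ι h + + 4 * ι h * s - + 2 * ι h * s * U - ι h * U + s) Q∣U²)
      shift : ∀ i h → i + h * + 2 + + 1 + + 1 ≡ i + (+ 1 + h) * + 2
      shift = solve-∀

    iter-β : ∀ j s f k l → iter β (j ℕ.* 2) (pt s f k l) ≋ pt (βᶜ (ι j) s) f k (l - ι j * + 2)
    iter-β zero s f k l = subst (λ z → pt s f k l ≋ pt (βᶜ z s) f k (l - z * + 2)) (sym ι-0)
      ⟨ mod-≡ {Q} (trans (base U s) (sym (βᶜ≡ (+ 0) s))) , refl , mod-refl {_} {k} , mod-≡ (sym (+-identityʳ l)) ⟩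
      where
      base : ∀ u s → s ≡ (+ 1 + + 2 * + 0 * u) * s + + 0 + u * (+ 0 * (+ 0 - + 1))
      base = solve-∀
    iter-β (suc j) s f k l = subst (λ z → iter β (suc j ℕ.* 2) (pt s f k l) ≋ pt (βᶜ z s) f k (l - z * + 2)) (sym (ι-suc j))
      (≋-trans (β-cong (β-cong (iter-β j s f k l))) ⟨ step f , not-involutive f , mod-≡ (neg-involutive k) , mod-≡ (shift l (ι j)) ⟩)
      where
      expand : ∀ u j s → ((+ 1 + + 2 * u) * ((+ 1 + + 2 * j * u) * s + j + u * (j * (j - + 1))) + + 1)
        - ((+ 1 + + 2 * (+ 1 + j) * u) * s + (+ 1 + j) + u * ((+ 1 + j) * ((+ 1 + j) - + 1))) ≡ (+ 4 * j * s + + 2 * j * (j - + 1)) * (u * u)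
      expand = solve-∀
      step : ∀ f → Q ∣ βs (not f) (βs f (βᶜ (ι j) s)) - βᶜ (+ 1 + ι j) s
      step false = ∣-via (trans (cong₂ _-_ (βs₁′ (trans (βs₀ _) (βᶜ≡ (ι j) s))) (βᶜ≡ (+ 1 + ι j) s)) (expand U (ι j) s)) (∣n⇒∣m*n (+ 4 * ι j * s + + 2 * ι j * (ι j - + 1)) Q∣U²)
      step true  = ∣-via (trans (cong₂ _-_ (trans (βs₀ _) (βs₁′ (βᶜ≡ (ι j) s))) (βᶜ≡ (+ 1 + ι j) s)) (expand U (ι j) s)) (∣n⇒∣m*n (+ 4 * ι j * s + + 2 * ι j * (ι j - + 1)) Q∣U²)
      shift : ∀ l j → l - j * + 2 - + 1 - + 1 ≡ l - (+ 1 + j) * + 2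
      shift = solve-∀

    α^p : ∀ x → iter α p x ≋ x
    α^p (pt s f k l) = ≋-trans (iter-α (g ℕ.* P′) s f k l)
      ⟨ first f , refl , ∣-via (trans (cancel k (ι h * + 2)) (trans (cong (_* + 2) (ι-* g P′)) (rearrange (ι g) (ι P′)))) (∣n⇒∣m*n (ι g) (∣-via (sym (ι-*2 P′)) (self (P′ ℕ.* 2)))) ,
        ∣-via (trans (cancel l (ι h * + 2)) (trans (cong (_* + 2) (ι-* g P′)) (rearrange′ (ι g) (ι P′)))) (∣n⇒∣m*n (ι P′) (∣-via (sym (ι-*2 g)) (self (g ℕ.* 2)))) ⟩
      where
      h : ℕ
      h = g ℕ.* P′
      self : ∀ n → ι n ∣ ι n
      self n = ι-∣ (ℕ∣.∣-refl {n})
      Q∣hU : Q ∣ ι h * U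
      Q∣hU = ∣-via (trans (cong (_* U) (ι-* g P′)) (swap (ι g) (ι P′) U)) (∣n⇒∣m*n (ι P′) Q∣gU)
        where
        swap : ∀ g P u → g * P * u ≡ P * (g * u)
        swap = solve-∀
      first₀ : ∀ u h s → (+ 1 - + 2 * h * u) * s - s ≡ - (+ 2 * s) * (h * u)
      first₀ = solve-∀
      first₁ : ∀ u h s → (+ 1 - + 2 * h * u) * s - h * u - s ≡ - (+ 2 * s + + 1) * (h * u)
      first₁ = solve-∀
      first : ∀ f → Q ∣ αᶜ f (ι h) s - s
      first false = ∣-via (trans (cong (_- s) (αᶜ₀ (ι h) s)) (first₀ U (ι h) s)) (∣n⇒∣m*n (- (+ 2 * s)) Q∣hU)
      first true  = ∣-via (trans (cong (_- s) (αᶜ₁ (ι h) s)) (first₁ U (ι h) s)) (∣n⇒∣m*n (- (+ 2 * s + + 1)) Q∣hU)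
      cancel : ∀ i x → i + x - i ≡ x
      cancel = solve-∀
      rearrange : ∀ g P → g * P * + 2 ≡ g * (P * + 2)
      rearrange = solve-∀
      rearrange′ : ∀ g P → g * P * + 2 ≡ P * (g * + 2)
      rearrange′ = solve-∀

    β^q : ∀ x → iter β q x ≋ x
    β^q (pt s f k l) = ≋-trans (iter-β Q′ s f k l)
      ⟨ ∣-via (trans (cong (_- s) (βᶜ≡ Q s)) (close U Q s)) (∣n⇒∣m*n (+ 2 * U * s + + 1 + U * (Q - + 1)) (ι-∣ (ℕ∣.∣-refl {Q′}))) , refl , mod-refl {_} {k} ,
        ∣-via (cancel l (Q * + 2)) (∣m⇒∣-m (∣-via (sym (ι-*2 Q′)) (ι-∣ (ℕ∣.*-monoˡ-∣ 2 g∣Q)))) ⟩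
      where
      close : ∀ u q s → (+ 1 + + 2 * q * u) * s + q + u * (q * (q - + 1)) - s ≡ (+ 2 * u * s + + 1 + u * (q - + 1)) * q
      close = solve-∀
      cancel : ∀ l x → l - x - l ≡ - x
      cancel = solve-∀

    iter-α-at-0 : ∀ n k l → iter α n (pt (+ 0) false k l) ≡ pt (+ 0) false (k + ι n) (l + ι n)
    iter-α-at-0 zero    k l = cong₂ (λ k l → pt (+ 0) false k l) (shift₀ k) (shift₀ l)
      where
      shift₀ : ∀ i → i ≡ i + ι 0
      shift₀ i = sym (trans (cong (λ z → i + z) ι-0) (+-identityʳ i))
    iter-α-at-0 (suc n) k l = trans (cong α (iter-α-at-0 n k l))
      (trans (cong (λ s → pt s false (k + ι n + + 1) (l + ι n + + 1)) (trans (αs₀ (+ 0)) (*-zeroʳ (U - + 1)))) (cong₂ (λ k l → pt (+ 0) false k l) (shift k) (shift l)))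
      where
      shift′ : ∀ i n → i + n + + 1 ≡ i + (+ 1 + n)
      shift′ = solve-∀
      shift : ∀ i → i + ι n + + 1 ≡ i + ι (suc n)
      shift i = trans (shift′ i (ι n)) (cong (λ z → i + z) (sym (ι-suc n)))

    origin : X
    origin = pt (+ 0) false (+ 0) (+ 0)

    -- The dihedral coordinate has period `2P′` and the abelian one `2g`; for coprime `g` and `P′`
    -- their least common multiple is `2gP′ = p`.
    α-order : ∀ i → (∀ x → iter α i x ≋ x) → p ℕ∣.∣ i
    α-order i h = from (∣-ι (∣-via (zero-shift (ι i)) (_≋_.k-mod at-0))) (∣-ι (∣-via (zero-shift (ι i)) (_≋_.l-mod at-0)))
      where
      zero-shift : ∀ x → x ≡ + 0 + x - + 0
      zero-shift = solve-∀
      at-0 : (pt (+ 0) false (+ 0 + ι i) (+ 0 + ι i)) ≋ origin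
      at-0 = subst (_≋ origin) (iter-α-at-0 i (+ 0) (+ 0)) (h origin)
      from : P′ ℕ.* 2 ℕ∣.∣ i → g ℕ.* 2 ℕ∣.∣ i → p ℕ∣.∣ i
      from (ℕ∣.divides m refl) g2∣ = from′ (coprime-divisor {g} {P′} {m} coprime (subst (g ℕ∣.∣_) (ℕₚ.*-comm m P′)
        (ℕ∣.*-cancelʳ-∣ 2 (subst (g ℕ.* 2 ℕ∣.∣_) (sym (ℕₚ.*-assoc m P′ 2)) g2∣))))
        where
        from′ : g ℕ∣.∣ m → p ℕ∣.∣ m ℕ.* (P′ ℕ.* 2)
        from′ (ℕ∣.divides z refl) = ℕ∣.divides z (trans (ℕₚ.*-assoc z g (P′ ℕ.* 2)) (cong (z ℕ.*_) (sym (ℕₚ.*-assoc g P′ 2))))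

    -- The copy containing the base face determines the parity of `j`. For `j = 2m` the equation is
    -- `m (1 + u (m - 1)) = 0`, and `1 - u (m - 1)` inverts the second factor.
    separated : ∀ i j → (∀ x → iter α i x ≋ iter β j x) → q ℕ∣.∣ j
    separated i j h = cases (parity j)
      where
      at-0 : (pt (+ 0) false (+ 0 + ι i) (+ 0 + ι i)) ≋ iter β j origin
      at-0 = subst (_≋ iter β j origin) (iter-α-at-0 i (+ 0) (+ 0)) (h origin)
      expand : ∀ u j → j ≡ - (+ 1 - u * (j - + 1)) * (+ 0 - ((+ 1 + + 2 * j * u) * + 0 + j + u * (j * (j - + 1)))) + j * (j - + 1) * (j - + 1) * (u * u)
      expand = solve-∀
      cases : (∃ λ m → j ≡ 2 ℕ.* m ⊎ j ≡ suc (2 ℕ.* m)) → q ℕ∣.∣ j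
      cases (m , inj₁ e) = subst (q ℕ∣.∣_) (sym j≡) (ℕ∣.*-monoˡ-∣ 2 (∣-ι (∣-via (expand U (ι m))
        (∣m∣n⇒∣m+n (∣n⇒∣m*n (- (+ 1 - U * (ι m - + 1))) (subst (λ z → Q ∣ + 0 - z) (βᶜ≡ (ι m) (+ 0)) (_≋_.s-mod closed))) (∣n⇒∣m*n (ι m * (ι m - + 1) * (ι m - + 1)) Q∣U²)))))
        where
        j≡ : j ≡ m ℕ.* 2
        j≡ = trans e (ℕₚ.*-comm 2 m)
        closed : (pt (+ 0) false (+ 0 + ι i) (+ 0 + ι i)) ≋ pt (βᶜ (ι m) (+ 0)) false (+ 0) (+ 0 - ι m * + 2)
        closed = ≋-trans (subst (λ j → (pt (+ 0) false (+ 0 + ι i) (+ 0 + ι i)) ≋ iter β j origin) j≡ at-0) (iter-β m (+ 0) false (+ 0) (+ 0))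
      cases (m , inj₂ e) = ⊥-elim (true≢false (_≋_.f-eq (≋-trans (subst (λ j → (pt (+ 0) false (+ 0 + ι i) (+ 0 + ι i)) ≋ iter β j origin) (trans e (cong suc (ℕₚ.*-comm 2 m))) at-0)
          (β-cong (iter-β m (+ 0) false (+ 0) (+ 0))))))
        where
        true≢false : false ≡ true → ⊥
        true≢false ()

    αβ-involutive : ∀ x → α (β (α (β x))) ≋ x
    αβ-involutive (pt s f k l) = ⟨ first f , not-involutive f , mod-≡ (shift k) , mod-≡ (shift′ l) ⟩
      where
      turn₀ : ∀ u s → (u - + 1) * ((+ 1 + + 2 * u) * ((u - + 1) * s + (+ 2 * u - + 1)) + + 1) - s ≡ (+ 2 * s * u - + 3 * s + + 4 * u - + 4) * (u * u)
      turn₀ = solve-∀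
      turn₁ : ∀ u s → ((u - + 1) * ((u - + 1) * ((+ 1 + + 2 * u) * s + + 1)) + (+ 2 * u - + 1)) - s ≡ (+ 2 * s * u - + 3 * s + + 1) * (u * u)
      turn₁ = solve-∀
      first : ∀ f → Q ∣ αs (not (not f)) (βs (not f) (αs (not f) (βs f s))) - s
      first false = ∣-via (trans (cong (_- s) (αs₀′ (βs₁′ (αs₁′ (βs₀ s))))) (turn₀ U s)) (∣n⇒∣m*n (+ 2 * s * U - + 3 * s + + 4 * U - + 4) Q∣U²)
      first true  = ∣-via (trans (cong (_- s) (αs₁′ (trans (βs₀ _) (αs₀′ (βs₁ s))))) (turn₁ U s)) (∣n⇒∣m*n (+ 2 * s * U - + 3 * s + + 1) Q∣U²)
      shift : ∀ k → - (- k + + 1) + + 1 ≡ k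
      shift = solve-∀
      shift′ : ∀ l → l - + 1 + + 1 - + 1 + + 1 ≡ l
      shift′ = solve-∀

    -- Solves `α^(2h) β = β^(2j + 1) α^(2h′)`. The value at the base face gives `j = -hu`. The
    -- dihedral coordinate requires `h′ = -h` modulo `P′` and the abelian one `h′ = h + j` modulo
    -- `g`; coprimality of `g` and `P′` makes these compatible.
    module EvenPower (h : ℕ) where
      j : ℕ
      j = h ℕ.* u ℕ.* ℕ.pred Q′

      remainder : ∃ λ h′ → ι g ∣ ι h′ - ι (h ℕ.+ j) × ι P′ ∣ ι h′ - ι (h ℕ.* ℕ.pred P′)
      remainder = chinese-remainder g P′ coprime (h ℕ.+ j) (h ℕ.* ℕ.pred P′)

      h′ : ℕ
      h′ = proj₁ remainder

      +j≡ : ι j ≡ ι h * U * (Q - + 1)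
      +j≡ = trans (ι-* (h ℕ.* u) (ℕ.pred Q′)) (cong₂ _*_ (ι-* h u) (+pred≡ Q′))

      Q∣Z : Q ∣ ι j + ι h * U
      Q∣Z = ∣-via (trans (cong (_+ ι h * U) +j≡) (close U (ι h) Q)) (∣n⇒∣m*n (ι h * U) (ι-∣ (ℕ∣.∣-refl {Q′})))
        where
        close : ∀ u h q → h * u * (q - + 1) + h * u ≡ h * u * q
        close = solve-∀

      Q∣X : Q ∣ U * ι j
      Q∣X = ∣-via (split U (ι h) (ι j)) (∣m∣n⇒∣m-n (∣n⇒∣m*n U Q∣Z) (∣n⇒∣m*n (ι h) Q∣U²))
        where
        split : ∀ u h j → u * j ≡ u * (j + h * u) - h * (u * u)
        split = solve-∀

      Q∣Y : Q ∣ U * (ι h′ - ι h)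
      Q∣Y = from (proj₁ (proj₂ remainder))
        where
        split : ∀ u h h′ j m g → h′ - (h + j) ≡ m * g → u * (h′ - h) ≡ m * (g * u) + u * j
        split u h h′ j m g e = trans (regroup u h h′ j) (trans (cong (λ x → u * x + u * j) e) (swap u m g j))
          where
          regroup : ∀ u h h′ j → u * (h′ - h) ≡ u * (h′ - (h + j)) + u * j
          regroup = solve-∀
          swap : ∀ u m g j → u * (m * g) + u * j ≡ m * (g * u) + u * j
          swap = solve-∀
        from : ι g ∣ ι h′ - ι (h ℕ.+ j) → Q ∣ U * (ι h′ - ι h)
        from (divides m e) = ∣-via (split U (ι h) (ι h′) (ι j) m (ι g) (trans (cong (λ z → ι h′ - z) (sym (ι-+ h j))) e)) (∣m∣n⇒∣m+n (∣n⇒∣m*n m Q∣gU) Q∣X)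

      double : ∀ n x → ι n ∣ x → ι (n ℕ.* 2) ∣ x * + 2
      double n x d = subst (_∣ x * + 2) (sym (ι-*2 n)) (*-monoˡ-∣ (+ 2) d)

      exchanged : ∀ x → iter α (h ℕ.* 2) (β x) ≋ iter β (suc (j ℕ.* 2)) (iter α (h′ ℕ.* 2) x)
      exchanged (pt s f k l) = ≋-trans (iter-α h (βs f s) (not f) (- k) (l - + 1))
        (≋-trans ⟨ first f , refl ,
            ∣-via (k-diff k (ι h) (ι h′)) (double P′ (ι h + ι h′) P′∣h+h′) ,
            ∣-via (l-diff l (ι h) (ι h′) (ι j)) (double g (- (ι h′ - (ι h + ι j))) (∣m⇒∣-m (subst (λ z → ι g ∣ ι h′ - z) (ι-+ h j) (proj₁ (proj₂ remainder))))) ⟩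
          (≋-sym (β-cong (≋-trans (iter-cong {β} (λ {x} {y} → β-cong {x} {y}) (j ℕ.* 2) (iter-α h′ s f k l)) (iter-β j (αᶜ f (ι h′) s) f (k + ι h′ * + 2) (l + ι h′ * + 2))))))
        where
        P′∣h+h′ : ι P′ ∣ ι h + ι h′
        P′∣h+h′ = ∣-via (trans (split (ι h) (ι h′) (ι P′)) (cong (λ x → (ι h′ - x) + ι h * ι P′) (sym (trans (ι-* h (ℕ.pred P′)) (cong (ι h *_) (+pred≡ P′))))))
          (∣m∣n⇒∣m+n (proj₂ (proj₂ remainder)) (∣n⇒∣m*n (ι h) (ι-∣ (ℕ∣.∣-refl {P′}))))
          where
          split : ∀ h h′ P → h + h′ ≡ (h′ - h * (P - + 1)) + h * P
          split = solve-∀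
        k-diff : ∀ k h h′ → (- k + h * + 2) - - (k + h′ * + 2) ≡ (h + h′) * + 2
        k-diff = solve-∀
        l-diff : ∀ l h h′ j → (l - + 1 + h * + 2) - (l + h′ * + 2 - j * + 2 - + 1) ≡ - (h′ - (h + j)) * + 2
        l-diff = solve-∀
        compare₀ : ∀ u h h′ j s → ((+ 1 - + 2 * h * u) * s - h * u) - ((+ 1 + + 2 * j * u) * ((+ 1 - + 2 * h′ * u) * s) + j + u * (j * (j - + 1)))
          ≡ + 2 * s * (u * (h′ - h)) - (j + h * u) - (+ 2 * ((+ 1 - + 2 * h′ * u) * s) + (j - + 1)) * (u * j)
        compare₀ = solve-∀
        compare₁ : ∀ u h h′ j s → (+ 1 - + 2 * h * u) * ((+ 1 + + 2 * u) * s + + 1)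
            - ((+ 1 + + 2 * u) * ((+ 1 + + 2 * j * u) * ((+ 1 - + 2 * h′ * u) * s - h′ * u) + j + u * (j * (j - + 1))) + + 1)
          ≡ (+ 1 + + 2 * u) * ((+ 2 * s + + 1) * (u * (h′ - h)) - (j + h * u)) + + 4 * h * (u * u)
            - (+ 1 + + 2 * u) * (+ 2 * ((+ 1 - + 2 * h′ * u) * s - h′ * u) + (j - + 1)) * (u * j)
        compare₁ = solve-∀
        first : ∀ f → Q ∣ αᶜ (not f) (ι h) (βs f s) - βs f (βᶜ (ι j) (αᶜ f (ι h′) s))
        first false = ∣-via (trans (cong₂ _-_ (αᶜ₁′ (ι h) (βs₀ s)) (trans (βs₀ _) (βᶜ′ (ι j) (αᶜ₀ (ι h′) s)))) (compare₀ U (ι h) (ι h′) (ι j) s)) (∣m∣n⇒∣m-n (∣m∣n⇒∣m-n (∣n⇒∣m*n (+ 2 * s) Q∣Y) Q∣Z) (∣n⇒∣m*n (+ 2 * ((+ 1 - + 2 * ι h′ * U) * s) + (ι j - + 1)) Q∣X))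
        first true  = ∣-via (trans (cong₂ _-_ (αᶜ₀′ (ι h) (βs₁ s)) (βs₁′ (βᶜ′ (ι j) (αᶜ₁ (ι h′) s)))) (compare₁ U (ι h) (ι h′) (ι j) s))
          (∣m∣n⇒∣m-n (∣m∣n⇒∣m+n (∣n⇒∣m*n (+ 1 + + 2 * U) (∣m∣n⇒∣m-n (∣n⇒∣m*n (+ 2 * s + + 1) Q∣Y) Q∣Z)) (∣n⇒∣m*n (+ 4 * ι h) Q∣U²))
            (∣n⇒∣m*n ((+ 1 + + 2 * U) * (+ 2 * ((+ 1 - + 2 * ι h′ * U) * s - ι h′ * U) + (ι j - + 1))) Q∣X))

    exchange-even : ∀ j h → ∃ λ j′ → ∃ λ h′ → ∀ x → iter α (h ℕ.* 2) (iter β j x) ≋ iter β j′ (iter α (h′ ℕ.* 2) x)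
    exchange-even zero    h = 0 , h , λ x → ≋-refl
    exchange-even (suc j) h = let j₂ , h₂ , e = exchange-even j (E.h′) in suc (E.j ℕ.* 2) ℕ.+ j₂ , h₂ , λ x →
      ≋-trans (E.exchanged (iter β j x)) (≋-trans (iter-cong {β} (λ {x} {y} → β-cong {x} {y}) (suc (E.j ℕ.* 2)) (e x))
        (subst (iter β (suc (E.j ℕ.* 2)) (iter β j₂ (iter α (h₂ ℕ.* 2) x)) ≋_) (sym (iter-+ β (suc (E.j ℕ.* 2)) j₂ (iter α (h₂ ℕ.* 2) x))) ≋-refl))
      where module E = EvenPower h

    -- The involution `αβ` equals its inverse, in which `β` stands to the left. This reduces odd
    -- powers of `α` to even ones.
    αβ≋ : ∀ x → α (β x) ≋ iter β (ℕ.pred q) (iter α (ℕ.pred p) x)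
    αβ≋ x = ≋-trans (α-cong (β-cong (≋-sym (≋-trans (α-cong ββ⁻¹) αα⁻¹)))) (αβ-involutive y)
      where
      y : X
      y = iter β (ℕ.pred q) (iter α (ℕ.pred p) x)
      ββ⁻¹ : β y ≋ iter α (ℕ.pred p) x
      ββ⁻¹ = subst (λ n → iter β n (iter α (ℕ.pred p) x) ≋ iter α (ℕ.pred p) x) (sym (ℕₚ.suc-pred q)) (β^q _)
      αα⁻¹ : α (iter α (ℕ.pred p) x) ≋ x
      αα⁻¹ = subst (λ n → iter α n x ≋ x) (sym (ℕₚ.suc-pred p)) (α^p x)

    exchange : ∀ i → ∃ λ j → ∃ λ k → ∀ x → iter α i (β x) ≋ iter β j (iter α k x)
    exchange i = cases (parity i)
      where
      Exchange : ℕ → Set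
      Exchange i = ∃ λ j → ∃ λ k → ∀ x → iter α i (β x) ≋ iter β j (iter α k x)
      cases : (∃ λ h → i ≡ 2 ℕ.* h ⊎ i ≡ suc (2 ℕ.* h)) → Exchange i
      cases (h , inj₁ e) = subst Exchange (trans (ℕₚ.*-comm h 2) (sym e)) (suc (EvenPower.j h ℕ.* 2) , EvenPower.h′ h ℕ.* 2 , EvenPower.exchanged h)
      cases (h , inj₂ e) = let j , h′ , ex = exchange-even (ℕ.pred q) h in
        subst Exchange (trans (ℕₚ.+-comm (h ℕ.* 2) 1) (trans (cong suc (ℕₚ.*-comm h 2)) (sym e))) (j , h′ ℕ.* 2 ℕ.+ ℕ.pred p , λ x →
          subst₂ _≋_ (sym (iter-+ α (h ℕ.* 2) 1 (β x))) (cong (iter β j) (sym (iter-+ α (h′ ℕ.* 2) (ℕ.pred p) x)))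
            (≋-trans (iter-cong {α} (λ {x} {y} → α-cong {x} {y}) (h ℕ.* 2) (αβ≋ x)) (ex (iter α (ℕ.pred p) x))))

    open PermutationGroup S α β (λ {x} {y} → α-cong {x} {y}) (λ {x} {y} → β-cong {x} {y}) p q α^p β^q α-order separated exchange αβ-involutive public
      using (tightGroup; mirrored)

    -- For `h = 1` one has `j = -u` and `u h′ = u`. The first coordinate of the mirrored relation at
    -- `origin` reads `0 = -u - u`.
    not-reflexible : ¬ Q′ ℕ∣.∣ 2 ℕ.* u → ¬ Reflexible tightGroup
    not-reflexible Q∤2u ρ = Q∤2u (∣-ι (∣-via (trans (ι-2* u) (expand U (ι h′) (ι j)))
      (∣m∣n⇒∣m+n (subst₂ (λ x y → Q ∣ x - y) (βs₀ (+ 0)) (αᶜ₁′ (ι h′) (trans (βs₀ _) (βᶜ≡ (ι j) (+ 0)))) (_≋_.s-mod relation)) (∣m∣n⇒∣m-n (∣m∣n⇒∣m+n (∣m∣n⇒∣m-n Q∣Z₁ Q∣Y₁) (∣n⇒∣m*n (ι j - + 1) Q∣X)) (∣n⇒∣m*n (+ 2 * ι h′ * (+ 1 + U * (ι j - + 1))) Q∣X)))))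
      where
      open EvenPower 1
      ι-1 : ι 1 ≡ + 1
      ι-1 = trans (ι-suc 0) (cong (λ z → + 1 + z) ι-0)
      Q∣Z₁ : Q ∣ ι j + + 1 * U
      Q∣Z₁ = subst (λ z → Q ∣ ι j + z * U) ι-1 Q∣Z
      Q∣Y₁ : Q ∣ U * (ι h′ - + 1)
      Q∣Y₁ = subst (λ z → Q ∣ U * (ι h′ - z)) ι-1 Q∣Y
      relation : β (pt (+ 0) false (+ 0 + ι 2) (+ 0 + ι 2)) ≋ pt (αᶜ true (ι h′) (βs false (βᶜ (ι j) (+ 0)))) true (- + 0 + ι h′ * + 2) (+ 0 - ι j * + 2 - + 1 + ι h′ * + 2)
      relation = ≋-trans (subst (λ x → β x ≋ iter α (h′ ℕ.* 2) (iter β (suc (j ℕ.* 2)) origin)) (iter-α-at-0 2 (+ 0) (+ 0))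
          (mirrored ρ 2 (suc (j ℕ.* 2)) (h′ ℕ.* 2) exchanged origin))
        (≋-trans (iter-cong {α} (λ {x} {y} → α-cong {x} {y}) (h′ ℕ.* 2) (β-cong (iter-β j (+ 0) false (+ 0) (+ 0)))) (iter-α h′ (βs false (βᶜ (ι j) (+ 0))) true (- + 0) (+ 0 - ι j * + 2 - + 1)))
      expand : ∀ u h′ j → + 2 * u ≡ (+ 0 - ((+ 1 - + 2 * h′ * u) * ((+ 1 + + 2 * j * u) * + 0 + j + u * (j * (j - + 1))) - h′ * u))
        + ((j + + 1 * u) - u * (h′ - + 1) + (j - + 1) * (u * j) - + 2 * h′ * (+ 1 + u * (j - + 1)) * (u * j))
      expand = solve-∀

-- The parameters for each of the six conditions.

module Sufficiency where
  open import Data.Nat.Base using (ℕ; zero; suc; _+_; _*_; _^_; _≤_; _<_; NonZero; ≢-nonZero; ≢-nonZero⁻¹; >-nonZero)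
  import Data.Nat.Properties as ℕₚ
  open import Data.Nat.Divisibility
  open import Data.Nat.Induction using (<-rec)
  open import Data.Nat.Coprimality using (Coprime; coprime-divisor) renaming (sym to coprime-sym)
  open import Data.Nat.Primality using (Prime; prime⇒irreducible; prime⇒nonTrivial; euclidsLemma; prime[2])
  open import Data.Nat.Tactic.RingSolver using (solve-∀)
  open import Data.Product using (Σ; ∃; _×_; _,_)
  open import Data.Sum using (_⊎_; inj₁; inj₂)
  open import Data.Empty using (⊥-elim)
  open import Relation.Nullary using (¬_; Dec; yes; no)
  open import Relation.Binary.PropositionalEquality
  open GeometricSums using (parity)
  open TightGroups
  open Reflections
  open Arithmetic using (odd-coprime-2; cancel-odd-2)

  ChiralGroup : ℕ → ℕ → Set₁
  ChiralGroup p q = Σ (TightGroup p q) λ T → ¬ Reflexible T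

  chiral-dual : ∀ {p q} {{_ : NonZero p}} {{_ : NonZero q}} → ChiralGroup p q → ChiralGroup q p
  chiral-dual (T , chiral) = dual T , λ ρ → chiral (Duality.reflexible-dual T ρ)

  prime-coprime : ∀ {l n} → Prime l → ¬ l ∣ n → Coprime l n
  prime-coprime l-prime l∤n {d} (d∣l , d∣n) with prime⇒irreducible l-prime d∣l
  ... | inj₁ d≡1 = d≡1
  ... | inj₂ refl = ⊥-elim (l∤n d∣n)

  coprime-power : ∀ {l n} k → Coprime l n → Coprime (l ^ k) n
  coprime-power zero    c (d∣1 , _) = ∣1⇒≡1 d∣1
  coprime-power {l} {n} (suc k) c {d} (d∣ , d∣n) =
    coprime-power k c (coprime-divisor {d} {l} {l ^ k} (λ (e∣d , e∣l) → c (e∣l , ∣-trans e∣d d∣n)) d∣ , d∣n)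

  power-∣ : ∀ l {i j} → i ≤ j → l ^ i ∣ l ^ j
  power-∣ l {i} i≤j with ℕₚ.m≤n⇒∃[o]m+o≡n i≤j
  ... | o , refl = subst (l ^ i ∣_) (sym (ℕₚ.^-distribˡ-+-* l i o)) (m∣m*n (l ^ o))

  record Split (l n : ℕ) : Set where
    field
      f n′ : ℕ
      n≡   : n ≡ l ^ f * n′
      l∤n′ : ¬ l ∣ n′

  split : ∀ {l} → Prime l → ∀ n → .{{_ : NonZero n}} → Split l n
  split {l} l-prime n = <-rec (λ n → NonZero n → Split l n) step n (≢-nonZero (≢-nonZero⁻¹ n))
    where
    step : ∀ n → (∀ {m} → m < n → NonZero m → Split l m) → NonZero n → Split l n
    step n rec n≢0 = cases (l ∣? n)
      where
      cases : Dec (l ∣ n) → Split l n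
      cases (no l∤n) = record { f = 0 ; n′ = n ; n≡ = sym (ℕₚ.+-identityʳ n) ; l∤n′ = l∤n }
      cases (yes (divides m n≡ml)) = record
        { f = suc (Split.f s) ; n′ = Split.n′ s ; l∤n′ = Split.l∤n′ s
        ; n≡ = trans n≡ml (trans (cong (_* l) (Split.n≡ s)) (trans (ℕₚ.*-comm _ l) (sym (ℕₚ.*-assoc l (l ^ Split.f s) (Split.n′ s))))) }
        where
        ml≢0 : NonZero (m * l)
        ml≢0 = subst NonZero n≡ml n≢0
        m≢0 : NonZero m
        m≢0 = ℕₚ.m*n≢0⇒m≢0 m {{ml≢0}}
        s : Split l m
        s = rec (subst (m <_) (sym n≡ml) (ℕₚ.m<m*n m l {{m≢0}} (nonTrivial⇒n>1 l {{prime⇒nonTrivial l-prime}}))) m≢0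
          where open import Data.Nat.Base using (nonTrivial⇒n>1)

  -- Taking for `g` the full `l`-part of `P` makes it coprime to the cofactor.
  even-group : ∀ {l} P N u → .{{_ : NonZero P}} → {{_ : NonZero N}} → Prime l → (s : Split l P) → l ^ Split.f s ∣ N →
    N ∣ u * u → N ∣ l ^ Split.f s * u → ¬ N ∣ 2 * u → ChiralGroup (P * 2) (N * 2)
  even-group {l} P N u l-prime s g∣N N∣uu N∣gu N∤2u = subst (λ P → ChiralGroup (P * 2) (N * 2)) (sym n≡)
    (EvenConstruction.tightGroup (l ^ f) n′ N u coprime g∣N N∣uu N∣gu , EvenConstruction.not-reflexible (l ^ f) n′ N u coprime g∣N N∣uu N∣gu N∤2u)
    where
    open Split s
    coprime : Coprime (l ^ f) n′
    coprime = coprime-power f (prime-coprime l-prime l∤n′)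
    gn′≢0 : NonZero (l ^ f * n′)
    gn′≢0 = ≢-nonZero (λ e → ≢-nonZero⁻¹ P (trans n≡ e))
    instance
      g≢0 : NonZero (l ^ f)
      g≢0 = ℕₚ.m*n≢0⇒m≢0 (l ^ f) {{gn′≢0}}
      n′≢0 : NonZero n′
      n′≢0 = ℕₚ.m*n≢0⇒n≢0 (l ^ f) {{gn′≢0}}

  double-nonZero : ∀ n .{{_ : NonZero n}} → NonZero (n * 2)
  double-nonZero n = ℕₚ.m*n≢0 n 2

  odd-prime-∤2^ : ∀ {m} → OddPrime m → ∀ k → ¬ m ∣ 2 ^ k
  odd-prime-∤2^ (m-prime , m-odd) zero    m∣1 = ¬prime[1] (subst Prime (∣1⇒≡1 m∣1) m-prime)
    where open import Data.Nat.Primality using (¬prime[1])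
  odd-prime-∤2^ {m} (m-prime , m-odd) (suc k) m∣ with euclidsLemma 2 (2 ^ k) m-prime m∣
  ... | inj₂ h = odd-prime-∤2^ (m-prime , m-odd) k h
  ... | inj₁ m∣2 with prime⇒irreducible prime[2] m∣2
  ... | inj₁ refl = odd-prime-∤2^ (m-prime , m-odd) 0 ∣-refl
  ... | inj₂ refl = m-odd ∣-refl

  cancel-prime : ∀ {l g n} → Prime l → ¬ l ∣ n → l ∣ g * n → l ∣ g
  cancel-prime {l} {g} {n} l-prime l∤n h with euclidsLemma g n l-prime h
  ... | inj₁ x = x
  ... | inj₂ x = ⊥-elim (l∤n x)

  -- The case g = m-part of P divides N, with translation step u = N / m.
  odd-direct : ∀ {m} P N .{{_ : NonZero P}} {{_ : NonZero N}} → OddPrime m → (s : Split m P) → m ^ Split.f s ∣ N →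
    m ∣ P → m * m ∣ N → ChiralGroup (P * 2) (N * 2)
  odd-direct {m} P N m-odd-prime@(m-prime , _) s g∣N m∣P (divides z N≡) = even-group P N (z * m) m-prime s g∣N N∣uu N∣gu N∤2u
    where
    open Split s
    m∣g : m ∣ m ^ f
    m∣g = cancel-prime m-prime l∤n′ (subst (m ∣_) n≡ m∣P)
    N∣uu : N ∣ z * m * (z * m)
    N∣uu = divides z (trans (square z m) (cong (z *_) (sym N≡)))
      where
      square : ∀ z m → z * m * (z * m) ≡ z * (z * (m * m))
      square = solve-∀
    N∣gu : N ∣ m ^ f * (z * m)
    N∣gu = from m∣g
      where
      regroup : ∀ w m z → w * m * (z * m) ≡ w * (z * (m * m))
      regroup = solve-∀
      from : m ∣ m ^ f → N ∣ m ^ f * (z * m)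
      from (divides w e) = divides w (trans (cong (_* (z * m)) e) (trans (regroup w m z) (cong (w *_) (sym N≡))))
    N∤2u : ¬ N ∣ 2 * (z * m)
    N∤2u h = odd-prime-∤2^ m-odd-prime 1 (*-cancelˡ-∣ (z * m) {{zm≢0}} (subst₂ _∣_ (trans N≡ (sym (ℕₚ.*-assoc z m m))) (ℕₚ.*-comm 2 (z * m)) h))
      where
      zm≢0 : NonZero (z * m)
      zm≢0 = ℕₚ.m*n≢0⇒m≢0 (z * m) {{≢-nonZero (λ e → ≢-nonZero⁻¹ N (trans N≡ (trans (sym (ℕₚ.*-assoc z m m)) e)))}}

  -- The case g = 2-part of P divides N, with u = N / 4.
  two-direct : ∀ P N .{{_ : NonZero P}} {{_ : NonZero N}} → (s : Split 2 P) → 2 ^ Split.f s ∣ N →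
    4 ∣ P → 16 ∣ N → ChiralGroup (P * 2) (N * 2)
  two-direct P N s g∣N 4∣P (divides z N≡) = even-group P N (z * 4) prime[2] s g∣N N∣uu N∣gu N∤2u
    where
    open Split s
    4∣g : 4 ∣ 2 ^ f
    4∣g = cancel-odd-2 2 l∤n′ (subst (4 ∣_) (trans n≡ (ℕₚ.*-comm (2 ^ f) n′)) 4∣P)
    N∣uu : N ∣ z * 4 * (z * 4)
    N∣uu = divides z (trans (square z) (cong (z *_) (sym N≡)))
      where
      square : ∀ z → z * 4 * (z * 4) ≡ z * (z * 16)
      square = solve-∀
    N∣gu : N ∣ 2 ^ f * (z * 4)
    N∣gu = from 4∣g
      where
      regroup : ∀ w z → w * 4 * (z * 4) ≡ w * (z * 16)
      regroup = solve-∀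
      from : 4 ∣ 2 ^ f → N ∣ 2 ^ f * (z * 4)
      from (divides w e) = divides w (trans (cong (_* (z * 4)) e) (trans (regroup w z) (cong (w *_) (sym N≡))))
    N∤2u : ¬ N ∣ 2 * (z * 4)
    N∤2u h = >⇒∤ (ℕₚ.m≤m+n 9 7) (*-cancelˡ-∣ z {{z≢0}} (subst₂ _∣_ N≡ (eight z) h))
      where
      z≢0 : NonZero z
      z≢0 = ℕₚ.m*n≢0⇒m≢0 z {{≢-nonZero (λ e → ≢-nonZero⁻¹ N (trans N≡ e))}}
      eight : ∀ z → 2 * (z * 4) ≡ z * 8
      eight = solve-∀

  -- The construction needs `g` to divide the other parameter. Of the `m`-parts of `P` and `N` one
  -- divides the other; if that of `N` is the smaller, the dual group is built, and `m²` passes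
  -- through this part from `N` to `P`.
  odd-both : ∀ {m} P N {{_ : NonZero P}} {{_ : NonZero N}} → OddPrime m → m ∣ P → m * m ∣ N → ChiralGroup (P * 2) (N * 2)
  odd-both {m} P N m-odd-prime@(m-prime , _) m∣P mm∣N = cases (ℕₚ.≤-total (Split.f s) (Split.f t))
    where
    s : Split m P
    s = split m-prime P
    t : Split m N
    t = split m-prime N
    part∣ : ∀ {n} (w : Split m n) → m ^ Split.f w ∣ n
    part∣ w = subst (m ^ Split.f w ∣_) (sym (Split.n≡ w)) (m∣m*n (Split.n′ w))
    cases : Split.f s ≤ Split.f t ⊎ Split.f t ≤ Split.f s → ChiralGroup (P * 2) (N * 2)
    cases (inj₁ f≤e) = odd-direct P N m-odd-prime s (∣-trans (power-∣ m f≤e) (part∣ t)) m∣P mm∣N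
    cases (inj₂ e≤f) = chiral-dual {{double-nonZero N}} {{double-nonZero P}} (odd-direct N P m-odd-prime t g∣P (∣-trans (m∣m*n m) mm∣N) (∣-trans mm∣g g∣P))
      where
      g∣P : m ^ Split.f t ∣ P
      g∣P = ∣-trans (power-∣ m e≤f) (part∣ s)
      mm∣g : m * m ∣ m ^ Split.f t
      mm∣g = coprime-divisor {m * m} {Split.n′ t} {m ^ Split.f t}
        (subst (λ x → Coprime x (Split.n′ t)) (cong (m *_) (ℕₚ.*-identityʳ m)) (coprime-power 2 (prime-coprime m-prime (Split.l∤n′ t))))
        (subst (m * m ∣_) (trans (Split.n≡ t) (ℕₚ.*-comm (m ^ Split.f t) (Split.n′ t))) mm∣N)

  -- The same comparison of 2-parts: when the roles are exchanged, 16 divides the 2-part of `N` and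
  -- thus `P`, while `4 ∣ N` is clear.
  two-both : ∀ P N {{_ : NonZero P}} {{_ : NonZero N}} → 4 ∣ P → 16 ∣ N → ChiralGroup (P * 2) (N * 2)
  two-both P N 4∣P 16∣N = cases (ℕₚ.≤-total (Split.f s) (Split.f t))
    where
    s : Split 2 P
    s = split prime[2] P
    t : Split 2 N
    t = split prime[2] N
    part∣ : ∀ {n} (w : Split 2 n) → 2 ^ Split.f w ∣ n
    part∣ w = subst (2 ^ Split.f w ∣_) (sym (Split.n≡ w)) (m∣m*n (Split.n′ w))
    cases : Split.f s ≤ Split.f t ⊎ Split.f t ≤ Split.f s → ChiralGroup (P * 2) (N * 2)
    cases (inj₁ f≤e) = two-direct P N s (∣-trans (power-∣ 2 f≤e) (part∣ t)) 4∣P 16∣N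
    cases (inj₂ e≤f) = chiral-dual {{double-nonZero N}} {{double-nonZero P}} (two-direct N P t g∣P (∣-trans (divides 4 refl) 16∣N) (∣-trans 16∣g g∣P))
      where
      g∣P : 2 ^ Split.f t ∣ P
      g∣P = ∣-trans (power-∣ 2 e≤f) (part∣ s)
      16∣g : 16 ∣ 2 ^ Split.f t
      16∣g = cancel-odd-2 4 (Split.l∤n′ t) (subst (16 ∣_) (trans (Split.n≡ t) (ℕₚ.*-comm (2 ^ Split.f t) (Split.n′ t))) 16∣N)

  -- `P` divides the odd `q`, so `P = 2k + 1`. With `q = z m²` the choice `u = z m` gives `u² = 0`,
  -- and `P u = 0` because `m ∣ P`, while `8u = 0` would make `m` divide 8.
  odd-group : ∀ {m} P q {{_ : NonZero q}} → ¬ 2 ∣ q → P * 2 ∣ 2 * q → OddPrime m → m ∣ P * 2 → m * m ∣ q → ChiralGroup (P * 2) q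
  odd-group {m} P q 2∤q 2P∣2q m-odd-prime@(m-prime , _) m∣2P (divides z q≡) = from P∣q (parity P)
    where
    P∣q : P ∣ q
    P∣q = *-cancelˡ-∣ 2 (subst (_∣ 2 * q) (ℕₚ.*-comm P 2) 2P∣2q)
    m∣P : m ∣ P
    m∣P = cancel-prime m-prime (odd-prime-∤2^ m-odd-prime 1) m∣2P
    u : ℕ
    u = z * m
    q∣uu : q ∣ u * u
    q∣uu = divides z (trans (square z m) (cong (z *_) (sym q≡)))
      where
      square : ∀ z m → z * m * (z * m) ≡ z * (z * (m * m))
      square = solve-∀
    cancel-4 : ∀ j → q ∣ 4 * j → q ∣ j
    cancel-4 j h = coprime-divisor {q} {4} {j} (coprime-sym (coprime-power 2 (odd-coprime-2 2∤q))) h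
    q∤8u : ¬ q ∣ 8 * u
    q∤8u h = odd-prime-∤2^ m-odd-prime 3 (*-cancelˡ-∣ u {{u≢0}} (subst₂ _∣_ (trans q≡ (sym (ℕₚ.*-assoc z m m))) (ℕₚ.*-comm 8 u) h))
      where
      u≢0 : NonZero u
      u≢0 = ℕₚ.m*n≢0⇒m≢0 u {{≢-nonZero (λ e → ≢-nonZero⁻¹ q (trans q≡ (trans (sym (ℕₚ.*-assoc z m m)) e)))}}
    from : P ∣ q → (∃ λ k → P ≡ 2 * k ⊎ P ≡ suc (2 * k)) → ChiralGroup (P * 2) q
    from P∣q (k , inj₁ e) = ⊥-elim (2∤q (∣-trans (subst (2 ∣_) (sym e) (m∣m*n k)) P∣q))
    from (divides c q≡cP) (k , inj₂ e) = subst (λ P → ChiralGroup (P * 2) q) (sym P≡)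
      (OddConstruction.tightGroup q k u q∣uu q∣Pu p∣q2k cancel-4 , OddConstruction.not-reflexible q k u q∣uu q∣Pu p∣q2k cancel-4 q∤8u)
      where
      P≡ : P ≡ suc (k * 2)
      P≡ = trans e (cong suc (ℕₚ.*-comm 2 k))
      q∣Pu : q ∣ suc (k * 2) * u
      q∣Pu = multiple (subst (m ∣_) P≡ m∣P)
        where
        regroup : ∀ w m z → w * m * (z * m) ≡ w * (z * (m * m))
        regroup = solve-∀
        multiple : m ∣ suc (k * 2) → q ∣ suc (k * 2) * u
        multiple (divides w e) = divides w (trans (cong (_* u) e) (trans (regroup w m z) (cong (w *_) (sym q≡))))
      p∣q2k : suc (k * 2) * 2 ∣ q * (k * 2)
      p∣q2k = divides (c * k) (trans (cong (_* (k * 2)) (trans q≡cP (cong (c *_) P≡))) (regroup c (suc (k * 2)) k))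
        where
        regroup : ∀ c P k → c * P * (k * 2) ≡ c * k * (P * 2)
        regroup = solve-∀

  sufficiency : ∀ {p q} → 2 ≤ p → 2 ≤ q → Conditions p q → ChiralGroup p q
  sufficiency {p} {q} 2≤p 2≤q = construct
    where
    instance
      p≢0 : NonZero p
      p≢0 = >-nonZero (ℕₚ.<⇒≤ 2≤p)
      q≢0 : NonZero q
      q≢0 = >-nonZero (ℕₚ.<⇒≤ 2≤q)
    halve-nonZero : ∀ {n} k .{{_ : NonZero n}} → n ≡ k * 2 → NonZero k
    halve-nonZero {n} zero    e = ⊥-elim (≢-nonZero⁻¹ n e)
    halve-nonZero     (suc k) e = _
    odd-case : ∀ {p q} {{_ : NonZero q}} → (Odd q × Even p × p ∣ 2 * q × ∃ λ m → OddPrime m × m ∣ p × m * m ∣ q) → ChiralGroup p q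
    odd-case {q = q} (q-odd , divides P refl , p∣2q , m , m-odd-prime , m∣p , mm∣q) = odd-group P q q-odd p∣2q m-odd-prime m∣p mm∣q
    both-case : ∀ {p q} {{_ : NonZero p}} {{_ : NonZero q}} → Even p → Even q → (∃ λ m → OddPrime m × m ∣ p × m * m ∣ q) → ChiralGroup p q
    both-case {p} {q} (divides P p≡) (divides N q≡) (m , m-odd-prime@(m-prime , _) , m∣p , mm∣q) = subst₂ ChiralGroup (sym p≡) (sym q≡)
      (odd-both P N {{halve-nonZero P p≡}} {{halve-nonZero N q≡}} m-odd-prime
        (cancel-prime m-prime (odd-prime-∤2^ m-odd-prime 1) (subst (m ∣_) p≡ m∣p))
        (coprime-divisor {m * m} {2} {N} (subst (λ x → Coprime x 2) (cong (m *_) (ℕₚ.*-identityʳ m)) (coprime-power 2 (prime-coprime m-prime (odd-prime-∤2^ m-odd-prime 1))))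
          (subst (m * m ∣_) (trans q≡ (ℕₚ.*-comm N 2)) mm∣q)))
    two-case : ∀ {p q} {{_ : NonZero p}} {{_ : NonZero q}} → 8 ∣ p → 32 ∣ q → ChiralGroup p q
    two-case {p} {q} (divides x p≡) (divides y q≡) = subst₂ ChiralGroup (sym p≡′) (sym q≡′)
      (two-both (x * 4) (y * 16) {{halve-nonZero (x * 4) p≡′}} {{halve-nonZero (y * 16) q≡′}} (n∣m*n x) (n∣m*n y))
      where
      p≡′ : p ≡ x * 4 * 2
      p≡′ = trans p≡ (sym (ℕₚ.*-assoc x 4 2))
      q≡′ : q ≡ y * 16 * 2
      q≡′ = trans q≡ (sym (ℕₚ.*-assoc y 16 2))
    construct : Conditions p q → ChiralGroup p q
    construct (inj₁ c)                                           = odd-case c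
    construct (inj₂ (inj₁ c))                                    = chiral-dual (odd-case c)
    construct (inj₂ (inj₂ (inj₁ (ep , eq , c))))                 = both-case ep eq c
    construct (inj₂ (inj₂ (inj₂ (inj₁ (ep , eq , c)))))          = chiral-dual (both-case eq ep c)
    construct (inj₂ (inj₂ (inj₂ (inj₂ (inj₁ (x , y))))))         = two-case x y
    construct (inj₂ (inj₂ (inj₂ (inj₂ (inj₂ (x , y))))))         = chiral-dual (two-case x y)

theorem5p2 : (p q : ℕ) → 2 ≤ p → 2 ≤ q →
    (TightChiralPolyhedronOfType p q ⇔ Conditions p q)
theorem5p2 p q 2≤p 2≤q = mk⇔ forward backward
  where
  open import Data.Nat.Base using (NonZero; >-nonZero)
  open import Data.Nat.Properties using (<⇒≤)
  open import Data.Product using (_,_)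
  open import Function.Bundles using (mk⇔)
  open FlagGroup using (polyhedron⇒group)
  open CosetGeometry using (group⇒polyhedron)
  open Necessity using (necessity)
  open Sufficiency using (sufficiency)
  instance
    p≢0 : NonZero p
    p≢0 = >-nonZero (<⇒≤ 2≤p)
    q≢0 : NonZero q
    q≢0 = >-nonZero (<⇒≤ 2≤q)
  forward : TightChiralPolyhedronOfType p q → Conditions p q
  forward polyhedron = let T , chiral = polyhedron⇒group polyhedron in necessity 2≤p 2≤q T chiral
  backward : Conditions p q → TightChiralPolyhedronOfType p q
  backward conditions = let T , chiral = sufficiency 2≤p 2≤q conditions in group⇒polyhedron 2≤p 2≤q T chiral
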